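{- Let $n\ge 2$ and $q\ge 1$ be integers, and let $G=(V,E)$ be an $n$-vertex directed graph with two special vertices $s,t\in V$, whose edge weights are univariate polynomials of the form $$\mathsf{wt}(e)=a_{e,q}\lambda^q+a_{e,q-1}\lambda^{q-1}+\cdots+a_{e,2}\lambda^2+a_{e,1}\lambda+a_{e,0},\qquad a_{e,i}\in\mathbb{R}.$$ Then there exists a data structure that takes as input a number $x\in\mathbb{R}$ at which $G$ has no negative-weight directed cycle, and outputs a shortest path from $s$ to $t$ in $G$ at $\lambda=x$ in $O(\log^2 n+\log n\log q)$ time. The data structure takes $(nq)^{\tilde{O}(1)}$ space and $(nq)^{\tilde{O}(1)}$ preprocessing time.
   Context: Graphs are simple (no multi-edges or self-loops) and connected, and there is at least one path from $s$ to $t$. Logarithms are to base 2. The parameter $\lambda\in\mathbb{R}$ is common to the entire graph, while the coefficients $a_{e,i}$ are fixed real constants for each edge. "At $\lambda=x$" refers to the fixed-edge-weight graph obtained by setting $\lambda=x$ in all edge weights; the weight of a path (or cycle) is the sum of the weights of its edges. The data structure is built from $G$ in a preprocessing phase (before any query is known) and afterwards answers queries $x$. Time and space are measured with unit-cost arithmetic operations and comparisons on real numbers (real RAM), where additionally the real roots of a univariate real polynomial of degree at most $q$ can be computed in time polynomial in $q$; "outputs a shortest path" means returning the label (identifier or pointer) of a stored shortest path. The constants in the $O(\cdot)$ are absolute, and $\tilde{O}(1)$ suppresses factors polylogarithmic in $n$ and $q$, i.e. $(nq)^{\tilde O(1)}$ means at most $(nq)^{\mathrm{polylog}(n,q)}$.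 -}

module Defs where

open import Level using (Level; _⊔_) renaming (suc to lsuc)
open import Algebra.Bundles using (CommutativeRing)
import Algebra.Properties.Monoid.Sum as Sum
import Algebra.Properties.Semiring.Exp as Exp
open import Data.Bool.Base using (Bool; true; false; if_then_else_)
open import Data.Fin.Base using (Fin; toℕ)
open import Data.List.Base
  using (List; []; _∷_; map; concatMap; allFin; cartesianProduct; length)
open import Data.List.Relation.Unary.All using (All)
open import Data.List.Relation.Unary.Any using (Any)
open import Data.List.Relation.Unary.Linked using (Linked)
open import Data.List.Relation.Unary.Unique.Propositional using (Unique)
open import Data.Maybe.Base using (Maybe; just; nothing; maybe′)
open import Data.Nat.Base as ℕ using (ℕ; suc; ⌊_/2⌋)
import Data.Nat.Properties as ℕ
open import Data.Nat.Logarithm using (⌈log₂_⌉)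
open import Data.Product.Base using (∃; ∃-syntax; Σ-syntax; _×_; _,_; proj₁)
open import Data.Unit.Base using (⊤)
open import Data.Vec.Functional using (Vector; toList; replicate)
open import Relation.Binary.Core using (Rel)
open import Relation.Binary.Construct.Closure.Equivalence using (EqClosure)
open import Relation.Binary.Construct.Closure.ReflexiveTransitive using (Star; ε; _◅_)
open import Relation.Binary.Definitions using (tri<; tri≈; tri>)
open import Relation.Binary.PropositionalEquality.Core using (_≡_)
open import Relation.Binary.Structures using (IsStrictTotalOrder)
open import Relation.Nullary.Decidable.Core using (does)
open import Relation.Nullary.Negation.Core using (¬_)

-- The real numbers are given by their second-order axioms, which determine
-- them up to isomorphism.  Trichotomy is read constructively, so the order is
-- decidable; this is what the comparisons of the real RAM rely on.

record CompleteOrderedField (c ℓ₁ ℓ₂ : Level) : Set (lsuc (c ⊔ ℓ₁ ⊔ ℓ₂)) where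
  infix 4 _<_ _≤_
  field
    commutativeRing : CommutativeRing c ℓ₁
  open CommutativeRing commutativeRing public
  field
    _<_                : Rel Carrier ℓ₂
    isStrictTotalOrder : IsStrictTotalOrder _≈_ _<_
    +-monoˡ-<          : ∀ {x y} z → x < y → x + z < y + z
    *-pos              : ∀ {x y} → 0# < x → 0# < y → 0# < x * y
    0≉1                : ¬ 0# ≈ 1#
    inverse            : ∀ x → ¬ x ≈ 0# → ∃[ y ] x * y ≈ 1#

  _≤_ : Rel Carrier ℓ₂
  x ≤ y = ¬ y < x

  UpperBound : (Carrier → Set (c ⊔ ℓ₁ ⊔ ℓ₂)) → Carrier → Set (c ⊔ ℓ₁ ⊔ ℓ₂)
  UpperBound P b = ∀ x → P x → x ≤ b

  field
    supremum : ∀ (P : Carrier → Set (c ⊔ ℓ₁ ⊔ ℓ₂)) → ∃ P → ∃ (UpperBound P) →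
               ∃[ b ] UpperBound P b × (∀ b′ → UpperBound P b′ → b ≤ b′)

  open IsStrictTotalOrder isStrictTotalOrder public using (compare; _<?_)

  _÷_ : Carrier → Carrier → Carrier
  x ÷ y with compare y 0#
  ... | tri< _ y≉0 _ = x * proj₁ (inverse y y≉0)
  ... | tri≈ _ _ _   = 0#
  ... | tri> _ y≉0 _ = x * proj₁ (inverse y y≉0)

  open Sum +-monoid using (sum⁺-syntax)
  open Exp semiring using (_^_)

  -- The coefficient at index i belongs to the i-th power.
  Polynomial : ℕ → Set c
  Polynomial d = Vector Carrier (suc d)

  eval : ∀ {d} → Polynomial d → Carrier → Carrier
  eval {d} p x = ∑[ i ≤ d ] (p i * x ^ toℕ i)

  record IsRootList {d} (p : Polynomial d) (rs : List Carrier) : Set (c ⊔ ℓ₁ ⊔ ℓ₂) where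
    field
      increasing : Linked _<_ rs
      sound      : All (λ r → eval p r ≈ 0#) rs
      complete   : ∀ x → eval p x ≈ 0# → Any (x ≈_) rs

-- The additional primitive of the machine: the real roots of a polynomial of
-- degree at most d, found in time polynomial in d.

record RootFinder {c ℓ₁ ℓ₂} (ℝ : CompleteOrderedField c ℓ₁ ℓ₂) : Set (c ⊔ ℓ₁ ⊔ ℓ₂) where
  open CompleteOrderedField ℝ
  field
    roots         : ∀ {d} → Polynomial d → List Carrier
    roots-zero    : ∀ {d} (p : Polynomial d) → (∀ i → p i ≈ 0#) → roots p ≡ []
    roots-nonzero : ∀ {d} (p : Polynomial d) → (∃[ i ] ¬ p i ≈ 0#) → IsRootList p (roots p)
    rootTime      : ℕ → ℕ
    rootTime-poly : ∃[ k ] ∀ d → rootTime d ℕ.≤ (2 ℕ.+ d) ℕ.^ k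

-- Programs of the real RAM.  There is one memory of integers and one of real
-- numbers.  A program is a fixed finite text without real constants other than
-- 0 and 1, so nothing about a particular graph can be hidden in it.

-- The cell at a fixed address, or the cell whose address is held by the
-- integer cell at a fixed address.
data Cell : Set where
  at  : ℕ → Cell
  ind : ℕ → Cell

data IntOp : Set where
  plus monus times : IntOp

data RealOp : Set where
  add sub mul div : RealOp

data Instr : Set where
  intConst         : (dst : Cell) → ℕ → Instr
  intCopy halve    : (dst src : Cell) → Instr
  intOp            : IntOp → (dst src₁ src₂ : Cell) → Instr
  realZero realOne : (dst : Cell) → Instr
  realCopy         : (dst src : Cell) → Instr
  realOp           : RealOp → (dst src₁ src₂ : Cell) → Instr
  -- The integer cell deg holds a degree bound d.  The d + 1 coefficients are
  -- read from consecutive real cells starting at src, the roots are written to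
  -- consecutive real cells starting at dst, and their number is written to the
  -- integer cell num.
  findRoots        : (deg num dst src : Cell) → Instr

data Test : Set where
  int< real< : (src₁ src₂ : Cell) → Test

infixr 5 _︔_

data Program : Set where
  skip   : Program
  instr  : Instr → Program
  _︔_    : Program → Program → Program
  ifThen : Test → Program → Program → Program
  while  : Test → Program → Program

⟦_⟧ᵢ : IntOp → ℕ → ℕ → ℕ
⟦ plus  ⟧ᵢ = ℕ._+_
⟦ monus ⟧ᵢ = ℕ._∸_
⟦ times ⟧ᵢ = ℕ._*_

infixl 8 _[_≔_] _[_≔*_]

_[_≔_] : ∀ {a} {A : Set a} → (ℕ → A) → ℕ → A → (ℕ → A)
(m [ k ≔ v ]) j = if does (j ℕ.≟ k) then v else m j

_[_≔*_] : ∀ {a} {A : Set a} → (ℕ → A) → ℕ → List A → (ℕ → A)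
m [ k ≔* []     ] = m
m [ k ≔* v ∷ vs ] = m [ suc k ≔* vs ] [ k ≔ v ]

module RealRAM {c ℓ₁ ℓ₂} (ℝ : CompleteOrderedField c ℓ₁ ℓ₂) (F : RootFinder ℝ) where
  open CompleteOrderedField ℝ
  open RootFinder F

  record Store : Set c where
    constructor store
    field
      int  : ℕ → ℕ
      real : ℕ → Carrier
  open Store public

  address : Cell → Store → ℕ
  address (at k)  σ = k
  address (ind k) σ = int σ k

  intAt : Cell → Store → ℕ
  intAt a σ = int σ (address a σ)

  realAt : Cell → Store → Carrier
  realAt a σ = real σ (address a σ)

  setInt : Cell → ℕ → Store → Store
  setInt a v σ = store (int σ [ address a σ ≔ v ]) (real σ)

  setReal : Cell → Carrier → Store → Store
  setReal a v σ = store (int σ) (real σ [ address a σ ≔ v ])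

  ⟦_⟧ᵣ : RealOp → Carrier → Carrier → Carrier
  ⟦ add ⟧ᵣ = _+_
  ⟦ sub ⟧ᵣ = _-_
  ⟦ mul ⟧ᵣ = _*_
  ⟦ div ⟧ᵣ = _÷_

  ⟦_⟧ₜ : Test → Store → Bool
  ⟦ int<  a b ⟧ₜ σ = does (intAt a σ ℕ.<? intAt b σ)
  ⟦ real< a b ⟧ₜ σ = does (realAt a σ <? realAt b σ)

  polynomialAt : (d : ℕ) → Cell → Store → Polynomial d
  polynomialAt d a σ i = real σ (address a σ ℕ.+ toℕ i)

  exec : Instr → Store → Store
  exec (intConst a k)        σ = setInt a k σ
  exec (intCopy a b)         σ = setInt a (intAt b σ) σ
  exec (halve a b)           σ = setInt a ⌊ intAt b σ /2⌋ σ
  exec (intOp ∙ a b₁ b₂)     σ = setInt a (⟦ ∙ ⟧ᵢ (intAt b₁ σ) (intAt b₂ σ)) σ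
  exec (realZero a)          σ = setReal a 0# σ
  exec (realOne a)           σ = setReal a 1# σ
  exec (realCopy a b)        σ = setReal a (realAt b σ) σ
  exec (realOp ∙ a b₁ b₂)    σ = setReal a (⟦ ∙ ⟧ᵣ (realAt b₁ σ) (realAt b₂ σ)) σ
  exec (findRoots g m a b)   σ =
    store (int σ [ address m σ ≔ length rs ]) (real σ [ address a σ ≔* rs ])
    where rs = roots (polynomialAt (intAt g σ) b σ)

  cost : Instr → Store → ℕ
  cost (findRoots g _ _ _) σ = suc (rootTime (intAt g σ))
  cost _                   σ = 1

  -- Space S: only the first S cells of each memory are in use, and integers
  -- stay below S.  The bound on integers keeps them to a word of about log S
  -- bits, so that unit-cost integer arithmetic is not abused.
  record Fits (S : ℕ) (σ : Store) : Set ℓ₁ where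
    field
      int-word   : ∀ k → int σ k ℕ.< S
      int-blank  : ∀ k → S ℕ.≤ k → int σ k ≡ 0
      real-blank : ∀ k → S ℕ.≤ k → real σ k ≈ 0#

  -- Run S P σ t σ′: started in σ, the program P halts in σ′ after time t,
  -- never exceeding space S.
  data Run (S : ℕ) : Program → Store → ℕ → Store → Set (c ⊔ ℓ₁) where
    skip        : ∀ {σ} → Run S skip σ 0 σ
    instr       : ∀ {i σ} → Fits S (exec i σ) → Run S (instr i) σ (cost i σ) (exec i σ)
    _︔_         : ∀ {P Q σ σ′ σ″ t t′} → Run S P σ t σ′ → Run S Q σ′ t′ σ″ →
                  Run S (P ︔ Q) σ (t ℕ.+ t′) σ″
    if-true     : ∀ {b P Q σ σ′ t} → ⟦ b ⟧ₜ σ ≡ true → Run S P σ t σ′ →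
                  Run S (ifThen b P Q) σ (suc t) σ′
    if-false    : ∀ {b P Q σ σ′ t} → ⟦ b ⟧ₜ σ ≡ false → Run S Q σ t σ′ →
                  Run S (ifThen b P Q) σ (suc t) σ′
    while-true  : ∀ {b P σ σ′ σ″ t t′} → ⟦ b ⟧ₜ σ ≡ true → Run S P σ t σ′ →
                  Run S (while b P) σ′ t′ σ″ → Run S (while b P) σ (suc (t ℕ.+ t′)) σ″
    while-false : ∀ {b P σ} → ⟦ b ⟧ₜ σ ≡ false → Run S (while b P) σ 1 σ

module Graphs {c ℓ₁ ℓ₂} (ℝ : CompleteOrderedField c ℓ₁ ℓ₂) where
  open CompleteOrderedField ℝ

  -- Connectedness of a directed graph refers to the underlying undirected graph.
  record Graph (n q : ℕ) : Set c where
    field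
      wt : Fin n → Fin n → Maybe (Polynomial q)

    Edge : Fin n → Fin n → Set c
    Edge u v = ∃[ p ] wt u v ≡ just p

    field
      loopless  : ∀ v → wt v v ≡ nothing
      connected : ∀ u v → EqClosure Edge u v

  module _ {n q : ℕ} (G : Graph n q) where
    open Graph G

    Walk : Fin n → Fin n → Set c
    Walk = Star Edge

    vertices : ∀ {u v} → Walk u v → List (Fin n)
    vertices {u} ε       = u ∷ []
    vertices {u} (_ ◅ w) = u ∷ vertices w

    weight : ∀ {u v} → Carrier → Walk u v → Carrier
    weight x ε             = 0#
    weight x ((p , _) ◅ w) = eval p x + weight x w

    IsPath : ∀ {u v} → Walk u v → Set
    IsPath w = Unique (vertices w)

    Path : Fin n → Fin n → Set c
    Path u v = Σ[ w ∈ Walk u v ] IsPath w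

    -- A directed cycle is an edge from u to v followed by a path back to u.
    NoNegativeCycle : Carrier → Set (c ⊔ ℓ₂)
    NoNegativeCycle x = ∀ {u v} (e : Edge u v) (w : Walk v u) → IsPath w →
                        ¬ weight x (e ◅ w) < 0#

    IsShortestPath : ∀ {u v} → Carrier → Walk u v → Set (c ⊔ ℓ₂)
    IsShortestPath {u} {v} x w =
      IsPath w × (∀ (w′ : Walk u v) → IsPath w′ → weight x w ≤ weight x w′)

module ShortestPathQueries
    {c ℓ₁ ℓ₂} (ℝ : CompleteOrderedField c ℓ₁ ℓ₂) (F : RootFinder ℝ) where
  open CompleteOrderedField ℝ
  open RealRAM ℝ F public
  open Graphs ℝ public

  -- Integer memory: n, q, s, t, then the adjacency matrix in row-major order.
  -- Real memory: the q + 1 coefficients of every ordered pair of vertices in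
  -- the same order, all zero for a pair that is not an edge.
  input : ∀ {n q} → Graph n q → Fin n → Fin n → Store
  input {n} {q} G s t = store
    ((λ _ → 0)  [ 0 ≔* n ∷ q ∷ toℕ s ∷ toℕ t ∷ map adjacent pairs ])
    ((λ _ → 0#) [ 0 ≔* concatMap coefficients pairs ])
    where
    open Graph G
    pairs = cartesianProduct (allFin n) (allFin n)

    adjacent : Fin n × Fin n → ℕ
    adjacent (u , v) = maybe′ (λ _ → 1) 0 (wt u v)

    coefficients : Fin n × Fin n → List Carrier
    coefficients (u , v) = toList (maybe′ (λ p → p) (replicate (suc q) 0#) (wt u v))

  ListAt : Store → ℕ → List ℕ → Set
  ListAt σ k []       = ⊤
  ListAt σ k (v ∷ vs) = int σ k ≡ v × ListAt σ (suc k) vs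

  -- A path is stored as the number of its vertices followed by the vertices.
  StoredAt : ∀ {n q} (G : Graph n q) {u v} → Store → ℕ → Walk G u v → Set
  StoredAt G σ k w = ListAt σ k (length (vertices G w) ∷ map toℕ (vertices G w))

  -- The upper integer part of the logarithm changes these bounds only through
  -- the constants, because n ≥ 2 and q ≥ 1.
  quasiPoly : (K n q : ℕ) → ℕ
  quasiPoly K n q = (n ℕ.* q) ℕ.^ (K ℕ.* ⌈log₂ (n ℕ.* q) ⌉ ℕ.^ K)

  queryTime : (C n q : ℕ) → ℕ
  queryTime C n q = C ℕ.* (⌈log₂ n ⌉ ℕ.^ 2 ℕ.+ ⌈log₂ n ⌉ ℕ.* ⌈log₂ q ⌉)

  -- The query x is passed in real cell 0 and the label of the answer is
  -- returned in integer cell 0.  The label has to be valid both before and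
  -- after the query, so the path itself is already part of the data structure.
  Answers : (S T : ℕ) (query : Program) {n q : ℕ} (G : Graph n q) (s t : Fin n) →
            Carrier → Store → Store → Set (c ⊔ ℓ₁ ⊔ ℓ₂)
  Answers S T query G s t x σ σ′ =
    (∃[ τ ] τ ℕ.≤ T × Run S query (setReal (at 0) x σ) τ σ′) ×
    (Σ[ w ∈ Walk G s t ] IsShortestPath G x w ×
      StoredAt G σ (int σ′ 0) w × StoredAt G σ′ (int σ′ 0) w)

  -- Ready describes the stores from which queries can be answered.  It holds
  -- after preprocessing and is preserved by queries, so any number of queries
  -- may follow one preprocessing.
  record Solves (pre query : Program) (S Tₚ T : ℕ) {n q : ℕ}
                (G : Graph n q) (s t : Fin n) : Set (lsuc (c ⊔ ℓ₁ ⊔ ℓ₂)) where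
    field
      Ready      : Store → Set (c ⊔ ℓ₁ ⊔ ℓ₂)
      preprocess : ∃[ τ ] ∃[ σ ] τ ℕ.≤ Tₚ × Run S pre (input G s t) τ σ ×
                   Fits S σ × Ready σ
      answer     : ∀ {σ} → Ready σ → ∀ x → NoNegativeCycle G x →
                   ∃[ σ′ ] Answers S T query G s t x σ σ′ × Ready σ′

{-# OPTIONS --safe #-}
-- For every query x a shortest path is found by doubling: a table holds, for all pairs u, v, a shortest walk among the
-- candidates with at most 2^k edges, and the next table concatenates two entries at the best middle vertex.  The table
-- depends on x only through comparisons of two walk weights, that is, through signs of polynomials of degree at most q.
-- By the intermediate value theorem these signs are constant between consecutive roots, so each cell of one level
-- splits into polynomially many cells of the next, and after ⌈log n⌉ levels there are (nq)^O(log n)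
-- breakpoints in all.  In a cell the final table is constant, which yields one path that is shortest throughout.
--
-- Preprocessing sweeps the line from left to right: at a sample point of the current interval it computes the tables, and
-- every root met on the way inside the interval shrinks the interval; once no root is left the cell is final and its path
-- and its right end are stored.  A query is a binary search among the stored breakpoints.
--
-- To obtain a machine program with a running time, preprocessing is written in a small language of bounded loops whose
-- weakest preconditions are proved correct once and for all for the compiled code.  A table stores walks only through
-- weight, and for every vertex its successor after the last visit, which is enough to read off a simple path.

module Submission where

open import Defs

-- The hypothesis on negative cycles concerns the query point only, while the tables are computed at
-- a sample point, where negative cycles may exist. So the tables range over walks, and carrying
-- comparisons from the sample to the query uses no cycle hypothesis; cycles are cut out at the very
-- end, by one path that serves all admissible points of the cell. Cells are closed on the right at
-- no cost, since a strict reversal between sample and query forces a root strictly between them.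
-- The program compares a candidate only with the winner of its entry, because it is enough that the
-- winner stays no worse than every candidate. The roots of differences of all pairs of candidates
-- occur in the proof alone: their number is below a computable `B`, a power of `(nq)^12` with one
-- factor per doubling step and one to spare. Hence running every search loop `B` times is enough,
-- and no loop needs a data-dependent end. The same `B` is the base of the address arithmetic: an
-- array cell is a number of five digits in base `B` with nonzero leading digit, so disjointness of
-- arrays is uniqueness of digits, and the space is `33 B^4`.

module OrderedFields where
  open import Level using (_⊔_; Lift; lift; lower)
  open import Algebra.Bundles using (CommutativeRing)
  open import Algebra.Solver.Ring.AlmostCommutativeRing using (AlmostCommutativeRing; fromCommutativeRing; _-Raw-AlmostCommutative⟶_)
  import Algebra.Solver.Ring as RingSolver
  import Algebra.Properties.Monoid.Mult as Mult
  import Algebra.Properties.Semiring.Mult as SMult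
  import Algebra.Properties.Ring as RingProps
  open import Data.Fin.Base using (Fin; zero; suc; toℕ)
  open import Data.Integer.Base as ℤ using (ℤ; +_; -[1+_])
  import Data.Integer.Properties as ℤ
  import Data.Sign.Base as Sign
  open import Data.List.Base using ([]; _∷_; length)
  open import Data.List.Relation.Unary.All as All using (All; []; _∷_)
  open import Data.List.Relation.Unary.AllPairs using (AllPairs; []; _∷_)
  open import Data.List.Relation.Unary.Linked using (Linked)
  import Data.List.Relation.Unary.Linked.Properties as Linked
  open import Data.Maybe.Base using (Maybe; just; nothing)
  open import Data.Nat.Base as ℕ using (ℕ; zero; suc)
  import Data.Nat.Properties as ℕ
  open import Data.Product.Base using (∃-syntax; _×_; _,_; proj₁; proj₂)
  open import Data.Sum.Base using (_⊎_; inj₁; inj₂)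
  open import Data.Empty using (⊥-elim)
  open import Function.Base using (_∘_)
  open import Relation.Binary.Definitions using (tri<; tri≈; tri>; Tri)
  open import Relation.Binary.PropositionalEquality.Core as ≡ using (_≡_)
  open import Relation.Nullary using (¬_; yes; no)
  open import Relation.Binary.Structures using (IsStrictTotalOrder)

  -- The ring solver with integer coefficients, so that x - x cancels.
  module IntegerSolver {c ℓ} (R : CommutativeRing c ℓ) where
    open CommutativeRing R
    open Mult +-monoid using (×-homo-+) renaming (_×_ to _·_)
    open SMult semiring using (×1-homo-*)
    open RingProps ring
    open import Relation.Binary.Reasoning.Setoid setoid

    private
      ⟦_⟧ₙ : ℕ → Carrier
      ⟦ n ⟧ₙ = n · 1#

    ⟦_⟧ℤ : ℤ → Carrier
    ⟦ + n ⟧ℤ      = ⟦ n ⟧ₙ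
    ⟦ -[1+ n ] ⟧ℤ = - ⟦ suc n ⟧ₙ

    private
      ⊖-homo : ∀ m n → ⟦ m ℤ.⊖ n ⟧ℤ ≈ ⟦ m ⟧ₙ - ⟦ n ⟧ₙ
      ⊖-homo zero zero = sym (-‿inverseʳ _)
      ⊖-homo zero (suc n) = sym (+-identityˡ _)
      ⊖-homo (suc m) zero = sym (trans (+-congˡ -0#≈0#) (+-identityʳ _))
      ⊖-homo (suc m) (suc n) = begin
        ⟦ suc m ℤ.⊖ suc n ⟧ℤ                ≡⟨ ≡.cong ⟦_⟧ℤ (ℤ.[1+m]⊖[1+n]≡m⊖n m n) ⟩
        ⟦ m ℤ.⊖ n ⟧ℤ                        ≈⟨ ⊖-homo m n ⟩
        a - b                               ≈⟨ +-congʳ (sym (+-identityˡ _)) ⟩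
        -- The inserted `1# - 1#` supplies the two units that turn `a - b` into a difference of
        -- successors.
        (0# + a) - b                        ≈⟨ +-congʳ (+-congʳ (sym (-‿inverseʳ 1#))) ⟩
        ((1# - 1#) + a) - b                 ≈⟨ +-congʳ (trans (+-assoc _ _ _) (+-congˡ (+-comm _ _))) ⟩
        (1# + (a - 1#)) - b                 ≈⟨ +-congʳ (sym (+-assoc _ _ _)) ⟩
        ((1# + a) - 1#) - b                 ≈⟨ +-assoc _ _ _ ⟩
        (1# + a) + (- 1# - b)               ≈⟨ +-congˡ (-‿+-comm 1# b) ⟩
        (1# + a) - (1# + b)                 ∎
        where a = ⟦ m ⟧ₙ
              b = ⟦ n ⟧ₙ

      +-homo : ∀ i j → ⟦ i ℤ.+ j ⟧ℤ ≈ ⟦ i ⟧ℤ + ⟦ j ⟧ℤ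
      +-homo (+ m) (+ n) = ×-homo-+ 1# m n
      +-homo (+ m) -[1+ n ] = ⊖-homo m (suc n)
      +-homo -[1+ m ] (+ n) = trans (⊖-homo n (suc m)) (+-comm _ _)
      +-homo -[1+ m ] -[1+ n ] = begin
        - ⟦ suc (suc (m ℕ.+ n)) ⟧ₙ       ≡⟨ ≡.cong (λ k → - ⟦ suc k ⟧ₙ) (≡.sym (ℕ.+-suc m n)) ⟩
        - ⟦ suc m ℕ.+ suc n ⟧ₙ           ≈⟨ -‿cong (×-homo-+ 1# (suc m) (suc n)) ⟩
        - (⟦ suc m ⟧ₙ + ⟦ suc n ⟧ₙ)      ≈⟨ sym (-‿+-comm _ _) ⟩
        - ⟦ suc m ⟧ₙ - ⟦ suc n ⟧ₙ        ∎

      -◃-homo : ∀ n → ⟦ Sign.- ℤ.◃ n ⟧ℤ ≈ - ⟦ n ⟧ₙ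
      -◃-homo zero    = sym -0#≈0#
      -◃-homo (suc n) = refl

      +◃-homo : ∀ n → ⟦ Sign.+ ℤ.◃ n ⟧ℤ ≈ ⟦ n ⟧ₙ
      +◃-homo zero    = refl
      +◃-homo (suc n) = refl

      *-homo : ∀ i j → ⟦ i ℤ.* j ⟧ℤ ≈ ⟦ i ⟧ℤ * ⟦ j ⟧ℤ
      *-homo (+ m) (+ n) = trans (+◃-homo (m ℕ.* n)) (×1-homo-* m n)
      *-homo (+ m) -[1+ n ] = begin
        _                       ≈⟨ -◃-homo (m ℕ.* suc n) ⟩
        - ⟦ m ℕ.* suc n ⟧ₙ      ≈⟨ -‿cong (×1-homo-* m (suc n)) ⟩
        - (⟦ m ⟧ₙ * ⟦ suc n ⟧ₙ) ≈⟨ -‿distribʳ-* _ _ ⟩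
        _                       ∎
      *-homo -[1+ m ] (+ n) = begin
        _                       ≈⟨ -◃-homo (suc m ℕ.* n) ⟩
        - ⟦ suc m ℕ.* n ⟧ₙ      ≈⟨ -‿cong (×1-homo-* (suc m) n) ⟩
        - (⟦ suc m ⟧ₙ * ⟦ n ⟧ₙ) ≈⟨ -‿distribˡ-* _ _ ⟩
        _                       ∎
      *-homo -[1+ m ] -[1+ n ] = begin
        _                              ≈⟨ +◃-homo (suc m ℕ.* suc n) ⟩
        ⟦ suc m ℕ.* suc n ⟧ₙ           ≈⟨ ×1-homo-* (suc m) (suc n) ⟩
        ⟦ suc m ⟧ₙ * ⟦ suc n ⟧ₙ        ≈⟨ sym (-‿involutive _) ⟩
        - - (⟦ suc m ⟧ₙ * ⟦ suc n ⟧ₙ)  ≈⟨ -‿cong (-‿distribˡ-* _ _) ⟩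
        - (- ⟦ suc m ⟧ₙ * ⟦ suc n ⟧ₙ)  ≈⟨ -‿distribʳ-* _ _ ⟩
        _                              ∎

      -‿homo : ∀ i → ⟦ ℤ.- i ⟧ℤ ≈ - ⟦ i ⟧ℤ
      -‿homo (+ zero)  = sym -0#≈0#
      -‿homo (+ suc n) = refl
      -‿homo -[1+ n ]  = sym (-‿involutive _)

      acr : AlmostCommutativeRing c ℓ
      acr = fromCommutativeRing R

      morphism : ℤ.+-*-rawRing -Raw-AlmostCommutative⟶ acr
      morphism = record
        { ⟦_⟧ = ⟦_⟧ℤ ; +-homo = +-homo ; *-homo = *-homo ; -‿homo = -‿homo
        ; 0-homo = refl ; 1-homo = +-identityʳ 1# }

      coeff≟ : ∀ i j → Maybe (⟦ i ⟧ℤ ≈ ⟦ j ⟧ℤ)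
      coeff≟ i j with i ℤ.≟ j
      ... | yes i≡j = just (reflexive (≡.cong ⟦_⟧ℤ i≡j))
      ... | no  _   = nothing

    open RingSolver ℤ.+-*-rawRing acr morphism coeff≟ public
      using (solve; _:+_; _:*_; _:-_; :-_; _:=_; con)

  -- Order, division and midpoints in an ordered field.

  module OrderedField {c ℓ₁ ℓ₂} (ℝ : CompleteOrderedField c ℓ₁ ℓ₂) where
    open CompleteOrderedField ℝ
    open IntegerSolver commutativeRing
    private module O = IsStrictTotalOrder isStrictTotalOrder

    infix 4 _>0 _≥0
    _>0 _≥0 : Carrier → Set ℓ₂
    x >0 = 0# < x
    x ≥0 = 0# ≤ x

    <-trans : ∀ {x y z} → x < y → y < z → x < z
    <-trans = O.trans

    <-irrefl : ∀ {x y} → x ≈ y → ¬ x < y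
    <-irrefl = O.irrefl

    <-asym : ∀ {x y} → x < y → ¬ y < x
    <-asym = O.asym

    <-resp : ∀ {x x′ y y′} → x ≈ x′ → y ≈ y′ → x < y → x′ < y′
    <-resp p q = O.<-respˡ-≈ p ∘ O.<-respʳ-≈ q

    ≤-resp : ∀ {x x′ y y′} → x ≈ x′ → y ≈ y′ → x ≤ y → x′ ≤ y′
    ≤-resp p q x≤y = x≤y ∘ <-resp (sym q) (sym p)

    <⇒≤ : ∀ {x y} → x < y → x ≤ y
    <⇒≤ = <-asym

    ≤-refl : ∀ {x y} → x ≈ y → x ≤ y
    ≤-refl x≈y = <-irrefl (sym x≈y)

    <⊎≥ : ∀ x y → x < y ⊎ y ≤ x
    <⊎≥ x y with compare x y
    ... | tri< a _ _ = inj₁ a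
    ... | tri≈ a _ _ = inj₂ a
    ... | tri> a _ _ = inj₂ a

    ≤⇒<⊎≈ : ∀ {x y} → x ≤ y → x < y ⊎ x ≈ y
    ≤⇒<⊎≈ {x} {y} x≤y with compare x y
    ... | tri< a _ _ = inj₁ a
    ... | tri≈ _ b _ = inj₂ b
    ... | tri> _ _ d = ⊥-elim (x≤y d)

    <-≤-trans : ∀ {x y z} → x < y → y ≤ z → x < z
    <-≤-trans x<y y≤z with ≤⇒<⊎≈ y≤z
    ... | inj₁ y<z = <-trans x<y y<z
    ... | inj₂ y≈z = <-resp refl y≈z x<y

    ≤-<-trans : ∀ {x y z} → x ≤ y → y < z → x < z
    ≤-<-trans x≤y y<z with ≤⇒<⊎≈ x≤y
    ... | inj₁ x<y = <-trans x<y y<z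
    ... | inj₂ x≈y = <-resp (sym x≈y) refl y<z

    ≤-trans : ∀ {x y z} → x ≤ y → y ≤ z → x ≤ z
    ≤-trans x≤y y≤z z<x = y≤z (<-≤-trans z<x x≤y)

    diff>0 : ∀ {x y} → x < y → y - x >0
    diff>0 {x} x<y = <-resp (-‿inverseʳ x) refl (+-monoˡ-< (- x) x<y)

    diff>0⁻¹ : ∀ {x y} → y - x >0 → x < y
    diff>0⁻¹ {x} {y} p = <-resp (+-identityˡ x)
      (solve 2 (λ x y → (y :- x) :+ x := y) refl x y) (+-monoˡ-< x p)

    diff≥0 : ∀ {x y} → x ≤ y → y - x ≥0
    diff≥0 {x} {y} x≤y p = x≤y (diff>0⁻¹
      (<-resp refl (solve 2 (λ x y → :- (y :- x) := x :- y) refl x y) (<-resp (-‿inverseʳ _) (+-identityˡ _) (+-monoˡ-< (- (y - x)) p))))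

    diff≥0⁻¹ : ∀ {x y} → y - x ≥0 → x ≤ y
    diff≥0⁻¹ {x} {y} p y<x = p (<-resp (solve 2 (λ x y → y :+ (:- x) := y :- x) refl x y) (-‿inverseʳ x) (+-monoˡ-< (- x) y<x))

    neg>0 : ∀ {x} → x < 0# → - x >0
    neg>0 {x} x<0 = <-resp refl (+-identityˡ _) (diff>0 x<0)

    neg<0 : ∀ {x} → x >0 → - x < 0#
    neg<0 {x} x>0 = diff>0⁻¹ (<-resp refl (solve 1 (λ x → x := con (+ 0) :- (:- x)) refl x) x>0)

    >0-+ : ∀ {x y} → x >0 → y >0 → x + y >0
    >0-+ {x} {y} p q = <-trans q (<-resp (+-identityˡ y) refl (+-monoˡ-< y p))

    >0-≥0-+ : ∀ {x y} → x >0 → y ≥0 → x + y >0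
    >0-≥0-+ {x} {y} p q = ≤-<-trans q (<-resp (+-identityˡ y) refl (+-monoˡ-< y p))

    ≥0-+ : ∀ {x y} → x ≥0 → y ≥0 → x + y ≥0
    ≥0-+ {x} {y} p q with ≤⇒<⊎≈ p
    ... | inj₁ x>0 = <⇒≤ (>0-≥0-+ x>0 q)
    ... | inj₂ 0≈x = ≤-resp refl (trans (sym (+-identityˡ y)) (+-congʳ 0≈x)) q

    ≥0-* : ∀ {x y} → x ≥0 → y ≥0 → x * y ≥0
    ≥0-* {x} {y} p q with ≤⇒<⊎≈ p | ≤⇒<⊎≈ q
    ... | inj₁ x>0 | inj₁ y>0 = <⇒≤ (*-pos x>0 y>0)
    ... | inj₂ 0≈x | _ = ≤-refl (sym (trans (*-congʳ (sym 0≈x)) (zeroˡ y)))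
    ... | inj₁ _ | inj₂ 0≈y = ≤-refl (sym (trans (*-congˡ (sym 0≈y)) (zeroʳ x)))

    +-mono-≤ : ∀ {x x′ y y′} → x ≤ x′ → y ≤ y′ → x + y ≤ x′ + y′
    +-mono-≤ {x} {x′} {y} {y′} p q = diff≥0⁻¹ (≤-resp refl
      (solve 4 (λ x x′ y y′ → (x′ :- x) :+ (y′ :- y) := (x′ :+ y′) :- (x :+ y)) refl x x′ y y′)
      (≥0-+ (diff≥0 p) (diff≥0 q)))

    0<1 : 1# >0
    0<1 with compare 0# 1#
    ... | tri< a _ _ = a
    ... | tri≈ _ b _ = ⊥-elim (0≉1 b)
    -- If one were negative, the square of minus one would be positive; but that square is one.
    ... | tri> _ _ d = <-resp refl
      (trans (solve 1 (λ o → :- o :* :- o := o :* o) refl 1#) (*-identityʳ 1#))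
      (*-pos (neg>0 d) (neg>0 d))

    <-+1 : ∀ x → x < x + 1#
    <-+1 x = diff>0⁻¹ (<-resp refl (solve 2 (λ x o → o := (x :+ o) :- x) refl x 1#) 0<1)

    -1-< : ∀ x → x - 1# < x
    -1-< x = diff>0⁻¹ (<-resp refl (solve 2 (λ x o → o := x :- (x :- o)) refl x 1#) 0<1)

    2>0 : 1# + 1# >0
    2>0 = >0-+ 0<1 0<1

    ÷-* : ∀ x {y} → y >0 → (x ÷ y) * y ≈ x
    ÷-* x {y} y>0 with compare y 0#
    ... | tri< a _ _ = ⊥-elim (<-asym a y>0)
    ... | tri≈ _ b _ = ⊥-elim (<-irrefl (sym b) y>0)
    ... | tri> _ y≉0 _ = trans (*-assoc _ _ _) (trans (*-congˡ (trans (*-comm _ _) (proj₂ (inverse y y≉0)))) (*-identityʳ x))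

    *-cancel>0 : ∀ {x y} → y >0 → x * y >0 → x >0
    *-cancel>0 {x} {y} y>0 xy>0 with <⊎≥ 0# x
    ... | inj₁ x>0 = x>0
    ... | inj₂ x≤0 = ⊥-elim (≥0-* (≤-resp refl (+-identityˡ _) (diff≥0 x≤0)) (<⇒≤ y>0)
          (<-resp (solve 2 (λ x y → :- (x :* y) := (:- x) :* y) refl x y) refl (neg<0 xy>0)))

    ÷-pos : ∀ {x y} → x >0 → y >0 → (x ÷ y) >0
    ÷-pos {x} x>0 y>0 = *-cancel>0 y>0 (<-resp refl (sym (÷-* x y>0)) x>0)

    module _ {x y : Carrier} (x<y : x < y) where
      private
        m = (x + y) ÷ (1# + 1#)

        double : ∀ z → z * (1# + 1#) ≈ z + z
        double z = trans (distribˡ z 1# 1#) (+-cong (*-identityʳ z) (*-identityʳ z))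

      <-midpoint : x < m
      -- Positivity of the difference is checked after multiplication by two, where the quotient
      -- disappears.
      <-midpoint = diff>0⁻¹ (*-cancel>0 2>0 (<-resp refl (trans
        (solve 2 (λ x y → y :- x := (x :+ y) :- (x :+ x)) refl x y) (trans
        (+-cong (sym (÷-* (x + y) 2>0)) (-‿cong (sym (double x))))
        (solve 3 (λ m x t → m :* t :- x :* t := (m :- x) :* t) refl m x (1# + 1#)))) (diff>0 x<y)))

      midpoint-< : m < y
      midpoint-< = diff>0⁻¹ (*-cancel>0 2>0 (<-resp refl (trans
        (solve 2 (λ x y → y :- x := (y :+ y) :- (x :+ y)) refl x y) (trans
        (+-cong (sym (double y)) (-‿cong (sym (÷-* (x + y) 2>0))))
        (solve 3 (λ m y t → y :* t :- m :* t := (y :- m) :* t) refl m y (1# + 1#)))) (diff>0 x<y)))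

  -- Polynomials: number of roots, continuity, intermediate values.

  module Polynomials {c ℓ₁ ℓ₂} (ℝ : CompleteOrderedField c ℓ₁ ℓ₂) where
    open CompleteOrderedField ℝ hiding (zero)
    open OrderedField ℝ
    open IntegerSolver commutativeRing
    open RingProps ring using (-‿involutive; -0#≈0#)
    open import Algebra.Properties.Semiring.Exp semiring using (_^_)
    open import Algebra.Properties.Monoid.Sum +-monoid using (sum)

    -- Horner's scheme recurses on the constant coefficient, so division by a linear factor and
    -- inductions on the number of coefficients involve no powers.
    horner : ∀ {m} → (Fin m → Carrier) → Carrier → Carrier
    horner {zero}  p x = 0#
    horner {suc m} p x = p zero + x * horner (p ∘ suc) x

    sum-shift : ∀ {m} (p : Fin m → Carrier) x →
                sum (λ i → p i * (x * x ^ toℕ i)) ≈ x * sum (λ i → p i * x ^ toℕ i)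
    sum-shift {m} p x = go (λ i → x ^ toℕ i) p
      where
      -- The powers are generalised to an arbitrary sequence `e`, because the induction shifts their
      -- index.
      go : ∀ {m} (e p : Fin m → Carrier) → sum (λ i → p i * (x * e i)) ≈ x * sum (λ i → p i * e i)
      go {zero}  e p = sym (zeroʳ x)
      go {suc m} e p = trans (+-congˡ (go (e ∘ suc) (p ∘ suc)))
        (solve 4 (λ p x e s → p :* (x :* e) :+ x :* s := x :* (p :* e :+ s)) refl (p zero) x (e zero) _)

    sum≈horner : ∀ {m} (p : Fin m → Carrier) x → sum (λ i → p i * x ^ toℕ i) ≈ horner p x
    sum≈horner {zero}  p x = refl
    sum≈horner {suc m} p x = +-cong (*-identityʳ _) (trans (sum-shift (p ∘ suc) x) (*-congˡ (sum≈horner (p ∘ suc) x)))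

    eval≈horner : ∀ {d} (p : Polynomial d) x → eval p x ≈ horner p x
    eval≈horner p x = sum≈horner p x

    horner-cong : ∀ {m} {p p′ : Fin m → Carrier} {x x′} → (∀ i → p i ≈ p′ i) → x ≈ x′ → horner p x ≈ horner p′ x′
    horner-cong {zero}  p≈ x≈ = refl
    horner-cong {suc m} p≈ x≈ = +-cong (p≈ zero) (*-cong x≈ (horner-cong (p≈ ∘ suc) x≈))

    horner-congʳ : ∀ {m} (p : Fin m → Carrier) {x x′} → x ≈ x′ → horner p x ≈ horner p x′
    horner-congʳ p = horner-cong {p = p} (λ _ → refl)

    eval-cong : ∀ {d} {p p′ : Polynomial d} {x x′} → (∀ i → p i ≈ p′ i) → x ≈ x′ → eval p x ≈ eval p′ x′
    eval-cong {p = p} {p′} p≈ x≈ = trans (eval≈horner p _) (trans (horner-cong p≈ x≈) (sym (eval≈horner p′ _)))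

    eval-0 : ∀ {d} (p : Polynomial d) x → (∀ i → p i ≈ 0#) → eval p x ≈ 0#
    eval-0 p x p≈0 = trans (eval≈horner p x) (go p p≈0)
      where
      go : ∀ {m} (p : Fin m → Carrier) → (∀ i → p i ≈ 0#) → horner p x ≈ 0#
      go {zero}  p p≈0 = refl
      go {suc m} p p≈0 = trans (+-cong (p≈0 zero) (trans (*-congˡ (go (p ∘ suc) (p≈0 ∘ suc))) (zeroʳ x))) (+-identityˡ 0#)

    eval-+ : ∀ {d} (p q : Polynomial d) x → eval (λ i → p i + q i) x ≈ eval p x + eval q x
    eval-+ p q x = trans (eval≈horner (λ i → p i + q i) x) (trans (go p q) (sym (+-cong (eval≈horner p x) (eval≈horner q x))))
      where
      go : ∀ {m} (p q : Fin m → Carrier) → horner (λ i → p i + q i) x ≈ horner p x + horner q x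
      go {zero}  p q = sym (+-identityˡ 0#)
      go {suc m} p q = trans (+-congˡ (*-congˡ (go (p ∘ suc) (q ∘ suc))))
        (solve 5 (λ a b x h k → (a :+ b) :+ x :* (h :+ k) := (a :+ x :* h) :+ (b :+ x :* k)) refl (p zero) (q zero) x _ _)

    horner-neg : ∀ {m} (p : Fin m → Carrier) x → horner (λ i → - p i) x ≈ - horner p x
    horner-neg {zero}  p x = solve 0 (con (+ 0) := :- con (+ 0)) refl
    horner-neg {suc m} p x = trans (+-congˡ (*-congˡ (horner-neg (p ∘ suc) x)))
      (solve 3 (λ a x h → :- a :+ x :* :- h := :- (a :+ x :* h)) refl (p zero) x _)

    eval-neg : ∀ {d} (p : Polynomial d) x → eval (λ i → - p i) x ≈ - eval p x
    eval-neg p x = trans (eval≈horner (λ i → - p i) x) (trans (horner-neg p x) (-‿cong (sym (eval≈horner p x))))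

    eval-- : ∀ {d} (p q : Polynomial d) x → eval (λ i → p i - q i) x ≈ eval p x - eval q x
    eval-- p q x = trans (eval-+ p (λ i → - q i) x) (+-congˡ (eval-neg q x))

    -- Synthetic division by `x - r`: the coefficients of the quotient are the Horner values at `r`
    -- of the tails of `p`.
    quotient : ∀ {m} → (Fin (suc m) → Carrier) → Carrier → Fin m → Carrier
    quotient {suc m} p r zero    = horner (p ∘ suc) r
    quotient {suc m} p r (suc i) = quotient (p ∘ suc) r i

    factor : ∀ {m} (p : Fin (suc m) → Carrier) r x → horner p x ≈ horner p r + (x - r) * horner (quotient p r) x
    factor {zero} p r x = solve 3 (λ a r x → a :+ x :* con (+ 0) := (a :+ r :* con (+ 0)) :+ (x :- r) :* con (+ 0)) refl (p zero) r x
    factor {suc m} p r x = trans (+-congˡ (*-congˡ (factor (p ∘ suc) r x)))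
      (solve 5 (λ a r x h g → a :+ x :* (h :+ (x :- r) :* g) := (a :+ r :* h) :+ (x :- r) :* (h :+ x :* g)) refl
        (p zero) r x (horner (p ∘ suc) r) (horner (quotient (p ∘ suc) r) x))

    -- Read contrapositively, a nonzero polynomial divided by the factor of one of its roots leaves
    -- a nonzero quotient, which lets `count-roots` recurse.
    quotient-0 : ∀ {m} (p : Fin (suc m) → Carrier) r → horner p r ≈ 0# →
                 (∀ i → quotient p r i ≈ 0#) → ∀ i → p i ≈ 0#
    quotient-0 {zero} p r pr≈0 q≈0 zero = trans (solve 2 (λ a r → a := a :+ r :* con (+ 0)) refl (p zero) r) pr≈0
    quotient-0 {suc m} p r pr≈0 q≈0 zero = trans (trans (sym (+-identityʳ _)) (+-congˡ (sym (trans (*-congˡ (q≈0 zero)) (zeroʳ r))))) pr≈0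
    quotient-0 {suc m} p r pr≈0 q≈0 (suc i) = quotient-0 (p ∘ suc) r (q≈0 zero) (q≈0 ∘ suc) i

    zero⊎nonzero : ∀ {m} (p : Fin m → Carrier) → (∀ i → p i ≈ 0#) ⊎ (∃[ i ] ¬ p i ≈ 0#)
    zero⊎nonzero {zero} p = inj₁ λ ()
    zero⊎nonzero {suc m} p with compare (p zero) 0# | zero⊎nonzero (p ∘ suc)
    ... | tri< _ a _ | _ = inj₂ (zero , a)
    ... | tri> _ a _ | _ = inj₂ (zero , a)
    ... | tri≈ _ _ _ | inj₂ (i , a) = inj₂ (suc i , a)
    ... | tri≈ _ a _ | inj₁ b = inj₁ λ { zero → a ; (suc i) → b i }

    *-≈0 : ∀ {x y} → x * y ≈ 0# → ¬ x ≈ 0# → y ≈ 0#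
    *-≈0 {x} {y} xy≈0 x≉0 with inverse x x≉0
    ... | z , xz≈1 = trans (trans (sym (*-identityˡ y)) (trans (*-congʳ (sym xz≈1))
      (solve 3 (λ x y z → (x :* z) :* y := z :* (x :* y)) refl x y z))) (trans (*-congˡ xy≈0) (zeroʳ z))

    -- The first root is divided out. Every later root is strictly larger, so its distance to the
    -- first is not zero and it remains a root of the quotient, which has one coefficient less.
    count-roots : ∀ {m} (p : Fin m → Carrier) rs → AllPairs _<_ rs → All (λ r → horner p r ≈ 0#) rs →
                  (∃[ i ] ¬ p i ≈ 0#) → length rs ℕ.< m
    count-roots {suc m} p [] _ _ _ = ℕ.s≤s ℕ.z≤n
    count-roots {zero} p (r ∷ rs) _ _ (() , _)
    count-roots {suc m} p (r ∷ rs) (r<rs ∷ rs↗) (pr≈0 ∷ prs≈0) (i , pi≉0) with zero⊎nonzero (quotient p r)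
    ... | inj₁ q≈0 = ⊥-elim (pi≉0 (quotient-0 p r pr≈0 q≈0 i))
    ... | inj₂ q≉0 = ℕ.s≤s (count-roots (quotient p r) rs rs↗ (All.zipWith root (r<rs , prs≈0)) q≉0)
      where
      root : ∀ {x} → r < x × horner p x ≈ 0# → horner (quotient p r) x ≈ 0#
      root {x} (r<x , px≈0) = *-≈0
        (trans (trans (sym (+-identityˡ _)) (+-congʳ (sym pr≈0))) (trans (sym (factor p r x)) px≈0))
        (λ x-r≈0 → <-irrefl (sym x-r≈0) (diff>0 r<x))

    rootList-length : ∀ {d} {p : Polynomial d} {rs} → IsRootList p rs → (∃[ i ] ¬ p i ≈ 0#) → length rs ℕ.≤ d
    rootList-length {p = p} {rs} L p≉0 = ℕ.≤-pred (count-roots p rs (Linked.Linked⇒AllPairs <-trans increasing)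
      (All.map (λ {r} e → trans (sym (eval≈horner p r)) e) sound) p≉0)
      where open IsRootList L

    -- The inequality `|x| ≤ b` without an absolute value.
    Bounded : Carrier → Carrier → Set ℓ₂
    Bounded x b = (b - x ≥0) × (b + x ≥0)

    bounded-nonneg : ∀ {x b} → Bounded x b → b ≥0
    bounded-nonneg {x} {b} (p , q) with <⊎≥ b 0#
    ... | inj₂ b≥0 = b≥0
    ... | inj₁ b<0 = ⊥-elim (≥0-+ p q (diff>0⁻¹ (<-resp refl (solve 2 (λ x b → :- b :+ :- b := con (+ 0) :- ((b :- x) :+ (b :+ x))) refl x b) (>0-+ (neg>0 b<0) (neg>0 b<0)))))

    bounded-+ : ∀ {x y a b} → Bounded x a → Bounded y b → Bounded (x + y) (a + b)
    bounded-+ {x} {y} {a} {b} (p , q) (r , s) =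
      ≤-resp refl (solve 4 (λ x y a b → (a :- x) :+ (b :- y) := (a :+ b) :- (x :+ y)) refl x y a b) (≥0-+ p r) ,
      ≤-resp refl (solve 4 (λ x y a b → (a :+ x) :+ (b :+ y) := (a :+ b) :+ (x :+ y)) refl x y a b) (≥0-+ q s)

    halve≥0 : ∀ {x} → x + x ≥0 → x ≥0
    halve≥0 {x} 2x≥0 x<0 = 2x≥0 (diff>0⁻¹ (<-resp refl (solve 1 (λ x → :- x :+ :- x := con (+ 0) :- (x :+ x)) refl x) (>0-+ (neg>0 x<0) (neg>0 x<0))))

    -- Twice `ab - xy` is `(a - x)(b + y) + (a + x)(b - y)`, a sum of products of nonnegative
    -- factors, and similarly for `ab + xy`. This avoids a distinction of signs.
    bounded-* : ∀ {x y a b} → Bounded x a → Bounded y b → Bounded (x * y) (a * b)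
    bounded-* {x} {y} {a} {b} (p , q) (r , s) =
      halve≥0 (≤-resp refl (solve 4 (λ x y a b → (a :- x) :* (b :+ y) :+ (a :+ x) :* (b :- y) := (a :* b :- x :* y) :+ (a :* b :- x :* y)) refl x y a b)
        (≥0-+ (≥0-* p s) (≥0-* q r))) ,
      halve≥0 (≤-resp refl (solve 4 (λ x y a b → (a :- x) :* (b :- y) :+ (a :+ x) :* (b :+ y) := (a :* b :+ x :* y) :+ (a :* b :+ x :* y)) refl x y a b)
        (≥0-+ (≥0-* p r) (≥0-* q s)))

    bounded-abs : ∀ x → ∃[ b ] Bounded x b
    bounded-abs x with <⊎≥ x 0#
    ... | inj₁ x<0 = - x , ≤-resp refl (solve 1 (λ x → :- x :+ :- x := :- x :- x) refl x) (≥0-+ (<⇒≤ (neg>0 x<0)) (<⇒≤ (neg>0 x<0)))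
                   , ≤-refl (sym (-‿inverseˡ x))
    ... | inj₂ x≥0 = x , ≤-refl (sym (-‿inverseʳ x)) , ≥0-+ x≥0 x≥0

    bounded-horner : ∀ {m} (p : Fin m → Carrier) a → ∃[ b ] ∀ {x} → Bounded x a → Bounded (horner p x) b
    bounded-horner {zero} p a = 0# , λ _ → ≤-refl (sym (-‿inverseʳ 0#)) , ≤-refl (sym (+-identityˡ 0#))
    bounded-horner {suc m} p a with bounded-abs (p zero) | bounded-horner (p ∘ suc) a
    ... | b , h | b′ , h′ = b + a * b′ , λ k → bounded-+ h (bounded-* k (h′ k))

    minimum>0 : ∀ {x y} → x >0 → y >0 → ∃[ z ] z >0 × z ≤ x × z ≤ y
    minimum>0 {x} {y} p q with <⊎≥ x y
    ... | inj₁ x<y = x , p , ≤-refl refl , <⇒≤ x<y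
    ... | inj₂ y≤x = y , q , y≤x , ≤-refl refl

    -- The increment of a polynomial near s is at most M |z - s|, where M bounds the quotient by z - s.
    continuous : ∀ {m} (p : Fin m → Carrier) s {ε} → ε >0 →
                 ∃[ δ ] δ >0 × (∀ z → Bounded (z - s) δ → Bounded (horner p z - horner p s) ε)
    continuous {zero} p s {ε} ε>0 = 1# , 0<1 , λ _ _ →
      ≤-resp refl (solve 1 (λ e → e := e :- (con (+ 0) :- con (+ 0))) refl ε) (<⇒≤ ε>0) ,
      ≤-resp refl (solve 1 (λ e → e := e :+ (con (+ 0) :- con (+ 0))) refl ε) (<⇒≤ ε>0)
    continuous {suc m} p s {ε} ε>0 with bounded-abs s
    ... | a , hs with bounded-horner (quotient p s) (1# + a)
    -- The bound `δ ≤ 1` keeps `z` in the range where `b` bounds the quotient. The other bound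
    -- divides by `1 + b`, which is positive even if `b` is zero.
    ... | b , hb with minimum>0 0<1 (÷-pos ε>0 (>0-≥0-+ 0<1 b≥0))
      where
      b≥0 : b ≥0
      b≥0 = bounded-nonneg (hb {s} (≤-resp refl (solve 3 (λ o a s → o :+ (a :- s) := (o :+ a) :- s) refl 1# a s) (≥0-+ (<⇒≤ 0<1) (proj₁ hs)) ,
        ≤-resp refl (solve 3 (λ o a s → o :+ (a :+ s) := (o :+ a) :+ s) refl 1# a s) (≥0-+ (<⇒≤ 0<1) (proj₂ hs))))
    ... | δ , δ>0 , δ≤1 , δ≤ε/b = δ , δ>0 , close
      where
      M = 1# + b
      close : ∀ z → Bounded (z - s) δ → Bounded (horner p z - horner p s) ε
      close z hz = weaken (bounded-* hz (hb zb))
        where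
        zb : Bounded z (1# + a)
        zb = ≤-resp refl (solve 5 (λ o δ a z s → (o :- δ) :+ ((δ :- (z :- s)) :+ (a :- s)) := (o :+ a) :- z) refl 1# δ a z s)
               (≥0-+ (diff≥0 δ≤1) (≥0-+ (proj₁ hz) (proj₁ hs))) ,
             ≤-resp refl (solve 5 (λ o δ a z s → (o :- δ) :+ ((δ :+ (z :- s)) :+ (a :+ s)) := (o :+ a) :+ z) refl 1# δ a z s)
               (≥0-+ (diff≥0 δ≤1) (≥0-+ (proj₂ hz) (proj₂ hs)))
        b≥0 = bounded-nonneg (hb zb)
        M>0 = >0-≥0-+ 0<1 b≥0
        e≈ : (z - s) * horner (quotient p s) z ≈ horner p z - horner p s
        e≈ = trans (solve 2 (λ d h → d := (h :+ d) :- h) refl _ (horner p s)) (+-congʳ (sym (factor p s z)))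
        ε-δb≥0 : ε - δ * b ≥0
        ε-δb≥0 = ≤-resp refl (trans (solve 4 (λ e δ o b → e :* (o :+ b) :- δ :* (o :+ b) :+ δ :* o := e :* (o :+ b) :- δ :* b) refl (ε ÷ M) δ 1# b) (+-congʳ (÷-* ε M>0)))
          (≥0-+ (≤-resp refl (solve 3 (λ e δ M → (e :- δ) :* M := e :* M :- δ :* M) refl (ε ÷ M) δ M) (≥0-* (diff≥0 δ≤ε/b) (<⇒≤ M>0)))
                (≥0-* (<⇒≤ δ>0) (<⇒≤ 0<1)))
        weaken : Bounded ((z - s) * horner (quotient p s) z) (δ * b) → Bounded (horner p z - horner p s) ε
        weaken (l , r) =
          ≤-resp refl (trans (solve 3 (λ e c x → (e :- c) :+ (c :- x) := e :- x) refl ε (δ * b) _) (+-congˡ (-‿cong e≈))) (≥0-+ ε-δb≥0 l) ,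
          ≤-resp refl (trans (solve 3 (λ e c x → (e :- c) :+ (c :+ x) := e :+ x) refl ε (δ * b) _) (+-congˡ e≈)) (≥0-+ ε-δb≥0 r)

    -- Here `s` is the supremum of the points up to `b` at which `p` is negative. A negative value
    -- at `s` would persist slightly to the right, against the upper bound; a positive one would
    -- persist slightly to the left, against leastness.
    module Supremum {m} (p : Fin m → Carrier) {a b} (a<b : a < b) (pa<0 : horner p a < 0#) (pb>0 : horner p b >0)
      (s : Carrier) (below : ∀ z → z ≤ b → horner p z < 0# → z ≤ s)
      (least : ∀ b′ → (∀ z → z ≤ b → horner p z < 0# → z ≤ b′) → s ≤ b′) where
      private
        a≤s = below a (<⇒≤ a<b) pa<0
        s≤b = least b (λ z z≤b _ → z≤b)

        shift-out : ∀ b s η → (b - s) - η ≈ b - (s + η)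
        shift-out = solve 3 (λ b s η → (b :- s) :- η := b :- (s :+ η)) refl

        half : ∀ {ε} → ε >0 → ∃[ δ ] δ >0 × δ < ε
        half ε>0 = _ , <-midpoint ε>0 , midpoint-< ε>0

        not<0 : ¬ horner p s < 0#
        not<0 ps<0 with half (neg>0 ps<0)
        ... | ε , ε>0 , ε<-ps with continuous p s ε>0
        ... | δ , δ>0 , close with ≤⇒<⊎≈ s≤b
        ... | inj₂ s≈b = <-asym pb>0 (<-resp (horner-congʳ p s≈b) refl ps<0)
        -- The step to the right must also stay below `b`, since only points up to `b` belong to the
        -- set.
        ... | inj₁ s<b with minimum>0 δ>0 (diff>0 s<b)
        ... | η , η>0 , η≤δ , η≤b-s = below z (diff≥0⁻¹ (≤-resp refl (shift-out b s η) (diff≥0 η≤b-s))) pz<0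
                 (diff>0⁻¹ (<-resp refl (solve 2 (λ s η → η := (s :+ η) :- s) refl s η) η>0))
          where
          z = s + η
          near : Bounded (z - s) δ
          near = ≤-resp refl (solve 3 (λ s η δ → δ :- η := δ :- ((s :+ η) :- s)) refl s η δ) (diff≥0 η≤δ) ,
                 ≤-resp refl (solve 3 (λ s η δ → δ :+ η := δ :+ ((s :+ η) :- s)) refl s η δ) (≥0-+ (<⇒≤ δ>0) (<⇒≤ η>0))
          pz<0 : horner p z < 0#
          pz<0 = diff>0⁻¹ (<-resp refl (solve 3 (λ e x y → (:- y :- e) :+ (e :- (x :- y)) := con (+ 0) :- x) refl ε (horner p z) (horner p s))
            (>0-≥0-+ (diff>0 ε<-ps) (proj₁ (close z near))))

        not>0 : ¬ horner p s >0
        not>0 ps>0 with half ps>0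
        ... | ε , ε>0 , ε<ps with continuous p s ε>0
        ... | δ , δ>0 , close = least (s - δ) upper (diff>0⁻¹ (<-resp refl (solve 2 (λ s δ → δ := s :- (s :- δ)) refl s δ) δ>0))
          where
          upper : ∀ z → z ≤ b → horner p z < 0# → z ≤ s - δ
          upper z z≤b pz<0 s-δ<z = <-asym pz<0 pz>0
            where
            z≤s = below z z≤b pz<0
            near : Bounded (z - s) δ
            near = ≤-resp refl (solve 3 (λ s z δ → δ :+ (s :- z) := δ :- (z :- s)) refl s z δ) (≥0-+ (<⇒≤ δ>0) (diff≥0 z≤s)) ,
                   ≤-resp refl (solve 3 (λ s z δ → z :- (s :- δ) := δ :+ (z :- s)) refl s z δ) (<⇒≤ (diff>0 s-δ<z))
            pz>0 : horner p z >0
            pz>0 = <-resp refl (solve 3 (λ e x y → (y :- e) :+ (e :+ (x :- y)) := x) refl ε (horner p z) (horner p s))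
              (>0-≥0-+ (diff>0 ε<ps) (proj₂ (close z near)))

        root : horner p s ≈ 0#
        root with compare (horner p s) 0#
        ... | tri< h _ _ = ⊥-elim (not<0 h)
        ... | tri≈ _ h _ = h
        ... | tri> _ _ h = ⊥-elim (not>0 h)

      root-between : a < s × s < b × horner p s ≈ 0#
      root-between = a<s , s<b , root
        where
        a<s : a < s
        a<s with ≤⇒<⊎≈ a≤s
        ... | inj₁ h = h
        ... | inj₂ a≈s = ⊥-elim (<-irrefl (trans (horner-congʳ p a≈s) root) pa<0)
        s<b : s < b
        s<b with ≤⇒<⊎≈ s≤b
        ... | inj₁ h = h
        ... | inj₂ s≈b = ⊥-elim (<-irrefl (sym (trans (sym (horner-congʳ p s≈b)) root)) pb>0)

    intermediate-horner : ∀ {m} (p : Fin m → Carrier) {a b} → a < b → horner p a < 0# → horner p b >0 →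
                          ∃[ r ] a < r × r < b × horner p r ≈ 0#
    intermediate-horner p {a} {b} a<b pa<0 pb>0
      with supremum (λ z → Lift (c ⊔ ℓ₁ ⊔ ℓ₂) (z ≤ b × horner p z < 0#))
             (a , lift (<⇒≤ a<b , pa<0)) (b , λ z Pz → proj₁ (lower Pz))
    ... | s , below , least = s , Supremum.root-between p a<b pa<0 pb>0 s
            (λ z z≤b pz<0 → below z (lift (z≤b , pz<0))) (λ b′ up → least b′ (λ z Pz → up z (proj₁ (lower Pz)) (proj₂ (lower Pz))))

    -- The order of the two points is left open, because a query may lie on either side of the
    -- sample point.
    Between : Carrier → Carrier → Carrier → Set ℓ₂
    Between x y r = (x < r × r < y) ⊎ (y < r × r < x)

    intermediate : ∀ {d} (p : Polynomial d) {x y} → eval p x < 0# → eval p y >0 →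
                   ∃[ r ] Between x y r × eval p r ≈ 0#
    intermediate {d} p {x} {y} px<0 py>0 = go (compare x y)
      where
      hx = <-resp (eval≈horner p x) refl px<0
      hy = <-resp refl (eval≈horner p y) py>0
      -p : Fin (suc d) → Carrier
      -p i = - p i
      neg-root : ∀ {r} → horner -p r ≈ 0# → horner p r ≈ 0#
      neg-root {r} e = trans (sym (-‿involutive _)) (trans (-‿cong (trans (sym (horner-neg p r)) e)) -0#≈0#)
      go : Tri (x < y) (x ≈ y) (y < x) → ∃[ r ] Between x y r × eval p r ≈ 0#
      go (tri≈ _ x≈y _) = ⊥-elim (<-asym hy (<-resp (horner-congʳ p x≈y) refl hx))
      go (tri< x<y _ _) =
        let r , x<r , r<y , e = intermediate-horner p x<y hx hy
        in r , inj₁ (x<r , r<y) , trans (eval≈horner p r) e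
      -- From left to right the sign now falls, so the theorem is applied to the negated polynomial.
      go (tri> _ _ y<x) =
        let r , y<r , r<x , e = intermediate-horner -p y<x (<-resp (sym (horner-neg p y)) refl (neg<0 hy)) (<-resp refl (sym (horner-neg p x)) (neg>0 hx))
        in r , inj₂ (y<r , r<x) , trans (eval≈horner p r) (neg-root e)

open OrderedFields

-- A language of bounded loops and its compilation.

module Compilation where
  open import Level using (Level; _⊔_)
  open import Data.Bool.Base using (Bool; true; false; if_then_else_; T; _∧_; _∨_)
  import Data.Bool.Properties as Bool
  open import Data.Fin.Base using (Fin; toℕ)
  import Data.Fin.Properties as Fin
  open import Data.List.Base using (List; []; _∷_; length)
  open import Data.Nat.Base hiding (_⊔_)
  open import Data.Nat.Properties as ℕ using (_≟_)
  open import Data.Product.Base using (∃-syntax; _×_; _,_; proj₁; proj₂)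
  open import Data.Sum.Base using (_⊎_; inj₁; inj₂)
  open import Data.Empty using (⊥-elim)
  open import Function.Base using (_∘_)
  open import Relation.Binary.Definitions using (tri<; tri≈; tri>)
  open import Relation.Binary.PropositionalEquality using (_≡_; _≢_; refl; sym; trans; cong; cong₂; subst; subst₂)
  open import Relation.Nullary using (¬_; Dec; yes; no; does)
  open import Relation.Nullary.Decidable using (dec-true; dec-false)
  open import Data.List.Relation.Unary.All as All using (All)

  [≔]-same : ∀ {a} {A : Set a} (m : ℕ → A) k {v} → (m [ k ≔ v ]) k ≡ v
  [≔]-same m k {v} rewrite dec-true (k ≟ k) refl = refl

  [≔]-other : ∀ {a} {A : Set a} (m : ℕ → A) {k j v} → j ≢ k → (m [ k ≔ v ]) j ≡ m j
  [≔]-other m {k} {j} j≢k rewrite dec-false (j ≟ k) j≢k = refl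

  [≔*]-outside : ∀ {a} {A : Set a} (m : ℕ → A) k vs {j} → (j < k ⊎ k + length vs ≤ j) → (m [ k ≔* vs ]) j ≡ m j
  [≔*]-outside m k [] _ = refl
  [≔*]-outside m k (v ∷ vs) {j} (inj₁ j<k) =
    trans ([≔]-other (m [ suc k ≔* vs ]) (ℕ.<⇒≢ j<k)) ([≔*]-outside m (suc k) vs (inj₁ (ℕ.m<n⇒m<1+n j<k)))
  [≔*]-outside m k (v ∷ vs) {j} (inj₂ k+l≤j) =
    trans ([≔]-other (m [ suc k ≔* vs ]) (≢-sym′ (ℕ.<⇒≢ (ℕ.≤-trans (ℕ.m≤m+n (suc k) (length vs)) k+l≤j′))))
          ([≔*]-outside m (suc k) vs (inj₂ k+l≤j′))
    where
    k+l≤j′ = subst (_≤ j) (ℕ.+-suc k (length vs)) k+l≤j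
    ≢-sym′ : ∀ {x y : ℕ} → x ≢ y → y ≢ x
    ≢-sym′ p = p ∘ sym

  -- A structured language over the machine.  Variables are immutable and scoped: a variable of level d < 25
  -- lives in register 16 + d.  Mutable data live in arrays of ints and of reals with four indices.
  -- Loops run over one of five parameters only, so running times are bounded syntactically.

  data Par : Set where
    vertexPar widthPar levelPar lengthPar boundPar : Par

  -- With 32 names and leading digits starting at 1, array addresses stay below `33 B^4`; the
  -- leading digit 0 remains for registers and input.
  Name : Set
  Name = Fin 32

  record Loc : Set where
    constructor loc
    field name i j k l : ℕ

  record Ref (d : ℕ) : Set where
    constructor ref
    field
      array   : Name
      i j k l : Fin d

  infixr 4 _⨾_

  -- A command that yields an integer binds it in its own continuation, so a variable never changes
  -- while it is in scope. The implicit test on `d` is solved by evaluation and keeps all variable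
  -- registers below 64.
  data Cmd : ℕ → Set where
    skip   : ∀ {d} → Cmd d
    _⨾_    : ∀ {d} → Cmd d → Cmd d → Cmd d
    setI   : ∀ {d} → Ref d → Fin d → Cmd d
    getI   : ∀ {d} {_ : T (d <ᵇ 25)} → Ref d → Cmd (suc d) → Cmd d
    decr   : ∀ {d} {_ : T (d <ᵇ 25)} → Fin d → Cmd (suc d) → Cmd d
    adjI   : ∀ {d} {_ : T (d <ᵇ 25)} → Fin d → Fin d → Cmd (suc d) → Cmd d
    loop   : ∀ {d} {_ : T (d <ᵇ 25)} → Par → Cmd (suc d) → Cmd d
    ifI    : ∀ {d} → Fin d → Fin d → Cmd d → Cmd d → Cmd d
    ifR    : ∀ {d} → Ref d → Ref d → Cmd d → Cmd d → Cmd d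
    zeroR oneR : ∀ {d} → Ref d → Cmd d
    copyR  : ∀ {d} → Ref d → Ref d → Cmd d
    opR    : ∀ {d} → RealOp → Ref d → Ref d → Ref d → Cmd d
    coefR  : ∀ {d} → Ref d → (u v l : Fin d) → Cmd d
    rootsR : ∀ {d} {_ : T (d <ᵇ 25)} → (dst src : Name) → Cmd (suc d) → Cmd d

  -- Boolean and starting with the array name, so that a lookup in another concrete array reduces by
  -- evaluation and many frame conditions are `refl`.
  _==_ : Loc → Loc → Bool
  loc a i j k l == loc a′ i′ j′ k′ l′ =
    (a ≡ᵇ a′) ∧ ((i ≡ᵇ i′) ∧ ((j ≡ᵇ j′) ∧ ((k ≡ᵇ k′) ∧ (l ≡ᵇ l′))))

  ≡ᵇ-sound : ∀ m n → (m ≡ᵇ n) ≡ true → m ≡ n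
  ≡ᵇ-sound m n e = ℕ.≡ᵇ⇒≡ m n (subst T (sym e) _)

  ==-sound : ∀ x y → (x == y) ≡ true → x ≡ y
  ==-sound (loc a i j k l) (loc a′ i′ j′ k′ l′) eq with a ≡ᵇ a′ in e₁ | i ≡ᵇ i′ in e₂ | j ≡ᵇ j′ in e₃ | k ≡ᵇ k′ in e₄ | l ≡ᵇ l′ in e₅
  ... | true | true | true | true | true
    with refl ← ≡ᵇ-sound a a′ e₁ | refl ← ≡ᵇ-sound i i′ e₂ | refl ← ≡ᵇ-sound j j′ e₃ | refl ← ≡ᵇ-sound k k′ e₄ | refl ← ≡ᵇ-sound l l′ e₅ = refl

  ≡ᵇ-refl : ∀ n → (n ≡ᵇ n) ≡ true
  ≡ᵇ-refl zero    = refl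
  ≡ᵇ-refl (suc n) = ≡ᵇ-refl n

  ==-refl : ∀ x → (x == x) ≡ true
  ==-refl (loc a i j k l) rewrite ≡ᵇ-refl a | ≡ᵇ-refl i | ≡ᵇ-refl j | ≡ᵇ-refl k | ≡ᵇ-refl l = refl

  update : ∀ {a} {A : Set a} → (Loc → A) → Loc → A → Loc → A
  update m x v y = if y == x then v else m y

  update-same : ∀ {a} {A : Set a} (m : Loc → A) x {v} → update m x v x ≡ v
  update-same m x rewrite ==-refl x = refl

  update-other : ∀ {a} {A : Set a} (m : Loc → A) {x v y} → y ≢ x → update m x v y ≡ m y
  update-other m {x} {v} {y} y≢x with y == x in e
  ... | true  = ⊥-elim (y≢x (==-sound y x e))
  ... | false = refl

  updates : ∀ {a} {A : Set a} → (Loc → A) → ℕ → ℕ → List A → Loc → A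
  updates m a l []       = m
  updates m a l (v ∷ vs) = update (updates m a (suc l) vs) (loc a 0 0 0 l) v

  -- A syntactic upper bound on the arrays written. For a concrete program it evaluates, so that an
  -- array is seen to be untouched by `refl`.
  writesI writesR : ∀ {d} → Cmd d → ℕ → Bool
  writesI skip           a = false
  writesI (c ⨾ c′)       a = writesI c a ∨ writesI c′ a
  writesI (setI x v)     a = a ≡ᵇ toℕ (Ref.array x)
  writesI (getI x c)     a = writesI c a
  writesI (decr x c)     a = writesI c a
  writesI (adjI u v c)   a = writesI c a
  writesI (loop p c)     a = writesI c a
  writesI (ifI _ _ c c′) a = writesI c a ∨ writesI c′ a
  writesI (ifR _ _ c c′) a = writesI c a ∨ writesI c′ a
  writesI (rootsR _ _ c) a = writesI c a
  writesI _              a = false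
  writesR skip           a = false
  writesR (c ⨾ c′)       a = writesR c a ∨ writesR c′ a
  writesR (setI x v)     a = false
  writesR (getI x c)     a = writesR c a
  writesR (decr x c)     a = writesR c a
  writesR (adjI u v c)   a = writesR c a
  writesR (loop p c)     a = writesR c a
  writesR (ifI _ _ c c′) a = writesR c a ∨ writesR c′ a
  writesR (ifR _ _ c c′) a = writesR c a ∨ writesR c′ a
  writesR (zeroR x)      a = a ≡ᵇ toℕ (Ref.array x)
  writesR (oneR x)       a = a ≡ᵇ toℕ (Ref.array x)
  writesR (copyR x _)    a = a ≡ᵇ toℕ (Ref.array x)
  writesR (opR _ x _ _)  a = a ≡ᵇ toℕ (Ref.array x)
  writesR (coefR x _ _ _) a = a ≡ᵇ toℕ (Ref.array x)
  writesR (rootsR dst _ c) a = (a ≡ᵇ toℕ dst) ∨ writesR c a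

  ∨-false : ∀ {a b} → a ∨ b ≡ false → a ≡ false × b ≡ false
  ∨-false {false} p = refl , p

  update-name : ∀ {a} {A : Set a} (m : Loc → A) x {v} y → (Loc.name y ≡ᵇ Loc.name x) ≡ false → update m x v y ≡ m y
  update-name m x y e rewrite e = refl

  updates-name : ∀ {a} {A : Set a} (m : Loc → A) b l vs y → (Loc.name y ≡ᵇ b) ≡ false → updates m b l vs y ≡ m y
  updates-name m b l []       y e = refl
  updates-name m b l (v ∷ vs) y e = trans (update-name (updates m b (suc l) vs) (loc b 0 0 0 l) y e) (updates-name m b (suc l) vs y e)

  -- Weakest preconditions.

  module Semantics {c ℓ₁ ℓ₂} (ℝ : CompleteOrderedField c ℓ₁ ℓ₂) (F : RootFinder ℝ)
      (n q K B : ℕ) (adjacent : ℕ → ℕ → ℕ)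
      (coefficient : ℕ → ℕ → ℕ → CompleteOrderedField.Carrier ℝ) where
    open CompleteOrderedField ℝ using (Carrier; 0#; 1#; Polynomial; IsRootList) renaming (_≈_ to _≈ᵣ_; _<_ to _<ᵣ_)
    open RootFinder F
    open RealRAM ℝ F

    ℓ : Level
    ℓ = c ⊔ ℓ₁ ⊔ ℓ₂

    record Mem : Set c where
      constructor mem
      field
        I : Loc → ℕ
        R : Loc → Carrier
    open Mem public

    par : Par → ℕ
    par vertexPar = n
    par widthPar  = suc q
    par levelPar  = suc K
    par lengthPar = suc n
    par boundPar  = B

    Env : Set
    Env = ℕ → ℕ

    at′ : ∀ {d} → Ref d → Env → Loc
    at′ (ref a i j k l) ρ = loc (toℕ a) (ρ (toℕ i)) (ρ (toℕ j)) (ρ (toℕ k)) (ρ (toℕ l))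

    writeI : Loc → ℕ → Mem → Mem
    writeI x v g = mem (update (I g) x v) (R g)

    writeR : Loc → Carrier → Mem → Mem
    writeR x v g = mem (I g) (update (R g) x v)

    RootsOf : ∀ {d} → Polynomial d → List Carrier → Set ℓ
    RootsOf p rs = ((∀ i → p i ≈ᵣ 0#) → rs ≡ []) × ((∃[ i ] ¬ p i ≈ᵣ 0#) → IsRootList p rs)

    iterate : (ℕ → (Mem → Set ℓ) → Mem → Set ℓ) → ℕ → ℕ → (Mem → Set ℓ) → Mem → Set ℓ
    iterate f zero    i Q = Q
    iterate f (suc r) i Q = f i (iterate f r (suc i) Q)

    -- A loop is unfolded to its exact number of rounds, so correctness is total. Reading the graph
    -- carries the proof obligation that the indices are in range. `rootsR` must succeed for every
    -- list that meets the contract of the root finder, so the meaning of a command depends on that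
    -- contract only.
    wp : ∀ {d} → Cmd d → Env → (Mem → Set ℓ) → Mem → Set ℓ
    wp skip ρ Q g = Q g
    wp (c ⨾ c′) ρ Q g = wp c ρ (wp c′ ρ Q) g
    wp (setI x v) ρ Q g = Q (writeI (at′ x ρ) (ρ (toℕ v)) g)
    wp {d} (getI x c) ρ Q g = wp c (ρ [ d ≔ I g (at′ x ρ) ]) Q g
    wp {d} (decr v c) ρ Q g = wp c (ρ [ d ≔ ρ (toℕ v) ∸ 1 ]) Q g
    wp {d} (adjI u v c) ρ Q g = (ρ (toℕ u) < n) × (ρ (toℕ v) < n) × wp c (ρ [ d ≔ adjacent (ρ (toℕ u)) (ρ (toℕ v)) ]) Q g
    wp {d} (loop p c) ρ Q g = iterate (λ i → wp c (ρ [ d ≔ i ])) (par p) 0 Q g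
    wp (ifI a b c c′) ρ Q g = (ρ (toℕ a) < ρ (toℕ b) → wp c ρ Q g) × (¬ ρ (toℕ a) < ρ (toℕ b) → wp c′ ρ Q g)
    wp (ifR x y c c′) ρ Q g = (R g (at′ x ρ) <ᵣ R g (at′ y ρ) → wp c ρ Q g) × (¬ R g (at′ x ρ) <ᵣ R g (at′ y ρ) → wp c′ ρ Q g)
    wp (zeroR x) ρ Q g = Q (writeR (at′ x ρ) 0# g)
    wp (oneR x) ρ Q g = Q (writeR (at′ x ρ) 1# g)
    wp (copyR x y) ρ Q g = Q (writeR (at′ x ρ) (R g (at′ y ρ)) g)
    wp (opR ∙ x y z) ρ Q g = Q (writeR (at′ x ρ) (⟦ ∙ ⟧ᵣ (R g (at′ y ρ)) (R g (at′ z ρ))) g)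
    wp (coefR x u v l) ρ Q g = (ρ (toℕ u) < n) × (ρ (toℕ v) < n) × (ρ (toℕ l) < suc q) ×
      Q (writeR (at′ x ρ) (coefficient (ρ (toℕ u)) (ρ (toℕ v)) (ρ (toℕ l))) g)
    wp {d} (rootsR dst src c) ρ Q g = ∀ rs → RootsOf {q} (λ i → R g (loc (toℕ src) 0 0 0 (toℕ i))) rs →
      length rs ≤ q → wp c (ρ [ d ≔ length rs ]) Q (mem (I g) (updates (R g) (toℕ dst) 0 rs))

    iterate-mono : ∀ {f : ℕ → (Mem → Set ℓ) → Mem → Set ℓ} →
      (∀ i {Q Q′} → (∀ g → Q g → Q′ g) → ∀ g → f i Q g → f i Q′ g) →
      ∀ r i {Q Q′} → (∀ g → Q g → Q′ g) → ∀ g → iterate f r i Q g → iterate f r i Q′ g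
    iterate-mono f↗ zero    i Q⊆Q′ = Q⊆Q′
    iterate-mono f↗ (suc r) i Q⊆Q′ = f↗ i (iterate-mono f↗ r (suc i) Q⊆Q′)

    wp-mono : ∀ {d} (c : Cmd d) ρ {Q Q′ : Mem → Set ℓ} → (∀ g → Q g → Q′ g) → ∀ g → wp c ρ Q g → wp c ρ Q′ g
    wp-mono skip ρ h g = h g
    wp-mono (c ⨾ c′) ρ h g = wp-mono c ρ (wp-mono c′ ρ h) g
    wp-mono (setI x v) ρ h g = h _
    wp-mono (getI x c) ρ h g = wp-mono c _ h g
    wp-mono (decr v c) ρ h g = wp-mono c _ h g
    wp-mono (adjI u v c) ρ h g (a , b , p) = a , b , wp-mono c _ h g p
    wp-mono {d} (loop p c) ρ h g = iterate-mono (λ i → wp-mono c (ρ [ d ≔ i ])) (par p) 0 h g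
    wp-mono (ifI a b c c′) ρ h g (p , p′) = wp-mono c ρ h g ∘ p , wp-mono c′ ρ h g ∘ p′
    wp-mono (ifR x y c c′) ρ h g (p , p′) = wp-mono c ρ h g ∘ p , wp-mono c′ ρ h g ∘ p′
    wp-mono (zeroR x) ρ h g = h _
    wp-mono (oneR x) ρ h g = h _
    wp-mono (copyR x y) ρ h g = h _
    wp-mono (opR ∙ x y z) ρ h g = h _
    wp-mono (coefR x u v l) ρ h g (a , b , e , p) = a , b , e , h _ p
    wp-mono (rootsR dst src c) ρ h g p rs rs-ok len = wp-mono c _ h _ (p rs rs-ok len)

    Frame : (bI bR : ℕ → Bool) → Mem → Mem → Set c
    Frame bI bR g g′ = (∀ x → bI (Loc.name x) ≡ false → I g′ x ≡ I g x) × (∀ x → bR (Loc.name x) ≡ false → R g′ x ≡ R g x)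

    module _ (bI bR : ℕ → Bool) (g₀ : Mem) where
      private
        Within : ∀ {d} → Cmd d → Set
        Within c = (∀ a → bI a ≡ false → writesI c a ≡ false) × (∀ a → bR a ≡ false → writesR c a ≡ false)

        Fr : Mem → Set c
        Fr = Frame bI bR g₀

        left : ∀ {d} {c c′ : Cmd d} → Within (c ⨾ c′) → Within c × Within c′
        left {_} {c} {c′} (p , r) = ((λ a e → proj₁ (∨-false (p a e))) , (λ a e → proj₁ (∨-false (r a e)))) ,
                 ((λ a e → proj₂ (∨-false {writesI c a} (p a e))) , (λ a e → proj₂ (∨-false {writesR c a} (r a e))))

        frI : ∀ g x v → (∀ a → bI a ≡ false → (a ≡ᵇ Loc.name x) ≡ false) → Fr g → Fr (writeI x v g)
        frI g x v w (p , r) = (λ y e → trans (update-name (I g) x y (w _ e)) (p y e)) , r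

        frR : ∀ g x v → (∀ a → bR a ≡ false → (a ≡ᵇ Loc.name x) ≡ false) → Fr g → Fr (writeR x v g)
        frR g x v w (p , r) = p , (λ y e → trans (update-name (R g) x y (w _ e)) (r y e))

        iterate-frame : ∀ {f : ℕ → (Mem → Set ℓ) → Mem → Set ℓ} →
          (∀ i {Q Q′} → (∀ g → Q g → Q′ g) → ∀ g → f i Q g → f i Q′ g) →
          (∀ i {Q} g → Fr g → f i Q g → f i (λ g′ → Q g′ × Fr g′) g) →
          ∀ r i {Q} g → Fr g → iterate f r i Q g → iterate f r i (λ g′ → Q g′ × Fr g′) g
        iterate-frame f↗ h zero    i g fr p = p , fr
        iterate-frame f↗ h (suc r) i g fr p =
          f↗ i (λ g′ (p′ , fr′) → iterate-frame f↗ h r (suc i) g′ fr′ p′) g (h i g fr p)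

      -- The writable names `bI` and `bR` and the initial memory are fixed from outside, because the
      -- induction passes through subcommands that write less and start later.
      wp-frame′ : ∀ {d} (c : Cmd d) ρ {Q : Mem → Set ℓ} → Within c → ∀ g → Fr g → wp c ρ Q g → wp c ρ (λ g′ → Q g′ × Fr g′) g
      wp-frame′ skip ρ w g fr p = p , fr
      wp-frame′ (c ⨾ c′) ρ w g fr p = wp-mono c ρ (λ g′ (p′ , fr′) → wp-frame′ c′ ρ (proj₂ (left {c = c} {c′} w)) g′ fr′ p′) g
        (wp-frame′ c ρ (proj₁ (left {c = c} {c′} w)) g fr p)
      wp-frame′ (setI x v) ρ w g fr p = p , frI g (at′ x ρ) _ (proj₁ w) fr
      wp-frame′ (getI x c) ρ w g fr p = wp-frame′ c _ w g fr p
      wp-frame′ (decr v c) ρ w g fr p = wp-frame′ c _ w g fr p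
      wp-frame′ (adjI u v c) ρ w g fr (a , b , p) = a , b , wp-frame′ c _ w g fr p
      wp-frame′ {d} (loop p c) ρ w g fr h =
        iterate-frame (λ i → wp-mono c (ρ [ d ≔ i ])) (λ i → wp-frame′ c (ρ [ d ≔ i ]) w) (par p) 0 g fr h
      wp-frame′ (ifI a b c c′) ρ w g fr (p , p′) =
        wp-frame′ c ρ (proj₁ (left {c = c} {c′} w)) g fr ∘ p , wp-frame′ c′ ρ (proj₂ (left {c = c} {c′} w)) g fr ∘ p′
      wp-frame′ (ifR x y c c′) ρ w g fr (p , p′) =
        wp-frame′ c ρ (proj₁ (left {c = c} {c′} w)) g fr ∘ p , wp-frame′ c′ ρ (proj₂ (left {c = c} {c′} w)) g fr ∘ p′
      wp-frame′ (zeroR x) ρ w g fr p = p , frR g (at′ x ρ) _ (proj₂ w) fr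
      wp-frame′ (oneR x) ρ w g fr p = p , frR g (at′ x ρ) _ (proj₂ w) fr
      wp-frame′ (copyR x y) ρ w g fr p = p , frR g (at′ x ρ) _ (proj₂ w) fr
      wp-frame′ (opR ∙ x y z) ρ w g fr p = p , frR g (at′ x ρ) _ (proj₂ w) fr
      wp-frame′ (coefR x u v l) ρ w g fr (a , b , e , p) = a , b , e , p , frR g (at′ x ρ) _ (proj₂ w) fr
      wp-frame′ (rootsR dst src c) ρ w g fr h rs rs-ok len =
        wp-frame′ c _ (proj₁ w , λ a e → proj₂ (∨-false {a ≡ᵇ toℕ dst} (proj₂ w a e))) _
          (proj₁ fr , λ y e → trans (updates-name (R g) (toℕ dst) 0 rs y (proj₁ (∨-false (proj₂ w _ e)))) (proj₂ fr y e))
          (h rs rs-ok len)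

    -- Lets specifications mention only what changes; everything else is recovered from the syntax
    -- of the command.
    wp-frame : ∀ {d} (c : Cmd d) ρ {Q : Mem → Set ℓ} g → wp c ρ Q g →
               wp c ρ (λ g′ → Q g′ × Frame (writesI c) (writesR c) g g′) g
    wp-frame c ρ g p = wp-frame′ (writesI c) (writesR c) g c ρ ((λ _ e → e) , (λ _ e → e)) g ((λ _ _ → refl) , (λ _ _ → refl)) p

    wp-loop : ∀ {d} {o} p (c : Cmd (suc d)) ρ {Q : Mem → Set ℓ} {g} (Inv : ℕ → Mem → Set ℓ) → Inv 0 g →
              (∀ i g → i < par p → Inv i g → wp c (ρ [ d ≔ i ]) (Inv (suc i)) g) →
              (∀ g → Inv (par p) g → Q g) → wp (loop {d} {o} p c) ρ Q g
    wp-loop {d} p c ρ {Q} {g} Inv inv₀ step done = go (par p) 0 refl g inv₀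
      where
      go : ∀ r i → i + r ≡ par p → ∀ g → Inv i g → iterate (λ i → wp c (ρ [ d ≔ i ])) r i Q g
      go zero i e g inv = done g (subst (λ j → Inv j g) (trans (sym (ℕ.+-identityʳ i)) e) inv)
      go (suc r) i e g inv = wp-mono c _ (go r (suc i) (trans (sym (ℕ.+-suc i r)) e)) g
        (step i g (subst (i <_) e (ℕ.m<m+n i z<s)) inv)

  -- Registers: 1-4 scratch, 5-9 the parameters, 10 the degree q, 11 the constant 1,
  -- 12 the base of the relocated adjacency matrix, 16 + d the variable of level d.

  parReg : Par → ℕ
  parReg vertexPar = 5
  parReg widthPar  = 6
  parReg levelPar  = 7
  parReg lengthPar = 8
  parReg boundPar  = 9

  varReg : ℕ → ℕ
  varReg i = 16 + i

  var : ∀ {d} → Fin d → Cell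
  var i = at (varReg (toℕ i))

  -- One step of Horner's scheme in base `B`, which register 9 holds; five digits make an address.
  digit : ℕ → ℕ → Program
  digit p r = instr (intOp times (at p) (at p) (at 9)) ︔ instr (intOp plus (at p) (at p) (at r))

  pointer : ∀ {d} → ℕ → Ref d → Program
  pointer p (ref a i j k l) =
    instr (intConst (at p) (suc (toℕ a))) ︔ digit p (varReg (toℕ i)) ︔ digit p (varReg (toℕ j)) ︔
    digit p (varReg (toℕ k)) ︔ digit p (varReg (toℕ l))

  block : ℕ → Name → Program
  block p a = instr (intConst (at p) (suc (toℕ a))) ︔ scale ︔ scale ︔ scale ︔ scale
    where scale = instr (intOp times (at p) (at p) (at 9))

  compile : ∀ {d} → Cmd d → Program
  compile skip = skip
  compile (c ⨾ c′) = compile c ︔ compile c′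
  compile (setI x v) = pointer 1 x ︔ instr (intCopy (ind 1) (var v))
  compile {d} (getI x c) = pointer 1 x ︔ instr (intCopy (at (varReg d)) (ind 1)) ︔ compile c
  compile {d} (decr v c) = instr (intOp monus (at (varReg d)) (var v) (at 11)) ︔ compile c
  compile {d} (adjI u v c) =
    instr (intOp times (at 1) (var u) (at 5)) ︔ instr (intOp plus (at 1) (at 1) (var v)) ︔
    instr (intOp plus (at 1) (at 12) (at 1)) ︔ instr (intCopy (at (varReg d)) (ind 1)) ︔ compile c
  compile {d} (loop p c) = instr (intConst (at (varReg d)) 0) ︔
    while (int< (at (varReg d)) (at (parReg p))) (compile c ︔ instr (intOp plus (at (varReg d)) (at (varReg d)) (at 11)))
  compile (ifI a b c c′) = ifThen (int< (var a) (var b)) (compile c) (compile c′)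
  compile (ifR x y c c′) = pointer 1 x ︔ pointer 2 y ︔ ifThen (real< (ind 1) (ind 2)) (compile c) (compile c′)
  compile (zeroR x) = pointer 1 x ︔ instr (realZero (ind 1))
  compile (oneR x) = pointer 1 x ︔ instr (realOne (ind 1))
  compile (copyR x y) = pointer 1 x ︔ pointer 2 y ︔ instr (realCopy (ind 1) (ind 2))
  compile (opR ∙ x y z) = pointer 1 x ︔ pointer 2 y ︔ pointer 3 z ︔ instr (realOp ∙ (ind 1) (ind 2) (ind 3))
  -- The coefficients are read where the input placed them, from address 0 on: registers occupy
  -- integer memory only, and the arrays start beyond.
  compile (coefR x u v l) = pointer 1 x ︔
    instr (intOp times (at 2) (var u) (at 5)) ︔ instr (intOp plus (at 2) (at 2) (var v)) ︔
    instr (intOp times (at 2) (at 2) (at 6)) ︔ instr (intOp plus (at 2) (at 2) (var l)) ︔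
    instr (realCopy (ind 1) (ind 2))
  compile {d} (rootsR dst src c) = block 1 dst ︔ block 2 src ︔ instr (findRoots (at 10) (at (varReg d)) (ind 1) (ind 2)) ︔ compile c

  -- The running time of a compiled command is at most T ^ timeExponent for suitable T.
  timeExponent : ∀ {d} → Cmd d → ℕ
  timeExponent skip           = 1
  timeExponent (c ⨾ c′)       = suc (timeExponent c + timeExponent c′)
  timeExponent (setI _ _)     = 1
  timeExponent (getI _ c)     = suc (timeExponent c)
  timeExponent (decr _ c)     = suc (timeExponent c)
  timeExponent (adjI _ _ c)   = suc (timeExponent c)
  timeExponent (loop _ c)     = 3 + timeExponent c
  timeExponent (ifI _ _ c c′) = suc (timeExponent c + timeExponent c′)
  timeExponent (ifR _ _ c c′) = suc (timeExponent c + timeExponent c′)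
  timeExponent (rootsR _ _ c) = suc (timeExponent c)
  timeExponent _              = 1

  x*b+l<y*b : ∀ b {x y l} → x < y → l < b → x * b + l < y * b
  x*b+l<y*b b {x} {y} x<y l<b = ℕ.<-≤-trans (ℕ.+-monoʳ-< (x * b) l<b)
    (ℕ.≤-trans (ℕ.≤-reflexive (ℕ.+-comm (x * b) b)) (ℕ.*-monoˡ-≤ b x<y))

  x*b+l-injective : ∀ b {x x′ l l′} → l < b → l′ < b → x * b + l ≡ x′ * b + l′ → x ≡ x′ × l ≡ l′
  x*b+l-injective b {x} {x′} {l} {l′} l<b l′<b e with ℕ.<-cmp x x′
  ... | tri≈ _ refl _ = refl , ℕ.+-cancelˡ-≡ (x * b) l l′ e
  ... | tri< x<x′ _ _ = ⊥-elim (ℕ.<-irrefl e (ℕ.<-≤-trans (x*b+l<y*b b x<x′ l<b) (ℕ.m≤m+n (x′ * b) l′)))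
  ... | tri> _ _ x′<x = ⊥-elim (ℕ.<-irrefl (sym e) (ℕ.<-≤-trans (x*b+l<y*b b x′<x l′<b) (ℕ.m≤m+n (x * b) l)))

  module _ {t : ℕ} where
    private
      t^x>0 : 1 ≤ t → ∀ x → 1 ≤ t ^ x
      t^x>0 1≤t zero    = ℕ.≤-refl
      t^x>0 1≤t (suc x) = ℕ.*-mono-≤ 1≤t (t^x>0 1≤t x)

    -- Additive costs are absorbed by one more factor `t`. Time bounds therefore compose by
    -- computing exponents, and no explicit polynomial is carried along.
    const-+-power : ∀ k x → k < t → k + t ^ x ≤ t ^ suc x
    const-+-power k x k<t = ℕ.≤-trans (ℕ.+-monoˡ-≤ (t ^ x) (ℕ.m≤m*n k (t ^ x) {{>-nonZero (t^x>0 (ℕ.≤-trans (s≤s z≤n) k<t) x)}}))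
      (ℕ.≤-trans (ℕ.≤-reflexive (ℕ.+-comm (k * t ^ x) (t ^ x))) (ℕ.*-monoˡ-≤ (t ^ x) k<t))

    power-mono : 1 ≤ t → ∀ {x y} → x ≤ y → t ^ x ≤ t ^ y
    power-mono 1≤t {x} {y} x≤y = ℕ.^-monoʳ-≤ t {{>-nonZero 1≤t}} x≤y

    power-+-power : ∀ {a b} k x y → k + 2 ≤ t → a ≤ t ^ x → b ≤ t ^ y → k + (a + b) ≤ t ^ suc (x + y)
    power-+-power {a} {b} k x y k+2≤t a≤ b≤ = begin
      k + (a + b)                        ≤⟨ ℕ.+-mono-≤ (ℕ.m≤m*n k p {{>-nonZero (t^x>0 1≤t (x + y))}})
                                              (ℕ.+-mono-≤ (ℕ.≤-trans a≤ (power-mono 1≤t (ℕ.m≤m+n x y)))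
                                                          (ℕ.≤-trans b≤ (power-mono 1≤t (ℕ.m≤n+m y x)))) ⟩
      k * p + (p + p)                    ≡⟨ cong (λ z → k * p + (p + z)) (sym (ℕ.+-identityʳ p)) ⟩
      k * p + 2 * p                      ≡⟨ sym (ℕ.*-distribʳ-+ p k 2) ⟩
      (k + 2) * p                        ≤⟨ ℕ.*-monoˡ-≤ p k+2≤t ⟩
      t * p                              ∎
      where
      open ℕ.≤-Reasoning
      p = t ^ (x + y)
      1≤t = ℕ.≤-trans (ℕ.≤-trans (s≤s z≤n) (ℕ.m≤n+m 2 k)) k+2≤t

  -- Soundness and running time of compiled commands.

  module Soundness {c ℓ₁ ℓ₂} (ℝ : CompleteOrderedField c ℓ₁ ℓ₂) (F : RootFinder ℝ)
      (n q K B : ℕ) (adjacent : ℕ → ℕ → ℕ)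
      (coefficient : ℕ → ℕ → ℕ → CompleteOrderedField.Carrier ℝ)
      (base S t₀ : ℕ) where
    open CompleteOrderedField ℝ using (Carrier; 0#; 1#; Polynomial; IsRootList; _<?_) renaming (_≈_ to _≈ᵣ_; _<_ to _<ᵣ_)
    open RootFinder F
    open RealRAM ℝ F
    open Semantics ℝ F n q K B adjacent coefficient

    B⁴ : ℕ
    B⁴ = B * B * B * B

    record Sizes : Set where
      field
        64≤B      : 64 ≤ B
        par≤B     : ∀ p → par p ≤ B
        64≤base   : 64 ≤ base
        base-fits : base + n * n ≤ B⁴
        real-fits : n * n * suc q ≤ B⁴
        adjacent<B : ∀ u v → adjacent u v < B
        S-large   : 33 * B * B * B * B ≤ S
        t₀-large  : rootTime q + 64 ≤ t₀
        B≤t₀      : B ≤ t₀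

    address′ : Loc → ℕ
    address′ (loc a i j k l) = (((suc a * B + i) * B + j) * B + k) * B + l

    InRange : Loc → Set
    InRange (loc a i j k l) = a < 32 × i < B × j < B × k < B × l < B

    address-injective : ∀ x y → InRange x → InRange y → address′ x ≡ address′ y → x ≡ y
    address-injective (loc a i j k l) (loc a′ i′ j′ k′ l′) (_ , i< , j< , k< , l<) (_ , i′< , j′< , k′< , l′<) e
      with e₁ , refl ← x*b+l-injective B l< l′< e
      with e₂ , refl ← x*b+l-injective B k< k′< e₁
      with e₃ , refl ← x*b+l-injective B j< j′< e₂
      with e₄ , refl ← x*b+l-injective B {suc a} {suc a′} i< i′< e₃
      with refl ← e₄ = refl

    -- The leading digit is `suc a`, hence at least 1. So arrays never meet the registers and the
    -- input, which lie below `B⁴`.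
    address-≥ : ∀ x → B⁴ ≤ address′ x
    address-≥ (loc a i j k l) = up (up (up (up′ i (ℕ.m≤m+n B (a * B))) j) k) l
      where
      up′ : ∀ l {b x} → b ≤ x → b ≤ x + l
      up′ l {b} {x} b≤x = ℕ.≤-trans b≤x (ℕ.m≤m+n x l)
      up : ∀ {b x} → b ≤ x → ∀ l → b * B ≤ x * B + l
      up b≤x l = up′ l (ℕ.*-monoˡ-≤ B b≤x)

    -- The simulation relation. Values of variables and of integer arrays stay below `B`, because a
    -- value read from memory may become a digit of the next address.
    record Rep (d : ℕ) (ρ : Env) (g : Mem) (σ : Store) : Set (c ⊔ ℓ₁) where
      field
        depth  : d ≤ 25
        env    : ∀ i → i < d → int σ (varReg i) ≡ ρ i
        env<B  : ∀ i → i < d → ρ i < B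
        pars   : ∀ p → int σ (parReg p) ≡ par p
        deg    : int σ 10 ≡ q
        one    : int σ 11 ≡ 1
        raw    : int σ 12 ≡ base
        rawI   : ∀ u v → u < n → v < n → int σ (base + (u * n + v)) ≡ adjacent u v
        rawR   : ∀ u v l → u < n → v < n → l < suc q → real σ ((u * n + v) * suc q + l) ≡ coefficient u v l
        arrI   : ∀ x → InRange x → int σ (address′ x) ≡ I g x
        arrI<B : ∀ x → InRange x → I g x < B
        arrR   : ∀ x → InRange x → real σ (address′ x) ≡ R g x
        fits   : Fits S σ

    module Sound (sizes : Sizes) where
      open Sizes sizes

      0<B : 0 < B
      0<B = ℕ.≤-trans (s≤s z≤n) 64≤B

      B≤B⁴ : B ≤ B⁴
      B≤B⁴ = ℕ.≤-trans (ℕ.m≤m*n B (B * B * B) {{>-nonZero (ℕ.*-mono-≤ {1} {B * B} {1} (ℕ.*-mono-≤ {1} {B} {1} 0<B 0<B) 0<B)}})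
        (ℕ.≤-reflexive (trans (sym (ℕ.*-assoc B (B * B) B)) (cong (_* B) (sym (ℕ.*-assoc B B B)))))

      address-< : ∀ x → InRange x → address′ x < S
      address-< (loc a i j k l) (a< , i< , j< , k< , l<) = ℕ.<-≤-trans
        (x*b+l<y*b B (x*b+l<y*b B (x*b+l<y*b B (x*b+l<y*b B {suc a} {33} (s≤s a<) i<) j<) k<) l<) S-large

      B⁴<S : B⁴ < S
      B⁴<S = ℕ.≤-<-trans (address-≥ (loc 0 0 0 0 0)) (address-< (loc 0 0 0 0 0) (s≤s z≤n , 0<B , 0<B , 0<B , 0<B))

      B≤S : B ≤ S
      B≤S = ℕ.<⇒≤ (ℕ.≤-<-trans B≤B⁴ B⁴<S)

      low : ∀ {j} → j < 64 → j < S
      low j<64 = ℕ.<-≤-trans j<64 (ℕ.≤-trans 64≤B B≤S)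

      low≢address : ∀ {j} x → j < 64 → address′ x ≢ j
      low≢address x j<64 e = ℕ.<-irrefl (sym e) (ℕ.<-≤-trans j<64 (ℕ.≤-trans 64≤B (ℕ.≤-trans B≤B⁴ (address-≥ x))))

      matrix< : ∀ {u v} → u < n → v < n → u * n + v < n * n
      matrix< u<n v<n = x*b+l<y*b n u<n v<n

      fits-int : ∀ σ a v → Fits S σ → a < S → v < S → Fits S (store (int σ [ a ≔ v ]) (real σ))
      fits-int σ a v fit a<S v<S = record
        { int-word = word ; int-blank = λ k S≤k → trans ([≔]-other (int σ) (λ e → ℕ.<⇒≱ a<S (subst (S ≤_) e S≤k))) (Fits.int-blank fit k S≤k)
        ; real-blank = Fits.real-blank fit }
        where
        word : ∀ k → (int σ [ a ≔ v ]) k < S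
        word k with k ≟ a
        ... | yes refl = subst (_< S) (sym ([≔]-same (int σ) k)) v<S
        ... | no k≢a = subst (_< S) (sym ([≔]-other (int σ) k≢a)) (Fits.int-word fit k)

      fits-real : ∀ σ a v → Fits S σ → a < S → Fits S (store (int σ) (real σ [ a ≔ v ]))
      fits-real σ a v fit a<S = record
        { int-word = Fits.int-word fit ; int-blank = Fits.int-blank fit
        ; real-blank = λ k S≤k → subst (_≈ᵣ 0#) (sym ([≔]-other (real σ) (λ e → ℕ.<⇒≱ a<S (subst (S ≤_) e S≤k)))) (Fits.real-blank fit k S≤k) }

      -- The effect of code that changes a single register; the values it held on the way are
      -- forgotten when such pieces are composed.
      record Sets (P : Program) (t r v : ℕ) (σ : Store) : Set (c ⊔ ℓ₁) where
        field
          after : Store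
          run   : Run S P σ t after
          off   : ∀ j → j ≢ r → int after j ≡ int σ j
          val   : int after r ≡ v
          reals : real after ≡ real σ
          fit   : Fits S after
      open Sets

      sets : ∀ {r v w σ} i → exec i σ ≡ setInt (at r) w σ → cost i σ ≡ 1 → Fits S σ → r < 64 → w ≡ v → v < S →
             Sets (instr i) 1 r v σ
      sets {r} {v} {_} {σ} i e e′ fit r<64 refl v<S = record
        { after = setInt (at r) v σ
        ; run = subst₂ (λ t σ′ → Run S (instr i) σ t σ′) e′ e (instr (subst (Fits S) (sym e) fit′))
        ; off = λ j j≢r → [≔]-other (int σ) j≢r ; val = [≔]-same (int σ) r ; reals = refl ; fit = fit′ }
        where fit′ = fits-int σ r v fit (low r<64) v<S

      infixr 5 _then_
      _then_ : ∀ {P Q t t′ r v v′ σ} (s : Sets P t r v σ) → Sets Q t′ r v′ (after s) → Sets (P ︔ Q) (t + t′) r v′ σ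
      s then s′ = record { after = after s′ ; run = run s ︔ run s′ ; off = λ j j≢r → trans (off s′ j j≢r) (off s j j≢r)
                         ; val = val s′ ; reals = trans (reals s′) (reals s) ; fit = fit s′ }

      scratch≢ : ∀ {p j} → p < 5 → 5 ≤ j → j ≢ p
      scratch≢ p<5 5≤j refl = ℕ.<⇒≱ p<5 5≤j

      reg≥5 : ∀ i → 5 ≤ varReg i
      reg≥5 i = ℕ.m≤m+n 5 (11 + i)

      large≢ : ∀ {r j} → r < 64 → 64 ≤ j → j ≢ r
      large≢ r<64 64≤j refl = ℕ.<⇒≱ r<64 64≤j

      address-large : ∀ x → 64 ≤ address′ x
      address-large x = ℕ.≤-trans 64≤B (ℕ.≤-trans B≤B⁴ (address-≥ x))

      par≥5 : ∀ p → 5 ≤ parReg p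
      par≥5 vertexPar = ℕ.m≤m+n 5 0
      par≥5 widthPar  = ℕ.m≤m+n 5 1
      par≥5 levelPar  = ℕ.m≤m+n 5 2
      par≥5 lengthPar = ℕ.m≤m+n 5 3
      par≥5 boundPar  = ℕ.m≤m+n 5 4

      par<16 : ∀ p → parReg p < 16
      par<16 vertexPar = ℕ.m≤m+n 6 10
      par<16 widthPar  = ℕ.m≤m+n 7 9
      par<16 levelPar  = ℕ.m≤m+n 8 8
      par<16 lengthPar = ℕ.m≤m+n 9 7
      par<16 boundPar  = ℕ.m≤m+n 10 6

      rep-off : ∀ {d ρ g σ σ′} r → r < 64 → (∀ j → 5 ≤ j → j < 16 → j ≢ r) → (∀ i → i < d → varReg i ≢ r) →
                (∀ j → j ≢ r → int σ′ j ≡ int σ j) → real σ′ ≡ real σ → Fits S σ′ → Rep d ρ g σ → Rep d ρ g σ′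
      rep-off {σ = σ} {σ′} r r<64 fixed vars off reals fit rep = record
        { Rep rep
        ; env = λ i i<d → trans (off _ (vars i i<d)) (env i i<d)
        ; pars = λ p → trans (off _ (fixed _ (par≥5 p) (par<16 p))) (pars p)
        ; deg = trans (off _ (fixed _ (ℕ.m≤m+n 5 5) (ℕ.m≤m+n 11 5))) deg
        ; one = trans (off _ (fixed _ (ℕ.m≤m+n 5 6) (ℕ.m≤m+n 12 4))) one
        ; raw = trans (off _ (fixed _ (ℕ.m≤m+n 5 7) (ℕ.m≤m+n 13 3))) raw
        ; rawI = λ u v u< v< → trans (off _ (large≢ r<64 (ℕ.≤-trans 64≤base (ℕ.m≤m+n base _)))) (rawI u v u< v<)
        ; rawR = λ u v l u< v< l< → trans (cong (λ m → m _) reals) (rawR u v l u< v< l<)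
        ; arrI = λ x x∈ → trans (off _ (large≢ r<64 (address-large x))) (arrI x x∈)
        ; arrR = λ x x∈ → trans (cong (λ m → m _) reals) (arrR x x∈)
        ; fits = fit }
        where open Rep rep

      rep-scratch : ∀ {d ρ g σ P t p v} → p < 5 → (s : Sets P t p v σ) → Rep d ρ g σ → Rep d ρ g (after s)
      rep-scratch {p = p} p<5 s = rep-off p (ℕ.<-≤-trans p<5 (ℕ.m≤m+n 5 59)) (λ j 5≤j _ → scratch≢ p<5 5≤j)
        (λ i _ → scratch≢ p<5 (reg≥5 i)) (off s) (reals s) (fit s)

      var<64 : ∀ {d} → d < 25 → varReg d < 64
      var<64 d<25 = ℕ.<-≤-trans (ℕ.+-monoʳ-< 16 d<25) (ℕ.m≤m+n 41 23)

      -- At depth `d` the variable of level `d` is not yet in scope, so its register may be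
      -- overwritten.
      rep-forget : ∀ {d ρ g σ P t v} → d < 25 → (s : Sets P t (varReg d) v σ) → Rep d ρ g σ → Rep d ρ g (after s)
      rep-forget {d} d<25 s = rep-off (varReg d) (var<64 d<25) (λ { j _ j<16 refl → ℕ.<⇒≱ j<16 (ℕ.m≤m+n 16 d) })
        (λ i i<d → ℕ.<⇒≢ i<d ∘ ℕ.+-cancelˡ-≡ 16 i d) (off s) (reals s) (fit s)

      rep-bind : ∀ {d ρ g σ v} → d < 25 → v < B → int σ (varReg d) ≡ v → Rep d ρ g σ → Rep (suc d) (ρ [ d ≔ v ]) g σ
      rep-bind {d} {ρ} {g} {σ} {v} d<25 v<B val rep = record { Rep rep ; depth = d<25 ; env = env′ ; env<B = env<B′ }
        where
        open Rep rep
        env′ : ∀ i → i < suc d → int σ (varReg i) ≡ (ρ [ d ≔ v ]) i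
        env′ i i<1+d with i ≟ d
        ... | yes refl = trans val (sym ([≔]-same ρ d))
        ... | no i≢d = trans (env i (ℕ.≤∧≢⇒< (ℕ.≤-pred i<1+d) i≢d)) (sym ([≔]-other ρ i≢d))
        env<B′ : ∀ i → i < suc d → (ρ [ d ≔ v ]) i < B
        env<B′ i i<1+d with i ≟ d
        ... | yes refl = subst (_< B) (sym ([≔]-same ρ d)) v<B
        ... | no i≢d = subst (_< B) (sym ([≔]-other ρ i≢d)) (env<B i (ℕ.≤∧≢⇒< (ℕ.≤-pred i<1+d) i≢d))

      rep-shrink : ∀ {d ρ g σ v} → Rep (suc d) (ρ [ d ≔ v ]) g σ → Rep d ρ g σ
      rep-shrink {d} {ρ} rep = record
        { Rep rep
        ; depth = ℕ.≤-trans (ℕ.n≤1+n d) depth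
        ; env = λ i i<d → trans (env i (ℕ.m<n⇒m<1+n i<d)) ([≔]-other ρ (ℕ.<⇒≢ i<d))
        ; env<B = λ i i<d → subst (_< B) ([≔]-other ρ (ℕ.<⇒≢ i<d)) (env<B i (ℕ.m<n⇒m<1+n i<d)) }
        where open Rep rep

      rep-writeI : ∀ {d ρ g σ} x v → InRange x → v < B → Rep d ρ g σ →
                   Rep d ρ (writeI x v g) (store (int σ [ address′ x ≔ v ]) (real σ))
      rep-writeI {d} {ρ} {g} {σ} x v x∈ v<B rep = record
        { Rep rep
        ; env = λ i i<d → trans (elsewhere (low≢ (ℕ.≤-trans (ℕ.+-monoʳ-< 16 i<d) 16+d≤64))) (env i i<d)
        ; pars = λ r → trans (elsewhere (low≢ (ℕ.<-≤-trans (par<16 r) (ℕ.m≤m+n 16 48)))) (pars r)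
        ; deg = trans (elsewhere (low≢ (ℕ.m≤m+n 11 53))) deg
        ; one = trans (elsewhere (low≢ (ℕ.m≤m+n 12 52))) one
        ; raw = trans (elsewhere (low≢ (ℕ.m≤m+n 13 51))) raw
        ; rawI = λ u v u< v< → trans (elsewhere (ℕ.<⇒≢ (ℕ.<-≤-trans (ℕ.+-monoʳ-< base (matrix< u< v<)) (ℕ.≤-trans base-fits (address-≥ x))))) (rawI u v u< v<)
        ; arrI = arrI′ ; arrI<B = arrI<B′
        ; fits = fits-int σ (address′ x) v fits (address-< x x∈) (ℕ.<-≤-trans v<B B≤S) }
        where
        open Rep rep
        16+d≤64 = ℕ.≤-trans (ℕ.+-monoʳ-≤ 16 depth) (ℕ.m≤m+n 41 23)
        low≢ : ∀ {j} → j < 64 → j ≢ address′ x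
        low≢ j<64 = low≢address x j<64 ∘ sym
        elsewhere : ∀ {j} → j ≢ address′ x → (int σ [ address′ x ≔ v ]) j ≡ int σ j
        elsewhere = [≔]-other (int σ)
        arrI′ : ∀ y → InRange y → (int σ [ address′ x ≔ v ]) (address′ y) ≡ update (I g) x v y
        arrI′ y y∈ with y == x in e
        ... | true with refl ← ==-sound y x e = [≔]-same (int σ) (address′ x)
        ... | false = trans (elsewhere (λ e′ → y≢x (address-injective y x y∈ x∈ e′))) (arrI y y∈)
          where
          y≢x : y ≢ x
          y≢x refl with () ← trans (sym e) (==-refl x)
        arrI<B′ : ∀ y → InRange y → update (I g) x v y < B
        arrI<B′ y y∈ with y == x
        ... | true = v<B
        ... | false = arrI<B y y∈

      rep-writeR : ∀ {d ρ g σ} x v → InRange x → Rep d ρ g σ →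
                   Rep d ρ (writeR x v g) (store (int σ) (real σ [ address′ x ≔ v ]))
      rep-writeR {d} {ρ} {g} {σ} x v x∈ rep = record
        { Rep rep
        ; rawR = λ u v l u< v< l< → trans ([≔]-other (real σ) (ℕ.<⇒≢ (ℕ.<-≤-trans (x*b+l<y*b (suc q) (matrix< u< v<) l<) (ℕ.≤-trans real-fits (address-≥ x))))) (rawR u v l u< v< l<)
        ; arrR = arrR′
        ; fits = fits-real σ (address′ x) v fits (address-< x x∈) }
        where
        open Rep rep
        arrR′ : ∀ y → InRange y → (real σ [ address′ x ≔ v ]) (address′ y) ≡ update (R g) x v y
        arrR′ y y∈ with y == x in e
        ... | true with refl ← ==-sound y x e = [≔]-same (real σ) (address′ x)
        ... | false = trans ([≔]-other (real σ) (λ e′ → y≢x (address-injective y x y∈ x∈ e′))) (arrR y y∈)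
          where
          y≢x : y ≢ x
          y≢x refl with () ← trans (sym e) (==-refl x)

      at-InRange : ∀ {d ρ g σ} (x : Ref d) → Rep d ρ g σ → InRange (at′ x ρ)
      at-InRange (ref a i j k l) rep = Fin.toℕ<n a , bound i , bound j , bound k , bound l
        where bound = λ i → Rep.env<B rep (toℕ i) (Fin.toℕ<n i)

      var-val : ∀ {d ρ g σ} → Rep d ρ g σ → (i : Fin d) → int σ (varReg (toℕ i)) ≡ ρ (toℕ i)
      var-val rep i = Rep.env rep (toℕ i) (Fin.toℕ<n i)

      m≤m*B : ∀ m → m ≤ m * B
      m≤m*B m = ℕ.m≤m*n m B {{>-nonZero 0<B}}

      times-B : ∀ {d ρ g σ p X} → Rep d ρ g σ → p < 5 → int σ p ≡ X → X * B < S →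
                Sets (instr (intOp times (at p) (at p) (at 9))) 1 p (X * B) σ
      times-B rep p<5 eX <S = sets _ refl refl (Rep.fits rep) (ℕ.<-≤-trans p<5 (ℕ.m≤m+n 5 59)) (cong₂ _*_ eX (Rep.pars rep boundPar)) <S

      digit-run : ∀ {d ρ g σ p X} → Rep d ρ g σ → p < 5 → int σ p ≡ X → (i : Fin d) → X * B + ρ (toℕ i) < S →
                  Sets (digit p (varReg (toℕ i))) 2 p (X * B + ρ (toℕ i)) σ
      digit-run rep p<5 eX i <S = s₁ then sets _ refl refl (fit s₁) (ℕ.<-≤-trans p<5 (ℕ.m≤m+n 5 59))
          (cong₂ _+_ (val s₁) (var-val (rep-scratch p<5 s₁ rep) i)) <S
        where s₁ = times-B rep p<5 eX (ℕ.≤-<-trans (ℕ.m≤m+n _ _) <S)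

      pointer-run′ : ∀ {d ρ g σ p} → Rep d ρ g σ → p < 5 → (x : Ref d) → Sets (pointer p x) 9 p (address′ (at′ x ρ)) σ
      pointer-run′ {ρ = ρ} {σ = σ} {p} rep p<5 x@(ref a i j k l) = s₀ then s₁ then s₂ then s₃ then s₄
        where
        next : ∀ {X} Y → X * B + Y < S → X < S
        next {X} Y = ℕ.≤-<-trans (ℕ.≤-trans (m≤m*B X) (ℕ.m≤m+n (X * B) Y))
        -- Intermediate values are prefixes of the address, so their word bounds follow from the
        -- full one by dropping digits.
        <S₄ = address-< (at′ x ρ) (at-InRange x rep)
        <S₃ = next (ρ (toℕ l)) <S₄
        <S₂ = next (ρ (toℕ k)) <S₃
        <S₁ = next (ρ (toℕ j)) <S₂
        <S₀ = next (ρ (toℕ i)) <S₁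
        s₀ = sets (intConst (at p) (suc (toℕ a))) refl refl (Rep.fits rep) (ℕ.<-≤-trans p<5 (ℕ.m≤m+n 5 59)) refl <S₀
        r₀ = rep-scratch p<5 s₀ rep
        s₁ = digit-run r₀ p<5 (val s₀) i <S₁
        r₁ = rep-scratch p<5 s₁ r₀
        s₂ = digit-run r₁ p<5 (val s₁) j <S₂
        r₂ = rep-scratch p<5 s₂ r₁
        s₃ = digit-run r₂ p<5 (val s₂) k <S₃
        r₃ = rep-scratch p<5 s₃ r₂
        s₄ = digit-run r₃ p<5 (val s₃) l <S₄

      block-run′ : ∀ {d ρ g σ p} → Rep d ρ g σ → p < 5 → (a : Name) → Sets (block p a) 5 p (address′ (loc (toℕ a) 0 0 0 0)) σ
      block-run′ {p = p} rep p<5 a = s₀ then s₁ then s₂ then s₃ then subst (λ v → Sets (instr (intOp times (at p) (at p) (at 9))) 1 p v (after s₃)) (sym e) s₄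
        where
        e : address′ (loc (toℕ a) 0 0 0 0) ≡ suc (toℕ a) * B * B * B * B
        e = scale (scale (scale (scale {suc (toℕ a)} refl)))
          where
          scale : ∀ {x y} → x ≡ y → x * B + 0 ≡ y * B
          scale refl = ℕ.+-identityʳ _
        <S₄ : suc (toℕ a) * B * B * B * B < S
        <S₄ = subst (_< S) e (address-< (loc (toℕ a) 0 0 0 0) (Fin.toℕ<n a , 0<B , 0<B , 0<B , 0<B))
        next : ∀ {X} → X * B < S → X < S
        next {X} = ℕ.≤-<-trans (m≤m*B X)
        s₀ = sets (intConst (at p) (suc (toℕ a))) refl refl (Rep.fits rep) (ℕ.<-≤-trans p<5 (ℕ.m≤m+n 5 59)) refl (next (next (next (next <S₄))))
        r₀ = rep-scratch p<5 s₀ rep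
        s₁ = times-B r₀ p<5 (val s₀) (next (next (next <S₄)))
        r₁ = rep-scratch p<5 s₁ r₀
        s₂ = times-B r₁ p<5 (val s₁) (next (next <S₄))
        r₂ = rep-scratch p<5 s₂ r₁
        s₃ = times-B r₂ p<5 (val s₂) (next <S₄)
        r₃ = rep-scratch p<5 s₃ r₂
        s₄ = times-B r₃ p<5 (val s₃) <S₄

      -- Abstract, because the stores reached on the way unfold to large terms.
      abstract
        pointer-run : ∀ {d ρ g σ p} → Rep d ρ g σ → p < 5 → (x : Ref d) → Sets (pointer p x) 9 p (address′ (at′ x ρ)) σ
        pointer-run = pointer-run′

        block-run : ∀ {d ρ g σ p} → Rep d ρ g σ → p < 5 → (a : Name) → Sets (block p a) 5 p (address′ (loc (toℕ a) 0 0 0 0)) σ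
        block-run = block-run′

      record Outcome (d : ℕ) (ρ : Env) (P : Program) (bound : ℕ) (Q : Mem → Set ℓ) (σ : Store) : Set ℓ where
        field
          time  : ℕ
          end   : Store
          final : Mem
          time≤ : time ≤ bound
          run   : Run S P σ time end
          rep   : Rep d ρ final end
          post  : Q final

      prefix : ∀ {d ρ P P′ t b b′ Q σ σ′} → Run S P σ t σ′ → Outcome d ρ P′ b Q σ′ → t + b ≤ b′ → Outcome d ρ (P ︔ P′) b′ Q σ
      prefix {t = t} run o le = record { Outcome o ; time = t + time ; time≤ = ℕ.≤-trans (ℕ.+-monoʳ-≤ t time≤) le ; run = run ︔ Outcome.run o }
        where open Outcome o using (time; time≤)

      exact : ∀ {d ρ P t Q σ σ′ g} → Run S P σ t σ′ → Rep d ρ g σ′ → Q g → t ≤ 64 → Outcome d ρ P (t₀ ^ 1) Q σ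
      exact run rep post t≤64 = record { time = _ ; end = _ ; final = _ ; time≤ = ℕ.≤-trans t≤64 (ℕ.≤-trans (ℕ.m≤n+m 64 _) (ℕ.≤-trans t₀-large (ℕ.≤-reflexive (sym (ℕ.*-identityʳ t₀)))))
                                       ; run = run ; rep = rep ; post = post }

      64≤t₀ : 64 ≤ t₀
      64≤t₀ = ℕ.≤-trans (ℕ.m≤n+m 64 _) t₀-large

      bind : ∀ {d} (c : Cmd (suc d)) {ρ Q P t v σ g} → d < 25 → (s : Sets P t (varReg d) v σ) → v < B → Rep d ρ g σ →
             (Rep (suc d) (ρ [ d ≔ v ]) g (after s) → Outcome (suc d) (ρ [ d ≔ v ]) (compile c) (t₀ ^ timeExponent c) Q (after s)) →
             Outcome d ρ (P ︔ compile c) (t + t₀ ^ timeExponent c) Q σ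
      bind c {t = t} d<25 s v<B rep k = record { Outcome o ; time = t + Outcome.time o ; time≤ = ℕ.+-monoʳ-≤ t (Outcome.time≤ o) ; run = run s ︔ Outcome.run o ; rep = rep-shrink (Outcome.rep o) }
        where o = k (rep-bind d<25 v<B (val s) (rep-forget d<25 s rep))

      put-int : ∀ {d ρ g σ} i x {a v w} → Rep d ρ g σ → exec i σ ≡ store (int σ [ a ≔ v ]) (real σ) → cost i σ ≡ 1 →
                a ≡ address′ x → InRange x → v ≡ w → w < B →
                ∃[ σ′ ] Run S (instr i) σ 1 σ′ × Rep d ρ (writeI x w g) σ′
      put-int {σ = σ} i x {v = v} rep e e′ refl x∈ refl w<B = _ ,
        subst₂ (λ t σ′ → Run S (instr i) σ t σ′) e′ e (instr (subst (Fits S) (sym e) (Rep.fits rep′))) , rep′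
        where rep′ = rep-writeI x v x∈ w<B rep

      put-real : ∀ {d ρ g σ} i x {a v w} → Rep d ρ g σ → exec i σ ≡ store (int σ) (real σ [ a ≔ v ]) → cost i σ ≡ 1 →
                 a ≡ address′ x → InRange x → v ≡ w →
                 ∃[ σ′ ] Run S (instr i) σ 1 σ′ × Rep d ρ (writeR x w g) σ′
      put-real {σ = σ} i x {v = v} rep e e′ refl x∈ refl = _ ,
        subst₂ (λ t σ′ → Run S (instr i) σ t σ′) e′ e (instr (subst (Fits S) (sym e) (Rep.fits rep′))) , rep′
        where rep′ = rep-writeR x v x∈ rep

      private
        weaken : ∀ {d ρ P b b′ Q σ} → b ≤ b′ → Outcome d ρ P b Q σ → Outcome d ρ P b′ Q σ
        weaken le o = record { Outcome o ; time≤ = ℕ.≤-trans (Outcome.time≤ o) le }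

        k<t₀ : ∀ {k} → k < 64 → k < t₀
        k<t₀ k<64 = ℕ.<-≤-trans k<64 64≤t₀

        in-range : ∀ {d ρ g σ} (x : Ref d) → Rep d ρ g σ → InRange (at′ x ρ)
        in-range = at-InRange

      RootsOf-cong : ∀ {d d′} (f : ℕ → Carrier) (p : Polynomial d′) → d ≡ d′ → (∀ i → f (toℕ i) ≡ p i) →
                     RootsOf p (roots {d} (λ i → f (toℕ i)))
      RootsOf-cong {d} f p refl f≡p =
        (λ p≈0 → roots-zero _ (λ i → subst (_≈ᵣ 0#) (sym (f≡p i)) (p≈0 i))) ,
        (λ (i , pi≉0) → transport (roots-nonzero _ (i , subst (λ z → ¬ z ≈ᵣ 0#) (sym (f≡p i)) pi≉0)))
        where
        open CompleteOrderedField ℝ using (eval) renaming (trans to ≈-trans; sym to ≈-sym; reflexive to ≈-reflexive)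
        e≈ : ∀ x → eval p x ≈ᵣ eval (λ (i : Fin (suc d)) → f (toℕ i)) x
        e≈ x = Polynomials.eval-cong ℝ {p = p} {p′ = λ (i : Fin (suc d)) → f (toℕ i)} (λ i → ≈-reflexive (sym (f≡p i))) (≈-reflexive refl)
        transport : ∀ {rs} → IsRootList (λ (i : Fin (suc d)) → f (toℕ i)) rs → IsRootList p rs
        transport L = record { increasing = increasing ; sound = All.map (λ {r} e → ≈-trans (e≈ r) e) sound
                             ; complete = λ x e → complete x (≈-trans (≈-sym (e≈ x)) e) }
          where open IsRootList L

      RootsOf-length : ∀ {d} {p : Polynomial d} {rs} → RootsOf p rs → length rs ≤ d
      RootsOf-length {p = p} (z , nz) with Polynomials.zero⊎nonzero ℝ p
      ... | inj₁ p≈0 rewrite z p≈0 = z≤n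
      ... | inj₂ p≉0 = Polynomials.rootList-length ℝ (nz p≉0) p≉0

      rep-updates : ∀ {d ρ g σ} a l vs → a < 32 → l + length vs ≤ B → Rep d ρ g σ →
        Rep d ρ (mem (I g) (updates (R g) a l vs)) (store (int σ) (real σ [ address′ (loc a 0 0 0 l) ≔* vs ]))
      rep-updates a l [] a<32 l+≤B rep = rep
      rep-updates {d} {ρ} {g} {σ} a l (v ∷ vs) a<32 l+≤B rep =
        rep-writeR (loc a 0 0 0 l) v (a<32 , 0<B , 0<B , 0<B , ℕ.<-≤-trans (ℕ.m<m+n l z<s) l+≤B)
          (subst (λ k → Rep d ρ (mem (I g) (updates (R g) a (suc l) vs)) (store (int σ) (real σ [ k ≔* vs ])))
            (ℕ.+-suc _ l) (rep-updates a (suc l) vs a<32 (subst (_≤ B) (ℕ.+-suc l (length vs)) l+≤B) rep))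

      -- Simulation by induction on the command. It is mutual with `sound-loop`, which recurses on
      -- the rounds still to be run.
      sound : ∀ {d} (c : Cmd d) {ρ Q g σ} → Rep d ρ g σ → wp c ρ Q g → Outcome d ρ (compile c) (t₀ ^ timeExponent c) Q σ
      -- A round costs its test, its body and the increment, hence the 2; the additional unit is the
      -- last, failing test.
      sound-loop : ∀ {d} (c : Cmd (suc d)) p {ρ Q} → d < 25 → ∀ r i {g σ} → i + r ≡ par p → int σ (varReg d) ≡ i →
        Rep d ρ g σ → iterate (λ i → wp c (ρ [ d ≔ i ])) r i Q g →
        Outcome d ρ (while (int< (at (varReg d)) (at (parReg p))) (compile c ︔ instr (intOp plus (at (varReg d)) (at (varReg d)) (at 11))))
          (suc (r * (2 + t₀ ^ timeExponent c))) Q σ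

      sound-loop {d} c p d<25 zero i {σ = σ} e eσ rep post = record
        { time = 1 ; end = _ ; final = _ ; time≤ = ℕ.≤-refl ; run = while-false test ; rep = rep ; post = post }
        where
        test : does (int σ (varReg d) ℕ.<? int σ (parReg p)) ≡ false
        test = dec-false (int σ (varReg d) ℕ.<? int σ (parReg p)) (λ lt → ℕ.<-irrefl (trans (sym (ℕ.+-identityʳ i)) e) (subst₂ _<_ eσ (Rep.pars rep p) lt))
      sound-loop {d} c p {ρ} {Q} d<25 (suc r) i {g} {σ} e eσ rep pre = record
        { time = suc (time o + 1 + time o′) ; end = end o′ ; final = final o′
        ; time≤ = s≤s (ℕ.≤-trans (ℕ.+-mono-≤ (ℕ.≤-trans (ℕ.+-monoˡ-≤ 1 (time≤ o)) (ℕ.≤-reflexive (ℕ.+-comm _ 1))) (time≤ o′)) (ℕ.≤-reflexive (ℕ.+-suc (suc (t₀ ^ timeExponent c)) (r * (2 + t₀ ^ timeExponent c)))))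
        ; run = while-true test (run o ︔ run s) (run o′) ; rep = Outcome.rep o′ ; post = post o′ }
        where
        open Outcome hiding (rep)
        i<par : i < par p
        i<par = subst (i <_) e (ℕ.m<m+n i z<s)
        i<B : i < B
        i<B = ℕ.<-≤-trans i<par (par≤B p)
        test : does (int σ (varReg d) ℕ.<? int σ (parReg p)) ≡ true
        test = dec-true (int σ (varReg d) ℕ.<? int σ (parReg p)) (subst₂ _<_ (sym eσ) (sym (Rep.pars rep p)) i<par)
        o : Outcome (suc d) (ρ [ d ≔ i ]) (compile c) (t₀ ^ timeExponent c) (iterate (λ i → wp c (ρ [ d ≔ i ])) r (suc i) Q) σ
        o = sound c (rep-bind d<25 i<B eσ rep) pre
        open Sets hiding (run)
        open Sets using (run)
        s : Sets _ 1 (varReg d) (suc i) (end o)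
        s = sets (intOp plus (at (varReg d)) (at (varReg d)) (at 11)) refl refl (Rep.fits (Outcome.rep o)) (var<64 d<25)
              (trans (cong₂ _+_ (trans (Rep.env (Outcome.rep o) d ℕ.≤-refl) ([≔]-same ρ d)) (Rep.one (Outcome.rep o))) (ℕ.+-comm i 1))
              (ℕ.<-≤-trans (s≤s i<B) (ℕ.≤-<-trans B≤B⁴ B⁴<S))
        o′ : Outcome d ρ _ (suc (r * (2 + t₀ ^ timeExponent c))) Q (after s)
        o′ = sound-loop c p d<25 r (suc i) (trans (sym (ℕ.+-suc i r)) e) (val s) (rep-forget d<25 s (rep-shrink (Outcome.rep o))) (post o)

      sound skip rep p = record { time = 0 ; end = _ ; final = _ ; time≤ = z≤n ; run = skip ; rep = rep ; post = p }
      sound (c ⨾ c′) {ρ} {Q} {g} {σ} rep p = record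
        { time = time o + time o′ ; end = end o′ ; final = final o′
        ; time≤ = power-+-power 0 (timeExponent c) _ (ℕ.≤-trans (ℕ.m≤m+n 2 62) 64≤t₀) (time≤ o) (time≤ o′)
        ; run = run o ︔ run o′ ; rep = Outcome.rep o′ ; post = post o′ }
        where
        open Outcome hiding (rep)
        o : Outcome _ ρ (compile c) (t₀ ^ timeExponent c) (wp c′ ρ Q) σ
        o = sound c rep p
        o′ = sound c′ (Outcome.rep o) (post o)
      sound (setI x v) {ρ} {σ = σ} rep p = exact (run s ︔ proj₁ (proj₂ r)) (proj₂ (proj₂ r)) p (ℕ.m≤m+n 10 54)
        where
        s = pointer-run rep (ℕ.m≤m+n 2 3) x
        rep′ = rep-scratch (ℕ.m≤m+n 2 3) s rep
        r = put-int (intCopy (ind 1) (var v)) (at′ x ρ) rep′ refl refl (val s) (in-range x rep) (var-val rep′ v) (Rep.env<B rep (toℕ v) (Fin.toℕ<n v))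
      sound {d} (getI {_} {o} x c) {ρ} {g = g} rep p =
        prefix (run s) (bind c d<25 s′ (Rep.arrI<B rep _ (in-range x rep)) rep′ (λ r → sound c r p))
          (const-+-power 10 (timeExponent c) (k<t₀ (ℕ.m≤m+n 11 53)))
        where
        d<25 = ℕ.<ᵇ⇒< d 25 o
        s = pointer-run rep (ℕ.m≤m+n 2 3) x
        rep′ = rep-scratch (ℕ.m≤m+n 2 3) s rep
        s′ = sets {v = I g (at′ x ρ)} (intCopy (at (varReg d)) (ind 1)) refl refl (fit s) (var<64 d<25)
          (trans (cong (int (after s)) (val s)) (Rep.arrI rep′ _ (in-range x rep))) (ℕ.<-≤-trans (Rep.arrI<B rep _ (in-range x rep)) B≤S)
      sound {d} (decr {_} {o} v c) {ρ} rep p =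
        weaken (const-+-power 1 (timeExponent c) (k<t₀ (ℕ.m≤m+n 2 62))) (bind c d<25 s v<B rep (λ r → sound c r p))
        where
        d<25 = ℕ.<ᵇ⇒< d 25 o
        v<B = ℕ.≤-<-trans (ℕ.m∸n≤m (ρ (toℕ v)) 1) (Rep.env<B rep (toℕ v) (Fin.toℕ<n v))
        s = sets (intOp monus (at (varReg d)) (var v) (at 11)) refl refl (Rep.fits rep) (var<64 d<25)
              (cong₂ _∸_ (var-val rep v) (Rep.one rep)) (ℕ.<-≤-trans v<B B≤S)
      sound {d} (adjI {_} {o} u v c) {ρ} rep (u<n , v<n , p) =
        weaken (const-+-power 4 (timeExponent c) (k<t₀ (ℕ.m≤m+n 5 59)))
         (prefix (run s₁) (prefix (run s₂) (prefix (run s₃) (bind c d<25 s₄ (adjacent<B _ _) r₃ (λ r → sound c r p)) ℕ.≤-refl) ℕ.≤-refl) ℕ.≤-refl)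
        where
        d<25 = ℕ.<ᵇ⇒< d 25 o
        1<64 = ℕ.m≤m+n 2 62
        X = ρ (toℕ u) * n + ρ (toℕ v)
        b<S : base + X < S
        b<S = ℕ.<-≤-trans (ℕ.+-monoʳ-< base (matrix< u<n v<n)) (ℕ.≤-trans base-fits (ℕ.<⇒≤ B⁴<S))
        X<S = ℕ.≤-<-trans (ℕ.m≤n+m X base) b<S
        s₁ = sets (intOp times (at 1) (var u) (at 5)) refl refl (Rep.fits rep) 1<64 (cong₂ _*_ (var-val rep u) (Rep.pars rep vertexPar)) (ℕ.≤-<-trans (ℕ.m≤m+n _ _) X<S)
        r₁ = rep-scratch (ℕ.m≤m+n 2 3) s₁ rep
        s₂ = sets (intOp plus (at 1) (at 1) (var v)) refl refl (fit s₁) 1<64 (cong₂ _+_ (val s₁) (var-val r₁ v)) X<S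
        r₂ = rep-scratch (ℕ.m≤m+n 2 3) s₂ r₁
        s₃ = sets (intOp plus (at 1) (at 12) (at 1)) refl refl (fit s₂) 1<64 (cong₂ _+_ (Rep.raw r₂) (val s₂)) b<S
        r₃ = rep-scratch (ℕ.m≤m+n 2 3) s₃ r₂
        s₄ = sets (intCopy (at (varReg d)) (ind 1)) refl refl (fit s₃) (var<64 d<25)
          (trans (cong (int (after s₃)) (val s₃)) (Rep.rawI r₃ _ _ u<n v<n)) (ℕ.<-≤-trans (adjacent<B _ _) B≤S)
      sound {d} (loop {_} {o} p c) {ρ} {Q} {g} rep h =
        prefix (run s) (sound-loop c p d<25 (par p) 0 refl (val s) (rep-forget d<25 s rep) h)
          -- Three factors `t₀` are spent: one absorbs the constant cost of a round, one bounds the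
          -- number of rounds, one absorbs the initialisation and the last test.
          (ℕ.≤-trans (s≤s (s≤s (ℕ.≤-trans (ℕ.*-mono-≤ (ℕ.≤-trans (par≤B p) B≤t₀) (const-+-power 2 (timeExponent c) (k<t₀ (ℕ.m≤m+n 3 61)))) ℕ.≤-refl)))
            (const-+-power 2 (suc (suc (timeExponent c))) (k<t₀ (ℕ.m≤m+n 3 61))))
        where
        d<25 = ℕ.<ᵇ⇒< d 25 o
        s = sets (intConst (at (varReg d)) 0) refl refl (Rep.fits rep) (var<64 d<25) refl (ℕ.≤-trans 0<B B≤S)
      sound (ifI a b c c′) {ρ} {σ = σ} rep (p , p′) with ρ (toℕ a) ℕ.<? ρ (toℕ b)
      ... | yes lt = record { Outcome o ; time = suc (Outcome.time o)
          ; time≤ = ℕ.≤-trans (s≤s (ℕ.≤-trans (Outcome.time≤ o) (ℕ.m≤m+n _ _))) (power-+-power 1 (timeExponent c) (timeExponent c′) (ℕ.≤-trans (ℕ.m≤m+n 3 61) 64≤t₀) ℕ.≤-refl ℕ.≤-refl)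
          ; run = if-true (dec-true (int σ _ ℕ.<? int σ _) (subst₂ _<_ (sym (var-val rep a)) (sym (var-val rep b)) lt)) (Outcome.run o) }
        where o = sound c rep (p lt)
      ... | no ≮ = record { Outcome o ; time = suc (Outcome.time o)
          ; time≤ = ℕ.≤-trans (s≤s (ℕ.≤-trans (Outcome.time≤ o) (ℕ.m≤n+m _ _))) (power-+-power 1 (timeExponent c) (timeExponent c′) (ℕ.≤-trans (ℕ.m≤m+n 3 61) 64≤t₀) ℕ.≤-refl ℕ.≤-refl)
          ; run = if-false (dec-false (int σ _ ℕ.<? int σ _) (λ lt → ≮ (subst₂ _<_ (var-val rep a) (var-val rep b) lt))) (Outcome.run o) }
        where o = sound c′ rep (p′ ≮)
      sound (ifR x y c c′) {ρ} {Q} {g} {σ} rep (p , p′) = prefix (run s₁) (prefix (run s₂) (go (R g (at′ x ρ) <? R g (at′ y ρ))) ℕ.≤-refl)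
          (power-+-power 19 (timeExponent c) (timeExponent c′) (ℕ.≤-trans (ℕ.m≤m+n 21 43) 64≤t₀) ℕ.≤-refl ℕ.≤-refl)
        where
        s₁ = pointer-run rep (ℕ.m≤m+n 2 3) x
        r₁ = rep-scratch (ℕ.m≤m+n 2 3) s₁ rep
        s₂ = pointer-run r₁ (ℕ.m≤m+n 3 2) y
        r₂ = rep-scratch (ℕ.m≤m+n 3 2) s₂ r₁
        σ₂ = after s₂
        ex : real σ₂ (int σ₂ 1) ≡ R g (at′ x ρ)
        ex = trans (cong (real σ₂) (trans (off s₂ 1 (λ ())) (val s₁))) (Rep.arrR r₂ _ (in-range x rep))
        ey : real σ₂ (int σ₂ 2) ≡ R g (at′ y ρ)
        ey = trans (cong (real σ₂) (val s₂)) (Rep.arrR r₂ _ (in-range y rep))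
        go : Dec (R g (at′ x ρ) <ᵣ R g (at′ y ρ)) → Outcome _ ρ (ifThen (real< (ind 1) (ind 2)) (compile c) (compile c′)) (1 + (t₀ ^ timeExponent c + t₀ ^ timeExponent c′)) Q σ₂
        go (yes lt) = record { Outcome o ; time = suc (Outcome.time o) ; time≤ = s≤s (ℕ.≤-trans (Outcome.time≤ o) (ℕ.m≤m+n _ _))
          ; run = if-true (dec-true (real σ₂ _ <? real σ₂ _) (subst₂ _<ᵣ_ (sym ex) (sym ey) lt)) (Outcome.run o) }
          where o = sound c r₂ (p lt)
        go (no ≮) = record { Outcome o ; time = suc (Outcome.time o) ; time≤ = s≤s (ℕ.≤-trans (Outcome.time≤ o) (ℕ.m≤n+m _ _))
          ; run = if-false (dec-false (real σ₂ _ <? real σ₂ _) (λ lt → ≮ (subst₂ _<ᵣ_ ex ey lt))) (Outcome.run o) }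
          where o = sound c′ r₂ (p′ ≮)
      sound (zeroR x) {ρ} rep p = exact (run s ︔ proj₁ (proj₂ r)) (proj₂ (proj₂ r)) p (ℕ.m≤m+n 10 54)
        where
        s = pointer-run rep (ℕ.m≤m+n 2 3) x
        r = put-real (realZero (ind 1)) (at′ x ρ) (rep-scratch (ℕ.m≤m+n 2 3) s rep) refl refl (val s) (in-range x rep) refl
      sound (oneR x) {ρ} rep p = exact (run s ︔ proj₁ (proj₂ r)) (proj₂ (proj₂ r)) p (ℕ.m≤m+n 10 54)
        where
        s = pointer-run rep (ℕ.m≤m+n 2 3) x
        r = put-real (realOne (ind 1)) (at′ x ρ) (rep-scratch (ℕ.m≤m+n 2 3) s rep) refl refl (val s) (in-range x rep) refl
      sound (copyR x y) {ρ} rep p = exact (run s₁ ︔ run s₂ ︔ proj₁ (proj₂ r)) (proj₂ (proj₂ r)) p (ℕ.m≤m+n 19 45)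
        where
        s₁ = pointer-run rep (ℕ.m≤m+n 2 3) x
        r₁ = rep-scratch (ℕ.m≤m+n 2 3) s₁ rep
        s₂ = pointer-run r₁ (ℕ.m≤m+n 3 2) y
        r₂ = rep-scratch (ℕ.m≤m+n 3 2) s₂ r₁
        r = put-real (realCopy (ind 1) (ind 2)) (at′ x ρ) r₂ refl refl (trans (off s₂ 1 (λ ())) (val s₁)) (in-range x rep)
              (trans (cong (real (after s₂)) (val s₂)) (Rep.arrR r₂ _ (in-range y rep)))
      sound (opR ∙ x y z) {ρ} rep p = exact (run s₁ ︔ run s₂ ︔ run s₃ ︔ proj₁ (proj₂ r)) (proj₂ (proj₂ r)) p (ℕ.m≤m+n 28 36)
        where
        s₁ = pointer-run rep (ℕ.m≤m+n 2 3) x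
        r₁ = rep-scratch (ℕ.m≤m+n 2 3) s₁ rep
        s₂ = pointer-run r₁ (ℕ.m≤m+n 3 2) y
        r₂ = rep-scratch (ℕ.m≤m+n 3 2) s₂ r₁
        s₃ = pointer-run r₂ (ℕ.m≤m+n 4 1) z
        r₃ = rep-scratch (ℕ.m≤m+n 4 1) s₃ r₂
        r = put-real (realOp ∙ (ind 1) (ind 2) (ind 3)) (at′ x ρ) r₃ refl refl (trans (off s₃ 1 (λ ())) (trans (off s₂ 1 (λ ())) (val s₁))) (in-range x rep)
              (cong₂ ⟦ ∙ ⟧ᵣ (trans (cong (real (after s₃)) (trans (off s₃ 2 (λ ())) (val s₂))) (Rep.arrR r₃ _ (in-range y rep)))
                            (trans (cong (real (after s₃)) (val s₃)) (Rep.arrR r₃ _ (in-range z rep))))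
      sound (coefR x u v l) {ρ} rep (u<n , v<n , l<w , p) =
        exact (run s₁ ︔ run s₂ ︔ run s₃ ︔ run s₄ ︔ run s₅ ︔ proj₁ (proj₂ r)) (proj₂ (proj₂ r)) p (ℕ.m≤m+n 14 50)
        where
        2<64 = ℕ.m≤m+n 3 61
        2<5 = ℕ.m≤m+n 3 2
        X = ρ (toℕ u) * n + ρ (toℕ v)
        <S₅ : X * suc q + ρ (toℕ l) < S
        <S₅ = ℕ.<-≤-trans (x*b+l<y*b (suc q) (matrix< u<n v<n) l<w) (ℕ.≤-trans real-fits (ℕ.<⇒≤ B⁴<S))
        <S₄ = ℕ.≤-<-trans (ℕ.m≤m+n (X * suc q) (ρ (toℕ l))) <S₅
        <S₃ = ℕ.≤-<-trans (ℕ.m≤m*n X (suc q)) <S₄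
        <S₂ = ℕ.≤-<-trans (ℕ.m≤m+n (ρ (toℕ u) * n) (ρ (toℕ v))) <S₃
        s₁ = pointer-run rep (ℕ.m≤m+n 2 3) x
        r₁ = rep-scratch (ℕ.m≤m+n 2 3) s₁ rep
        s₂ = sets (intOp times (at 2) (var u) (at 5)) refl refl (fit s₁) 2<64 (cong₂ _*_ (var-val r₁ u) (Rep.pars r₁ vertexPar)) <S₂
        r₂ = rep-scratch 2<5 s₂ r₁
        s₃ = sets (intOp plus (at 2) (at 2) (var v)) refl refl (fit s₂) 2<64 (cong₂ _+_ (val s₂) (var-val r₂ v)) <S₃
        r₃ = rep-scratch 2<5 s₃ r₂
        s₄ = sets (intOp times (at 2) (at 2) (at 6)) refl refl (fit s₃) 2<64 (cong₂ _*_ (val s₃) (Rep.pars r₃ widthPar)) <S₄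
        r₄ = rep-scratch 2<5 s₄ r₃
        s₅ = sets (intOp plus (at 2) (at 2) (var l)) refl refl (fit s₄) 2<64 (cong₂ _+_ (val s₄) (var-val r₄ l)) <S₅
        r₅ = rep-scratch 2<5 s₅ r₄
        r = put-real (realCopy (ind 1) (ind 2)) (at′ x ρ) r₅ refl refl
              (trans (off s₅ 1 (λ ())) (trans (off s₄ 1 (λ ())) (trans (off s₃ 1 (λ ())) (trans (off s₂ 1 (λ ())) (val s₁))))) (in-range x rep)
              (trans (cong (real (after s₅)) (val s₅)) (Rep.rawR r₅ _ _ _ u<n v<n l<w))
      sound {d} (rootsR {_} {o} dst src c) {ρ} {Q} {g} {σ} rep p =
        prefix (run s₁) (prefix (run s₂) (prefix run₃ out ℕ.≤-refl) ℕ.≤-refl)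
          (ℕ.≤-trans (ℕ.≤-reflexive bound) (const-+-power (11 + rootTime q) (timeExponent c)
            (ℕ.≤-trans (ℕ.≤-trans (ℕ.+-monoˡ-≤ (rootTime q) (ℕ.m≤m+n 12 52)) (ℕ.≤-reflexive (ℕ.+-comm 64 (rootTime q)))) t₀-large)))
        where
        d<25 = ℕ.<ᵇ⇒< d 25 o
        s₁ = block-run rep (ℕ.m≤m+n 2 3) dst
        r₁ = rep-scratch (ℕ.m≤m+n 2 3) s₁ rep
        s₂ = block-run r₁ (ℕ.m≤m+n 3 2) src
        r₂ = rep-scratch (ℕ.m≤m+n 3 2) s₂ r₁
        σ₂ = after s₂
        e₁ : int σ₂ 1 ≡ address′ (loc (toℕ dst) 0 0 0 0)
        e₁ = trans (off s₂ 1 (λ ())) (val s₁)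
        rs : List Carrier
        rs = roots (polynomialAt (int σ₂ 10) (ind 2) σ₂)
        q<B : q < B
        q<B = par≤B widthPar
        ok : RootsOf {q} (λ i → R g (loc (toℕ src) 0 0 0 (toℕ i))) rs
        ok = RootsOf-cong (λ j → real σ₂ (int σ₂ 2 + j)) (λ i → R g (loc (toℕ src) 0 0 0 (toℕ i))) (Rep.deg r₂) row
          where
          row : ∀ (i : Fin (suc q)) → real σ₂ (int σ₂ 2 + toℕ i) ≡ R g (loc (toℕ src) 0 0 0 (toℕ i))
          row i = trans (cong (real σ₂) (trans (cong (_+ toℕ i) (val s₂)) (cong (_+ toℕ i) (ℕ.+-identityʳ _))))
            (Rep.arrR r₂ (loc (toℕ src) 0 0 0 (toℕ i)) (Fin.toℕ<n src , 0<B , 0<B , 0<B , ℕ.<-≤-trans (Fin.toℕ<n i) q<B))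
        len : length rs ≤ q
        len = RootsOf-length ok
        σ₃ = exec (findRoots (at 10) (at (varReg d)) (ind 1) (ind 2)) σ₂
        a-rep : Rep d ρ (mem (I g) (updates (R g) (toℕ dst) 0 rs)) (store (int σ₂) (real σ₃))
        a-rep = subst (λ k → Rep d ρ (mem (I g) (updates (R g) (toℕ dst) 0 rs)) (store (int σ₂) (real σ₂ [ k ≔* rs ]))) (sym e₁)
          (rep-updates (toℕ dst) 0 rs (Fin.toℕ<n dst) (ℕ.≤-trans len (ℕ.<⇒≤ q<B)) r₂)
        fit₃ : Fits S σ₃
        fit₃ = fits-int (store (int σ₂) (real σ₃)) (varReg d) (length rs) (Rep.fits a-rep) (low (var<64 d<25)) (ℕ.<-≤-trans (ℕ.≤-<-trans len q<B) B≤S)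
        r₃ : Rep d ρ (mem (I g) (updates (R g) (toℕ dst) 0 rs)) σ₃
        r₃ = rep-off (varReg d) (var<64 d<25) (λ { j _ j<16 refl → ℕ.<⇒≱ j<16 (ℕ.m≤m+n 16 d) }) (λ i i<d → ℕ.<⇒≢ i<d ∘ ℕ.+-cancelˡ-≡ 16 i d)
               (λ j j≢ → [≔]-other (int σ₂) j≢) refl fit₃ a-rep
        run₃ : Run S (instr (findRoots (at 10) (at (varReg d)) (ind 1) (ind 2))) σ₂ (suc (rootTime q)) σ₃
        run₃ = subst (λ t → Run S _ σ₂ (suc (rootTime t)) σ₃) (Rep.deg r₂) (instr fit₃)
        out : Outcome d ρ (compile c) (t₀ ^ timeExponent c) Q σ₃
        out = record { Outcome o′ ; rep = rep-shrink (Outcome.rep o′) }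
          where o′ = sound c (rep-bind d<25 (ℕ.≤-<-trans len q<B) ([≔]-same (int σ₂) (varReg d)) r₃) (p rs ok len)
        bound : 5 + (5 + (suc (rootTime q) + t₀ ^ timeExponent c)) ≡ 11 + rootTime q + t₀ ^ timeExponent c
        bound = refl

open Compilation

-- Walks, paths and doubling tables.

module ShortestWalks where
  open import Level using (_⊔_; Lift; lower)
  open import Data.Fin.Base using (Fin; zero; suc; toℕ; fromℕ<)
  import Data.Fin.Properties as Fin
  open import Data.List.Base using (List; []; _∷_; length; lookup; map; concatMap; allFin; _++_; cartesianProductWith)
  open import Data.List.Membership.Propositional using (_∈_; _∉_; lose; find)
  import Data.List.Membership.DecPropositional as DecMembership
  open import Data.List.Relation.Unary.All as All using (All; []; _∷_)
  open import Data.List.Relation.Unary.All.Properties using (¬Any⇒All¬; All¬⇒¬Any)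
  open import Data.List.Relation.Unary.Any as Any using (Any; here; there)
  open import Data.List.Relation.Unary.AllPairs using ([]; _∷_)
  open import Data.List.Relation.Unary.Unique.Propositional using (Unique)
  open import Data.Maybe.Base using (Maybe; just; nothing; _<∣>_)
  open import Data.Nat.Base as ℕ using (ℕ; zero; suc; z≤n; s≤s)
  import Data.Nat.Properties as ℕ
  open import Data.Product.Base using (∃-syntax; Σ-syntax; _×_; _,_; proj₁; proj₂)
  open import Data.Sum.Base using (_⊎_; inj₁; inj₂)
  open import Data.Empty using (⊥; ⊥-elim)
  open import Data.Unit.Base using (⊤; tt)
  open import Function.Base using (_∘_)
  open import Relation.Binary.Construct.Closure.ReflexiveTransitive using (ε; _◅_; _◅◅_)
  open import Relation.Binary.PropositionalEquality as ≡ using (_≡_; _≢_)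
  open import Relation.Nullary using (¬_; Dec; yes; no; does)
  open import Data.Bool.Base using (if_then_else_)
  import Data.Integer.Base as ℤ
  open import Data.List.Membership.Propositional.Properties using (∈-lookup; ∈-allFin; ∈-concatMap⁺; ∈-map⁺; ∈-++⁺ˡ; ∈-++⁺ʳ; ∈-cartesianProductWith⁺)
  import Data.List.Properties as List
  import Data.List.Relation.Unary.Any.Properties as Any
  open import Relation.Binary.Definitions using (Tri; tri<; tri≈; tri>)

  lookup-injective : ∀ {a} {A : Set a} {xs : List A} → Unique xs → ∀ {i j} → lookup xs i ≡ lookup xs j → i ≡ j
  lookup-injective (x∉ ∷ u) {zero}  {zero}  e = ≡.refl
  lookup-injective (x∉ ∷ u) {zero}  {suc j} e = ⊥-elim (All.lookup x∉ (∈-lookup j) e)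
  lookup-injective (x∉ ∷ u) {suc i} {zero}  e = ⊥-elim (All.lookup x∉ (∈-lookup i) (≡.sym e))
  lookup-injective (x∉ ∷ u) {suc i} {suc j} e = ≡.cong suc (lookup-injective u e)

  module Walks {c ℓ₁ ℓ₂} (ℝ : CompleteOrderedField c ℓ₁ ℓ₂) {n q : ℕ} (G : Graphs.Graph ℝ n q) where
    open CompleteOrderedField ℝ hiding (zero)
    open OrderedField ℝ
    open IntegerSolver commutativeRing
    open Graphs ℝ
    open Graph G
    open DecMembership (Fin._≟_ {n}) using (_∈?_)

    W : Fin n → Fin n → Set c
    W = Walk G

    weight-◅◅ : ∀ {u v w} x (a : W u v) (b : W v w) → weight G x (a ◅◅ b) ≈ weight G x a + weight G x b
    weight-◅◅ x ε b = sym (+-identityˡ _)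
    weight-◅◅ x (e ◅ a) b = trans (+-congˡ (weight-◅◅ x a b)) (sym (+-assoc _ _ _))

    end∈ : ∀ {u v} (w : W u v) → v ∈ vertices G w
    end∈ ε       = here ≡.refl
    end∈ (e ◅ w) = there (end∈ w)

    ∉-head : ∀ {u v a} {e : Edge u v} {w : W v a} → IsPath G (e ◅ w) → u ∉ vertices G w
    ∉-head (u∉ ∷ _) u∈ = All¬⇒¬Any u∉ u∈

    cons-path : ∀ {u v a} (e : Edge u v) (w : W v a) → u ∉ vertices G w → IsPath G w → IsPath G (e ◅ w)
    cons-path e w u∉ uniq = ¬Any⇒All¬ _ u∉ ∷ uniq

    split : ∀ x {a v u} (p : W a v) → IsPath G p → u ∈ vertices G p →
            Σ[ p₁ ∈ W a u ] Σ[ p₂ ∈ W u v ] IsPath G p₁ × IsPath G p₂ × weight G x p ≈ weight G x p₁ + weight G x p₂ ×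
              (∀ {z} → z ∈ vertices G p₁ → z ∈ vertices G p)
    split x ε uniq (here ≡.refl) = ε , ε , uniq , uniq , sym (+-identityˡ _) , λ z∈ → z∈
    split x (e ◅ p) uniq (here ≡.refl) = ε , e ◅ p , [] ∷ [] , uniq , sym (+-identityˡ _) , λ { (here e) → here e }
    split x (e ◅ p) uniq@(_ ∷ uniq′) (there u∈) with split x p uniq′ u∈
    ... | p₁ , p₂ , path₁ , path₂ , w≈ , ⊆p = e ◅ p₁ , p₂ , cons-path e p₁ (∉-head {e = e} {p} uniq ∘ ⊆p) path₁ , path₂ ,
          trans (+-congˡ w≈) (sym (+-assoc _ _ _)) , λ { (here e) → here e ; (there z∈) → there (⊆p z∈) }

    -- By induction along the walk: an edge whose source already lies on the shortened remainder
    -- closes a directed cycle, and dropping a cycle of nonnegative weight does not increase the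
    -- weight.
    shorten : ∀ x → NoNegativeCycle G x → ∀ {u v} (w : W u v) → Σ[ p ∈ W u v ] IsPath G p × weight G x p ≤ weight G x w
    shorten x noneg ε = ε , [] ∷ [] , ≤-refl refl
    shorten x noneg {u} (e ◅ w) with shorten x noneg w
    ... | p , path , p≤w with u ∈? vertices G p
    ... | no u∉ = e ◅ p , cons-path e p u∉ path , +-mono-≤ (≤-refl refl) p≤w
    ... | yes u∈ with split x p path u∈
    ... | p₁ , p₂ , path₁ , path₂ , w≈ , _ = p₂ , path₂ ,
      ≤-trans (≤-resp (+-identityˡ _) (trans (+-assoc _ _ _) (+-congˡ (sym w≈))) (+-mono-≤ (noneg e p₁ path₁) (≤-refl refl)))
              (+-mono-≤ (≤-refl refl) p≤w)

    -- A closed path cannot have an edge, since its first vertex would recur. So a closed walk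
    -- shortens to the empty walk, of weight zero.
    closed≥0 : ∀ x → NoNegativeCycle G x → ∀ {u} (w : W u u) → weight G x w ≥0
    closed≥0 x noneg w with shorten x noneg w
    ... | ε , _ , p≤w = p≤w
    ... | e ◅ p , path , _ = ⊥-elim (∉-head {e = e} {p} path (end∈ p))

    -- The vertex after the last visit of a vertex, other than the one at the end of the walk.
    next : ∀ {u v} → W u v → Fin n → Maybe (Fin n)
    next ε a = nothing
    next (_◅_ {i} {j} e w) a = next w a <∣> (if does (a Fin.≟ i) then just j else nothing)

    <∣>-assoc : ∀ {A : Set} (x y z : Maybe A) → (x <∣> y) <∣> z ≡ x <∣> (y <∣> z)
    <∣>-assoc (just _) y z = ≡.refl
    <∣>-assoc nothing  y z = ≡.refl

    -- The reason for recording last visits: the record of a concatenation is computed vertex by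
    -- vertex from the records of its parts, without a list of vertices.
    next-◅◅ : ∀ {u v w} (a : W u v) (b : W v w) z → next (a ◅◅ b) z ≡ next b z <∣> next a z
    next-◅◅ ε b z with next b z
    ... | just _  = ≡.refl
    ... | nothing = ≡.refl
    next-◅◅ (_◅_ {i} {j} e a) b z = ≡.trans (≡.cong (_<∣> (if does (z Fin.≟ i) then just j else nothing)) (next-◅◅ a b z))
      (<∣>-assoc (next b z) (next a z) _)

    next-first : ∀ {u v} (w : W u v) → u ≢ v → ∃[ b ] next w u ≡ just b
    next-first ε u≢v = ⊥-elim (u≢v ≡.refl)
    next-first {u} (e ◅ w) u≢v with next w u | u Fin.≟ u
    ... | just b  | _ = b , ≡.refl
    ... | nothing | yes _ = _ , ≡.refl
    ... | nothing | no u≢u = ⊥-elim (u≢u ≡.refl)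

    -- The last component says that `a` is not left again; this is what makes the extracted path
    -- simple.
    last-visit : ∀ {u t} (w : W u t) a {b} → next w a ≡ just b →
      Σ[ pre ∈ W u a ] Σ[ e ∈ Edge a b ] Σ[ post ∈ W b t ] w ≡ pre ◅◅ (e ◅ post) × next post a ≡ nothing
    last-visit (_◅_ {i} {j} e w) a eq with next w a in eq′
    last-visit (_◅_ {i} {j} e w) a ≡.refl | just b with last-visit w a eq′
    ... | pre , e′ , post , ≡.refl , none = e ◅ pre , e′ , post , ≡.refl , none
    last-visit (_◅_ {i} {j} e w) a eq | nothing with a Fin.≟ i
    last-visit (_◅_ {i} {j} e w) a ≡.refl | nothing | yes ≡.refl = ε , e , w , ≡.refl , eq′

    next-nothing : ∀ {u t} (w : W u t) a → next w a ≡ nothing → a ∈ vertices G w → a ≡ t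
    next-nothing ε a eq (here a≡) = a≡
    next-nothing (_◅_ {i} {j} e w) a eq a∈ with next w a in eq′ | a Fin.≟ i
    next-nothing (_◅_ {i} {j} e w) a eq (here a≡i) | nothing | no a≢i = ⊥-elim (a≢i a≡i)
    next-nothing (_◅_ {i} {j} e w) a eq (there a∈) | nothing | no a≢i = next-nothing w a eq′ a∈

    len : ∀ {u v} → W u v → ℕ
    len ε       = 0
    len (e ◅ w) = suc (len w)

    len-◅◅ : ∀ {u v w} (a : W u v) (b : W v w) → len (a ◅◅ b) ≡ len a ℕ.+ len b
    len-◅◅ ε b       = ≡.refl
    len-◅◅ (e ◅ a) b = ≡.cong suc (len-◅◅ a b)

    -- The condition `i ≢ t` is included because the program stops as soon as it reaches `t`.
    Follows : (Fin n → Maybe (Fin n)) → ∀ {u t} → W u t → Set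
    Follows f ε = ⊤
    Follows f {t = t} (_◅_ {i} {j} e p) = i ≢ t × f i ≡ just j × Follows f p

    vertices-len : ∀ {u v} (w : W u v) → length (vertices G w) ≡ suc (len w)
    vertices-len ε       = ≡.refl
    vertices-len (e ◅ w) = ≡.cong suc (vertices-len w)

    path-length : ∀ {u v} (p : W u v) → IsPath G p → length (vertices G p) ℕ.≤ n
    path-length p uniq = Fin.injective⇒≤ {f = lookup (vertices G p)} (lookup-injective uniq)

    -- The step from `v` is its last exit, and the part before it is a closed walk, which may be
    -- dropped. A last exit in the remainder is also one in the whole walk, so the single successor
    -- map `f` serves every suffix. The path is chosen before `x`, so it does not vary over a cell.
    -- The number `m` bounds the length for termination.
    extract : ∀ m {v t} (w : W v t) → len w ℕ.≤ m → (f : Fin n → Maybe (Fin n)) → (∀ a b → next w a ≡ just b → f a ≡ just b) →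
      Σ[ p ∈ W v t ] IsPath G p × Follows f p × (∀ x → NoNegativeCycle G x → weight G x p ≤ weight G x w) ×
        (∀ {z} → z ∈ vertices G p → z ∈ vertices G w)
    extract m {v} {t} w len≤m f w⊆f with v Fin.≟ t
    ... | yes ≡.refl = ε , [] ∷ [] , tt , (λ x noneg → closed≥0 x noneg w) , λ { (here ≡.refl) → end∈ w }
    extract m {v} {t} w len≤m f w⊆f | no v≢t with next-first w v≢t
    ... | b , eq with last-visit w v eq
    extract zero {v} w len≤m f w⊆f | no v≢t | b , eq | pre , e , post , ≡.refl , none
      with () ← ≡.subst (ℕ._≤ 0) (≡.trans (len-◅◅ pre (e ◅ post)) (ℕ.+-suc (len pre) (len post))) len≤m
    extract (suc m) {v} {t} w len≤m f w⊆f | no v≢t | b , eq | pre , e , post , ≡.refl , none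
      with extract m post (ℕ.≤-trans (ℕ.m≤n+m (len post) (len pre)) (ℕ.≤-pred (≡.subst (ℕ._≤ suc m) (≡.trans (len-◅◅ pre (e ◅ post)) (ℕ.+-suc (len pre) (len post))) len≤m)))
             f (λ a b eq → w⊆f a b (≡.trans (next-◅◅ pre (e ◅ post) a) (≡.cong (_<∣> next pre a) (≡.cong (_<∣> _) eq))))
    ... | p , path , follows , p≤ , p⊆ = e ◅ p , cons-path e p (λ v∈ → v≢t (next-nothing post v none (p⊆ v∈))) path ,
          (v≢t , w⊆f v b eq , follows) ,
          (λ x noneg → ≤-resp (+-identityˡ _) (sym (weight-◅◅ x pre (e ◅ post))) (+-mono-≤ (closed≥0 x noneg pre) (+-mono-≤ (≤-refl refl) (p≤ x noneg)))) ,
          λ { (here ≡.refl) → v∈ pre ; (there z∈) → ∈-◅◅ʳ pre (there (p⊆ z∈)) }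
      where
      ∈-◅◅ʳ : ∀ {u v w z} (a : W u v) {b : W v w} → z ∈ vertices G b → z ∈ vertices G (a ◅◅ b)
      ∈-◅◅ʳ ε z∈ = z∈
      ∈-◅◅ʳ (e ◅ a) z∈ = there (∈-◅◅ʳ a z∈)
      v∈ : ∀ (pre : W v v) → v ∈ vertices G (pre ◅◅ (e ◅ post))
      v∈ pre = ∈-◅◅ʳ pre (here ≡.refl)

    coefs : ∀ {u v} → W u v → Polynomial q
    coefs ε i             = 0#
    coefs ((p , _) ◅ w) i = p i + coefs w i

    coefs-◅◅ : ∀ {u v w} (a : W u v) (b : W v w) i → coefs (a ◅◅ b) i ≈ coefs a i + coefs b i
    coefs-◅◅ ε b i = sym (+-identityˡ _)
    coefs-◅◅ (e ◅ a) b i = trans (+-congˡ (coefs-◅◅ a b i)) (sym (+-assoc _ _ _))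

    open Polynomials ℝ

    eval-coefs : ∀ {u v} x (w : W u v) → eval (coefs w) x ≈ weight G x w
    eval-coefs x ε = eval-0 {q} (λ _ → 0#) x (λ _ → refl)
    eval-coefs x (e ◅ w) = trans (eval-+ (proj₁ e) (coefs w) x) (+-congˡ (eval-coefs x w))

    difference : ∀ {u v} → W u v → W u v → Polynomial q
    difference a b i = coefs a i - coefs b i

    eval-difference : ∀ {u v} x (a b : W u v) → eval (difference a b) x ≈ weight G x a - weight G x b
    eval-difference x a b = trans (eval-- (coefs a) (coefs b) x) (+-cong (eval-coefs x a) (-‿cong (eval-coefs x b)))

    difference<0 : ∀ {u v} x (a b : W u v) → weight G x a < weight G x b → eval (difference a b) x < 0#
    difference<0 x a b a<b = <-resp (sym (eval-difference x a b)) refl (diff>0⁻¹ (<-resp refl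
      (solve 2 (λ a b → b :- a := con (ℤ.+ 0) :- (a :- b)) refl (weight G x a) (weight G x b)) (diff>0 a<b)))

    difference<0⁻¹ : ∀ {u v} x (a b : W u v) → eval (difference a b) x < 0# → weight G x a < weight G x b
    difference<0⁻¹ x a b d<0 = diff>0⁻¹ (<-resp refl
      (solve 2 (λ a b → con (ℤ.+ 0) :- (a :- b) := b :- a) refl (weight G x a) (weight G x b))
      (diff>0 (<-resp (eval-difference x a b) refl d<0)))

    -- Candidates for shortest walks with at most 2ᵏ edges.
    Table : Set c
    Table = ∀ u v → Maybe (W u v)

    concat : ∀ {u v w} → Maybe (W u v) → Maybe (W v w) → Maybe (W u w)
    concat (just a) (just b) = just (a ◅◅ b)
    concat _        _        = nothing

    -- Indexed by a natural number, like the loop of the program; indices from `n` on give no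
    -- candidate.
    candidate : Table → ∀ u v → ℕ → Maybe (W u v)
    candidate τ u v i with i ℕ.<? n
    ... | yes i<n = concat (τ u (fromℕ< i<n)) (τ (fromℕ< i<n) v)
    ... | no _    = nothing

    candidate-toℕ : ∀ τ u v w → candidate τ u v (toℕ w) ≡ concat (τ u w) (τ w v)
    candidate-toℕ τ u v w with toℕ w ℕ.<? n
    ... | yes w<n = ≡.cong (λ w → concat (τ u w) (τ w v)) (Fin.fromℕ<-toℕ w w<n)
    ... | no w≮n = ⊥-elim (w≮n (Fin.toℕ<n w))

    -- On a tie the earlier candidate stays, in accordance with the strict comparison that the
    -- program makes.
    better : ∀ {u v} → Carrier → Maybe (W u v) → Maybe (W u v) → Maybe (W u v)
    better y nothing  m        = m
    better y (just a) nothing  = just a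
    better y (just a) (just b) = if does (weight G y b <? weight G y a) then just b else just a

    best : Carrier → Table → ∀ u v → ℕ → Maybe (W u v)
    best y τ u v zero    = nothing
    best y τ u v (suc i) = better y (best y τ u v i) (candidate τ u v i)

    step : Carrier → Table → Table
    step y τ u v = best y τ u v n

    -- The matrix entry is passed together with an equation, so that it can be split while the proof
    -- that the pair is an edge survives.
    edge : ∀ {u v} (m : Maybe (Polynomial q)) → wt u v ≡ m → Maybe (W u v)
    edge (just p) eq = just ((p , eq) ◅ ε)
    edge nothing  eq = nothing

    edge-just : ∀ {u v p} m (eq : wt u v ≡ m) → wt u v ≡ just p → ∃[ eq′ ] edge m eq ≡ just ((p , eq′) ◅ ε)
    edge-just (just p) eq eq′ with ≡.refl ← ≡.trans (≡.sym eq) eq′ = eq , ≡.refl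
    edge-just nothing  eq eq′ with () ← ≡.trans (≡.sym eq) eq′

    -- The empty walk on the diagonal makes doubling cover every number of edges up to `2^k`, and
    -- not only `2^k` itself.
    table₀ : Table
    table₀ u v with u Fin.≟ v
    ... | yes ≡.refl = just ε
    ... | no _       = edge (wt u v) ≡.refl

    table : Carrier → ℕ → Table
    table y zero    = table₀
    table y (suc k) = step y (table y k)

    best-candidate : ∀ y τ u v i {f} → best y τ u v i ≡ just f → ∃[ j ] candidate τ u v j ≡ just f
    best-candidate y τ u v (suc i) eq with best y τ u v i in eq₁ | candidate τ u v i in eq₂
    ... | nothing | m = i , ≡.trans eq₂ eq
    ... | just a | nothing = best-candidate y τ u v i (≡.trans eq₁ eq)
    ... | just a | just b with weight G y b <? weight G y a
    ...   | yes _ = i , ≡.trans eq₂ eq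
    ...   | no _  = best-candidate y τ u v i (≡.trans eq₁ eq)

    best-minimal : ∀ y τ u v i j {c} → j ℕ.< i → candidate τ u v j ≡ just c →
                   ∃[ f ] best y τ u v i ≡ just f × weight G y f ≤ weight G y c
    best-minimal y τ u v (suc i) j {c} j≤i eq with best y τ u v i in eq₁ | candidate τ u v i in eq₂ | ℕ.m≤n⇒m<n∨m≡n (ℕ.≤-pred j≤i)
    ... | nothing | m | inj₁ j<i with best-minimal y τ u v i j j<i eq
    ...   | f , eq′ , _ with () ← ≡.trans (≡.sym eq₁) eq′
    best-minimal y τ u v (suc i) j {c} j≤i eq | nothing | m | inj₂ ≡.refl = c , ≡.trans (≡.sym eq₂) eq , ≤-refl refl
    best-minimal y τ u v (suc i) j {c} j≤i eq | just a | nothing | inj₂ ≡.refl with () ← ≡.trans (≡.sym eq₂) eq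
    best-minimal y τ u v (suc i) j {c} j≤i eq | just a | nothing | inj₁ j<i with best-minimal y τ u v i j j<i eq
    ...   | f , eq′ , f≤c with ≡.refl ← ≡.trans (≡.sym eq₁) eq′ = a , ≡.refl , f≤c
    best-minimal y τ u v (suc i) j {c} j≤i eq | just a | just b | k with weight G y b <? weight G y a
    best-minimal y τ u v (suc i) j {c} j≤i eq | just a | just b | inj₂ ≡.refl | yes _
      with ≡.refl ← ≡.trans (≡.sym eq₂) eq = b , ≡.refl , ≤-refl refl
    best-minimal y τ u v (suc i) j {c} j≤i eq | just a | just b | inj₁ j<i | yes b<a with best-minimal y τ u v i j j<i eq
    ...   | f , eq′ , f≤c with ≡.refl ← ≡.trans (≡.sym eq₁) eq′ = b , ≡.refl , ≤-trans (<⇒≤ b<a) f≤c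
    best-minimal y τ u v (suc i) j {c} j≤i eq | just a | just b | inj₂ ≡.refl | no b≮a
      with ≡.refl ← ≡.trans (≡.sym eq₂) eq = a , ≡.refl , b≮a
    best-minimal y τ u v (suc i) j {c} j≤i eq | just a | just b | inj₁ j<i | no b≮a with best-minimal y τ u v i j j<i eq
    ...   | f , eq′ , f≤c with ≡.refl ← ≡.trans (≡.sym eq₁) eq′ = a , ≡.refl , f≤c

    -- Stability of the tables in a cell.

    NonZero : Polynomial q → Set ℓ₁
    NonZero p = ∃[ i ] ¬ p i ≈ 0#

    -- Only differences of a candidate and the winner of its entry count. A vanishing difference is
    -- excluded, since all points are its roots although the two walks never change order.
    ComparisonRoot : ℕ → Carrier → Carrier → Set (c ⊔ ℓ₁)
    ComparisonRoot K y r = ∃[ k ] k ℕ.< K × ∃[ u ] ∃[ v ] ∃[ w ] ∃[ a ] ∃[ b ]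
      (concat (table y k u w) (table y k w v) ≡ just a × table y (suc k) u v ≡ just b ×
       NonZero (difference a b) × eval (difference a b) r ≈ 0#)

    -- As an end of an interval, `nothing` stands for infinity.
    Above : Maybe Carrier → Carrier → Set ℓ₂
    Above nothing  x = Lift ℓ₂ ⊤
    Above (just l) x = l < x

    Below AtMost : Maybe Carrier → Carrier → Set ℓ₂
    Below nothing  x = Lift ℓ₂ ⊤
    Below (just h) x = x < h
    AtMost nothing  x = Lift ℓ₂ ⊤
    AtMost (just h) x = x ≤ h

    above-trans : ∀ lo {x y} → Above lo x → x < y → Above lo y
    above-trans nothing  _ _ = _
    above-trans (just l) p x<y = <-trans p x<y

    below-trans : ∀ hi {x y} → Below hi y → x < y → Below hi x
    below-trans nothing  _ _ = _
    below-trans (just h) p x<y = <-trans x<y p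

    atMost-below : ∀ hi {x y} → AtMost hi y → x < y → Below hi x
    atMost-below nothing  _ _ = _
    atMost-below (just h) p x<y = <-≤-trans x<y p

    sample : Maybe Carrier → Maybe Carrier → Carrier
    sample nothing  nothing  = 0#
    sample nothing  (just h) = h - 1#
    sample (just l) nothing  = l + 1#
    sample (just l) (just h) = (l + h) ÷ (1# + 1#)

    NonEmpty : Maybe Carrier → Maybe Carrier → Set ℓ₂
    NonEmpty nothing  hi = Lift ℓ₂ ⊤
    NonEmpty (just l) hi = Below hi l

    sample-above : ∀ lo hi → NonEmpty lo hi → Above lo (sample lo hi)
    sample-above nothing  hi       ne = _
    sample-above (just l) nothing  ne = <-+1 l
    sample-above (just l) (just h) ne = <-midpoint ne

    sample-below : ∀ lo hi → NonEmpty lo hi → Below hi (sample lo hi)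
    sample-below lo       nothing  ne = _
    sample-below nothing  (just h) ne = -1-< h
    sample-below (just l) (just h) ne = midpoint-< ne

    Stable : ℕ → Maybe Carrier → Maybe Carrier → Set (c ⊔ ℓ₁ ⊔ ℓ₂)
    Stable K lo hi = ∀ r → ComparisonRoot K (sample lo hi) r → Above lo r → ¬ Below hi r

    module _ (K : ℕ) (lo hi : Maybe Carrier) (ne : NonEmpty lo hi) (stable : Stable K lo hi)
             (x : Carrier) (lo<x : Above lo x) (x≤hi : AtMost hi x) where
      private
        y = sample lo hi
        lo<y = sample-above lo hi ne
        y<hi = sample-below lo hi ne

      -- The order of two walks that are compared at y cannot change between y and x, by the intermediate value theorem.
      transfer : ∀ {k} → k ℕ.< K → ∀ {u v w a b} → concat (table y k u w) (table y k w v) ≡ just a →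
                 table y (suc k) u v ≡ just b → weight G y b ≤ weight G y a → weight G x b ≤ weight G x a
      transfer {k} k<K {u} {v} {w} {a} {b} eqa eqb b≤a with zero⊎nonzero (difference a b)
      ... | inj₁ d≈0 = diff≥0⁻¹ (≤-refl (trans (sym (eval-0 (difference a b) x d≈0)) (eval-difference x a b)))
      ... | inj₂ d≉0 = λ a<b → go a<b (≤⇒<⊎≈ (≤-resp refl (sym (eval-difference y a b)) (diff≥0 b≤a)))
        where
        isRoot : ∀ {r} → eval (difference a b) r ≈ 0# → ComparisonRoot K y r
        isRoot e = k , k<K , u , v , w , a , b , eqa , eqb , d≉0 , e
        go : weight G x a < weight G x b → _ → ⊥
        -- Equality at the sample makes the sample itself a root inside the cell.
        go a<b (inj₂ 0≈) = stable y (isRoot (sym 0≈)) lo<y y<hi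
        go a<b (inj₁ dy>0) with intermediate (difference a b) {x} {y} (difference<0 x a b a<b) dy>0
        ... | r , inj₁ (x<r , r<y) , e = stable r (isRoot e) (above-trans lo lo<x x<r) (below-trans hi y<hi r<y)
        -- The root lies strictly left of `x`, hence strictly inside the cell even if `x` is its
        -- right end.
        ... | r , inj₂ (y<r , r<x) , e = stable r (isRoot e) (above-trans lo lo<y y<r) (atMost-below hi x≤hi r<x)

      split-walk : ∀ m {u v} (w : W u v) m′ → len w ℕ.≤ m ℕ.+ m′ →
                   ∃[ z ] Σ[ a ∈ W u z ] Σ[ b ∈ W z v ] len a ℕ.≤ m × len b ℕ.≤ m′ × w ≡ a ◅◅ b
      split-walk zero w m′ le = _ , ε , w , z≤n , le , ≡.refl
      split-walk (suc m) ε m′ le = _ , ε , ε , z≤n , z≤n , ≡.refl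
      split-walk (suc m) (e ◅ w) m′ (s≤s le) with split-walk m w m′ le
      ... | z , a , b , la , lb , ≡.refl = z , e ◅ a , b , s≤s la , lb , ≡.refl

      -- The walk is cut into two halves, and each is replaced by its table entry. At the sample
      -- point the new winner is no worse than the concatenation of the entries by construction, and
      -- at `x` by `transfer`.
      table-optimal : ∀ k → k ℕ.≤ K → ∀ {u v} (w : W u v) → len w ℕ.≤ 2 ℕ.^ k →
                      Σ[ f ∈ W u v ] table y k u v ≡ just f × weight G x f ≤ weight G x w
      table-optimal zero _ {u} ε _ with u Fin.≟ u
      ... | yes ≡.refl = ε , ≡.refl , ≤-refl refl
      ... | no u≢u = ⊥-elim (u≢u ≡.refl)
      table-optimal zero _ (e ◅ e′ ◅ w) (s≤s ())
      table-optimal zero _ {u} {v} ((p , eq) ◅ ε) _ with u Fin.≟ v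
      ... | yes ≡.refl with () ← ≡.trans (≡.sym eq) (loopless u)
      ... | no _ with edge-just (wt u v) ≡.refl eq
      ...   | _ , eq′ = _ , eq′ , ≤-refl refl
      table-optimal (suc k) k<K {u} {v} w le
        with split-walk (2 ℕ.^ k) w (2 ℕ.^ k) (ℕ.≤-trans le (ℕ.≤-reflexive (≡.cong (2 ℕ.^ k ℕ.+_) (ℕ.+-identityʳ _))))
      ... | z , a , b , la , lb , ≡.refl with table-optimal k (ℕ.<⇒≤ k<K) a la | table-optimal k (ℕ.<⇒≤ k<K) b lb
      ... | f , eqf , f≤a | g , eqg , g≤b = h , eqh , ≤-trans (transfer k<K {w = z} eqc eqh h≤)
              (≤-resp (sym (weight-◅◅ x f g)) (sym (weight-◅◅ x a b)) (+-mono-≤ f≤a g≤b))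
        where
        eqc : concat (table y k u z) (table y k z v) ≡ just (f ◅◅ g)
        eqc rewrite eqf | eqg = ≡.refl
        minimal = best-minimal y (table y k) u v n (toℕ z) (Fin.toℕ<n z) (≡.trans (candidate-toℕ (table y k) u v z) eqc)
        h = proj₁ minimal
        eqh = proj₁ (proj₂ minimal)
        h≤ = proj₂ (proj₂ minimal)

    shortest : ∀ K lo hi → NonEmpty lo hi → Stable K lo hi → n ℕ.≤ 2 ℕ.^ K → ∀ {s t} → Path G s t →
      Σ[ f ∈ W s t ] table (sample lo hi) K s t ≡ just f × Σ[ p ∈ W s t ] IsPath G p × Follows (next f) p ×
        (∀ x → NoNegativeCycle G x → Above lo x → AtMost hi x → IsShortestPath G x p)
    shortest K lo hi ne stable n≤2^K {s} {t} (p₀ , path₀)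
      -- Applied at the sample point only to learn that the entry for `s` and `t` is present, before
      -- any `x` is chosen.
      with table-optimal K lo hi ne stable (sample lo hi) (sample-above lo hi ne) (atMost hi (sample-below lo hi ne)) K ℕ.≤-refl p₀ (len≤ p₀ path₀)
      where
      atMost : ∀ hi {x} → Below hi x → AtMost hi x
      atMost nothing  _ = _
      atMost (just h) p = <⇒≤ p
      len≤ : ∀ {u v} (p : W u v) → IsPath G p → len p ℕ.≤ 2 ℕ.^ K
      len≤ p path = ℕ.≤-trans (ℕ.≤-trans (ℕ.n≤1+n _) (≡.subst (ℕ._≤ n) (vertices-len p) (path-length p path))) n≤2^K
    ... | f , eqf , _ with extract (len f) f ℕ.≤-refl (next f) (λ a b e → e)
    ... | p , path , follows , p≤f , _ = f , eqf , p , path , follows , λ x noneg lo<x x≤hi → path , λ p′ path′ →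
          ≤-trans (p≤f x noneg) (optimal x lo<x x≤hi p′ path′)
      where
      len≤ : ∀ {u v} (p : W u v) → IsPath G p → len p ℕ.≤ 2 ℕ.^ K
      len≤ p path = ℕ.≤-trans (ℕ.≤-trans (ℕ.n≤1+n _) (≡.subst (ℕ._≤ n) (vertices-len p) (path-length p path))) n≤2^K
      optimal : ∀ x → Above lo x → AtMost hi x → ∀ (p′ : W s t) → IsPath G p′ → weight G x f ≤ weight G x p′
      optimal x lo<x x≤hi p′ path′ with table-optimal K lo hi ne stable x lo<x x≤hi K ℕ.≤-refl p′ (len≤ p′ path′)
      ... | f′ , eqf′ , f′≤ with ≡.refl ← ≡.trans (≡.sym eqf) eqf′ = f′≤

  -- Counting breakpoints.

  length-concatMap : ∀ {a b} {A : Set a} {B : Set b} (f : A → List B) {m} → (∀ x → length (f x) ℕ.≤ m) →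
                     ∀ xs → length (concatMap f xs) ℕ.≤ length xs ℕ.* m
  length-concatMap f f≤m []       = z≤n
  length-concatMap f {m} f≤m (x ∷ xs) = ℕ.≤-trans (ℕ.≤-reflexive (List.length-++ (f x))) (ℕ.+-mono-≤ (f≤m x) (length-concatMap f f≤m xs))

  length-cartesianProductWith : ∀ {a b c} {A : Set a} {B : Set b} {C : Set c} (f : A → B → C) xs ys →
                                length (cartesianProductWith f xs ys) ≡ length xs ℕ.* length ys
  length-cartesianProductWith f [] ys = ≡.refl
  length-cartesianProductWith f (x ∷ xs) ys = ≡.trans (List.length-++ (map (f x) ys))
    (≡.cong₂ ℕ._+_ (List.length-map (f x) ys) (length-cartesianProductWith f xs ys))

  any-concatMap-allFin : ∀ {a p} {A : Set a} {P : A → Set p} {n} (f : Fin n → List A) i → Any P (f i) → Any P (concatMap f (allFin n))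
  any-concatMap-allFin f i p = Any.concatMap⁺ f (lose (∈-allFin i) p)

  count : ∀ {a p} {A : Set a} {P : A → Set p} → (∀ x → Dec (P x)) → List A → ℕ
  count P? [] = 0
  count P? (x ∷ xs) = (if does (P? x) then 1 else 0) ℕ.+ count P? xs

  count≤length : ∀ {a p} {A : Set a} {P : A → Set p} (P? : ∀ x → Dec (P x)) xs → count P? xs ℕ.≤ length xs
  count≤length P? [] = z≤n
  count≤length P? (x ∷ xs) with P? x
  ... | yes _ = s≤s (count≤length P? xs)
  ... | no _  = ℕ.m≤n⇒m≤1+n (count≤length P? xs)

  module _ {a p q} {A : Set a} {P : A → Set p} {Q : A → Set q} (P? : ∀ x → Dec (P x)) (Q? : ∀ x → Dec (Q x))
           (P⊆Q : ∀ x → P x → Q x) where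
    count-mono : ∀ xs → count P? xs ℕ.≤ count Q? xs
    count-mono [] = z≤n
    count-mono (x ∷ xs) with P? x | Q? x
    ... | yes _ | yes _ = s≤s (count-mono xs)
    ... | yes p | no ¬q = ⊥-elim (¬q (P⊆Q x p))
    ... | no _  | yes _ = ℕ.m≤n⇒m≤1+n (count-mono xs)
    ... | no _  | no _  = count-mono xs

    count-strict : ∀ {xs} → Any (λ x → Q x × ¬ P x) xs → count P? xs ℕ.< count Q? xs
    count-strict {x ∷ xs} (here (q , ¬p)) with P? x | Q? x
    ... | yes p | _     = ⊥-elim (¬p p)
    ... | no _  | yes _ = s≤s (count-mono xs)
    ... | no _  | no ¬q = ⊥-elim (¬q q)
    count-strict {x ∷ xs} (there i) with P? x | Q? x
    ... | yes _ | yes _ = s≤s (count-strict i)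
    ... | yes p | no ¬q = ⊥-elim (¬q (P⊆Q x p))
    ... | no _  | yes _ = ℕ.m≤n⇒m≤1+n (count-strict i)
    ... | no _  | no _  = count-strict i

  -- Although the sample point ranges over all reals, only boundedly many tables arise on each level, because the next
  -- table depends only on the position of the sample relative to the roots of the differences of all candidates.
  module Counting {c ℓ₁ ℓ₂} (ℝ : CompleteOrderedField c ℓ₁ ℓ₂) (F : RootFinder ℝ) {n q : ℕ} (G : Graphs.Graph ℝ n q) where
    open CompleteOrderedField ℝ hiding (zero)
    open OrderedField ℝ
    open Polynomials ℝ
    open RootFinder F
    open Graphs ℝ
    open Walks ℝ G

    rootsBetween : ∀ {u v} → Maybe (W u v) → Maybe (W u v) → List Carrier
    rootsBetween (just a) (just b) = roots (difference a b)
    rootsBetween _        _        = []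

    -- Unlike in the program, all pairs of middle vertices are compared, because the winner varies
    -- with the point. This gives `n^4` differences with at most `q` roots each.
    breakpoints : Table → List Carrier
    breakpoints τ = concatMap (λ u → concatMap (λ v → concatMap (λ w → concatMap (λ w′ →
      rootsBetween (concat (τ u w) (τ w v)) (concat (τ u w′) (τ w′ v))) (allFin n)) (allFin n)) (allFin n)) (allFin n)

    breakpoints-bound : ℕ
    breakpoints-bound = n ℕ.* (n ℕ.* (n ℕ.* (n ℕ.* q)))

    length-breakpoints : ∀ τ → length (breakpoints τ) ℕ.≤ breakpoints-bound
    length-breakpoints τ = over λ u → over λ v → over λ w → over λ w′ → bound (concat (τ u w) (τ w v)) (concat (τ u w′) (τ w′ v))
      where
      over : ∀ {f : Fin n → List Carrier} {m} → (∀ i → length (f i) ℕ.≤ m) → length (concatMap f (allFin n)) ℕ.≤ n ℕ.* m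
      over {f} {m} h = ℕ.≤-trans (length-concatMap f h (allFin n)) (ℕ.≤-reflexive (≡.cong (ℕ._* m) (List.length-tabulate (λ (i : Fin n) → i))))
      bound : ∀ {u v} (a b : Maybe (W u v)) → length (rootsBetween a b) ℕ.≤ q
      bound nothing  _        = z≤n
      bound (just a) nothing  = z≤n
      bound (just a) (just b) with zero⊎nonzero (difference a b)
      ... | inj₁ d≈0 rewrite roots-zero (difference a b) d≈0 = z≤n
      ... | inj₂ d≉0 = rootList-length (roots-nonzero (difference a b) d≉0) d≉0

    root∈breakpoints : ∀ τ {u v w w′ a b r} → concat (τ u w) (τ w v) ≡ just a → concat (τ u w′) (τ w′ v) ≡ just b →
      NonZero (difference a b) → eval (difference a b) r ≈ 0# → Any (r ≈_) (breakpoints τ)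
    root∈breakpoints τ {u} {v} {w} {w′} {a} {b} {r} eqa eqb d≉0 e =
      any-concatMap-allFin _ u (any-concatMap-allFin _ v (any-concatMap-allFin _ w (any-concatMap-allFin _ w′ inside)))
      where
      inside : Any (r ≈_) (rootsBetween (concat (τ u w) (τ w v)) (concat (τ u w′) (τ w′ v)))
      inside rewrite eqa | eqb = IsRootList.complete (roots-nonzero (difference a b) d≉0) r e

    SameSide : Carrier → Carrier → Carrier → Set (ℓ₁ ⊔ ℓ₂)
    SameSide y s r = (y < r → s < r) × (y ≈ r → s ≈ r) × (r < y → r < s)

    sameSide-sym : ∀ {y s r} → SameSide y s r → SameSide s y r
    sameSide-sym {y} {s} {r} (f , g , h) with compare y r
    ... | tri< y<r y≉r _ = (λ _ → y<r) , (λ s≈r → ⊥-elim (<-irrefl s≈r (f y<r))) , (λ r<s → ⊥-elim (<-asym r<s (f y<r)))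
    ... | tri≈ _ y≈r _ = (λ s<r → ⊥-elim (<-irrefl (g y≈r) s<r)) , (λ _ → y≈r) , (λ r<s → ⊥-elim (<-irrefl (sym (g y≈r)) r<s))
    ... | tri> _ _ r<y = (λ s<r → ⊥-elim (<-asym s<r (h r<y))) , (λ s≈r → ⊥-elim (<-irrefl (sym s≈r) (h r<y))) , (λ _ → r<y)

    ends : List Carrier → List (Maybe Carrier)
    ends ρ = nothing ∷ map just ρ

    -- One point for every possible position relative to the roots: the roots themselves and a
    -- sample between any two ends. Taking all pairs of ends instead of neighbouring ones avoids
    -- sorting and costs only a square.
    samples : List Carrier → List Carrier
    samples ρ = ρ ++ cartesianProductWith sample (ends ρ) (ends ρ)

    length-samples : ∀ ρ {m} → length ρ ℕ.≤ m → length (samples ρ) ℕ.≤ m ℕ.+ suc m ℕ.* suc m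
    length-samples ρ {m} ρ≤m = ℕ.≤-trans (ℕ.≤-reflexive (List.length-++ ρ)) (ℕ.+-mono-≤ ρ≤m
      (ℕ.≤-trans (ℕ.≤-reflexive (length-cartesianProductWith sample (ends ρ) (ends ρ))) (ℕ.*-mono-≤ ends≤ ends≤)))
      where ends≤ = s≤s (ℕ.≤-trans (ℕ.≤-reflexive (List.length-map just ρ)) ρ≤m)

    Reaches : (Carrier → Carrier → Set ℓ₂) → Maybe Carrier → Carrier → Set ℓ₂
    Reaches _≼_ nothing  r = Lift ℓ₂ ⊥
    Reaches _≼_ (just l) r = r ≼ l

    predecessor : ∀ ρ y → ∃[ lo ] lo ∈ ends ρ × Above lo y × All (λ r → r < y → Reaches _≤_ lo r) ρ
    predecessor [] y = nothing , here ≡.refl , _ , []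
    predecessor (r ∷ ρ) y with predecessor ρ y | r <? y
    ... | lo , lo∈ , lo<y , all | no r≮y = lo , weaken lo∈ , lo<y , (λ r<y → ⊥-elim (r≮y r<y)) ∷ all
      where
      weaken : ∀ {lo} → lo ∈ ends ρ → lo ∈ ends (r ∷ ρ)
      weaken (here e)   = here e
      weaken (there l∈) = there (there l∈)
    ... | nothing , lo∈ , lo<y , all | yes r<y = just r , there (here ≡.refl) , r<y , (λ _ → ≤-refl refl) ∷ All.map (λ f r<y → ⊥-elim (lower (f r<y))) all
    ... | just l , there lo∈ , lo<y , all | yes r<y with <⊎≥ l r
    ...   | inj₁ l<r = just r , there (here ≡.refl) , r<y , (λ _ → ≤-refl refl) ∷ All.map (λ f r<y → ≤-trans (f r<y) (<⇒≤ l<r)) all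
    ...   | inj₂ r≤l = just l , there (there lo∈) , lo<y , (λ _ → r≤l) ∷ all

    successor : ∀ ρ y → ∃[ hi ] hi ∈ ends ρ × Below hi y × All (λ r → y < r → Reaches (λ r h → h ≤ r) hi r) ρ
    successor [] y = nothing , here ≡.refl , _ , []
    successor (r ∷ ρ) y with successor ρ y | y <? r
    ... | hi , hi∈ , y<hi , all | no y≮r = hi , weaken hi∈ , y<hi , (λ y<r → ⊥-elim (y≮r y<r)) ∷ all
      where
      weaken : ∀ {hi} → hi ∈ ends ρ → hi ∈ ends (r ∷ ρ)
      weaken (here e)   = here e
      weaken (there h∈) = there (there h∈)
    ... | nothing , hi∈ , y<hi , all | yes y<r = just r , there (here ≡.refl) , y<r , (λ _ → ≤-refl refl) ∷ All.map (λ f y<r → ⊥-elim (lower (f y<r))) all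
    ... | just h , there hi∈ , y<hi , all | yes y<r with <⊎≥ r h
    ...   | inj₁ r<h = just r , there (here ≡.refl) , y<r , (λ _ → ≤-refl refl) ∷ All.map (λ f y<r → ≤-trans (<⇒≤ r<h) (f y<r)) all
    ...   | inj₂ h≤r = just h , there (there hi∈) , y<hi , (λ _ → h≤r) ∷ all

    samples-cover : ∀ ρ y → ∃[ s ] s ∈ samples ρ × All (SameSide y s) ρ
    samples-cover ρ y with Any.any? (λ r → y ≈? r) ρ
      where
      _≈?_ : ∀ a b → Dec (a ≈ b)
      a ≈? b with compare a b
      ... | tri< _ a≉b _ = no a≉b
      ... | tri≈ _ a≈b _ = yes a≈b
      ... | tri> _ a≉b _ = no a≉b
    ... | yes y∈ with find y∈
    ...   | s , s∈ , y≈s = s , ∈-++⁺ˡ s∈ , All.universal (λ r → <-resp y≈s refl , trans (sym y≈s) , <-resp refl y≈s) ρ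
    samples-cover ρ y | no y∉ with predecessor ρ y | successor ρ y
    ... | lo , lo∈ , lo<y , lo-max | hi , hi∈ , y<hi , hi-min =
      sample lo hi , ∈-++⁺ʳ ρ (∈-cartesianProductWith⁺ sample lo∈ hi∈) , All.zipWith side (All.zip (lo-max , hi-min) , ¬Any⇒All¬ ρ y∉)
      where
      open import Data.List.Relation.Unary.All.Properties using (¬Any⇒All¬)
      nonEmpty : ∀ lo → Above lo y → NonEmpty lo hi
      nonEmpty nothing  _   = _
      nonEmpty (just l) l<y = below-trans hi y<hi l<y
      ne = nonEmpty lo lo<y
      up : ∀ lo {x r} → Above lo x → Reaches _≤_ lo r → r < x
      up (just l) l<x r≤l = ≤-<-trans r≤l l<x
      down : ∀ hi {x r} → Below hi x → Reaches (λ r h → h ≤ r) hi r → x < r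
      down (just h) x<h h≤r = <-≤-trans x<h h≤r
      side : ∀ {r} → ((r < y → Reaches _≤_ lo r) × (y < r → Reaches (λ r h → h ≤ r) hi r)) × ¬ (y ≈ r) → SameSide y (sample lo hi) r
      side ((f , g) , y≉r) = (λ y<r → down hi (sample-below lo hi ne) (g y<r)) , (λ y≈r → ⊥-elim (y≉r y≈r)) ,
                             (λ r<y → up lo (sample-above lo hi ne) (f r<y))

    candidate-index : ∀ τ u v i {a} → candidate τ u v i ≡ just a → ∃[ w ] concat (τ u w) (τ w v) ≡ just a
    candidate-index τ u v i eq with i ℕ.<? n
    ... | yes i<n = fromℕ< i<n , eq

    sameSide-resp : ∀ {y s r r′} → r′ ≈ r → SameSide y s r → SameSide y s r′
    sameSide-resp r′≈r (f , g , h) = (λ p → <-resp refl (sym r′≈r) (f (<-resp refl r′≈r p))) , (λ p → trans (g (trans p r′≈r)) (sym r′≈r)) ,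
                                     (λ p → <-resp (sym r′≈r) refl (h (<-resp r′≈r refl p)))

    -- A strict order that holds at `y` and fails at `s` would produce a root of the difference that
    -- separates the two points or meets just one of them.
    compare-same : ∀ τ {u v w w′ a b y s} → concat (τ u w) (τ w v) ≡ just a → concat (τ u w′) (τ w′ v) ≡ just b →
      All (SameSide y s) (breakpoints τ) → weight G y a < weight G y b → weight G s a < weight G s b
    compare-same τ {u} {v} {w} {w′} {a} {b} {y} {s} eqa eqb same a<b = difference<0⁻¹ s a b (go (zero⊎nonzero d) (compare (eval d s) 0#))
      where
      d = difference a b
      dy<0 = difference<0 y a b a<b
      side : NonZero d → ∀ {r} → eval d r ≈ 0# → SameSide y s r
      side d≉0 {r} e with find (root∈breakpoints τ {w = w} {w′} eqa eqb d≉0 e)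
      ... | r′ , r′∈ , r≈r′ = sameSide-resp r≈r′ (All.lookup same r′∈)
      go : (∀ i → d i ≈ 0#) ⊎ NonZero d → Tri (eval d s < 0#) (eval d s ≈ 0#) (0# < eval d s) → eval d s < 0#
      go (inj₁ d≈0) _ = ⊥-elim (<-irrefl (eval-0 d y d≈0) dy<0)
      go (inj₂ d≉0) (tri< lt _ _) = lt
      -- If `s` is a root, then `y` agrees with it, against strictness at `y`.
      go (inj₂ d≉0) (tri≈ _ e _) = ⊥-elim (<-irrefl (trans (eval-cong {p = d} (λ _ → refl) (proj₁ (proj₂ (sameSide-sym (side d≉0 e))) refl)) e) dy<0)
      go (inj₂ d≉0) (tri> _ _ gt) with intermediate d dy<0 gt
      ... | r , inj₁ (y<r , r<s) , e = ⊥-elim (<-asym r<s (proj₁ (side d≉0 e) y<r))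
      ... | r , inj₂ (s<r , r<y) , e = ⊥-elim (<-asym s<r (proj₂ (proj₂ (side d≉0 e)) r<y))

    step-same : ∀ τ {y s} → All (SameSide y s) (breakpoints τ) → ∀ u v i → best y τ u v i ≡ best s τ u v i
    step-same τ same u v zero = ≡.refl
    step-same τ {y} {s} same u v (suc i) rewrite ≡.sym (step-same τ same u v i)
      with best y τ u v i in eqa | candidate τ u v i in eqb
    ... | nothing | m       = ≡.refl
    ... | just a  | nothing = ≡.refl
    ... | just a  | just b with candidate-index τ u v i eqb | best-candidate y τ u v i eqa
    ...   | w , eqb′ | j , eqa′ with candidate-index τ u v j eqa′
    ...     | w′ , eqa″ with weight G y b <? weight G y a | weight G s b <? weight G s a
    ...       | yes _ | yes _ = ≡.refl
    ...       | no _  | no _  = ≡.refl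
    ...       | yes lt | no ≮ = ⊥-elim (≮ (compare-same τ {w = w} {w′} eqb′ eqa″ same lt))
    ...       | no ≮ | yes lt = ⊥-elim (≮ (compare-same τ {w = w} {w′} eqb′ eqa″ (All.map sameSide-sym same) lt))

    candidate-cong : ∀ {τ τ′ : Table} → (∀ u v → τ u v ≡ τ′ u v) → ∀ u v i → candidate τ u v i ≡ candidate τ′ u v i
    candidate-cong eq u v i with i ℕ.<? n
    ... | yes i<n = ≡.cong₂ concat (eq _ _) (eq _ _)
    ... | no _    = ≡.refl

    best-cong : ∀ y {τ τ′ : Table} → (∀ u v → τ u v ≡ τ′ u v) → ∀ u v i → best y τ u v i ≡ best y τ′ u v i
    best-cong y eq u v zero    = ≡.refl
    best-cong y eq u v (suc i) = ≡.cong₂ (better y) (best-cong y eq u v i) (candidate-cong eq u v i)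

    -- The tables that can follow `τ` for any sample point, since the step depends only on the
    -- position relative to its breakpoints.
    successors : Table → List Table
    successors τ = map (λ s → step s τ) (samples (breakpoints τ))

    tables : ℕ → List Table
    tables zero    = table₀ ∷ []
    tables (suc k) = concatMap successors (tables k)

    tables-cover : ∀ y k → ∃[ τ ] τ ∈ tables k × (∀ u v → table y k u v ≡ τ u v)
    tables-cover y zero = table₀ , here ≡.refl , λ u v → ≡.refl
    tables-cover y (suc k) with tables-cover y k
    ... | τ , τ∈ , eq with samples-cover (breakpoints τ) y
    ... | s , s∈ , same = step s τ , ∈-concatMap⁺ successors (lose τ∈ (∈-map⁺ (λ s → step s τ) s∈)) ,
          λ u v → ≡.trans (best-cong y eq u v n) (step-same τ same u v n)

    allBreakpoints : ℕ → List Carrier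
    allBreakpoints zero    = []
    allBreakpoints (suc k) = concatMap breakpoints (tables k) ++ allBreakpoints k

    module _ {m f : ℕ} (bound : breakpoints-bound ℕ.≤ m) (m+[1+m]²≤f : m ℕ.+ suc m ℕ.* suc m ℕ.≤ f) where
      length-tables : ∀ k → length (tables k) ℕ.≤ f ℕ.^ k
      length-tables zero    = ℕ.≤-refl
      length-tables (suc k) = ℕ.≤-trans (length-concatMap successors (λ τ → ℕ.≤-trans (ℕ.≤-reflexive (List.length-map _ (samples (breakpoints τ))))
          (ℕ.≤-trans (length-samples (breakpoints τ) (ℕ.≤-trans (length-breakpoints τ) bound)) m+[1+m]²≤f)) (tables k))
        (ℕ.≤-trans (ℕ.*-monoˡ-≤ f (length-tables k)) (ℕ.≤-reflexive (ℕ.*-comm (f ℕ.^ k) f)))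

      -- Strictness makes the induction close: `f^k m` new roots, the old ones and one more are at
      -- most `f^k (m + 1)`, which is at most `f^(k+1)`.
      length-allBreakpoints : ∀ k → length (allBreakpoints k) ℕ.< f ℕ.^ k
      length-allBreakpoints zero    = s≤s z≤n
      length-allBreakpoints (suc k) = ℕ.≤-trans (s≤s (ℕ.≤-trans (ℕ.≤-reflexive (List.length-++ (concatMap breakpoints (tables k))))
          (ℕ.+-monoˡ-≤ _ (ℕ.≤-trans (length-concatMap breakpoints length-breakpoints (tables k)) (ℕ.*-mono-≤ (length-tables k) bound)))))
        (ℕ.≤-trans (ℕ.≤-reflexive (≡.sym (ℕ.+-suc _ _))) (ℕ.≤-trans (ℕ.+-monoʳ-≤ (f ℕ.^ k ℕ.* m) (length-allBreakpoints k))
          (ℕ.≤-trans (ℕ.≤-reflexive (≡.trans (ℕ.+-comm _ (f ℕ.^ k)) (≡.sym (ℕ.*-suc (f ℕ.^ k) m)))) (ℕ.≤-trans (ℕ.*-monoʳ-≤ (f ℕ.^ k) 1+m≤f) (ℕ.≤-reflexive (ℕ.*-comm (f ℕ.^ k) f))))))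
        where
        1+m≤f : suc m ℕ.≤ f
        1+m≤f = ℕ.≤-trans (ℕ.m≤m*n (suc m) (suc m)) (ℕ.≤-trans (ℕ.m≤n+m _ m) m+[1+m]²≤f)

    -- The winner is one of the candidates, so its difference with another candidate is among the
    -- pairs counted. The list is the same for all sample points and can therefore measure the
    -- progress of the whole sweep.
    comparisonRoot∈ : ∀ K {y r} → ComparisonRoot K y r → Any (r ≈_) (allBreakpoints K)
    comparisonRoot∈ (suc K) {y} {r} (k , k<K , u , v , w , a , b , eqa , eqb , d≉0 , e) with ℕ.m≤n⇒m<n∨m≡n (ℕ.≤-pred k<K)
    ... | inj₁ k<K′ = Any.++⁺ʳ (concatMap breakpoints (tables K)) (comparisonRoot∈ K (k , k<K′ , u , v , w , a , b , eqa , eqb , d≉0 , e))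
    ... | inj₂ ≡.refl with tables-cover y k | best-candidate y (table y k) u v n eqb
    ... | τ , τ∈ , eq | j , eqj with candidate-index (table y k) u v j eqj
    ... | w′ , eqb′ = Any.++⁺ˡ (Any.concatMap⁺ breakpoints (lose τ∈ (root∈breakpoints τ {w = w} {w′} (same w eqa) (same w′ eqb′) d≉0 e)))
      where
      same : ∀ w {a} → concat (table y k u w) (table y k w v) ≡ just a → concat (τ u w) (τ w v) ≡ just a
      same w eq′ = ≡.trans (≡.sym (≡.cong₂ concat (eq u w) (eq w v))) eq′

    above? : ∀ lo x → Dec (Above lo x)
    above? nothing  x = yes _
    above? (just l) x = l <? x

    below? : ∀ hi x → Dec (Below hi x)
    below? nothing  x = yes _
    below? (just h) x = x <? h

    -- The two measures of progress: `ahead` drops from cell to cell, `behind` from one refinement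
    -- of a cell to the next.
    ahead : List Carrier → Maybe Carrier → ℕ
    ahead R lo = count (above? lo) R

    behind : List Carrier → Maybe Carrier → ℕ
    behind R hi = count (below? hi) R

    ahead-decreases : ∀ {R} lo {r} → Any (r ≈_) R → Above lo r → ahead R (just r) ℕ.< ahead R lo
    ahead-decreases lo {r} r∈ lo<r = count-strict (above? (just r)) (above? lo) (λ x r<x → above-trans lo lo<r r<x)
      (Any.map (λ r≈x → resp lo r≈x lo<r , <-irrefl r≈x) r∈)
      where
      resp : ∀ lo {x y} → x ≈ y → Above lo x → Above lo y
      resp nothing  _ _ = _
      resp (just l) x≈y l<x = <-resp refl x≈y l<x

    behind-decreases : ∀ {R} hi {r} → Any (r ≈_) R → Below hi r → behind R (just r) ℕ.< behind R hi
    behind-decreases hi {r} r∈ r<hi = count-strict (below? (just r)) (below? hi) (λ x x<r → below-trans hi r<hi x<r)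
      (Any.map (λ r≈x → resp hi r≈x r<hi , <-irrefl (sym r≈x)) r∈)
      where
      resp : ∀ hi {x y} → x ≈ y → Below hi x → Below hi y
      resp nothing  _ _ = _
      resp (just h) x≈y x<h = <-resp x≈y refl x<h

open ShortestWalks

-- The preprocessing program and its verification.

module Programming where
  open import Level using (_⊔_; Lift; lift; lower)
  open import Data.Bool.Base using (false; if_then_else_)
  open import Data.Fin.Base using (Fin; zero; suc; toℕ; fromℕ<)
  open import Data.Fin using (#_)
  import Data.Fin.Properties as Fin
  open import Data.List.Base using (List; []; _∷_; length; lookup; map; _++_; _∷ʳ_)
  open import Data.Nat.Base hiding (_⊔_; NonZero)
  open import Data.Nat.Properties as ℕ using (_≟_; _<?_)
  open import Data.Product.Base using (∃-syntax; _×_; _,_; proj₁; proj₂)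
  open import Data.Sum.Base using (_⊎_; inj₁; inj₂)
  open import Data.Empty using (⊥; ⊥-elim)
  open import Function.Base using (_∘_)
  open import Data.Unit.Base using (⊤; tt)
  open import Relation.Binary.PropositionalEquality using (_≡_; _≢_; refl; sym; trans; cong; cong₂; subst; subst₂)
  open import Relation.Nullary using (¬_; Dec; yes; no; does)
  open import Data.Maybe.Base using (Maybe; just; nothing; maybe′; _<∣>_)
  open import Relation.Binary.Construct.Closure.ReflexiveTransitive using (ε; _◅_; _◅◅_)
  open import Relation.Nullary.Decidable using (dec-true; dec-false)
  import Data.List.Properties as List
  open import Data.List.Relation.Unary.Any as Any using (Any)
  import Data.List.Relation.Unary.Any.Properties as Any
  open import Data.List.Relation.Unary.All as All using (All; []; _∷_)
  open import Data.List.Membership.Propositional.Properties using (∈-lookup)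

  -- The preprocessing program.  Variables 0-4 hold 0, 1, s, t and the number K of doubling steps.
  module Preprocessing where

    private
      z : ∀ {d} → Fin (suc d)
      z = zero

    -- Arrays of integers: is there a walk; does it leave the vertex a; where does it go after its last visit of a.
    exists follows next′ output : ∀ {d} → (i j k l : Fin d) → Ref d
    exists  = ref (# 0)
    follows = ref (# 1)
    next′   = ref (# 2)
    output  = ref (# 3)

    current finished hiFlag loFlag : ∀ {d} → Ref (suc d)
    current  = ref (# 4) z z z z
    finished = ref (# 5) z z z z
    hiFlag   = ref (# 6) z z z z
    loFlag   = ref (# 7) z z z z

    -- Real arrays are numbered independently of integer ones. The coefficients describe the walk
    -- itself, while `value` is its weight at the current sample point.
    coeffs value : ∀ {d} → (i j k l : Fin d) → Ref d
    coeffs = ref (# 0)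
    value  = ref (# 1)

    powers diffs rootCells breaks : ∀ {d} → Fin (suc d) → Ref (suc d)
    powers    = ref (# 2) z z z
    diffs     = ref (# 4) z z z
    rootCells = ref (# 5) z z z
    breaks    = ref (# 9) z z z

    temp point hi lo one′ two′ : ∀ {d} → Ref (suc d)
    temp  = ref (# 3) z z z z
    point = ref (# 6) z z z z
    hi    = ref (# 7) z z z z
    lo    = ref (# 8) z z z z
    one′  = ref (# 10) z z z z
    two′  = ref (# 11) z z z z

    -- The language only tests `<`, so equality appears as two failed tests. A walk of one edge
    -- leaves its first vertex only, and the empty walk on the diagonal leaves none. The entry is
    -- written even for a pair without edge, where `exists` is zero and hides it.
    loadNext : Cmd 8
    loadNext = setI (next′ z (# 5) (# 6) (# 7)) (# 6) ⨾
      ifI (# 7) (# 5) no-edge (ifI (# 5) (# 7) no-edge (ifI (# 5) (# 6) edge (ifI (# 6) (# 5) edge no-edge)))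
      where
      edge no-edge : Cmd 8
      edge    = setI (follows z (# 5) (# 6) (# 7)) (# 1)
      no-edge = setI (follows z (# 5) (# 6) (# 7)) (# 0)

    loadCoeff : Cmd 8
    loadCoeff = coefR (coeffs z (# 5) (# 6) (# 7)) (# 5) (# 6) (# 7)

    loadExists : Cmd 7
    loadExists = adjI (# 5) (# 6) (ifI (# 5) (# 6) (set (# 7)) (ifI (# 6) (# 5) (set (# 7)) (set (# 1))))
      where
      set : Fin 8 → Cmd 8
      set = setI (exists z (# 5) (# 6) z)

    loadPair : Cmd 7
    loadPair = loadExists ⨾ loop vertexPar loadNext ⨾ loop widthPar loadCoeff

    load : Cmd 5
    load = loop vertexPar (loop vertexPar loadPair)

    -- From here on, variable 5 is the number of the cell and 6 counts refinements.

    setPoint : Cmd 7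
    setPoint = oneR one′ ⨾ getI loFlag (getI hiFlag
      (ifI z (# 7) (ifI z (# 8) (opR add point lo hi ⨾ opR add two′ one′ one′ ⨾ opR div point point two′) (opR add point lo one′))
                   (ifI z (# 8) (opR sub point hi one′) (zeroR point))))

    power : Cmd 8
    power = ifI z (# 7) (decr (# 7) (opR mul (powers (# 7)) (powers (# 8)) point)) (oneR (powers (# 7)))

    addTerm : Cmd 10
    addTerm = opR mul temp (coeffs z (# 7) (# 8) (# 9)) (powers (# 9)) ⨾
              opR add (value z (# 7) (# 8) z) (value z (# 7) (# 8) z) temp

    evaluate : Cmd 9
    evaluate = zeroR (value z (# 7) (# 8) z) ⨾ loop widthPar addTerm

    -- `improveNext` carries out `next-◅◅`: the second half has priority, and the first half is
    -- consulted where the second does not leave the vertex.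
    improveCoeff improveNext : Cmd 16
    improveCoeff = opR add (coeffs (# 7) (# 9) (# 10) (# 15)) (coeffs (# 8) (# 9) (# 11) (# 15)) (coeffs (# 8) (# 11) (# 10) (# 15))
    improveNext = getI (follows (# 8) (# 11) (# 10) (# 15))
      (ifI z (# 16)
        (getI (next′ (# 8) (# 11) (# 10) (# 15)) (setI (next′ (# 7) (# 9) (# 10) (# 15)) (# 17) ⨾ setI (follows (# 7) (# 9) (# 10) (# 15)) (# 1)))
        (getI (next′ (# 8) (# 9) (# 11) (# 15)) (getI (follows (# 8) (# 9) (# 11) (# 15))
          (setI (next′ (# 7) (# 9) (# 10) (# 15)) (# 17) ⨾ setI (follows (# 7) (# 9) (# 10) (# 15)) (# 18)))))

    -- Level 7 is built from level 8 = level 7 - 1, for the vertices 9 and 10 by way of 11.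
    improve : Cmd 15
    improve = setI (exists (# 7) (# 9) (# 10) z) (# 1) ⨾ copyR (value (# 7) (# 9) (# 10) z) temp ⨾
              loop widthPar improveCoeff ⨾ loop vertexPar improveNext

    relax : Cmd 12
    relax = getI (exists (# 8) (# 9) (# 11) z) (ifI z (# 12) (getI (exists (# 8) (# 11) (# 10) z) (ifI z (# 13)
      (opR add temp (value (# 8) (# 9) (# 11) z) (value (# 8) (# 11) (# 10) z) ⨾
       getI (exists (# 7) (# 9) (# 10) z) (ifI z (# 14) (ifR temp (value (# 7) (# 9) (# 10) z) improve skip) improve)) skip)) skip)

    fillPair : Cmd 11
    fillPair = setI (exists (# 7) (# 9) (# 10) z) z ⨾ loop vertexPar relax

    fillLevel : Cmd 8
    fillLevel = ifI z (# 7) (decr (# 7) (loop vertexPar (loop vertexPar fillPair))) skip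

    fill : Cmd 7
    fill = loop widthPar power ⨾ loop vertexPar (loop vertexPar evaluate) ⨾ loop levelPar fillLevel

    lower′ : Cmd 18
    lower′ = copyR hi (rootCells (# 15)) ⨾ setI hiFlag (# 1)

    considerHi : Cmd 17
    considerHi = getI hiFlag (ifI z (# 17) (ifR (rootCells (# 15)) hi lower′ skip) lower′)

    -- Loops have fixed lengths, here `q + 1`, so the index is first compared with the number of
    -- roots found. Then only a root strictly inside the current interval becomes its right end.
    consider : Cmd 16
    consider = ifI (# 15) (# 14) (getI loFlag (ifI z (# 16) (ifR lo (rootCells (# 15)) considerHi skip) considerHi)) skip

    subtract : Cmd 15
    subtract = opR add temp (coeffs (# 8) (# 9) (# 11) (# 14)) (coeffs (# 8) (# 11) (# 10) (# 14)) ⨾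
               opR sub (diffs (# 14)) temp (coeffs (# 7) (# 9) (# 10) (# 14))

    compareVia : Cmd 12
    compareVia = getI (exists (# 8) (# 9) (# 11) z) (ifI z (# 12) (getI (exists (# 8) (# 11) (# 10) z) (ifI z (# 13)
      (loop widthPar subtract ⨾ rootsR (# 5) (# 4) (loop widthPar consider)) skip)) skip)

    compareLevel : Cmd 8
    compareLevel = ifI z (# 7) (decr (# 7) (loop vertexPar (loop vertexPar (loop vertexPar compareVia)))) skip

    compareAll : Cmd 7
    compareAll = loop levelPar compareLevel

    refine : Cmd 7
    refine = setPoint ⨾ fill ⨾ compareAll

    advance : Cmd 10
    advance = getI (next′ (# 4) (# 2) (# 3) (# 9)) (setI current (# 10))

    -- The loop counter is both the position of the current vertex and the number of vertices so
    -- far, so the length in position 0 is rewritten every time and is right at the end.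
    emit : Cmd 10
    emit = setI (output z z (# 5) (# 7)) (# 9) ⨾ setI (output z z (# 5) z) (# 7) ⨾
           ifI (# 9) (# 3) advance (ifI (# 3) (# 9) advance (setI finished (# 1)))

    emitNext : Cmd 8
    emitNext = ifI z (# 7) (getI finished (ifI z (# 8) skip (getI current emit))) skip

    emitPath : Cmd 7
    emitPath = setI current (# 2) ⨾ setI finished z ⨾ loop lengthPar emitNext

    raise : Cmd 7
    raise = ifI z (# 6) (copyR lo hi ⨾ setI loFlag (# 1)) skip

    -- The break is stored after `raise`, so it is the right end of the cell if there is one.
    -- Otherwise it is the unchanged left end, and the remaining rounds repeat this last cell.
    cell : Cmd 6
    cell = setI hiFlag z ⨾ loop boundPar refine ⨾ getI hiFlag (setPoint ⨾ fill ⨾ emitPath) ⨾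
           getI hiFlag raise ⨾ copyR (breaks (# 5)) lo

    main : Cmd 5
    main = load ⨾ setI loFlag z ⨾ zeroR lo ⨾ loop boundPar cell

  -- Proof rules for commands.

  module Rules {c ℓ₁ ℓ₂} (ℝ : CompleteOrderedField c ℓ₁ ℓ₂) (F : RootFinder ℝ)
      (n q K B : ℕ) (adjacent : ℕ → ℕ → ℕ)
      (coefficient : ℕ → ℕ → ℕ → CompleteOrderedField.Carrier ℝ) where
    open CompleteOrderedField ℝ using (Carrier)
    open Semantics ℝ F n q K B adjacent coefficient

    -- Finer than the frame by array names: single locations are described, so the treatment of one
    -- table entry is seen to leave the other entries of the same array alone.
    Touches : ∀ {d} → Cmd d → Env → (TI TR : Loc → Set) → Set
    Touches skip ρ TI TR = ⊤
    Touches (c ⨾ c′) ρ TI TR = Touches c ρ TI TR × Touches c′ ρ TI TR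
    Touches (setI x v) ρ TI TR = TI (at′ x ρ)
    Touches {d} (getI x c) ρ TI TR = ∀ v → Touches c (ρ [ d ≔ v ]) TI TR
    Touches {d} (decr x c) ρ TI TR = ∀ v → Touches c (ρ [ d ≔ v ]) TI TR
    Touches {d} (adjI _ _ c) ρ TI TR = ∀ v → Touches c (ρ [ d ≔ v ]) TI TR
    Touches {d} (loop p c) ρ TI TR = ∀ v → Touches c (ρ [ d ≔ v ]) TI TR
    Touches (ifI _ _ c c′) ρ TI TR = Touches c ρ TI TR × Touches c′ ρ TI TR
    Touches (ifR _ _ c c′) ρ TI TR = Touches c ρ TI TR × Touches c′ ρ TI TR
    Touches (zeroR x) ρ TI TR = TR (at′ x ρ)
    Touches (oneR x) ρ TI TR = TR (at′ x ρ)
    Touches (copyR x _) ρ TI TR = TR (at′ x ρ)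
    Touches (opR _ x _ _) ρ TI TR = TR (at′ x ρ)
    Touches (coefR x _ _ _) ρ TI TR = TR (at′ x ρ)
    Touches {d} (rootsR dst _ c) ρ TI TR = (∀ l → TR (loc (toℕ dst) 0 0 0 l)) × (∀ v → Touches c (ρ [ d ≔ v ]) TI TR)

    Same : (TI TR : Loc → Set) → Mem → Mem → Set c
    Same TI TR g g′ = (∀ x → ¬ TI x → I g′ x ≡ I g x) × (∀ x → ¬ TR x → R g′ x ≡ R g x)

    same-refl : ∀ {TI TR} g → Same TI TR g g
    same-refl g = (λ _ _ → refl) , (λ _ _ → refl)

    same-trans : ∀ {TI TR g g′ g″} → Same TI TR g g′ → Same TI TR g′ g″ → Same TI TR g g″
    same-trans (p , r) (p′ , r′) = (λ x t → trans (p′ x t) (p x t)) , (λ x t → trans (r′ x t) (r x t))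

    module _ {TI TR : Loc → Set} where
      private
        S = Same TI TR

        sameI : ∀ g x v → TI x → S g (writeI x v g)
        sameI g x v t = (λ y ¬t → update-other (I g) (λ { refl → ¬t t })) , (λ _ _ → refl)

        sameR : ∀ g x v → TR x → S g (writeR x v g)
        sameR g x v t = (λ _ _ → refl) , (λ y ¬t → update-other (R g) (λ { refl → ¬t t }))

        same-updates : ∀ m a l vs y → (∀ l → TR (loc a 0 0 0 l)) → ¬ TR y → updates {A = Carrier} m a l vs y ≡ m y
        same-updates m a l [] y t ¬t = refl
        same-updates m a l (v ∷ vs) y t ¬t = trans (update-other (updates m a (suc l) vs) (λ { refl → ¬t (t l) })) (same-updates m a (suc l) vs y t ¬t)

        weaken : ∀ {d ρ} {Q : Mem → Set ℓ} (c : Cmd d) {g g′} → S g g′ → wp c ρ (λ h → Q h × S g′ h) g′ → wp c ρ (λ h → Q h × S g h) g′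
        weaken {ρ = ρ} c s p = wp-mono c ρ (λ h (q , s′) → q , same-trans s s′) _ p

        iterate-touch : ∀ {f : ℕ → (Mem → Set ℓ) → Mem → Set ℓ} →
          (∀ i {Q Q′} → (∀ g → Q g → Q′ g) → ∀ g → f i Q g → f i Q′ g) →
          (∀ i {Q} g → f i Q g → f i (λ g′ → Q g′ × S g g′) g) →
          ∀ r i {Q} g → iterate f r i Q g → iterate f r i (λ g′ → Q g′ × S g g′) g
        iterate-touch f↗ h zero    i g p = p , same-refl g
        iterate-touch f↗ h (suc r) i g p = f↗ i (λ g′ (p′ , s) → iterate-mono f↗ r (suc i) (λ h (q , s′) → q , same-trans s s′) g′ (iterate-touch f↗ h r (suc i) g′ p′)) g (h i g p)

      wp-touch : ∀ {d} (c : Cmd d) ρ {Q : Mem → Set ℓ} → Touches c ρ TI TR → ∀ g → wp c ρ Q g → wp c ρ (λ g′ → Q g′ × S g g′) g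
      wp-touch skip ρ t g p = p , same-refl g
      wp-touch (c ⨾ c′) ρ {Q} (t , t′) g p =
        wp-mono c ρ (λ g′ (p′ , s) → weaken {Q = Q} c′ s (wp-touch c′ ρ t′ g′ p′)) g (wp-touch c ρ t g p)
      wp-touch (setI x v) ρ t g p = p , sameI g (at′ x ρ) _ t
      wp-touch (getI x c) ρ t g p = wp-touch c _ (t _) g p
      wp-touch (decr v c) ρ t g p = wp-touch c _ (t _) g p
      wp-touch (adjI u v c) ρ t g (a , b , p) = a , b , wp-touch c _ (t _) g p
      wp-touch {d} (loop p c) ρ t g h = iterate-touch (λ i → wp-mono c (ρ [ d ≔ i ])) (λ i → wp-touch c (ρ [ d ≔ i ]) (t i)) (par p) 0 g h
      wp-touch (ifI a b c c′) ρ (t , t′) g (p , p′) = wp-touch c ρ t g ∘ p , wp-touch c′ ρ t′ g ∘ p′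
      wp-touch (ifR x y c c′) ρ (t , t′) g (p , p′) = wp-touch c ρ t g ∘ p , wp-touch c′ ρ t′ g ∘ p′
      wp-touch (zeroR x) ρ t g p = p , sameR g (at′ x ρ) _ t
      wp-touch (oneR x) ρ t g p = p , sameR g (at′ x ρ) _ t
      wp-touch (copyR x y) ρ t g p = p , sameR g (at′ x ρ) _ t
      wp-touch (opR ∙ x y z) ρ t g p = p , sameR g (at′ x ρ) _ t
      wp-touch (coefR x u v l) ρ t g (a , b , e , p) = a , b , e , p , sameR g (at′ x ρ) _ t
      wp-touch (rootsR dst src c) ρ {Q} (t , t′) g h rs rs-ok len =
        weaken {Q = Q} c ((λ _ _ → refl) , (λ y ¬t → same-updates (R g) (toℕ dst) 0 rs y t ¬t)) (wp-touch c _ (t′ _) _ (h rs rs-ok len))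

    -- Iterations of a loop that establish Q one after the other, preserving what earlier ones established.
    wp-each : ∀ {d} {o} p (c : Cmd (suc d)) ρ {g} (J : Mem → Set ℓ) (Q : Fin (par p) → Mem → Set ℓ) → J g →
      (∀ w g → J g → wp c (ρ [ d ≔ toℕ w ]) (λ g′ → J g′ × Q w g′ × (∀ w′ → w′ ≢ w → Q w′ g → Q w′ g′)) g) →
      wp (loop {d} {o} p c) ρ (λ g′ → J g′ × (∀ w → Q w g′)) g
    wp-each {d} {o} p c ρ J Q j₀ step = wp-loop {d} {o} p c ρ (λ i g → J g × (∀ w → toℕ w < i → Q w g)) (j₀ , λ _ ()) body
        (λ g (j , all) → j , λ w → all w (Fin.toℕ<n w))
      where
      body : ∀ i g → i < par p → J g × (∀ w → toℕ w < i → Q w g) → wp c (ρ [ d ≔ i ]) (λ g′ → J g′ × (∀ w → toℕ w < suc i → Q w g′)) g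
      body i g i<p (j , all) = subst (λ i → wp c (ρ [ d ≔ i ]) (λ g′ → J g′ × (∀ w → toℕ w < suc i → Q w g′)) g) (Fin.toℕ-fromℕ< i<p)
        (wp-mono c _ (λ g′ (j′ , qw , keep) → j′ , extend g′ qw keep) g (step w₀ g j))
        where
        w₀ = fromℕ< i<p
        extend : ∀ g′ → Q w₀ g′ → (∀ w′ → w′ ≢ w₀ → Q w′ g → Q w′ g′) → ∀ w → toℕ w < suc (toℕ w₀) → Q w g′
        extend g′ qw keep w w≤ with w Fin.≟ w₀
        ... | yes refl = qw
        ... | no w≢ = keep w w≢ (all w (subst (toℕ w <_) (Fin.toℕ-fromℕ< i<p) (ℕ.≤∧≢⇒< (ℕ.≤-pred w≤) (w≢ ∘ Fin.toℕ-injective))))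

    -- The rule for loops whose rounds share one quantity that moves monotonically: facts
    -- established earlier survive along `_≾_`.
    wp-sweep : ∀ {d} {o} p (c : Cmd (suc d)) ρ {g} (J : Mem → Set ℓ) (_≾_ : Mem → Mem → Set ℓ) (Q : Fin (par p) → Mem → Set ℓ) →
      (∀ {g} → g ≾ g) → (∀ {g g′ g″} → g ≾ g′ → g′ ≾ g″ → g ≾ g″) → (∀ w {g g′} → g ≾ g′ → Q w g → Q w g′) → J g →
      (∀ w g → J g → wp c (ρ [ d ≔ toℕ w ]) (λ g′ → J g′ × g ≾ g′ × Q w g′) g) →
      wp (loop {d} {o} p c) ρ (λ g′ → J g′ × g ≾ g′ × (∀ w → Q w g′)) g
    wp-sweep {d} {o} p c ρ {g} J _≾_ Q rf tr up j₀ step =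
      wp-mono (loop {d} {o} p c) ρ (λ g′ ((j , s) , all) → j , s , all) g
        (wp-each {d} {o} p c ρ (λ g′ → J g′ × g ≾ g′) Q (j₀ , rf) λ w g′ (j , s) →
          wp-mono c _ (λ g″ (j′ , s′ , qw) → (j′ , tr s s′) , qw , λ w′ _ → up w′ s′) g′ (step w g′ j))

    wp-seq : ∀ {d} (c c′ : Cmd d) ρ (P Q : Mem → Set ℓ) g → wp c ρ P g →
             (∀ g′ → P g′ → Frame (writesI c) (writesR c) g g′ → wp c′ ρ Q g′) → wp (c ⨾ c′) ρ Q g
    wp-seq c c′ ρ P Q g p k = wp-mono c ρ {Q = λ g′ → P g′ × Frame (writesI c) (writesR c) g g′} {Q′ = wp c′ ρ Q} (λ g′ (p′ , fr) → k g′ p′ fr) g (wp-frame c ρ {Q = P} g p)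

    -- wp as an opaque record, so that comparing two types never unfolds a program.
    record Ensures {d} (c : Cmd d) (ρ : Env) (Q : Mem → Set ℓ) (g : Mem) : Set ℓ where
      constructor ensures
      field holds : wp c ρ Q g

    open Ensures

    infixr 4 _then_
    _then_ : ∀ {d} {c c′ : Cmd d} {ρ P Q g} → Ensures c ρ P g →
             (∀ g′ → P g′ → Frame (writesI c) (writesR c) g g′ → Ensures c′ ρ Q g′) → Ensures (c ⨾ c′) ρ Q g
    holds (_then_ {c = c} {c′} {ρ} {P} {Q} {g} p k) = wp-seq c c′ ρ P Q g (holds p) (λ g′ p′ fr → holds (k g′ p′ fr))

    conclude : ∀ {d} {c : Cmd d} {ρ P Q g} → Ensures c ρ P g → (∀ g′ → P g′ → Frame (writesI c) (writesR c) g g′ → Q g′) → Ensures c ρ Q g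
    holds (conclude {c = c} {ρ} {P} {Q} {g} p k) = wp-mono c ρ {Q = λ g′ → P g′ × Frame (writesI c) (writesR c) g g′} {Q′ = Q} (λ g′ (p′ , fr) → k g′ p′ fr) g (wp-frame c ρ {Q = P} g (holds p))

    touching : ∀ {d} {c : Cmd d} {ρ P g} (TI TR : Loc → Set) → Touches c ρ TI TR → Ensures c ρ P g → Ensures c ρ (λ g′ → P g′ × Same TI TR g g′) g
    holds (touching {c = c} {ρ} {P} {g} TI TR t p) = wp-touch c ρ {Q = P} t g (holds p)

    repeat : ∀ {d} {o} p {c : Cmd (suc d)} {ρ g} (Inv : ℕ → Mem → Set ℓ) → Inv 0 g →
             (∀ i g → i < par p → Inv i g → Ensures c (ρ [ d ≔ i ]) (Inv (suc i)) g) → Ensures (loop {d} {o} p c) ρ (Inv (par p)) g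
    holds (repeat {d} {o} p {c} {ρ} Inv inv₀ body) = wp-loop {d} {o} p c ρ Inv inv₀ (λ i g i< inv → holds (body i g i< inv)) (λ _ inv → inv)

    binding : ∀ {d} {o} {x} {c : Cmd (suc d)} {ρ Q g} → Ensures c (ρ [ d ≔ I g (at′ x ρ) ]) Q g → Ensures (getI {d} {o} x c) ρ Q g
    holds (binding p) = holds p

  -- Correctness of the computed tables.

  module Tables {c ℓ₁ ℓ₂} (ℝ : CompleteOrderedField c ℓ₁ ℓ₂) (F : RootFinder ℝ)
      {n q : ℕ} (G : Graphs.Graph ℝ n q) (s t : Fin n) (K B : ℕ) where
    open CompleteOrderedField ℝ using (Carrier; 0#; 1#; Polynomial; commutativeRing; semiring; +-monoid)
      renaming (_≈_ to _≈ᵣ_; _<_ to _<ᵣ_; _<?_ to _<?ᵣ_; _+_ to _+ᵣ_; _*_ to _*ᵣ_; _-_ to _-ᵣ_; _÷_ to _÷ᵣ_; refl to ≈-refl; sym to ≈-sym; trans to ≈-trans;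
                reflexive to ≈-reflexive; +-cong to +ᵣ-cong; *-cong to *ᵣ-cong; *-comm to *ᵣ-comm; +-identityˡ to +ᵣ-identityˡ; +-assoc to +ᵣ-assoc)
    open import Algebra.Properties.Semiring.Exp semiring using () renaming (_^_ to _^ᵣ_)
    open import Algebra.Properties.Monoid.Sum +-monoid using (sum)
    open OrderedField ℝ using (<-resp)
    open Graphs ℝ
    open Graph G
    open Walks ℝ G
    open Preprocessing

    entry : ℕ → ℕ → Maybe (Polynomial q)
    entry u v with u <? n | v <? n
    ... | yes u<n | yes v<n = wt (fromℕ< u<n) (fromℕ< v<n)
    ... | _       | _       = nothing

    entry-toℕ : ∀ u v → entry (toℕ u) (toℕ v) ≡ wt u v
    entry-toℕ u v with toℕ u <? n | toℕ v <? n
    ... | yes u<n | yes v<n = cong₂ wt (Fin.fromℕ<-toℕ u u<n) (Fin.fromℕ<-toℕ v v<n)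
    ... | no u≮n  | _       = ⊥-elim (u≮n (Fin.toℕ<n u))
    ... | yes _   | no v≮n  = ⊥-elim (v≮n (Fin.toℕ<n v))

    adjacentAt : ℕ → ℕ → ℕ
    adjacentAt u v = maybe′ (λ _ → 1) 0 (entry u v)

    coefficientOf : Maybe (Polynomial q) → ℕ → Carrier
    coefficientOf nothing  l = 0#
    coefficientOf (just p) l with l <? suc q
    ... | yes l<w = p (fromℕ< l<w)
    ... | no _    = 0#

    coefficientAt : ℕ → ℕ → ℕ → Carrier
    coefficientAt u v l = coefficientOf (entry u v) l

    coefficientOf-toℕ : ∀ p l → coefficientOf (just p) (toℕ l) ≡ p l
    coefficientOf-toℕ p l with toℕ l <? suc q
    ... | yes l<w = cong p (Fin.fromℕ<-toℕ l l<w)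
    ... | no l≮w  = ⊥-elim (l≮w (Fin.toℕ<n l))

    open Semantics ℝ F n q K B adjacentAt coefficientAt public
    open Rules ℝ F n q K B adjacentAt coefficientAt public

    ρ₀ : Env
    ρ₀ 0 = 0
    ρ₀ 1 = 1
    ρ₀ 2 = toℕ s
    ρ₀ 3 = toℕ t
    ρ₀ 4 = K
    ρ₀ _ = 0

    NextRep : Mem → ℕ → Fin n → Fin n → ℕ → Maybe (Fin n) → Set
    NextRep g k u v a nothing  = I g (loc 1 k (toℕ u) (toℕ v) a) ≡ 0
    NextRep g k u v a (just b) = I g (loc 1 k (toℕ u) (toℕ v) a) ≡ 1 × I g (loc 2 k (toℕ u) (toℕ v) a) ≡ toℕ b

    -- A walk in memory is its coefficients and its last exits; the walk itself exists only in the
    -- proof. Coefficients agree up to `≈`, since the machine adds in another order.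
    record Walked (g : Mem) (k : ℕ) {u v : Fin n} (w : W u v) : Set ℓ where
      field
        marked : I g (loc 0 k (toℕ u) (toℕ v) 0) ≡ 1
        coeffs≈ : ∀ l → R g (loc 0 k (toℕ u) (toℕ v) (toℕ l)) ≈ᵣ coefs w l
        nexts : ∀ a → NextRep g k u v (toℕ a) (next w a)

    -- `Static` is the part that does not mention the sample point. At level 0 it is established
    -- once and survives all samples, whereas `Valued` has to be established anew.
    Static : Mem → ℕ → (u v : Fin n) → Maybe (W u v) → Set ℓ
    Static g k u v nothing  = Lift ℓ (I g (loc 0 k (toℕ u) (toℕ v) 0) ≡ 0)
    Static g k u v (just w) = Walked g k w

    Valued : Carrier → Mem → ℕ → (u v : Fin n) → Maybe (W u v) → Set ℓ
    Valued y g k u v nothing  = Lift ℓ ⊤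
    Valued y g k u v (just w) = Lift ℓ (R g (loc 1 k (toℕ u) (toℕ v) 0) ≈ᵣ weight G y w)

    Entry : Carrier → Mem → ℕ → (u v : Fin n) → Maybe (W u v) → Set ℓ
    Entry y g k u v m = Static g k u v m × Valued y g k u v m

    record AgreeAt (k u v : ℕ) (g g′ : Mem) : Set c where
      constructor agree
      field
        ints  : ∀ a l → a < 3 → I g′ (loc a k u v l) ≡ I g (loc a k u v l)
        reals : ∀ a l → a < 2 → R g′ (loc a k u v l) ≡ R g (loc a k u v l)

    AgreeStatic : ℕ → ℕ → ℕ → Mem → Mem → Set c
    AgreeStatic k u v g g′ = (∀ a l → a < 3 → I g′ (loc a k u v l) ≡ I g (loc a k u v l)) ×
                             (∀ l → R g′ (loc 0 k u v l) ≡ R g (loc 0 k u v l))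

    agree-static : ∀ {k u v g g′} → AgreeAt k u v g g′ → AgreeStatic k u v g g′
    agree-static (agree p r) = p , λ l → r 0 l (s≤s z≤n)

    static-agree : ∀ {k u v} g g′ m → AgreeStatic k (toℕ u) (toℕ v) g g′ → Static g k u v m → Static g′ k u v m
    static-agree g g′ nothing  (p , _) (lift e) = lift (trans (p 0 0 (s≤s z≤n)) e)
    static-agree {k} {u} {v} g g′ (just w) (p , r) st = record
      { marked = trans (p 0 0 (s≤s z≤n)) marked
      ; coeffs≈ = λ l → ≈-trans (≈-reflexive (r (toℕ l))) (coeffs≈ l)
      ; nexts = λ a → nexts′ (toℕ a) (next w a) (nexts a) }
      where
      open Walked st
      nexts′ : ∀ a m → NextRep g k u v a m → NextRep g′ k u v a m
      nexts′ a nothing  e        = trans (p 1 _ (s≤s (s≤s z≤n))) e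
      nexts′ a (just b) (e , e′) = trans (p 1 _ (s≤s (s≤s z≤n))) e , trans (p 2 _ (s≤s (s≤s (s≤s z≤n)))) e′

    entry-agree : ∀ {y k u v} g g′ m → AgreeAt k (toℕ u) (toℕ v) g g′ → Entry y g k u v m → Entry y g′ k u v m
    entry-agree g g′ nothing  ag (st , _) = static-agree g g′ nothing (agree-static ag) st , _
    entry-agree g g′ (just w) ag@(agree _ r) (st , lift e) = static-agree g g′ (just w) (agree-static ag) st , lift (≈-trans (≈-reflexive (r 1 0 (s≤s (s≤s z≤n)))) e)

    frame-agree : ∀ {bI bR g g′} → bI 0 ≡ false → bI 1 ≡ false → bI 2 ≡ false → bR 0 ≡ false → bR 1 ≡ false →
                  Frame bI bR g g′ → ∀ k u v → AgreeAt k u v g g′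
    frame-agree i₀ i₁ i₂ r₀ r₁ (p , r) k u v = agree
      (λ { 0 l _ → p _ i₀ ; 1 l _ → p _ i₁ ; 2 l _ → p _ i₂ ; (suc (suc (suc _))) l (s≤s (s≤s (s≤s ()))) })
      (λ { 0 l _ → r _ r₀ ; 1 l _ → r _ r₁ ; (suc (suc _)) l (s≤s (s≤s ())) })

    -- The implications leave all other arrays unrestricted; only the arrays of the tables are
    -- confined to the entry at hand.
    OwnI OwnR : ℕ → Fin n → Fin n → Loc → Set
    OwnI k u v (loc a i j m l) = a < 3 → i ≡ k × j ≡ toℕ u × m ≡ toℕ v
    OwnR k u v (loc a i j m l) = a < 2 → i ≡ k × j ≡ toℕ u × m ≡ toℕ v

    own-agree : ∀ {k u v k′ u′ v′ g g′} → ¬ (k′ ≡ k × u′ ≡ u × v′ ≡ v) → Same (OwnI k u v) (OwnR k u v) g g′ → AgreeAt k′ (toℕ u′) (toℕ v′) g g′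
    own-agree diff (p , r) = agree
      (λ a l a<3 → p _ (λ own → diff (eq (own a<3)))) (λ a l a<2 → r _ (λ own → diff (eq (own a<2))))
      where
      eq : ∀ {k k′ u u′ v v′} → k′ ≡ k × toℕ u′ ≡ toℕ u × toℕ v′ ≡ toℕ v → k′ ≡ k × u′ ≡ u × v′ ≡ v
      eq (e , e′ , e″) = e , Fin.toℕ-injective e′ , Fin.toℕ-injective e″

    -- For a double loop over pairs of vertices whose body confines itself to its own entry. The
    -- property of a finished entry then survives the treatment of all others.
    wp-pairs : ∀ {d} {o o′} (c : Cmd (suc (suc d))) ρ (TI TR : Fin n → Fin n → Loc → Set) (J : Mem → Set ℓ) (Q : Fin n → Fin n → Mem → Set ℓ) →
      (∀ u v {g g′} → Same (TI u v) (TR u v) g g′ → J g → J g′) →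
      (∀ u v u′ v′ {g g′} → ¬ (u′ ≡ u × v′ ≡ v) → Same (TI u v) (TR u v) g g′ → Q u′ v′ g → Q u′ v′ g′) →
      (∀ u v → Touches c (ρ [ d ≔ toℕ u ] [ suc d ≔ toℕ v ]) (TI u v) (TR u v)) →
      (∀ u v g → J g → wp c (ρ [ d ≔ toℕ u ] [ suc d ≔ toℕ v ]) (Q u v) g) →
      ∀ g → J g → wp (loop {d} {o} vertexPar (loop {suc d} {o′} vertexPar c)) ρ (λ g′ → J g′ × (∀ u v → Q u v g′)) g
    wp-pairs {d} {o} {o′} c ρ TI TR J Q jc qc touches body g j =
      wp-mono (loop {d} {o} vertexPar (loop {suc d} {o′} vertexPar c)) ρ (λ g′ (j , all) → j , λ u → lower (all u)) g
       (wp-each {d} {o} vertexPar (loop {suc d} {o′} vertexPar c) ρ J (λ u g → Lift ℓ (∀ v → Q u v g)) j λ u g j →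
        wp-mono (loop {suc d} {o′} vertexPar c) (ρ [ d ≔ toℕ u ]) (λ g′ ((j , keep) , all) → j , lift all , λ u′ u′≢u (lift qs) → lift (λ v → keep u′ v u′≢u (qs v))) g
         (wp-each {suc d} {o′} vertexPar c (ρ [ d ≔ toℕ u ]) (λ g′ → J g′ × (∀ u′ v → u′ ≢ u → Q u′ v g → Q u′ v g′)) (λ v g′ → Q u v g′)
           (j , λ _ _ _ qq → qq) λ v g′ (j , keep) →
           wp-mono c _ (λ g″ (qq , same) → (jc u v same j , λ u′ v′ u′≢u qq → qc u v u′ v′ (u′≢u ∘ proj₁) same (keep u′ v′ u′≢u qq)) , qq ,
               λ v′ v′≢v → qc u v u v′ (v′≢v ∘ proj₂) same) g′
             (wp-touch c _ (touches u v) g′ (body u v g′ j))))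

    module _ (u v : Fin n) where
      private
        ρ : Env
        ρ = ρ₀ [ 5 ≔ toℕ u ] [ 6 ≔ toℕ v ]

        slot : ℕ → ℕ → Loc
        slot a l = loc a 0 (toℕ u) (toℕ v) l

      ExistsLoaded : Mem → Set ℓ
      ExistsLoaded g = Lift ℓ ((u ≡ v → I g (slot 0 0) ≡ 1) × (u ≢ v → I g (slot 0 0) ≡ adjacentAt (toℕ u) (toℕ v)))

      NextLoaded : Fin n → Mem → Set ℓ
      NextLoaded a g = Lift ℓ (I g (slot 2 (toℕ a)) ≡ toℕ v × (a ≡ u × u ≢ v → I g (slot 1 (toℕ a)) ≡ 1) ×
                                  (¬ (a ≡ u × u ≢ v) → I g (slot 1 (toℕ a)) ≡ 0))

      CoeffLoaded : Fin (suc q) → Mem → Set ℓ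
      CoeffLoaded l g = Lift ℓ (R g (slot 0 (toℕ l)) ≡ coefficientAt (toℕ u) (toℕ v) (toℕ l))

      private
        ≮⇒≡ : ∀ {a b : Fin n} → ¬ toℕ a < toℕ b → ¬ toℕ b < toℕ a → a ≡ b
        ≮⇒≡ p p′ = Fin.toℕ-injective (ℕ.≤-antisym (ℕ.≮⇒≥ p′) (ℕ.≮⇒≥ p))

        <⇒≢ : ∀ {a b : Fin n} → toℕ a < toℕ b → a ≢ b
        <⇒≢ lt refl = ℕ.<-irrefl refl lt

      loadExists-ok : ∀ g → wp loadExists ρ ExistsLoaded g
      loadExists-ok g = Fin.toℕ<n u , Fin.toℕ<n v ,
        (λ lt → lift ((λ e → ⊥-elim (<⇒≢ lt e)) , λ _ → update-same (I g) (slot 0 0))) ,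
        (λ u≮ → (λ lt → lift ((λ e → ⊥-elim (<⇒≢ lt (sym e))) , λ _ → update-same (I g) (slot 0 0))) ,
               (λ u≯ → lift ((λ _ → update-same (I g) (slot 0 0)) , λ u≢v → ⊥-elim (u≢v (≮⇒≡ u≮ u≯)))))

      loadNext-ok : ∀ g → wp (loop {7} vertexPar loadNext) ρ (λ g′ → Lift ℓ ⊤ × (∀ a → NextLoaded a g′)) g
      loadNext-ok g = wp-each {7} vertexPar loadNext ρ (λ _ → Lift ℓ ⊤) NextLoaded _ λ a g _ →
        (λ lt → no-edge a g (λ (e , _) → <⇒≢ lt e)) ,
        (λ u≮ → (λ lt → no-edge a g (λ (e , _) → <⇒≢ lt (sym e))) ,
               (λ u≯ → (λ lt → linked a g (≮⇒≡ u≮ u≯) (<⇒≢ lt)) ,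
                      (λ u≮v → (λ lt → linked a g (≮⇒≡ u≮ u≯) (<⇒≢ lt ∘ sym)) ,
                               (λ v≮u → no-edge a g (λ (_ , u≢v) → u≢v (≮⇒≡ u≮v v≮u))))))
        where
        written : ∀ (a : Fin n) x g → Mem
        written a x g = writeI (slot 1 (toℕ a)) x (writeI (slot 2 (toℕ a)) (toℕ v) g)
        same₂ : ∀ a x g → I (written a x g) (slot 2 (toℕ a)) ≡ toℕ v
        same₂ a x g = update-same (I g) (slot 2 (toℕ a))
        same₁ : ∀ a x g → I (written a x g) (slot 1 (toℕ a)) ≡ x
        same₁ a x g = update-same (I (writeI (slot 2 (toℕ a)) (toℕ v) g)) (slot 1 (toℕ a))
        keep : ∀ a x g a′ → a′ ≢ a → NextLoaded a′ g → NextLoaded a′ (written a x g)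
        keep a x g a′ a′≢a (lift (e , e₁ , e₀)) = lift (trans (update-other (I g) {slot 2 (toℕ a)} {y = slot 2 (toℕ a′)} (a′≢a ∘ Fin.toℕ-injective ∘ cong Loc.l)) e ,
          (λ h → trans other (e₁ h)) , (λ h → trans other (e₀ h)))
          where
          other : I (written a x g) (slot 1 (toℕ a′)) ≡ I g (slot 1 (toℕ a′))
          other = update-other (I (writeI (slot 2 (toℕ a)) (toℕ v) g)) {slot 1 (toℕ a)} {y = slot 1 (toℕ a′)} (a′≢a ∘ Fin.toℕ-injective ∘ cong Loc.l)
        linked : ∀ a g → a ≡ u → u ≢ v → Lift ℓ ⊤ × NextLoaded a (written a 1 g) × (∀ a′ → a′ ≢ a → NextLoaded a′ g → NextLoaded a′ (written a 1 g))
        linked a g a≡u u≢v = _ , lift (same₂ a 1 g , (λ _ → same₁ a 1 g) , (λ h → ⊥-elim (h (a≡u , u≢v)))) , keep a 1 g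
        no-edge : ∀ a g → ¬ (a ≡ u × u ≢ v) → Lift ℓ ⊤ × NextLoaded a (written a 0 g) × (∀ a′ → a′ ≢ a → NextLoaded a′ g → NextLoaded a′ (written a 0 g))
        no-edge a g h = _ , lift (same₂ a 0 g , (λ h′ → ⊥-elim (h h′)) , (λ _ → same₁ a 0 g)) , keep a 0 g

      loadCoeff-ok : ∀ g → wp (loop {7} widthPar loadCoeff) ρ (λ g′ → Lift ℓ ⊤ × (∀ l → CoeffLoaded l g′)) g
      loadCoeff-ok g = wp-each {7} widthPar loadCoeff ρ (λ _ → Lift ℓ ⊤) CoeffLoaded _ λ l g _ →
        Fin.toℕ<n u , Fin.toℕ<n v , Fin.toℕ<n l , _ , lift (update-same (R g) (slot 0 (toℕ l))) ,
        λ l′ l′≢l (lift e) → lift (trans (update-other (R g) {slot 0 (toℕ l)} {y = slot 0 (toℕ l′)} (l′≢l ∘ Fin.toℕ-injective ∘ cong Loc.l)) e)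

      loaded⇒static : ∀ g → ExistsLoaded g → (∀ a → NextLoaded a g) → (∀ l → CoeffLoaded l g) → Static g 0 u v (table₀ u v)
      loaded⇒static g (lift (ex₁ , ex₀)) nx co with u Fin.≟ v
      ... | yes refl = record
        { marked = ex₁ refl
        -- The absence of loops makes the matrix entry of the diagonal empty, so the coefficients
        -- read there are zero, as the empty walk requires.
        ; coeffs≈ = λ l → ≈-reflexive (trans (lower (co l)) (cong (λ m → coefficientOf m (toℕ l)) (trans (entry-toℕ u u) (loopless u))))
        ; nexts = λ a → proj₂ (proj₂ (lower (nx a))) (λ (_ , u≢u) → u≢u refl) }
      ... | no u≢v = go (wt u v) refl
        where
        go : ∀ m (eq : wt u v ≡ m) → Static g 0 u v (edge m eq)
        go nothing eq = lift (trans (ex₀ u≢v) (cong (maybe′ (λ _ → 1) 0) (trans (entry-toℕ u v) eq)))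
        go (just p) eq = record
          { marked = trans (ex₀ u≢v) (cong (maybe′ (λ _ → 1) 0) (trans (entry-toℕ u v) eq))
          ; coeffs≈ = λ l → ≈-trans (≈-reflexive (trans (lower (co l)) (trans (cong (λ m → coefficientOf m (toℕ l)) (trans (entry-toℕ u v) eq)) (coefficientOf-toℕ p l))))
                                    (≈-sym (CompleteOrderedField.+-identityʳ ℝ (p l)))
          ; nexts = nexts }
          where
          nexts : ∀ a → NextRep g 0 u v (toℕ a) (if does (a Fin.≟ u) then just v else nothing)
          nexts a with a Fin.≟ u
          ... | yes a≡u = proj₁ (proj₂ (lower (nx a))) (a≡u , u≢v) , proj₁ (lower (nx a))
          ... | no a≢u = proj₂ (proj₂ (lower (nx a))) (a≢u ∘ proj₁)

      Loaded : Mem → Set ℓ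
      Loaded g = Static g 0 u v (table₀ u v)

      loadPair-ok : ∀ g → wp loadPair ρ Loaded g
      loadPair-ok g = wp-seq loadExists (loop {7} vertexPar loadNext ⨾ loop {7} widthPar loadCoeff) ρ ExistsLoaded Loaded g (loadExists-ok g) λ g₁ ex _ →
        wp-seq (loop {7} vertexPar loadNext) (loop {7} widthPar loadCoeff) ρ (λ g′ → Lift ℓ ⊤ × (∀ a → NextLoaded a g′)) Loaded g₁ (loadNext-ok g₁) λ g₂ (_ , nx) fr →
        wp-mono (loop {7} widthPar loadCoeff) ρ {Q′ = Loaded} (λ g₃ ((_ , co) , fr′) →
          loaded⇒static g₃ (lift ((λ e → trans (trans (proj₁ fr′ (slot 0 0) refl) (proj₁ fr (slot 0 0) refl)) (proj₁ (lower ex) e)) ,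
                                  (λ e → trans (trans (proj₁ fr′ (slot 0 0) refl) (proj₁ fr (slot 0 0) refl)) (proj₂ (lower ex) e))))
            (λ a → let e , e₁ , e₀ = lower (nx a) in lift (trans (proj₁ fr′ (slot 2 (toℕ a)) refl) e ,
                     (λ h → trans (proj₁ fr′ (slot 1 (toℕ a)) refl) (e₁ h)) , (λ h → trans (proj₁ fr′ (slot 1 (toℕ a)) refl) (e₀ h)))) co) g₂
          (wp-frame (loop {7} widthPar loadCoeff) ρ g₂ (loadCoeff-ok g₂))

      loadPair-touches : Touches loadPair ρ (OwnI 0 u v) (OwnR 0 u v)
      loadPair-touches = (λ _ → own , own , own) , (λ _ → own , own , own , own , own , own) , (λ _ → own)
        where
        own : ∀ {a} {A : Set a} → A → 0 ≡ 0 × toℕ u ≡ toℕ u × toℕ v ≡ toℕ v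
        own _ = refl , refl , refl

    load-ok : ∀ g → Ensures load ρ₀ (λ g′ → ∀ u v → Static g′ 0 u v (table₀ u v)) g
    load-ok g = ensures (wp-mono load ρ₀ (λ g′ → proj₂) g
      (wp-pairs {5} loadPair ρ₀ (OwnI 0) (OwnR 0) (λ _ → Lift ℓ ⊤) (λ u v g → Static g 0 u v (table₀ u v)) (λ _ _ _ j → j)
        (λ u v u′ v′ {g} {g′} diff same st → static-agree g g′ (table₀ u′ v′) (agree-static (own-agree (diff ∘ proj₂) same)) st)
        loadPair-touches (λ u v g _ → loadPair-ok u v g) g _))

    AtPoint : Carrier → Mem → Set ℓ
    AtPoint y g = Lift ℓ (R g (loc 6 0 0 0 0) ≡ y)

    PowersUpTo : Carrier → ℕ → Mem → Set ℓ
    PowersUpTo y i g = Lift ℓ (∀ l → l < i → R g (loc 2 0 0 0 l) ≈ᵣ y ^ᵣ l)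

    power-ok : ∀ y ρ g → ρ 0 ≡ 0 → AtPoint y g → wp (loop {7} widthPar power) ρ (λ g′ → AtPoint y g′ × PowersUpTo y (suc q) g′) g
    power-ok y ρ g ρ₀≡0 pt = wp-loop {7} widthPar power ρ (λ i g → AtPoint y g × PowersUpTo y i g) (pt , lift (λ _ ()))
        (λ i g _ → body i g) (λ _ p → p)
      where
      cell₂ : ℕ → Loc
      cell₂ l = loc 2 0 0 0 l
      extend : ∀ i v g → PowersUpTo y i g → v ≈ᵣ y ^ᵣ i → PowersUpTo y (suc i) (writeR (cell₂ i) v g)
      extend i v g (lift ps) v≈ = lift λ l l≤i → go l (l ℕ.≟ i) l≤i
        where
        go : ∀ l → Dec (l ≡ i) → l < suc i → update (R g) (cell₂ i) v (cell₂ l) ≈ᵣ y ^ᵣ l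
        go l (yes refl) _ = ≈-trans (≈-reflexive (update-same (R g) (cell₂ i))) v≈
        go l (no l≢i) l≤i = ≈-trans (≈-reflexive (update-other (R g) {cell₂ i} {y = cell₂ l} (l≢i ∘ cong Loc.l))) (ps l (ℕ.≤∧≢⇒< (ℕ.≤-pred l≤i) l≢i))
      body : ∀ i g → AtPoint y g × PowersUpTo y i g → wp power (ρ [ 7 ≔ i ]) (λ g → AtPoint y g × PowersUpTo y (suc i) g) g
      body zero g (pt , ps) rewrite ρ₀≡0 = (λ ()) , λ _ → pt , extend 0 1# g ps ≈-refl
      body (suc i) g (pt , ps) rewrite ρ₀≡0 = (λ _ → pt , extend (suc i) _ g ps
          (≈-trans (*ᵣ-cong (lower ps i ℕ.≤-refl) (≈-reflexive (lower pt))) (*ᵣ-comm (y ^ᵣ i) y))) , λ ≮ → ⊥-elim (≮ (s≤s z≤n))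

    partialSum : (ℕ → Carrier) → ℕ → Carrier
    partialSum f zero    = 0#
    partialSum f (suc i) = partialSum f i +ᵣ f i

    -- The loop adds at the end whereas `sum` unfolds at the front; this bridges the two.
    partialSum-first : ∀ f m → partialSum f (suc m) ≈ᵣ f 0 +ᵣ partialSum (f ∘ suc) m
    partialSum-first f zero    = CompleteOrderedField.+-comm ℝ 0# (f 0)
    partialSum-first f (suc m) = ≈-trans (+ᵣ-cong (partialSum-first f m) ≈-refl) (+ᵣ-assoc _ _ _)

    partialSum≈sum : ∀ {m} f (h : Fin m → Carrier) → (∀ i → f (toℕ i) ≈ᵣ h i) → partialSum f m ≈ᵣ sum h
    partialSum≈sum {zero}  f h f≈h = ≈-refl
    partialSum≈sum {suc m} f h f≈h = ≈-trans (partialSum-first f m) (+ᵣ-cong (f≈h zero) (partialSum≈sum (f ∘ suc) (h ∘ suc) (f≈h ∘ suc)))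

    EvalReady : Carrier → Mem → Set ℓ
    EvalReady y g = AtPoint y g × PowersUpTo y (suc q) g × (∀ u v → Static g 0 u v (table₀ u v))

    ρ₇ : ℕ → ℕ → Env
    ρ₇ i it = ρ₀ [ 5 ≔ i ] [ 6 ≔ it ]

    module Filling (i it : ℕ) (y : Carrier) where
      private
        valueCell : ℕ → Fin n → Fin n → Loc
        valueCell k u v = loc 1 k (toℕ u) (toℕ v) 0

        term : Mem → Fin n → Fin n → ℕ → Carrier
        term g u v l = R g (loc 0 0 (toℕ u) (toℕ v) l) *ᵣ R g (loc 2 0 0 0 l)

      sum-ok : ∀ u v g → wp (loop {9} widthPar addTerm) (ρ₇ i it [ 7 ≔ toℕ u ] [ 8 ≔ toℕ v ])
        (λ g′ → Lift ℓ (R g′ (valueCell 0 u v) ≡ partialSum (term g u v) (suc q))) (writeR (valueCell 0 u v) 0# g)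
      sum-ok u v g = wp-loop {9} widthPar addTerm (ρ₇ i it [ 7 ≔ toℕ u ] [ 8 ≔ toℕ v ]) Inv (lift (update-same (R g) (valueCell 0 u v) , (λ _ → refl) , (λ _ → refl)))
        (λ j g′ _ (lift (e , es , ps)) → lift (trans (update-same (R (scratch g′ j)) (valueCell 0 u v)) (cong₂ _+ᵣ_ e (cong₂ _*ᵣ_ (es j) (ps j))) , es , ps))
        (λ g′ inv → lift (proj₁ (lower inv)))
        where
        scratch : Mem → ℕ → Mem
        scratch g j = writeR (loc 3 0 0 0 0) (term g u v j) g
        Inv : ℕ → Mem → Set ℓ
        Inv j g′ = Lift ℓ (R g′ (valueCell 0 u v) ≡ partialSum (term g u v) j ×
          (∀ l → R g′ (loc 0 0 (toℕ u) (toℕ v) l) ≡ R g (loc 0 0 (toℕ u) (toℕ v) l)) × (∀ l → R g′ (loc 2 0 0 0 l) ≡ R g (loc 2 0 0 0 l)))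

      evaluate-ok : ∀ u v g → EvalReady y g → wp evaluate (ρ₇ i it [ 7 ≔ toℕ u ] [ 8 ≔ toℕ v ]) (λ g′ → Valued y g′ 0 u v (table₀ u v)) g
      evaluate-ok u v g (_ , lift ps , st) = wp-mono (loop {9} widthPar addTerm) (ρ₇ i it [ 7 ≔ toℕ u ] [ 8 ≔ toℕ v ]) (λ g′ (lift e) → go (table₀ u v) (st u v) e) _ (sum-ok u v g)
        where
        go : ∀ {g′} m → Static g 0 u v m → R g′ (valueCell 0 u v) ≡ partialSum (term g u v) (suc q) → Valued y g′ 0 u v m
        go nothing  _ e = _
        go (just w) st e = lift (≈-trans (≈-reflexive e) (≈-trans
          (partialSum≈sum (term g u v) (λ l → coefs w l *ᵣ (y ^ᵣ toℕ l)) (λ l → *ᵣ-cong (Walked.coeffs≈ st l) (ps (toℕ l) (Fin.toℕ<n l))))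
          (eval-coefs y w)))

      evaluateAll-ok : ∀ g → EvalReady y g → wp (loop {7} vertexPar (loop {8} vertexPar evaluate)) (ρ₇ i it)
        (λ g′ → ∀ u v → Entry y g′ 0 u v (table₀ u v)) g
      evaluateAll-ok g ready = wp-mono (loop {7} vertexPar (loop {8} vertexPar evaluate)) (ρ₇ i it) (λ g′ ((_ , _ , st) , val) u v → st u v , val u v) g
        (wp-pairs {7} evaluate (ρ₇ i it) (λ _ _ _ → ⊥) TR (EvalReady y) (λ u v g → Valued y g 0 u v (table₀ u v)) jc qc
          (λ u v → inj₂ refl , λ _ → inj₁ refl , inj₂ refl) evaluate-ok g ready)
        where
        TR : Fin n → Fin n → Loc → Set
        TR u v x = x ≡ loc 3 0 0 0 0 ⊎ x ≡ valueCell 0 u v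
        jc : ∀ u v {g g′} → Same (λ _ → ⊥) (TR u v) g g′ → EvalReady y g → EvalReady y g′
        jc u v {g} {g′} (p , r) (lift pt , lift ps , st) =
          lift (trans (r _ (λ { (inj₁ ()) ; (inj₂ ()) })) pt) ,
          lift (λ l l< → ≈-trans (≈-reflexive (r _ (λ { (inj₁ ()) ; (inj₂ ()) }))) (ps l l<)) ,
          λ u′ v′ → static-agree g g′ (table₀ u′ v′) ((λ a l _ → p _ (λ ())) , λ l → r _ (λ { (inj₁ ()) ; (inj₂ ()) })) (st u′ v′)
        qc : ∀ u v u′ v′ {g g′} → ¬ (u′ ≡ u × v′ ≡ v) → Same (λ _ → ⊥) (TR u v) g g′ → Valued y g 0 u′ v′ (table₀ u′ v′) → Valued y g′ 0 u′ v′ (table₀ u′ v′)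
        qc u v u′ v′ {g} {g′} diff (p , r) = go (table₀ u′ v′)
          where
          go : ∀ m → Valued y g 0 u′ v′ m → Valued y g′ 0 u′ v′ m
          go nothing  _ = _
          go (just w) (lift e) = lift (≈-trans (≈-reflexive (r _ (λ { (inj₁ ()) ; (inj₂ eq) → diff (Fin.toℕ-injective (cong Loc.j eq) , Fin.toℕ-injective (cong Loc.k eq)) }))) e)

      module Doubling (κ : ℕ) (u v : Fin n) where
        ρ₁₁ : Env
        ρ₁₁ = ρ₇ i it [ 7 ≔ suc κ ] [ 8 ≔ κ ] [ 9 ≔ toℕ u ] [ 10 ≔ toℕ v ]

        private
          new : ℕ → ℕ → Loc
          new a l = loc a (suc κ) (toℕ u) (toℕ v) l

        module Via (w : Fin n) where
          ρ₁₂ : Env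
          ρ₁₂ = ρ₁₁ [ 11 ≔ toℕ w ]

          -- What stays fixed while the new entry is written: all other levels, its mark and its value.
          record Improving (g₀ : Mem) (x : Carrier) (g : Mem) : Set ℓ where
            field
              levelI : ∀ a k j m l → k ≢ suc κ → I g (loc a k j m l) ≡ I g₀ (loc a k j m l)
              levelR : ∀ a k j m l → k ≢ suc κ → R g (loc a k j m l) ≡ R g₀ (loc a k j m l)
              marked : I g (new 0 0) ≡ 1
              value≡ : R g (new 1 0) ≡ x

          module _ (a : W u w) (b : W w v) (g₀ : Mem) (wa : Walked g₀ κ a) (wb : Walked g₀ κ b) (x : Carrier) (e₁ e₂ e₃ : ℕ) where
            private
              ρ₁₅ : Env
              ρ₁₅ = ρ₁₂ [ 12 ≔ e₁ ] [ 13 ≔ e₂ ] [ 14 ≔ e₃ ]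

              κ≢ : κ ≢ suc κ
              κ≢ ()

              CoeffOk : Fin (suc q) → Mem → Set ℓ
              CoeffOk l g = Lift ℓ (R g (new 0 (toℕ l)) ≈ᵣ coefs (a ◅◅ b) l)

              NextOk : Fin n → Mem → Set ℓ
              NextOk z g = Lift ℓ (NextRep g (suc κ) u v (toℕ z) (next (a ◅◅ b) z))

            improveCoeff-ok : ∀ g → Improving g₀ x g → wp (loop {15} widthPar improveCoeff) ρ₁₅ (λ g′ → Improving g₀ x g′ × (∀ l → CoeffOk l g′)) g
            improveCoeff-ok g im = wp-each {15} widthPar improveCoeff ρ₁₅ (Improving g₀ x) CoeffOk im λ l g im →
              let open Improving im
                  v′ = R g (loc 0 κ (toℕ u) (toℕ w) (toℕ l)) +ᵣ R g (loc 0 κ (toℕ w) (toℕ v) (toℕ l))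
                  g′ = writeR (new 0 (toℕ l)) v′ g
              in record { levelI = levelI ; marked = marked ; value≡ = value≡
                        ; levelR = λ a k j m l′ k≢ → trans (update-other (R g) {new 0 (toℕ l)} {y = loc a k j m l′} (k≢ ∘ cong Loc.i)) (levelR a k j m l′ k≢) } ,
                 lift (≈-trans (≈-reflexive (update-same (R g) (new 0 (toℕ l)))) (≈-trans
                   (+ᵣ-cong (≈-trans (≈-reflexive (levelR 0 κ _ _ _ κ≢)) (Walked.coeffs≈ wa l)) (≈-trans (≈-reflexive (levelR 0 κ _ _ _ κ≢)) (Walked.coeffs≈ wb l)))
                   (≈-sym (coefs-◅◅ a b l)))) ,
                 λ l′ l′≢l (lift e) → lift (≈-trans (≈-reflexive (update-other (R g) {new 0 (toℕ l)} {y = new 0 (toℕ l′)} (l′≢l ∘ Fin.toℕ-injective ∘ cong Loc.l))) e)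

            improveNext-ok : ∀ g → Improving g₀ x g → wp (loop {15} vertexPar improveNext) ρ₁₅ (λ g′ → Improving g₀ x g′ × (∀ z → NextOk z g′)) g
            improveNext-ok g im = wp-each {15} vertexPar improveNext ρ₁₅ (Improving g₀ x) NextOk im λ z g im → body z g im
              where
              written : Fin n → ℕ → ℕ → Mem → Mem
              written z m f g = writeI (new 1 (toℕ z)) f (writeI (new 2 (toℕ z)) m g)
              module _ (z : Fin n) (m f : ℕ) (g : Mem) where
                g₁ = writeI (new 2 (toℕ z)) m g
                at₁ : I (written z m f g) (new 1 (toℕ z)) ≡ f
                at₁ = update-same (I g₁) (new 1 (toℕ z))
                at₂ : I (written z m f g) (new 2 (toℕ z)) ≡ m
                at₂ = update-same (I g) (new 2 (toℕ z))
                improving : Improving g₀ x g → Improving g₀ x (written z m f g)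
                improving im = record { levelR = levelR ; marked = marked ; value≡ = value≡
                  ; levelI = λ a k j m′ l k≢ → trans (update-other (I g₁) {new 1 (toℕ z)} {y = loc a k j m′ l} (k≢ ∘ cong Loc.i))
                      (trans (update-other (I g) {new 2 (toℕ z)} {y = loc a k j m′ l} (k≢ ∘ cong Loc.i)) (levelI a k j m′ l k≢)) }
                  where open Improving im
                keep : ∀ z′ → z′ ≢ z → NextOk z′ g → NextOk z′ (written z m f g)
                keep z′ z′≢z (lift r) = lift (go (next (a ◅◅ b) z′) r)
                  where
                  go : ∀ m′ → NextRep g (suc κ) u v (toℕ z′) m′ → NextRep (written z m f g) (suc κ) u v (toℕ z′) m′
                  same₁ : I (written z m f g) (new 1 (toℕ z′)) ≡ I g (new 1 (toℕ z′))
                  same₁ = update-other (I g₁) {new 1 (toℕ z)} {y = new 1 (toℕ z′)} (z′≢z ∘ Fin.toℕ-injective ∘ cong Loc.l)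
                  same₂ : I (written z m f g) (new 2 (toℕ z′)) ≡ I g (new 2 (toℕ z′))
                  same₂ = update-other (I g) {new 2 (toℕ z)} {y = new 2 (toℕ z′)} (z′≢z ∘ Fin.toℕ-injective ∘ cong Loc.l)
                  go nothing e = trans same₁ e
                  go (just _) (e , e′) = trans same₁ e , trans same₂ e′
              Post : Fin n → Mem → Mem → Set ℓ
              Post z g g′ = Improving g₀ x g′ × NextOk z g′ × (∀ z′ → z′ ≢ z → NextOk z′ g → NextOk z′ g′)
              body : ∀ z g → Improving g₀ x g → wp improveNext (ρ₁₅ [ 15 ≔ toℕ z ]) (Post z g) g
              body z g im = go (next b z) (Walked.nexts wb z) (next a z) (Walked.nexts wa z) (next-◅◅ a b z)
                where
                open Improving im
                fb = I g (loc 1 κ (toℕ w) (toℕ v) (toℕ z))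
                nb = I g (loc 2 κ (toℕ w) (toℕ v) (toℕ z))
                fa = I g (loc 1 κ (toℕ u) (toℕ w) (toℕ z))
                na = I g (loc 2 κ (toℕ u) (toℕ w) (toℕ z))
                fb≡ : ∀ {m} → I g₀ (loc 1 κ (toℕ w) (toℕ v) (toℕ z)) ≡ m → fb ≡ m
                fb≡ = trans (levelI 1 κ _ _ _ κ≢)
                go : ∀ mb → NextRep g₀ κ w v (toℕ z) mb → ∀ ma → NextRep g₀ κ u w (toℕ z) ma → next (a ◅◅ b) z ≡ mb <∣> ma →
                     (0 < fb → Post z g (written z nb 1 g)) × (¬ 0 < fb → Post z g (written z na fa g))
                go (just m) (eb , eb′) ma ra eq = (λ _ → improving z nb 1 g im ,
                    lift (subst (NextRep (written z nb 1 g) (suc κ) u v (toℕ z)) (sym eq) (at₁ z nb 1 g , trans (at₂ z nb 1 g) (trans (levelI 2 κ _ _ _ κ≢) eb′))) , keep z nb 1 g) ,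
                  (λ ≮ → ⊥-elim (≮ (subst (0 <_) (sym (fb≡ eb)) (s≤s z≤n))))
                go nothing eb nothing ea eq = (λ lt → ⊥-elim (ℕ.<-irrefl refl (subst (0 <_) (fb≡ eb) lt))) ,
                  (λ _ → improving z na fa g im , lift (subst (NextRep (written z na fa g) (suc κ) u v (toℕ z)) (sym eq)
                     (trans (at₁ z na fa g) (trans (levelI 1 κ _ _ _ κ≢) ea))) , keep z na fa g)
                go nothing eb (just m) (ea , ea′) eq = (λ lt → ⊥-elim (ℕ.<-irrefl refl (subst (0 <_) (fb≡ eb) lt))) ,
                  (λ _ → improving z na fa g im , lift (subst (NextRep (written z na fa g) (suc κ) u v (toℕ z)) (sym eq)
                     (trans (at₁ z na fa g) (trans (levelI 1 κ _ _ _ κ≢) ea) , trans (at₂ z na fa g) (trans (levelI 2 κ _ _ _ κ≢) ea′))) , keep z na fa g)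

            improve-ok : R g₀ (loc 3 0 0 0 0) ≈ᵣ weight G y (a ◅◅ b) → x ≡ R g₀ (loc 3 0 0 0 0) →
                         wp improve ρ₁₅ (λ g′ → Entry y g′ (suc κ) u v (just (a ◅◅ b))) g₀
            improve-ok temp≈ refl = wp-mono (loop {15} widthPar improveCoeff) ρ₁₅ (λ g₁ ((im₁ , co) , _) →
                wp-mono (loop {15} vertexPar improveNext) ρ₁₅ (λ g₂ ((im₂ , nx) , fr) →
                  record { marked = Improving.marked im₂ ; nexts = λ z → lower (nx z)
                         ; coeffs≈ = λ l → ≈-trans (≈-reflexive (proj₂ fr (new 0 (toℕ l)) refl)) (lower (co l)) } ,
                  lift (≈-trans (≈-reflexive (Improving.value≡ im₂)) temp≈)) g₁
                 (wp-frame (loop {15} vertexPar improveNext) ρ₁₅ g₁ (improveNext-ok g₁ im₁))) start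
               (wp-frame (loop {15} widthPar improveCoeff) ρ₁₅ start (improveCoeff-ok start (record
                 { levelI = λ a k j m l k≢ → update-other (I g₀) {new 0 0} {y = loc a k j m l} (k≢ ∘ cong Loc.i)
                 ; levelR = λ a k j m l k≢ → update-other (R g₀) {new 1 0} {y = loc a k j m l} (k≢ ∘ cong Loc.i)
                 ; marked = update-same (I g₀) (new 0 0) ; value≡ = update-same (R g₀) (new 1 0) })))
              where
              start = writeR (new 1 0) x (writeI (new 0 0) 1 g₀)

          private
            flag-<⇒⊥ : ∀ {m} → m ≡ 0 → 0 < m → ⊥
            flag-<⇒⊥ refl ()

            flag-≮⇒⊥ : ∀ {m} → m ≡ 1 → ¬ 0 < m → ⊥
            flag-≮⇒⊥ refl ≮ = ≮ (s≤s z≤n)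

          relax-ok : ∀ m₁ m₂ acc g → Entry y g κ u w m₁ → Entry y g κ w v m₂ → Entry y g (suc κ) u v acc →
                     wp relax ρ₁₂ (λ g′ → Entry y g′ (suc κ) u v (better y acc (concat m₁ m₂))) g
          relax-ok nothing m₂ acc g (lift e , _) _ en = (λ lt → ⊥-elim (flag-<⇒⊥ e lt)) , λ _ → same acc en
            where
            -- `better` reduces only when the first argument is split.
            same : ∀ acc → Entry y g (suc κ) u v acc → Entry y g (suc κ) u v (better y acc nothing)
            same nothing  en = en
            same (just f) en = en
          relax-ok (just a) nothing acc g (wa , _) (lift e , _) en = (λ _ → (λ lt → ⊥-elim (flag-<⇒⊥ e lt)) , λ _ → same acc en) , λ ≮ → ⊥-elim (flag-≮⇒⊥ (Walked.marked wa) ≮)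
            where
            same : ∀ acc → Entry y g (suc κ) u v acc → Entry y g (suc κ) u v (better y acc nothing)
            same nothing  en = en
            same (just f) en = en
          relax-ok (just a) (just b) acc g (wa , lift va) (wb , lift vb) en =
            (λ _ → (λ _ → go acc en) , λ ≮ → ⊥-elim (flag-≮⇒⊥ (Walked.marked wb) ≮)) , λ ≮ → ⊥-elim (flag-≮⇒⊥ (Walked.marked wa) ≮)
            where
            x = R g (valueCell κ u w) +ᵣ R g (valueCell κ w v)
            g₁ = writeR (loc 3 0 0 0 0) x g
            ρ₁₅ : Env
            ρ₁₅ = ρ₁₂ [ 12 ≔ I g (loc 0 κ (toℕ u) (toℕ w) 0) ] [ 13 ≔ I g (loc 0 κ (toℕ w) (toℕ v) 0) ] [ 14 ≔ I g (new 0 0) ]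
            x≈ : x ≈ᵣ weight G y (a ◅◅ b)
            x≈ = ≈-trans (+ᵣ-cong va vb) (≈-sym (weight-◅◅ y a b))
            improved : wp improve ρ₁₅ (λ g′ → Entry y g′ (suc κ) u v (just (a ◅◅ b))) g₁
            improved = improve-ok a b g₁
              (record { marked = Walked.marked wa ; coeffs≈ = Walked.coeffs≈ wa ; nexts = nexts₁ wa })
              (record { marked = Walked.marked wb ; coeffs≈ = Walked.coeffs≈ wb ; nexts = nexts₁ wb }) x
              (I g (loc 0 κ (toℕ u) (toℕ w) 0)) (I g (loc 0 κ (toℕ w) (toℕ v) 0)) (I g (new 0 0)) x≈ refl
              where
              nexts₁ : ∀ {u v} {w : W u v} → Walked g κ w → ∀ z → NextRep g₁ κ u v (toℕ z) (next w z)
              nexts₁ {w = w} st z with next w z | Walked.nexts st z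
              ... | nothing | e = e
              ... | just _  | e = e
            go : ∀ acc → Entry y g (suc κ) u v acc →
                 wp (ifI zero (# 14) (ifR temp (value (# 7) (# 9) (# 10) zero) improve skip) improve) ρ₁₅
                    (λ g′ → Entry y g′ (suc κ) u v (better y acc (just (a ◅◅ b)))) g₁
            go nothing (lift e , _) = (λ lt → ⊥-elim (flag-<⇒⊥ e lt)) , λ _ → improved
            go (just f) (st , lift vf) = (λ _ → decide (weight G y (a ◅◅ b) <?ᵣ weight G y f)) , λ ≮ → ⊥-elim (flag-≮⇒⊥ (Walked.marked st) ≮)
              where
              P : Maybe (W u v) → Mem → Set ℓ
              P m g′ = Entry y g′ (suc κ) u v m
              decide : Dec (weight G y (a ◅◅ b) <ᵣ weight G y f) →
                wp (ifR temp (value (# 7) (# 9) (# 10) zero) improve skip) ρ₁₅ (P (better y (just f) (just (a ◅◅ b)))) g₁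
              decide (yes lt) = subst (λ m → wp (ifR temp (value (# 7) (# 9) (# 10) zero) improve skip) ρ₁₅ (P m) g₁)
                (cong (if_then just (a ◅◅ b) else just f) (sym (dec-true (weight G y (a ◅◅ b) <?ᵣ weight G y f) lt)))
                ((λ _ → improved) , λ ≮ → ⊥-elim (≮ (<-resp (≈-sym x≈) (≈-sym vf) lt)))
              decide (no ≮) = subst (λ m → wp (ifR temp (value (# 7) (# 9) (# 10) zero) improve skip) ρ₁₅ (P m) g₁)
                (cong (if_then just (a ◅◅ b) else just f) (sym (dec-false (weight G y (a ◅◅ b) <?ᵣ weight G y f) ≮)))
                ((λ lt → ⊥-elim (≮ (<-resp x≈ vf lt))) ,
                 λ _ → entry-agree g g₁ (just f) (agree (λ _ _ _ → refl) (λ { 0 l _ → refl ; 1 l _ → refl ; (suc (suc _)) l (s≤s (s≤s ())) })) (st , lift vf))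

        relax-touches : ∀ w → Touches relax (ρ₁₁ [ 11 ≔ w ]) (OwnI (suc κ) u v) (OwnR (suc κ) u v)
        relax-touches w = λ e₁ → (λ e₂ → ((λ { (s≤s (s≤s ())) }) , λ e₃ → (imp e₁ e₂ e₃ , tt) , imp e₁ e₂ e₃) , tt) , tt
          where
          own : ∀ {A : Set} → A → suc κ ≡ suc κ × toℕ u ≡ toℕ u × toℕ v ≡ toℕ v
          own _ = refl , refl , refl
          imp : ∀ e₁ e₂ e₃ → Touches improve (ρ₁₁ [ 11 ≔ w ] [ 12 ≔ e₁ ] [ 13 ≔ e₂ ] [ 14 ≔ e₃ ]) (OwnI (suc κ) u v) (OwnR (suc κ) u v)
          imp _ _ _ = own , own , (λ _ → own) , (λ _ _ → (λ _ → own , own) , (λ _ _ → own , own))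

        LevelOk : ℕ → Mem → Set ℓ
        LevelOk k g = ∀ u v → Entry y g k u v (table y k u v)

        private
          other-levels : ∀ {g g′} → Same (OwnI (suc κ) u v) (OwnR (suc κ) u v) g g′ → ∀ {k} → k ≤ κ → LevelOk k g → LevelOk k g′
          other-levels {g} {g′} same {k} k≤κ lv u′ v′ = entry-agree g g′ (table y k u′ v′) (own-agree (λ (e , _) → ℕ.<⇒≢ (s≤s k≤κ) e) same) (lv u′ v′)

        -- The loop counter is the counter of `best`, so after `n` rounds the entry is that of
        -- `step` by definition.
        fillPair-ok : ∀ g → LevelOk κ g → wp fillPair ρ₁₁ (λ g′ → Entry y g′ (suc κ) u v (table y (suc κ) u v)) g
        fillPair-ok g lv = wp-loop {11} vertexPar relax ρ₁₁ Inv (lv₁ , lift (update-same (I g) (new 0 0)) , _) body (λ g′ → proj₂)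
          where
          Inv : ℕ → Mem → Set ℓ
          Inv i g = LevelOk κ g × Entry y g (suc κ) u v (best y (table y κ) u v i)
          lv₁ : LevelOk κ (writeI (new 0 0) 0 g)
          lv₁ u′ v′ = entry-agree g _ (table y κ u′ v′) (agree (λ a l _ → update-other (I g) {new 0 0} {y = loc a κ (toℕ u′) (toℕ v′) l} (λ eq → ℕ.<⇒≢ ℕ.≤-refl (cong Loc.i eq))) (λ _ _ _ → refl)) (lv u′ v′)
          body : ∀ i g → i < n → Inv i g → wp relax (ρ₁₁ [ 11 ≔ i ]) (Inv (suc i)) g
          body i g i<n (lv , en) = subst (λ j → Entry y g (suc κ) u v (best y (table y κ) u v j) → wp relax (ρ₁₁ [ 11 ≔ j ]) (Inv (suc j)) g) (Fin.toℕ-fromℕ< i<n) (at-vertex (fromℕ< i<n)) en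
            where
            at-vertex : ∀ w → Entry y g (suc κ) u v (best y (table y κ) u v (toℕ w)) → wp relax (ρ₁₁ [ 11 ≔ toℕ w ]) (Inv (suc (toℕ w))) g
            at-vertex w en = wp-mono relax (Via.ρ₁₂ w) {Q = λ g′ → P g′ × Same (OwnI (suc κ) u v) (OwnR (suc κ) u v) g g′} (λ g′ (en′ , same) → other-levels same ℕ.≤-refl lv ,
                subst (λ m → Entry y g′ (suc κ) u v (better y (best y (table y κ) u v (toℕ w)) m)) (sym (candidate-toℕ (table y κ) u v w)) en′) g
              (wp-touch relax (Via.ρ₁₂ w) {Q = P} (relax-touches (toℕ w)) g (Via.relax-ok w (table y κ u w) (table y κ w v) (best y (table y κ) u v (toℕ w)) g (lv u w) (lv w v) en))
              where
              P : Mem → Set ℓ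
              P g′ = Entry y g′ (suc κ) u v (better y (best y (table y κ) u v (toℕ w)) (concat (table y κ u w) (table y κ w v)))

        fillPair-touches : Touches fillPair ρ₁₁ (OwnI (suc κ) u v) (OwnR (suc κ) u v)
        fillPair-touches = (λ _ → refl , refl , refl) , relax-touches

        pair-other : ∀ {g g′} → Same (OwnI (suc κ) u v) (OwnR (suc κ) u v) g g′ → ∀ {k} → k ≤ κ → LevelOk k g → LevelOk k g′
        pair-other = other-levels

      Levels : ℕ → Mem → Set ℓ
      Levels m g = ∀ k → k ≤ m → ∀ u v → Entry y g k u v (table y k u v)

      fillLevel-ok : ∀ κ g → Levels κ g → wp fillLevel (ρ₇ i it [ 7 ≔ suc κ ]) (Levels (suc κ)) g
      fillLevel-ok κ g lv = (λ _ → wp-mono (loop {9} vertexPar (loop {10} vertexPar fillPair)) ρ₉ (λ g′ (lv′ , new) k k≤ → extend g′ lv′ new k k≤) g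
          (wp-pairs {9} fillPair ρ₉ (OwnI (suc κ)) (OwnR (suc κ)) (Levels κ) (λ u v g → Entry y g (suc κ) u v (table y (suc κ) u v))
            (λ u v same lv k k≤ → Doubling.pair-other κ u v same k≤ (lv k k≤))
            (λ u v u′ v′ {g} {g′} diff same en → entry-agree g g′ (table y (suc κ) u′ v′) (own-agree (diff ∘ proj₂) same) en)
            (Doubling.fillPair-touches κ) (λ u v g lv → Doubling.fillPair-ok κ u v g (lv κ ℕ.≤-refl)) g lv)) ,
        λ ≮ → ⊥-elim (≮ (s≤s z≤n))
        where
        ρ₉ : Env
        ρ₉ = ρ₇ i it [ 7 ≔ suc κ ] [ 8 ≔ κ ]
        extend : ∀ g′ → Levels κ g′ → (∀ u v → Entry y g′ (suc κ) u v (table y (suc κ) u v)) → Levels (suc κ) g′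
        extend g′ lv′ new k k≤ with ℕ.m≤n⇒m<n∨m≡n k≤
        ... | inj₁ k< = lv′ k (ℕ.≤-pred k<)
        ... | inj₂ refl = new

      fill-ok : ∀ g → AtPoint y g → (∀ u v → Static g 0 u v (table₀ u v)) → Ensures fill (ρ₇ i it) (Levels K) g
      fill-ok g pt st = ensures (
        wp-seq (loop {7} widthPar power) (loop {7} vertexPar (loop {8} vertexPar evaluate) ⨾ loop {7} levelPar fillLevel) (ρ₇ i it)
          (λ g′ → AtPoint y g′ × PowersUpTo y (suc q) g′) (Levels K) g (power-ok y (ρ₇ i it) g refl pt) λ g₁ (pt₁ , ps₁) fr →
        wp-seq (loop {7} vertexPar (loop {8} vertexPar evaluate)) (loop {7} levelPar fillLevel) (ρ₇ i it)
          (λ g′ → ∀ u v → Entry y g′ 0 u v (table₀ u v)) (Levels K) g₁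
          (evaluateAll-ok g₁ (pt₁ , ps₁ , λ u v → static-agree g g₁ (table₀ u v) (agree-static (frame-agree refl refl refl refl refl fr 0 (toℕ u) (toℕ v))) (st u v))) λ g₂ en _ →
        -- Level 0 is complete before the loop and round 0 is idle, so before round `j` the levels
        -- up to `j ∸ 1` are complete.
        wp-loop {7} levelPar fillLevel (ρ₇ i it) (λ j → Levels (j ∸ 1)) (λ { zero z≤n → en }) body (λ _ lv → lv))
        where
        body : ∀ j g → j < suc K → Levels (j ∸ 1) g → wp fillLevel (ρ₇ i it [ 7 ≔ j ]) (Levels j) g
        body zero    g _ lv = (λ ()) , λ _ → lv
        body (suc κ) g _ lv = fillLevel-ok κ g lv

    LoRep HiRep : Mem → Maybe Carrier → Set ℓ
    LoRep g nothing  = Lift ℓ (I g (loc 7 0 0 0 0) ≡ 0)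
    LoRep g (just x) = Lift ℓ (I g (loc 7 0 0 0 0) ≡ 1 × R g (loc 8 0 0 0 0) ≡ x)
    HiRep g nothing  = Lift ℓ (I g (loc 6 0 0 0 0) ≡ 0)
    HiRep g (just x) = Lift ℓ (I g (loc 6 0 0 0 0) ≡ 1 × R g (loc 7 0 0 0 0) ≡ x)

    setPoint-ok : ∀ i it lo hi g → LoRep g lo → HiRep g hi → wp setPoint (ρ₇ i it) (AtPoint (sample lo hi)) g
    setPoint-ok i it nothing nothing g (lift e) (lift e′) rewrite e | e′ = (λ ()) , λ _ → (λ ()) , λ _ → lift refl
    setPoint-ok i it nothing (just h) g (lift e) (lift (e′ , r′)) rewrite e | e′ =
      (λ ()) , λ _ → (λ _ → lift (cong (_-ᵣ 1#) r′)) , λ ≮ → ⊥-elim (≮ (s≤s z≤n))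
    setPoint-ok i it (just l) nothing g (lift (e , r)) (lift e′) rewrite e | e′ =
      (λ _ → (λ ()) , λ _ → lift (cong (_+ᵣ 1#) r)) , λ ≮ → ⊥-elim (≮ (s≤s z≤n))
    setPoint-ok i it (just l) (just h) g (lift (e , r)) (lift (e′ , r′)) rewrite e | e′ =
      (λ _ → (λ _ → lift (cong₂ (λ l h → (l +ᵣ h) ÷ᵣ (1# +ᵣ 1#)) r r′)) , λ ≮ → ⊥-elim (≮ (s≤s z≤n))) , λ ≮ → ⊥-elim (≮ (s≤s z≤n))

    setPoint-ensures : ∀ i it lo hi g → LoRep g lo → HiRep g hi → Ensures setPoint (ρ₇ i it) (AtPoint (sample lo hi)) g
    setPoint-ensures i it lo hi g lr hr = ensures (setPoint-ok i it lo hi g lr hr)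

  updates-lookup : ∀ {a} {A : Set a} (m : Loc → A) b l vs (i : Fin (length vs)) → updates m b l vs (loc b 0 0 0 (l + toℕ i)) ≡ lookup vs i
  updates-lookup m b l (v ∷ vs) zero rewrite ℕ.+-identityʳ l = update-same (updates m b (suc l) vs) (loc b 0 0 0 l)
  updates-lookup m b l (v ∷ vs) (suc i) = trans
    (update-other (updates m b (suc l) vs) {loc b 0 0 0 l} {y = loc b 0 0 0 (l + suc (toℕ i))} (λ eq → ℕ.m≢1+m+n l (trans (sym (cong Loc.l eq)) (ℕ.+-suc l (toℕ i)))))
    (trans (cong (λ j → updates m b (suc l) vs (loc b 0 0 0 j)) (ℕ.+-suc l (toℕ i))) (updates-lookup m b (suc l) vs i))

  -- Shrinking a cell by comparison roots.

  module Sweep {c ℓ₁ ℓ₂} (ℝ : CompleteOrderedField c ℓ₁ ℓ₂) (F : RootFinder ℝ)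
      {n q : ℕ} (G : Graphs.Graph ℝ n q) (s t : Fin n) (K B : ℕ) where
    open CompleteOrderedField ℝ using (Carrier; 0#; 1#; Polynomial; IsRootList; eval)
      renaming (_≈_ to _≈ᵣ_; _<_ to _<ᵣ_; _<?_ to _<?ᵣ_; _+_ to _+ᵣ_; _-_ to _-ᵣ_; refl to ≈-refl; sym to ≈-sym; trans to ≈-trans;
                reflexive to ≈-reflexive; +-cong to +ᵣ-cong; -‿cong to -ᵣ-cong)
    open OrderedField ℝ using (<-resp; <-irrefl) renaming (<-trans to <ᵣ-trans)
    open Polynomials ℝ using (eval-cong)
    open Graphs ℝ
    open Walks ℝ G
    open Preprocessing hiding (lo; hi)
    open Tables ℝ F G s t K B

    module Comparing (i it : ℕ) (lo hi₀ : Maybe Carrier) where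
      y : Carrier
      y = sample lo hi₀

      open Filling i it y using (Levels)

      Found : Maybe Carrier → Set (c ⊔ ℓ₁ ⊔ ℓ₂)
      Found nothing  = Lift (c ⊔ ℓ₁ ⊔ ℓ₂) ⊥
      Found (just h) = ComparisonRoot K y h × Above lo h × Below hi₀ h

      -- The tables and the sample stay those of the right end `hi₀` with which the pass began,
      -- while the stored right end `hi` moves. `origin` remembers that a new end is a comparison
      -- root for that sample.
      record State (g : Mem) : Set ℓ where
        field
          levels : Levels K g
          loRep  : LoRep g lo
          {hi}   : Maybe Carrier
          hiRep  : HiRep g hi
          origin : hi ≡ hi₀ ⊎ Found hi

      record _≾_ (g g′ : Mem) : Set ℓ where
        constructor narrowing
        field narrow : ∀ hi → HiRep g hi → ∃[ hi′ ] HiRep g′ hi′ × (∀ r → Below hi′ r → Below hi r)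

      -- The roots in `P` have been dealt with: none lies strictly inside the cell any more. As the
      -- right end only moves to the left, this persists.
      Passed : (Carrier → Set (c ⊔ ℓ₁)) → Mem → Set ℓ
      Passed P g = ∃[ hi ] HiRep g hi × (∀ r → P r → Above lo r → ¬ Below hi r)

      hi-unique : ∀ {g} a b → HiRep g a → HiRep g b → a ≡ b
      hi-unique nothing  nothing  _ _ = refl
      hi-unique nothing  (just _) (lift e) (lift (e′ , _)) with () ← trans (sym e) e′
      hi-unique (just _) nothing  (lift (e , _)) (lift e′) with () ← trans (sym e) e′
      hi-unique (just _) (just _) (lift (_ , e)) (lift (_ , e′)) = cong just (trans (sym e) e′)

      ≾-refl : ∀ {g} → g ≾ g
      ≾-refl = narrowing λ hi rep → hi , rep , λ _ b → b

      ≾-trans : ∀ {g g′ g″} → g ≾ g′ → g′ ≾ g″ → g ≾ g″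
      ≾-trans (narrowing p) (narrowing p′) = narrowing λ hi rep →
        let hi′ , rep′ , f = p hi rep
            hi″ , rep″ , f′ = p′ hi′ rep′
        in hi″ , rep″ , λ r → f r ∘ f′ r

      passed-up : ∀ P {g g′} → g ≾ g′ → Passed P g → Passed P g′
      passed-up P (narrowing p) (hi , rep , passed) with p hi rep
      ... | hi′ , rep′ , f = hi′ , rep′ , λ r Pr lo<r → passed r Pr lo<r ∘ f r

      passed-all : ∀ {A : Set} (P : A → Carrier → Set (c ⊔ ℓ₁)) {g} → State g → (∀ x → Passed (P x) g) → Passed (λ r → ∃[ x ] P x r) g
      passed-all P {g} st all = State.hi st , State.hiRep st , λ { r (x , Pr) lo<r below → let hi , rep , h = all x in
        h r Pr lo<r (subst (λ hi → Below hi r) (hi-unique (State.hi st) hi (State.hiRep st) rep) below) }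

      hiRep-frame : ∀ {bI bR g g′} hi → bI 6 ≡ false → bR 7 ≡ false → Frame bI bR g g′ → HiRep g hi → HiRep g′ hi
      hiRep-frame nothing  e e′ (p , r) (lift f)       = lift (trans (p _ e) f)
      hiRep-frame (just _) e e′ (p , r) (lift (f , f′)) = lift (trans (p _ e) f , trans (r _ e′) f′)

      loRep-frame : ∀ {bI bR g g′} lo → bI 7 ≡ false → bR 8 ≡ false → Frame bI bR g g′ → LoRep g lo → LoRep g′ lo
      loRep-frame nothing  e e′ (p , r) (lift f)       = lift (trans (p _ e) f)
      loRep-frame (just _) e e′ (p , r) (lift (f , f′)) = lift (trans (p _ e) f , trans (r _ e′) f′)

      levels-agree : ∀ {g g′} → (∀ k u v → AgreeAt k u v g g′) → Levels K g → Levels K g′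
      levels-agree {g} {g′} ag lv k k≤ u v = entry-agree g g′ (table y k u v) (ag k (toℕ u) (toℕ v)) (lv k k≤ u v)

      private
        flag-<⇒⊥ : ∀ {m} → m ≡ 0 → 0 < m → ⊥
        flag-<⇒⊥ refl ()

        flag-≮⇒⊥ : ∀ {m} → m ≡ 1 → ¬ 0 < m → ⊥
        flag-≮⇒⊥ refl ≮ = ≮ (s≤s z≤n)

      ρ₁₂ : ℕ → Fin n → Fin n → Fin n → Env
      ρ₁₂ κ u v w = ρ₇ i it [ 7 ≔ suc κ ] [ 8 ≔ κ ] [ 9 ≔ toℕ u ] [ 10 ≔ toℕ v ] [ 11 ≔ toℕ w ]

      module Consider (κ : ℕ) (u v w : Fin n) (e₁ e₂ m j : ℕ) where
        private
          ρ₁₆ : Env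
          ρ₁₆ = ρ₁₂ κ u v w [ 12 ≔ e₁ ] [ 13 ≔ e₂ ] [ 14 ≔ m ] [ 15 ≔ j ]

        module _ (g : Mem) (st : State g) (x : Carrier) (x≡ : R g (loc 5 0 0 0 j) ≡ x) (x-root : ComparisonRoot K y x) where
          open State st

          Considered : Mem → Set ℓ
          Considered g′ = State g′ × g ≾ g′ × Passed (λ r → Lift (c ⊔ ℓ₁) (r ≡ x)) g′

          unchanged : (Above lo x → ¬ Below hi x) → Considered g
          unchanged h = st , ≾-refl , hi , hiRep , λ { r (lift refl) → h }

          lower-ok : Above lo x → Below hi x → Considered (writeI (loc 6 0 0 0 0) 1 (writeR (loc 7 0 0 0 0) (R g (loc 5 0 0 0 j)) g))
          lower-ok lo<x x<hi = record
              { levels = levels-agree (λ k u v → agree (λ { 0 l _ → refl ; 1 l _ → refl ; 2 l _ → refl ; (suc (suc (suc _))) l (s≤s (s≤s (s≤s ()))) })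
                                                         (λ { 0 l _ → refl ; 1 l _ → refl ; (suc (suc _)) l (s≤s (s≤s ())) })) levels
              ; loRep = lo-same lo loRep ; hi = just x ; hiRep = lift (refl , x≡)
              ; origin = inj₂ (x-root , lo<x , below₀ origin) } ,
            narrowing (λ hi′ rep → just x , lift (refl , x≡) , λ r r<x → subst (λ hi → Below hi r) (hi-unique hi hi′ hiRep rep) (below-trans hi x<hi r<x)) ,
            just x , lift (refl , x≡) , λ { r (lift refl) _ → <-irrefl ≈-refl }
            where
            g′ = writeI (loc 6 0 0 0 0) 1 (writeR (loc 7 0 0 0 0) (R g (loc 5 0 0 0 j)) g)
            lo-same : ∀ lo → LoRep g lo → LoRep g′ lo
            lo-same nothing  r = r
            lo-same (just _) r = r
            below₀ : hi ≡ hi₀ ⊎ Found hi → Below hi₀ x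
            below₀ (inj₁ refl) = x<hi
            below₀ (inj₂ found) = go hi found x<hi
              where
              go : ∀ hi → Found hi → Below hi x → Below hi₀ x
              go (just h) (_ , _ , h<hi₀) x<h = below-trans hi₀ h<hi₀ x<h

          considerHi-ok : ∀ e → Above lo x → wp considerHi (ρ₁₆ [ 16 ≔ e ]) Considered g
          considerHi-ok e lo<x = go hi hiRep (λ b → b)
            where
            go : ∀ hi′ → HiRep g hi′ → (Below hi′ x → Below hi′ x) → wp considerHi (ρ₁₆ [ 16 ≔ e ]) Considered g
            go nothing rep@(lift e) _ = (λ lt → ⊥-elim (flag-<⇒⊥ e lt)) , λ _ → lower-ok lo<x (subst (λ hi → Below hi x) (hi-unique nothing hi rep hiRep) _)
            go (just h) rep@(lift (e , r)) _ = (λ _ → (λ lt → lower-ok lo<x (subst (λ hi → Below hi x) (hi-unique (just h) hi rep hiRep) (subst₂ _<ᵣ_ x≡ r lt))) ,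
                (λ ≮ → unchanged (λ _ below → ≮ (subst₂ _<ᵣ_ (sym x≡) (sym r) (subst (λ hi → Below hi x) (hi-unique hi (just h) hiRep rep) below))))) ,
              λ ≮ → ⊥-elim (flag-≮⇒⊥ e ≮)

          consider-ok : j < m → wp consider ρ₁₆ Considered g
          consider-ok j<m = (λ _ → go lo loRep (λ a → a) (λ a → a)) , λ ≮ → ⊥-elim (≮ j<m)
            where
            e = I g (loc 7 0 0 0 0)
            go : ∀ lo′ → LoRep g lo′ → (Above lo′ x → Above lo x) → (Above lo x → Above lo′ x) →
                 wp (ifI zero (# 16) (ifR Preprocessing.lo (rootCells (# 15)) considerHi skip) considerHi) (ρ₁₆ [ 16 ≔ e ]) Considered g
            go nothing (lift e≡0) f f′ = (λ lt → ⊥-elim (flag-<⇒⊥ e≡0 lt)) , λ _ → considerHi-ok e (f _)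
            go (just l) (lift (e≡1 , r)) f f′ = (λ _ → (λ lt → considerHi-ok e (f (subst₂ _<ᵣ_ r x≡ lt))) ,
                (λ ≮ → unchanged (λ lo<x _ → ≮ (subst₂ _<ᵣ_ (sym r) (sym x≡) (f′ lo<x))))) ,
              λ ≮ → ⊥-elim (flag-≮⇒⊥ e≡1 ≮)

      RootVia : ℕ → Fin n → Fin n → Fin n → Carrier → Set (c ⊔ ℓ₁)
      RootVia κ u v w r = ∃[ a ] ∃[ b ] (concat (table y κ u w) (table y κ w v) ≡ just a × table y (suc κ) u v ≡ just b ×
                          NonZero (difference a b) × eval (difference a b) r ≈ᵣ 0#)

      module Via (κ : ℕ) (κ<K : κ < K) (u v w : Fin n) where
        Post : Mem → Mem → Set ℓ
        Post g g′ = State g′ × g ≾ g′ × Passed (RootVia κ u v w) g′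

        vacuous : ∀ {g} → State g → concat (table y κ u w) (table y κ w v) ≡ nothing → Post g g
        vacuous st eq = st , ≾-refl , State.hi st , State.hiRep st , λ { r (a , b , eqa , _) → ⊥-elim (absurd (trans (sym eq) eqa)) }
          where
          absurd : ∀ {A : Set c} {x : A} → nothing ≡ just x → ⊥
          absurd ()

        module _ (e₁ e₂ : ℕ) (a : W u w) (b : W w v) (f : W u v) (eqc : concat (table y κ u w) (table y κ w v) ≡ just (a ◅◅ b))
                 (eqf : table y (suc κ) u v ≡ just f) where
          private
            ρ₁₄ : Env
            ρ₁₄ = ρ₁₂ κ u v w [ 12 ≔ e₁ ] [ 13 ≔ e₂ ]

            d : Polynomial q
            d = difference (a ◅◅ b) f

            DiffOk : Fin (suc q) → Mem → Set ℓ
            DiffOk l g = Lift ℓ (R g (loc 4 0 0 0 (toℕ l)) ≈ᵣ d l)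

          subtract-ok : ∀ g → Walked g κ a → Walked g κ b → Walked g (suc κ) f →
                        wp (loop {14} widthPar subtract) ρ₁₄ (λ g′ → ∀ l → DiffOk l g′) g
          subtract-ok g wa wb wf = wp-mono (loop {14} widthPar subtract) ρ₁₄ (λ _ → proj₂) g
            (wp-each {14} widthPar subtract ρ₁₄ (λ g′ → Lift ℓ (∀ k j m l → R g′ (loc 0 k j m l) ≡ R g (loc 0 k j m l))) DiffOk (lift (λ _ _ _ _ → refl))
              λ l g′ (lift same) → lift same ,
                lift (≈-trans (≈-reflexive (update-same (R (temp-written l g′)) (loc 4 0 0 0 (toℕ l)))) (+ᵣ-cong
                  (≈-trans (+ᵣ-cong (≈-trans (≈-reflexive (same κ _ _ _)) (Walked.coeffs≈ wa l)) (≈-trans (≈-reflexive (same κ _ _ _)) (Walked.coeffs≈ wb l))) (≈-sym (coefs-◅◅ a b l)))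
                  (-ᵣ-cong (≈-trans (≈-reflexive (same (suc κ) _ _ _)) (Walked.coeffs≈ wf l))))) ,
                λ l′ l′≢l (lift e) → lift (≈-trans (≈-reflexive (update-other (R (temp-written l g′)) {loc 4 0 0 0 (toℕ l)} {y = loc 4 0 0 0 (toℕ l′)} (l′≢l ∘ Fin.toℕ-injective ∘ cong Loc.l))) e))
            where
            temp-written : Fin (suc q) → Mem → Mem
            temp-written l g′ = writeR (loc 3 0 0 0 0) (R g′ (loc 0 κ (toℕ u) (toℕ w) (toℕ l)) +ᵣ R g′ (loc 0 κ (toℕ w) (toℕ v) (toℕ l))) g′

          module _ (g : Mem) (rs : List Carrier) (diff : ∀ l → DiffOk l g) (rs-ok : RootsOf {q} (λ i → R g (loc 4 0 0 0 (toℕ i))) rs)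
                   (len : length rs ≤ q) where
            private
              p : Polynomial q
              p i = R g (loc 4 0 0 0 (toℕ i))

              eval≈ : ∀ x → eval p x ≈ᵣ eval d x
              eval≈ x = eval-cong {p = p} {p′ = d} (λ i → lower (diff i)) ≈-refl

              root : ∀ idx → ComparisonRoot K y (lookup rs idx)
              root idx with Polynomials.zero⊎nonzero ℝ p
              ... | inj₁ p≈0 with refl ← proj₁ rs-ok p≈0 with () ← idx
              ... | inj₂ (l , pl≉0) = κ , κ<K , u , v , w , a ◅◅ b , f , eqc , eqf ,
                (l , λ dl≈0 → pl≉0 (≈-trans (lower (diff l)) dl≈0)) ,
                ≈-trans (≈-sym (eval≈ _)) (All.lookup (IsRootList.sound (proj₂ rs-ok (l , pl≉0))) (∈-lookup idx))

              J : Mem → Set ℓ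
              J g′ = State g′ × Lift ℓ (∀ idx → R g′ (loc 5 0 0 0 (toℕ idx)) ≡ lookup rs idx)

              At : Fin (suc q) → Carrier → Set (c ⊔ ℓ₁)
              At j r = Lift (c ⊔ ℓ₁) (∃[ idx ] toℕ {length rs} idx ≡ toℕ j × r ≡ lookup rs idx)

            scan-ok : ∀ g₂ → J g₂ → wp (loop {15} widthPar consider) (ρ₁₄ [ 14 ≔ length rs ]) (Post g₂) g₂
            scan-ok g₂ j₂ = wp-mono (loop {15} widthPar consider) (ρ₁₄ [ 14 ≔ length rs ])
                (λ g′ ((st′ , _) , p , all) → st′ , p , finish g′ st′ (passed-all At st′ all)) g₂
              (wp-sweep {15} widthPar consider (ρ₁₄ [ 14 ≔ length rs ]) J _≾_ (λ j → Passed (At j)) ≾-refl ≾-trans (λ j → passed-up (At j)) j₂ body)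
              where
              body : ∀ j g′ → J g′ → wp consider (ρ₁₄ [ 14 ≔ length rs ] [ 15 ≔ toℕ j ]) (λ g″ → J g″ × g′ ≾ g″ × Passed (At j) g″) g′
              body j g′ (st , lift cells) with toℕ j <? length rs
              ... | no j≮ = (λ lt → ⊥-elim (j≮ lt)) , λ _ → (st , lift cells) , ≾-refl , State.hi st , State.hiRep st ,
                    λ { r (lift (idx , e , _)) → ⊥-elim (j≮ (subst (_< length rs) e (Fin.toℕ<n idx))) }
              ... | yes j< = wp-mono consider ρ₁₆ {Q = λ g″ → P g″ × Frame (writesI consider) (writesR consider) g′ g″} {Q′ = λ g″ → J g″ × g′ ≾ g″ × Passed (At j) g″}
                    (λ g″ ((st″ , p , hi , rep , h) , fr) → (st″ , lift (λ idx → trans (proj₂ fr (loc 5 0 0 0 (toℕ idx)) refl) (cells idx))) , p , hi , rep ,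
                       λ { r (lift (idx , e , r≡)) → h r (lift (trans r≡ (cong (lookup rs) (Fin.toℕ-injective (trans e (sym (Fin.toℕ-fromℕ< j<))))))) }) g′
                    (wp-frame consider ρ₁₆ {Q = P} g′ (Consider.consider-ok κ u v w e₁ e₂ (length rs) (toℕ j) g′ st x x≡ (root (fromℕ< j<)) j<))
                where
                ρ₁₆ : Env
                ρ₁₆ = ρ₁₄ [ 14 ≔ length rs ] [ 15 ≔ toℕ j ]
                x = lookup rs (fromℕ< j<)
                P : Mem → Set ℓ
                P g″ = State g″ × g′ ≾ g″ × Passed (λ r → Lift (c ⊔ ℓ₁) (r ≡ x)) g″
                x≡ : R g′ (loc 5 0 0 0 (toℕ j)) ≡ x
                x≡ = trans (cong (λ k → R g′ (loc 5 0 0 0 k)) (sym (Fin.toℕ-fromℕ< j<))) (cells (fromℕ< j<))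
              finish : ∀ g′ → State g′ → Passed (λ r → ∃[ j ] At j r) g′ → Passed (RootVia κ u v w) g′
              finish g′ st (hi , rep , h) = hi , rep , λ { r (a′ , b′ , eqa , eqb , nz , e) → go r (trans (sym eqa) eqc) (trans (sym eqb) eqf) nz e }
                where
                go : ∀ r {a′ b′} → just a′ ≡ just (a ◅◅ b) → just b′ ≡ just f → NonZero (difference a′ b′) → eval (difference a′ b′) r ≈ᵣ 0# → Above lo r → ¬ Below hi r
                -- Completeness gives a list member equal to `r` only up to `≈`, so the interval
                -- conditions are transported to that member.
                go r refl refl (l , dl≉0) e lo<r r<hi = h x
                    (fromℕ< idx< , lift (idx , sym (Fin.toℕ-fromℕ< idx<) , refl)) (above-resp lo r≈x lo<r) (below-resp hi r≈x r<hi)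
                  where
                  r∈ : Any (r ≈ᵣ_) rs
                  r∈ = IsRootList.complete (proj₂ rs-ok (l , λ pl≈0 → dl≉0 (≈-trans (≈-sym (lower (diff l))) pl≈0))) r (≈-trans (eval≈ r) e)
                  idx = Any.index r∈
                  x = lookup rs idx
                  r≈x : r ≈ᵣ x
                  r≈x = Any.lookup-index r∈
                  idx< : toℕ idx < suc q
                  idx< = ℕ.<-≤-trans (Fin.toℕ<n idx) (ℕ.m≤n⇒m≤1+n len)
                  above-resp : ∀ lo {r x} → r ≈ᵣ x → Above lo r → Above lo x
                  above-resp nothing  _ _ = _
                  above-resp (just _) e a = <-resp ≈-refl e a
                  below-resp : ∀ hi {r x} → r ≈ᵣ x → Below hi r → Below hi x
                  below-resp nothing  _ _ = _
                  below-resp (just _) e a = <-resp e ≈-refl a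

        compareVia-ok : ∀ g → State g → wp compareVia (ρ₁₂ κ u v w) (Post g) g
        compareVia-ok g st = go (table y κ u w) (table y κ w v) refl refl (State.levels st κ (ℕ.<⇒≤ κ<K) u w) (State.levels st κ (ℕ.<⇒≤ κ<K) w v)
          where
          go : ∀ m₁ m₂ → table y κ u w ≡ m₁ → table y κ w v ≡ m₂ → Entry y g κ u w m₁ → Entry y g κ w v m₂ → wp compareVia (ρ₁₂ κ u v w) (Post g) g
          go nothing m₂ eq₁ eq₂ (lift e , _) _ = (λ lt → ⊥-elim (flag-<⇒⊥ e lt)) , λ _ → vacuous st (cong₂ concat eq₁ eq₂)
          go (just a) nothing eq₁ eq₂ (wa , _) (lift e , _) =
            (λ _ → (λ lt → ⊥-elim (flag-<⇒⊥ e lt)) , λ _ → vacuous st (cong₂ concat eq₁ eq₂)) , λ ≮ → ⊥-elim (flag-≮⇒⊥ (Walked.marked wa) ≮)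
          go (just a) (just b) eq₁ eq₂ (wa , _) (wb , _) =
            (λ _ → (λ _ → comparison) , λ ≮ → ⊥-elim (flag-≮⇒⊥ (Walked.marked wb) ≮)) , λ ≮ → ⊥-elim (flag-≮⇒⊥ (Walked.marked wa) ≮)
            where
            e₁ = I g (loc 0 κ (toℕ u) (toℕ w) 0)
            e₂ = I g (loc 0 κ (toℕ w) (toℕ v) 0)
            ρ₁₄ : Env
            ρ₁₄ = ρ₁₂ κ u v w [ 12 ≔ e₁ ] [ 13 ≔ e₂ ]
            eqc : concat (table y κ u w) (table y κ w v) ≡ just (a ◅◅ b)
            eqc = cong₂ concat eq₁ eq₂
            -- The candidate through `w` exists, so the entry has a winner with which it can be
            -- compared.
            final = best-minimal y (table y κ) u v n (toℕ w) (Fin.toℕ<n w) (trans (candidate-toℕ (table y κ) u v w) eqc)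
            f = proj₁ final
            eqf : table y (suc κ) u v ≡ just f
            eqf = proj₁ (proj₂ final)
            entry-f : Entry y g (suc κ) u v (just f)
            entry-f = subst (Entry y g (suc κ) u v) eqf (State.levels st (suc κ) κ<K u v)
            comparison : wp (loop {14} widthPar subtract ⨾ rootsR (# 5) (# 4) (loop {15} widthPar consider)) ρ₁₄ (Post g) g
            comparison = wp-seq (loop {14} widthPar subtract) (rootsR (# 5) (# 4) (loop {15} widthPar consider)) ρ₁₄
              (λ g′ → ∀ l → Lift ℓ (R g′ (loc 4 0 0 0 (toℕ l)) ≈ᵣ difference (a ◅◅ b) f l)) (Post g) g
              (subtract-ok e₁ e₂ a b f eqc eqf g wa wb (proj₁ entry-f)) λ g₁ diff fr rs rs-ok len →
              let g₂ = mem (I g₁) (updates (R g₁) 5 0 rs)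
                  same : ∀ {a k j m l} → (a ≡ᵇ 5) ≡ false → R g₂ (loc a k j m l) ≡ R g₁ (loc a k j m l)
                  same {a} {k} {j} {m} {l} ne = updates-name (R g₁) 5 0 rs (loc a k j m l) ne
                  frame₂ : Frame (λ _ → false) (λ a → a ≡ᵇ 5) g₁ g₂
                  frame₂ = (λ _ _ → refl) , (λ x e → updates-name (R g₁) 5 0 rs x e)
                  hi₂ = hiRep-frame {g = g₁} {g₂} (State.hi st) refl refl frame₂ (hiRep-frame {g = g} {g₁} (State.hi st) refl refl fr (State.hiRep st))
                  st₂ : State g₂
                  st₂ = record
                    { levels = levels-agree (frame-agree refl refl refl refl refl frame₂) (levels-agree (frame-agree refl refl refl refl refl fr) (State.levels st))
                    ; loRep = loRep-frame {g = g₁} {g₂} lo refl refl frame₂ (loRep-frame {g = g} {g₁} lo refl refl fr (State.loRep st))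
                    ; hi = State.hi st ; hiRep = hi₂ ; origin = State.origin st }
              in wp-mono (loop {15} widthPar consider) (ρ₁₄ [ 14 ≔ length rs ]) (λ g₃ (st₃ , narrowing p , passed) → st₃ ,
                   narrowing (λ hi rep → p hi (subst (HiRep g₂) (hi-unique (State.hi st) hi (State.hiRep st) rep) hi₂)) , passed) g₂
                 (scan-ok e₁ e₂ a b f eqc eqf g₁ rs diff rs-ok len g₂ (st₂ , lift (updates-lookup (R g₁) 5 0 rs)))

      RootAt : ℕ → Carrier → Set (c ⊔ ℓ₁)
      RootAt zero    r = Lift (c ⊔ ℓ₁) ⊥
      RootAt (suc κ) r = ∃[ u ] ∃[ v ] ∃[ w ] RootVia κ u v w r

      compareLevel-ok : ∀ k g → k ≤ K → State g → wp compareLevel (ρ₇ i it [ 7 ≔ k ]) (λ g′ → State g′ × g ≾ g′ × Passed (RootAt k) g′) g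
      compareLevel-ok zero g _ st = (λ ()) , λ _ → st , ≾-refl , State.hi st , State.hiRep st , λ { r (lift ()) }
      compareLevel-ok (suc κ) g κ<K st = (λ _ → over-u) , λ ≮ → ⊥-elim (≮ (s≤s z≤n))
        where
        ρ₉ : Env
        ρ₉ = ρ₇ i it [ 7 ≔ suc κ ] [ 8 ≔ κ ]
        over-w : ∀ u v g → State g → wp (loop {11} vertexPar compareVia) (ρ₉ [ 9 ≔ toℕ u ] [ 10 ≔ toℕ v ])
          (λ g′ → State g′ × g ≾ g′ × Passed (λ r → ∃[ w ] RootVia κ u v w r) g′) g
        over-w u v g st = wp-mono (loop {11} vertexPar compareVia) (ρ₉ [ 9 ≔ toℕ u ] [ 10 ≔ toℕ v ]) (λ g′ (st′ , p , all) → st′ , p , passed-all (RootVia κ u v) st′ all) g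
          (wp-sweep {11} vertexPar compareVia (ρ₉ [ 9 ≔ toℕ u ] [ 10 ≔ toℕ v ]) State _≾_ (λ w → Passed (RootVia κ u v w)) ≾-refl ≾-trans (λ w → passed-up (RootVia κ u v w)) st
            (λ w g st → Via.compareVia-ok κ κ<K u v w g st))
        over-v : ∀ u g → State g → wp (loop {10} vertexPar (loop {11} vertexPar compareVia)) (ρ₉ [ 9 ≔ toℕ u ])
          (λ g′ → State g′ × g ≾ g′ × Passed (λ r → ∃[ v ] ∃[ w ] RootVia κ u v w r) g′) g
        over-v u g st = wp-mono (loop {10} vertexPar (loop {11} vertexPar compareVia)) (ρ₉ [ 9 ≔ toℕ u ]) (λ g′ (st′ , p , all) → st′ , p , passed-all (λ v r → ∃[ w ] RootVia κ u v w r) st′ all) g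
          (wp-sweep {10} vertexPar (loop {11} vertexPar compareVia) (ρ₉ [ 9 ≔ toℕ u ]) State _≾_ (λ v → Passed (λ r → ∃[ w ] RootVia κ u v w r)) ≾-refl ≾-trans (λ v → passed-up (λ r → ∃[ w ] RootVia κ u v w r)) st
            (λ v g st → over-w u v g st))
        over-u : wp (loop {9} vertexPar (loop {10} vertexPar (loop {11} vertexPar compareVia))) ρ₉ (λ g′ → State g′ × g ≾ g′ × Passed (RootAt (suc κ)) g′) g
        over-u = wp-mono (loop {9} vertexPar (loop {10} vertexPar (loop {11} vertexPar compareVia))) ρ₉ (λ g′ (st′ , p , all) → st′ , p , passed-all (λ u r → ∃[ v ] ∃[ w ] RootVia κ u v w r) st′ all) g
          (wp-sweep {9} vertexPar (loop {10} vertexPar (loop {11} vertexPar compareVia)) ρ₉ State _≾_ (λ u → Passed (λ r → ∃[ v ] ∃[ w ] RootVia κ u v w r)) ≾-refl ≾-trans (λ u → passed-up (λ r → ∃[ v ] ∃[ w ] RootVia κ u v w r)) st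
            (λ u g st → over-v u g st))

      compareAll-ok : ∀ g → State g → Ensures compareAll (ρ₇ i it)
        (λ g′ → State g′ × Passed (ComparisonRoot K y) g′) g
      compareAll-ok g st = ensures (wp-mono compareAll (ρ₇ i it) (λ g′ (st′ , p , all) → st′ , finish g′ (passed-all (λ k r → RootAt (toℕ k) r) st′ all)) g
        (wp-sweep {7} levelPar compareLevel (ρ₇ i it) State _≾_ (λ k → Passed (RootAt (toℕ k))) ≾-refl ≾-trans (λ k → passed-up (RootAt (toℕ k))) st
          (λ k g st → compareLevel-ok (toℕ k) g (ℕ.≤-pred (Fin.toℕ<n k)) st)))
        where
        finish : ∀ g′ → Passed (λ r → ∃[ k ] RootAt (toℕ {suc K} k) r) g′ → Passed (ComparisonRoot K y) g′
        finish g′ (hi , rep , h) = hi , rep , λ { r (κ , κ<K , u , v , w , a , b , rest) →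
          h r (fromℕ< (s≤s κ<K) , subst (λ k → RootAt k r) (sym (Fin.toℕ-fromℕ< (s≤s κ<K))) (u , v , w , a , b , rest)) }

  -- Writing out the path and one refinement.

  module Main {c ℓ₁ ℓ₂} (ℝ : CompleteOrderedField c ℓ₁ ℓ₂) (F : RootFinder ℝ)
      {n q : ℕ} (G : Graphs.Graph ℝ n q) (s t : Fin n) (K B : ℕ) where
    open CompleteOrderedField ℝ using (Carrier; 0#; 1#; Polynomial; IsRootList; eval)
      renaming (_≈_ to _≈ᵣ_; _<_ to _<ᵣ_; _≤_ to _≤ᵣ_)
    open Graphs ℝ
    open Walks ℝ G
    open Preprocessing hiding (lo; hi)
    open Tables ℝ F G s t K B
    open Sweep ℝ F G s t K B
    open Counting ℝ F G

    Row : Mem → ℕ → ℕ → List ℕ → Set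
    Row g i l []       = ⊤
    Row g i l (x ∷ xs) = I g (loc 3 0 0 i l) ≡ x × Row g i (suc l) xs

    row-same : ∀ {g g′ i} l xs → (∀ l′ → l ≤ l′ → l′ < l + length xs → I g′ (loc 3 0 0 i l′) ≡ I g (loc 3 0 0 i l′)) → Row g i l xs → Row g′ i l xs
    row-same l [] same _ = _
    row-same l (x ∷ xs) same (e , row) = trans (same l ℕ.≤-refl (ℕ.m<m+n l z<s)) e ,
      row-same (suc l) xs (λ l′ l< l′< → same l′ (ℕ.<⇒≤ l<) (subst (l′ <_) (sym (ℕ.+-suc l (length xs))) l′<)) row

    row-snoc : ∀ {g i} l xs x → Row g i l xs → I g (loc 3 0 0 i (l + length xs)) ≡ x → Row g i l (xs ∷ʳ x)
    row-snoc {g} {i} l [] x _ e = trans (cong (λ l → I g (loc 3 0 0 i l)) (sym (ℕ.+-identityʳ l))) e , _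
    row-snoc {g} {i} l (y ∷ xs) x (e′ , row) e = e′ , row-snoc (suc l) xs x row (trans (cong (λ l → I g (loc 3 0 0 i l)) (sym (ℕ.+-suc l (length xs)))) e)

    module Emitting (i it : ℕ) (f p : W s t) (path : IsPath G p) where
      vs : List (Fin n)
      vs = vertices G p

      Nexts : Mem → Set
      Nexts g = ∀ a → NextRep g K s t (toℕ a) (next f a)

      Finished : Mem → Set
      Finished g = I g (loc 5 0 0 0 0) ≡ 1 × Row g i 0 (length vs ∷ map toℕ vs)

      -- The program knows only the current vertex. The division of the path into a written prefix
      -- and a remaining suffix is kept in the proof.
      record Going (m : ℕ) (g : Mem) : Set c where
        field
          flag   : I g (loc 5 0 0 0 0) ≡ 0
          done   : List (Fin n)
          here′  : Fin n
          rest   : W here′ t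
          split′ : vs ≡ done ++ vertices G rest
          count′ : length done ≡ m
          ahead′ : Follows (next f) rest
          at′′   : I g (loc 4 0 0 0 0) ≡ toℕ here′
          row    : Row g i 1 (map toℕ done)

      -- Position 0 is reserved for the length and round 0 is idle, so `j` rounds have written
      -- `j ∸ 1` vertices unless the path is finished.
      Inv : ℕ → Mem → Set ℓ
      Inv j g = Lift ℓ (Nexts g × (Finished g ⊎ Going (j ∸ 1) g))

      private
        nexts-same : ∀ {g g′} → (∀ l → I g′ (loc 1 K (toℕ s) (toℕ t) l) ≡ I g (loc 1 K (toℕ s) (toℕ t) l)) →
                     (∀ l → I g′ (loc 2 K (toℕ s) (toℕ t) l) ≡ I g (loc 2 K (toℕ s) (toℕ t) l)) → Nexts g → Nexts g′
        nexts-same e₁ e₂ nx a with next f a | nx a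
        ... | nothing | e = trans (e₁ _) e
        ... | just _  | e , e′ = trans (e₁ _) e , trans (e₂ _) e′

      emit-ok : ∀ m d g → Nexts g → (go : Going m g) → wp emit (ρ₇ i it [ 7 ≔ suc m ] [ 8 ≔ d ] [ 9 ≔ toℕ (Going.here′ go) ]) (Inv (suc (suc m))) g
      emit-ok m d g nx go = step′ (Going.rest go) (Going.split′ go) (Going.ahead′ go)
        where
        open Going go
        ρ₁₀ : Env
        ρ₁₀ = ρ₇ i it [ 7 ≔ suc m ] [ 8 ≔ d ] [ 9 ≔ toℕ here′ ]
        g₁ = writeI (loc 3 0 0 i (suc m)) (toℕ here′) g
        g₂ = writeI (loc 3 0 0 i 0) (suc m) g₁
        nx₂ : Nexts g₂
        nx₂ = nexts-same {g} {g₂} (λ _ → refl) (λ _ → refl) nx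
        row₂ : Row g₂ i 1 (map toℕ (done ∷ʳ here′))
        row₂ = subst (Row g₂ i 1) (sym (List.map-++ toℕ done (here′ ∷ []))) (row-snoc 1 (map toℕ done) (toℕ here′)
          (row-same 1 (map toℕ done) (λ l′ 1≤l′ l′< → trans (update-other (I g₁) {loc 3 0 0 i 0} {y = loc 3 0 0 i l′} (λ eq → ℕ.<⇒≢ 1≤l′ (sym (cong Loc.l eq))))
            (update-other (I g) {loc 3 0 0 i (suc m)} {y = loc 3 0 0 i l′} (λ eq → ℕ.<⇒≢ (subst (l′ <_) (cong suc lengths) l′<) (cong Loc.l eq)))) row)
          (trans (update-other (I g₁) {loc 3 0 0 i 0} {y = loc 3 0 0 i (suc (length (map toℕ done)))} (λ eq → ℕ.<⇒≢ z<s (sym (cong Loc.l eq))))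
            (trans (cong (λ l → I g₁ (loc 3 0 0 i (suc l))) lengths) (update-same (I g) (loc 3 0 0 i (suc m))))))
          where
          lengths : length (map toℕ done) ≡ m
          lengths = trans (List.length-map toℕ done) count′
        snoc : ∀ {rest′} → vs ≡ done ++ (here′ ∷ rest′) → vs ≡ (done ∷ʳ here′) ++ rest′
        snoc e = trans e (sym (List.++-assoc done _ _))
        length-snoc : length (done ∷ʳ here′) ≡ suc m
        length-snoc = trans (List.length-++ done) (trans (ℕ.+-comm (length done) 1) (cong suc count′))
        step′ : (rest : W here′ t) → vs ≡ done ++ vertices G rest → Follows (next f) rest → wp (ifI (# 9) (# 3) advance (ifI (# 3) (# 9) advance (setI finished (# 1)))) ρ₁₀ (Inv (suc (suc m))) g₂
        step′ ε e _ = (λ lt → ⊥-elim (ℕ.<-irrefl refl lt)) , λ _ → (λ lt → ⊥-elim (ℕ.<-irrefl refl lt)) , λ _ →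
          lift (nexts-same {g₂} {g₃} (λ _ → refl) (λ _ → refl) nx₂ , inj₁ (refl , trans (update-same (I g₁) (loc 3 0 0 i 0)) (sym (trans (cong length e) length-snoc)) ,
            subst (λ vs → Row g₃ i 1 (map toℕ vs)) (sym e) (row-same 1 (map toℕ (done ∷ʳ here′)) (λ _ _ _ → refl) row₂)))
          where g₃ = writeI (loc 5 0 0 0 0) 1 g₂
        step′ (_◅_ {j = b} edge′ rest′) e (c≢t , f≡b , follows) =
          (λ _ → adv) , λ u≮ → (λ _ → adv) , λ u≯ → ⊥-elim (c≢t (Fin.toℕ-injective (ℕ.≤-antisym (ℕ.≮⇒≥ u≯) (ℕ.≮⇒≥ u≮))))
          where
          g₃ = writeI (loc 4 0 0 0 0) (I g₂ (loc 2 K (toℕ s) (toℕ t) (toℕ here′))) g₂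
          next≡ : I g₂ (loc 2 K (toℕ s) (toℕ t) (toℕ here′)) ≡ toℕ b
          next≡ = proj₂ (subst (NextRep g₂ K s t (toℕ here′)) f≡b (nx₂ here′))
          adv : Inv (suc (suc m)) g₃
          adv = lift (nexts-same {g₂} {g₃} (λ _ → refl) (λ _ → refl) nx₂ , inj₂ (record
            { flag = flag ; done = done ∷ʳ here′ ; here′ = b ; rest = rest′ ; split′ = snoc e ; count′ = length-snoc ; ahead′ = follows
            ; at′′ = next≡ ; row = row-same 1 (map toℕ (done ∷ʳ here′)) (λ _ _ _ → refl) row₂ }))

      emitPath-ok : Follows (next f) p → ∀ g → Nexts g → Ensures emitPath (ρ₇ i it) (λ g′ → Lift ℓ (Row g′ i 0 (length vs ∷ map toℕ vs))) g
      emitPath-ok follows g nx = ensures (wp-loop {7} lengthPar emitNext (ρ₇ i it) Inv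
          (lift (nexts-same {g} (λ _ → refl) (λ _ → refl) nx , inj₂ (record { flag = refl ; done = [] ; here′ = s ; rest = p ; split′ = refl ; count′ = refl ; ahead′ = follows ; at′′ = refl ; row = _ })))
          body end)
        where
        body : ∀ j g → j < suc n → Inv j g → wp emitNext (ρ₇ i it [ 7 ≔ j ]) (Inv (suc j)) g
        body zero g _ inv = (λ ()) , λ _ → inv
        body (suc m) g _ (lift (nx , inj₁ fin@(e , _))) = (λ _ → (λ _ → lift (nx , inj₁ fin)) , λ ≮ → ⊥-elim (≮ (subst (0 <_) (sym e) (s≤s z≤n)))) , λ ≮ → ⊥-elim (≮ (s≤s z≤n))
        body (suc m) g _ (lift (nx , inj₂ go)) = (λ _ → (λ lt → ⊥-elim (ℕ.<-irrefl refl (subst (0 <_) (Going.flag go) lt))) ,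
            λ _ → subst (λ x → wp emit (ρ₇ i it [ 7 ≔ suc m ] [ 8 ≔ I g (loc 5 0 0 0 0) ] [ 9 ≔ x ]) (Inv (suc (suc m))) g) (sym (Going.at′′ go)) (emit-ok m (I g (loc 5 0 0 0 0)) g nx go)) ,
          λ ≮ → ⊥-elim (≮ (s≤s z≤n))
        end : ∀ g → Inv (suc n) g → Lift ℓ (Row g i 0 (length vs ∷ map toℕ vs))
        end g (lift (_ , inj₁ (_ , row))) = lift row
        -- After `n + 1` rounds `n` vertices would be written and another one would remain, which is
        -- too many for a path.
        end g (lift (_ , inj₂ go)) = ⊥-elim (ℕ.<-irrefl refl (ℕ.≤-trans too-long (path-length p path)))
          where
          open Going go
          too-long : suc n ≤ length vs
          too-long = subst (suc n ≤_) (sym (trans (cong length split′) (trans (List.length-++ done) (cong₂ _+_ count′ (vertices-len rest)))))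
                       (ℕ.≤-trans (s≤s (ℕ.m≤m+n n (len rest))) (ℕ.≤-reflexive (sym (ℕ.+-suc n (len rest)))))

    Static₀ : Mem → Set ℓ
    Static₀ g = ∀ u v → Static g 0 u v (table₀ u v)

    static₀-frame : ∀ bI bR {g g′} → bI 0 ≡ false → bI 1 ≡ false → bI 2 ≡ false → bR 0 ≡ false → Frame bI bR g g′ → Static₀ g → Static₀ g′
    static₀-frame bI bR {g} {g′} i₀ i₁ i₂ r₀ (p , r) st u v = static-agree g g′ (table₀ u v)
      ((λ { 0 l _ → p _ i₀ ; 1 l _ → p _ i₁ ; 2 l _ → p _ i₂ ; (suc (suc (suc _))) l (s≤s (s≤s (s≤s ()))) }) , λ l → r _ r₀) (st u v)

    hi-frame : ∀ bI bR {g g′} hi → bI 6 ≡ false → bR 7 ≡ false → Frame bI bR g g′ → HiRep g hi → HiRep g′ hi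
    hi-frame bI bR {g} {g′} = Comparing.hiRep-frame 0 0 nothing nothing {bI} {bR} {g} {g′}

    lo-frame : ∀ bI bR {g g′} lo → bI 7 ≡ false → bR 8 ≡ false → Frame bI bR g g′ → LoRep g lo → LoRep g′ lo
    lo-frame bI bR {g} {g′} = Comparing.loRep-frame 0 0 nothing nothing {bI} {bR} {g} {g′}

    Lowered : Maybe Carrier → Maybe Carrier → Maybe Carrier → Set (c ⊔ ℓ₁ ⊔ ℓ₂)
    Lowered lo hi hi′ = ∃[ h ] hi′ ≡ just h × ComparisonRoot K (sample lo hi) h × Above lo h × Below hi h

    record Refined (lo hi : Maybe Carrier) (g : Mem) : Set ℓ where
      field
        static : Static₀ g
        loRep  : LoRep g lo
        hi′    : Maybe Carrier
        hiRep  : HiRep g hi′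
        result : (hi′ ≡ hi × Stable K lo hi) ⊎ Lowered lo hi hi′

    module Refining (i it : ℕ) (lo hi : Maybe Carrier) where
      open Comparing i it lo hi

      result : ∀ g′ → State g′ → Passed (ComparisonRoot K y) g′ → Refined lo hi g′
      result g′ st (hi₁ , rep₁ , h) = record
        { static = λ u v → proj₁ (State.levels st 0 z≤n u v) ; loRep = State.loRep st ; hi′ = State.hi st ; hiRep = State.hiRep st
        ; result = go (State.hi st) (State.hiRep st) (State.origin st) }
        where
        go : ∀ hi′ → HiRep g′ hi′ → hi′ ≡ hi ⊎ Found hi′ → (hi′ ≡ hi × Stable K lo hi) ⊎ Lowered lo hi hi′
        go hi′ rep (inj₁ refl) = inj₁ (refl , λ r root lo<r below → h r root lo<r (subst (λ hi → Below hi r) (hi-unique hi′ hi₁ rep rep₁) below))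
        go (just x) rep (inj₂ (root , lo<x , x<hi)) = inj₂ (x , refl , root , lo<x , x<hi)

      refine-ok : ∀ g → Static₀ g → LoRep g lo → HiRep g hi → Ensures refine (ρ₇ i it) (Refined lo hi) g
      refine-ok g st lr hr =
        setPoint-ensures i it lo hi g lr hr then λ g₁ pt fr₁ →
        Filling.fill-ok i it y g₁ pt (static₀-frame (writesI setPoint) (writesR setPoint) {g} {g₁} refl refl refl refl fr₁ st) then λ g₂ lv fr₂ →
        conclude (compareAll-ok g₂ (record
          { levels = lv
          ; loRep = lo-frame (writesI fill) (writesR fill) {g₁} {g₂} lo refl refl fr₂ (lo-frame (writesI setPoint) (writesR setPoint) {g} {g₁} lo refl refl fr₁ lr)
          ; hi = hi
          ; hiRep = hi-frame (writesI fill) (writesR fill) {g₁} {g₂} hi refl refl fr₂ (hi-frame (writesI setPoint) (writesR setPoint) {g} {g₁} hi refl refl fr₁ hr)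
          ; origin = inj₁ refl })) λ g₃ (st₃ , passed) _ → result g₃ st₃ passed

  -- Correctness of the whole sweep.

  module Correct {c ℓ₁ ℓ₂} (ℝ : CompleteOrderedField c ℓ₁ ℓ₂) (F : RootFinder ℝ)
      {n q : ℕ} (G : Graphs.Graph ℝ n q) (s t : Fin n) (K B : ℕ) where
    open CompleteOrderedField ℝ using (Carrier; 0#; 1#)
      renaming (_≈_ to _≈ᵣ_; _<_ to _<ᵣ_; _≤_ to _≤ᵣ_)
    open Graphs ℝ
    open Walks ℝ G
    open Preprocessing hiding (lo; hi)
    open Tables ℝ F G s t K B
    open Sweep ℝ F G s t K B
    open Main ℝ F G s t K B
    open Counting ℝ F G

    -- The path stored in row i is shortest between the breaks i - 1 and i.
    record CellOk (i : ℕ) (g : Mem) : Set ℓ where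
      field
        path   : W s t
        isPath : IsPath G path
        row    : Row g i 0 (length (vertices G path) ∷ map toℕ (vertices G path))
        valid  : ∀ x → NoNegativeCycle G x → (∀ i′ → i ≡ suc i′ → R g (loc 9 0 0 0 i′) <ᵣ x) →
                 (suc i < B → x ≤ᵣ R g (loc 9 0 0 0 i)) → IsShortestPath G x path

    cellOk-same : ∀ {i g g′} → (∀ l → I g′ (loc 3 0 0 i l) ≡ I g (loc 3 0 0 i l)) →
                  (∀ l → l ≤ i → R g′ (loc 9 0 0 0 l) ≡ R g (loc 9 0 0 0 l)) → CellOk i g → CellOk i g′
    cellOk-same {i} {g} {g′} rows breaks ok = record
      { path = path ; isPath = isPath ; row = row-same {g} {g′} 0 _ (λ l _ _ → rows l) row
      ; valid = λ x noneg above below → valid x noneg (λ { i′ refl → subst (_<ᵣ x) (breaks i′ (ℕ.n≤1+n i′)) (above i′ refl) })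
          (λ lt → subst (x ≤ᵣ_) (breaks i ℕ.≤-refl) (below lt)) }
      where open CellOk ok

    module _ (path : Path G s t) (n≤2^K : n ≤ 2 ^ K) (few : length (allBreakpoints K) < B) where
      private
        ℛ : List Carrier
        ℛ = allBreakpoints K

      -- Each refinement finds the cell stable or removes a breakpoint below its right end, so more
      -- refinements than breakpoints reach stability. `steady` records that a cell already stable
      -- up to infinity never acquires a right end, which the repeated rounds at the last cell rely
      -- on.
      record Inner (lo : Maybe Carrier) (it : ℕ) (g : Mem) : Set ℓ where
        field
          static   : Static₀ g
          loRep    : LoRep g lo
          {top}    : Maybe Carrier
          hiRep    : HiRep g top
          nonEmpty : NonEmpty lo top
          progress : Stable K lo top ⊎ behind ℛ top + it ≤ length ℛ
          steady   : Stable K lo nothing → top ≡ nothing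
          member   : ∀ h → top ≡ just h → Any (h ≈ᵣ_) ℛ × Above lo h

      inner-step : ∀ {lo it g g′} (inn : Inner lo it g) → Refined lo (Inner.top inn) g′ → Inner lo (suc it) g′
      inner-step {lo} {it} {g} {g′} inn rd = go (Refined.hi′ rd) (Refined.hiRep rd) (Refined.result rd)
        where
        open Inner inn
        nonEmpty′ : ∀ lo h → Above lo h → NonEmpty lo (just h)
        nonEmpty′ nothing  _ _ = _
        nonEmpty′ (just _) _ l<h = l<h
        go : ∀ hi′ → HiRep g′ hi′ → (hi′ ≡ top × Stable K lo top) ⊎ Lowered lo top hi′ → Inner lo (suc it) g′
        go hi′ rep (inj₁ (refl , stable)) = record
          { static = Refined.static rd ; loRep = Refined.loRep rd ; hiRep = rep ; nonEmpty = nonEmpty ; progress = inj₁ stable ; steady = steady ; member = member }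
        go hi′ rep (inj₂ (h , refl , root , lo<h , h<top)) = record
          { static = Refined.static rd ; loRep = Refined.loRep rd ; hiRep = rep ; nonEmpty = nonEmpty′ lo h lo<h
          ; progress = inj₂ (progressed progress)
          ; steady = λ stable → ⊥-elim (unstable (subst (Stable K lo) (sym (steady stable)) stable))
          ; member = λ { _ refl → root∈ , lo<h } }
          where
          root∈ = comparisonRoot∈ K root
          unstable : ¬ Stable K lo top
          unstable stable = stable h root lo<h h<top
          progressed : Stable K lo top ⊎ behind ℛ top + it ≤ length ℛ → behind ℛ (just h) + suc it ≤ length ℛ
          progressed (inj₁ stable) = ⊥-elim (unstable stable)
          progressed (inj₂ le) = ℕ.≤-trans (ℕ.≤-reflexive (ℕ.+-suc (behind ℛ (just h)) it)) (ℕ.≤-trans (ℕ.+-monoˡ-≤ it (behind-decreases top root∈ h<top)) le)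

      inner-ok : ∀ j lo g → Static₀ g → LoRep g lo → HiRep g nothing → Ensures (loop {6} boundPar refine) (ρ₀ [ 5 ≔ j ]) (Inner lo B) g
      inner-ok j lo g st lr hr = repeat boundPar (Inner lo)
        (record { static = st ; loRep = lr ; hiRep = hr ; nonEmpty = nonEmpty lo ; progress = inj₂ (ℕ.≤-trans (ℕ.≤-reflexive (ℕ.+-identityʳ _)) (count≤length (below? nothing) ℛ))
                ; steady = λ _ → refl ; member = λ _ () })
        (λ it g _ inn → conclude (Refining.refine-ok j it lo (Inner.top inn) g (Inner.static inn) (Inner.loRep inn) (Inner.hiRep inn)) (λ g′ rd _ → inner-step inn rd))
        where
        nonEmpty : ∀ lo → NonEmpty lo nothing
        nonEmpty nothing  = _
        nonEmpty (just _) = _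

      -- The left end is the break stored last, by `link`. Either the last cell has been reached or
      -- each finished cell has used up a breakpoint, so that fewer than `B` proper breaks are ever
      -- stored.
      record Outer (j : ℕ) (g : Mem) : Set ℓ where
        field
          static   : Static₀ g
          {bottom} : Maybe Carrier
          loRep    : LoRep g bottom
          link     : ∀ l → bottom ≡ just l → ∃[ i ] j ≡ suc i × R g (loc 9 0 0 0 i) ≡ l
          progress : Stable K bottom nothing ⊎ ahead ℛ bottom + j ≤ length ℛ
          cells    : ∀ i → i < j → CellOk i g

      RowsBut : ℕ → Mem → Mem → Set
      RowsBut j g g′ = ∀ i l → i ≢ j → I g′ (loc 3 0 0 i l) ≡ I g (loc 3 0 0 i l)

      solvePath : Cmd 7
      solvePath = setPoint ⨾ fill ⨾ emitPath

      emitPath-touches : ∀ j e → Touches emitPath (ρ₇ j e) (λ x → Loc.name x ≡ 3 → Loc.k x ≡ j) (λ _ → ⊤)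
      emitPath-touches j e = (λ ()) , (λ ()) , λ _ → (λ _ → tt , λ _ → (λ _ → refl) , (λ _ → refl) , (λ _ ()) , (λ _ ()) , (λ ())) , tt

      module _ (j : ℕ) (lo top : Maybe Carrier) (ne : NonEmpty lo top) (stable : Stable K lo top) where
        private
          sh = shortest K lo top ne stable n≤2^K path
          f = proj₁ sh
          p = proj₁ (proj₂ (proj₂ sh))

        Solved : Mem → Mem → Set ℓ
        Solved g g′ = Static₀ g′ × Lift ℓ (Row g′ j 0 (length (vertices G p) ∷ map toℕ (vertices G p))) × Lift ℓ (RowsBut j g g′)

        solvePath-ok : ∀ e g → Static₀ g → LoRep g lo → HiRep g top → Ensures solvePath (ρ₇ j e) (Solved g) g
        solvePath-ok e g st lr hr =
          setPoint-ensures j e lo top g lr hr then λ g₁ pt fr₁ →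
          Filling.fill-ok j e y g₁ pt (static₀-frame (writesI setPoint) (writesR setPoint) {g} {g₁} refl refl refl refl fr₁ st) then λ g₂ lv fr₂ →
          conclude (touching TI (λ _ → ⊤) (emitPath-touches j e)
              (Emitting.emitPath-ok j e f p isPath chain g₂ (Walked.nexts (proj₁ (subst (Entry y g₂ K s t) eqf (lv K ℕ.≤-refl s t))))))
            λ g₃ (row , same) fr₃ → static₀-frame (writesI emitPath) (writesR emitPath) {g₂} {g₃} refl refl refl refl fr₃ (λ u v → proj₁ (lv 0 z≤n u v)) , row ,
              lift (λ i l i≢j → trans (proj₁ same (loc 3 0 0 i l) (λ h → i≢j (h refl))) (trans (proj₁ fr₂ (loc 3 0 0 i l) refl) (proj₁ fr₁ (loc 3 0 0 i l) refl)))
          where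
          y = sample lo top
          TI : Loc → Set
          TI x = Loc.name x ≡ 3 → Loc.k x ≡ j
          eqf = proj₁ (proj₂ sh)
          isPath = proj₁ (proj₂ (proj₂ (proj₂ sh)))
          chain = proj₁ (proj₂ (proj₂ (proj₂ (proj₂ sh))))

        solved-cell : ∀ {g′} → Row g′ j 0 (length (vertices G p) ∷ map toℕ (vertices G p)) →
          (∀ l → lo ≡ just l → ∃[ i ] j ≡ suc i × R g′ (loc 9 0 0 0 i) ≡ l) →
          (∀ h → top ≡ just h → suc j < B × R g′ (loc 9 0 0 0 j) ≡ h) → CellOk j g′
        solved-cell {g′} row link link′ = record
          { path = p ; isPath = proj₁ (proj₂ (proj₂ (proj₂ sh))) ; row = row
          ; valid = λ x noneg above below → proj₂ (proj₂ (proj₂ (proj₂ (proj₂ sh)))) x noneg (lo<x lo link x above) (x≤hi top link′ x below) }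
          where
          lo<x : ∀ lo → (∀ l → lo ≡ just l → ∃[ i ] j ≡ suc i × R g′ (loc 9 0 0 0 i) ≡ l) → ∀ x → (∀ i → j ≡ suc i → R g′ (loc 9 0 0 0 i) <ᵣ x) → Above lo x
          lo<x nothing  _ x _ = _
          lo<x (just l) link x above with link l refl
          ... | i , e , r = subst (_<ᵣ x) r (above i e)
          x≤hi : ∀ top → (∀ h → top ≡ just h → suc j < B × R g′ (loc 9 0 0 0 j) ≡ h) → ∀ x → (suc j < B → x ≤ᵣ R g′ (loc 9 0 0 0 j)) → AtMost top x
          x≤hi nothing  _ x _ = _
          x≤hi (just h) link′ x below with link′ h refl
          ... | lt , r = subst (x ≤ᵣ_) r (below lt)

      module _ (j : ℕ) (g g₂ g₃ : Mem) (out : Outer j g) (inn : Inner (Outer.bottom out) B g₂)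
        (stable : Stable K (Outer.bottom out) (Inner.top inn)) (solved : Solved j (Outer.bottom out) (Inner.top inn) (Inner.nonEmpty inn) stable g₂ g₃)
        (rows : ∀ i l → I g₂ (loc 3 0 0 i l) ≡ I g (loc 3 0 0 i l)) (breaks≡ : ∀ l → R g₃ (loc 9 0 0 0 l) ≡ R g (loc 9 0 0 0 l)) where
        private
          module Out = Outer out
          module Inn = Inner inn

        concluded : ∀ g₆ lo′ → (∀ a k u v l → a < 4 → I g₆ (loc a k u v l) ≡ I g₃ (loc a k u v l)) →
          (∀ k u v l → R g₆ (loc 0 k u v l) ≡ R g₃ (loc 0 k u v l)) → (∀ l → l ≢ j → R g₆ (loc 9 0 0 0 l) ≡ R g₃ (loc 9 0 0 0 l)) →
          LoRep g₆ lo′ → (∀ l → lo′ ≡ just l → R g₆ (loc 9 0 0 0 j) ≡ l) → Stable K lo′ nothing ⊎ ahead ℛ lo′ + suc j ≤ length ℛ →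
          (∀ h → Inn.top ≡ just h → suc j < B × R g₆ (loc 9 0 0 0 j) ≡ h) → Outer (suc j) g₆
        concluded g₆ lo′ ints reals brks lr link′ prog′ top′ = record
          { static = λ u v → static-agree g₃ g₆ (table₀ u v) ((λ a l a<3 → ints a 0 (toℕ u) (toℕ v) l (ℕ.m<n⇒m<1+n a<3)) , (λ l → reals 0 (toℕ u) (toℕ v) l)) (proj₁ solved u v)
          ; loRep = lr ; link = λ l e → j , refl , link′ l e ; progress = prog′
          ; cells = λ i i<1+j → new i (ℕ.m≤n⇒m<n∨m≡n (ℕ.≤-pred i<1+j)) }
          where
          new : ∀ i → i < j ⊎ i ≡ j → CellOk i g₆
          new i (inj₁ i<j) = cellOk-same {i} {g} {g₆}
            (λ l → trans (ints 3 0 0 i l ℕ.≤-refl) (trans (lower (proj₂ (proj₂ solved)) i l (ℕ.<⇒≢ i<j)) (rows i l)))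
            (λ l l≤i → trans (brks l (ℕ.<⇒≢ (ℕ.≤-<-trans l≤i i<j))) (breaks≡ l)) (Out.cells i i<j)
          new i (inj₂ refl) = solved-cell i Out.bottom Inn.top Inn.nonEmpty stable {g₆}
            (row-same {g₃} {g₆} 0 _ (λ l _ _ → ints 3 0 0 i l ℕ.≤-refl) (lower (proj₁ (proj₂ solved))))
            (λ l e → let i′ , e′ , r = Out.link l e in i′ , e′ , trans (brks i′ (ℕ.<⇒≢ (subst (i′ <_) (sym e′) ℕ.≤-refl))) (trans (breaks≡ i′) r)) top′

        private
          top-just : ∀ h → Inn.top ≡ just h → ahead ℛ (just h) + suc j ≤ length ℛ
          top-just h e with Out.progress
          -- In the last cell a right end would contradict `steady`.
          ... | inj₁ st with () ← trans (sym (Inn.steady st)) e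
          ... | inj₂ le = ℕ.≤-trans (ℕ.≤-reflexive (ℕ.+-suc _ j)) (ℕ.≤-trans (ℕ.+-monoˡ-≤ j (ahead-decreases Out.bottom (proj₁ (Inn.member h e)) (proj₂ (Inn.member h e)))) le)

          other-break : ∀ g x l → l ≢ j → R (writeR (loc 9 0 0 0 j) x g) (loc 9 0 0 0 l) ≡ R g (loc 9 0 0 0 l)
          other-break g x l l≢j = update-other (R g) {loc 9 0 0 0 j} {y = loc 9 0 0 0 l} (l≢j ∘ cong Loc.l)

        finish : LoRep g₃ Out.bottom → ∀ top → Inn.top ≡ top → HiRep g₃ top →
                 Ensures (getI hiFlag raise ⨾ copyR (breaks (# 5)) Preprocessing.lo) (ρ₀ [ 5 ≔ j ]) (Outer (suc j)) g₃
        -- Without a right end the left end is recorded once more as a break. No query satisfies the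
        -- two conditions of this cell then, except in the last row, where the upper one is dropped.
        finish lr nothing e (lift flag) = ensures ((λ lt → ⊥-elim (ℕ.<-irrefl refl (subst (0 <_) flag lt))) , λ _ →
            concluded g₆ Out.bottom (λ _ _ _ _ _ _ → refl) (λ _ _ _ _ → refl) (other-break g₃ _) (lo₆ Out.bottom lr)
              (λ l e′ → trans (update-same (R g₃) (loc 9 0 0 0 j)) (lo-value Out.bottom lr l e′)) (inj₁ (subst (Stable K Out.bottom) e stable))
              (λ h e′ → ⊥-elim (absurd (trans (sym e) e′))))
          where
          g₆ = writeR (loc 9 0 0 0 j) (R g₃ (loc 8 0 0 0 0)) g₃
          absurd : ∀ {h : Carrier} → nothing ≡ just h → ⊥
          absurd ()
          lo₆ : ∀ lo → LoRep g₃ lo → LoRep g₆ lo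
          lo₆ nothing  r = r
          lo₆ (just _) r = r
          lo-value : ∀ lo → LoRep g₃ lo → ∀ l → lo ≡ just l → R g₃ (loc 8 0 0 0 0) ≡ l
          lo-value (just _) (lift (_ , r)) l refl = r
        finish lr (just h) e (lift (flag , value)) = ensures ((λ _ →
            concluded g₆ (just h) ints (λ _ _ _ _ → refl) (λ l l≢j → other-break g₅ _ l l≢j) (lift (refl , value)) (λ { l refl → break })
              (inj₂ (top-just h e)) (λ h′ e′ → ℕ.≤-<-trans (ℕ.≤-trans (ℕ.m≤n+m (suc j) _) (top-just h e)) few , trans break (just-injective (trans (sym e) e′)))) ,
          λ ≮ → ⊥-elim (≮ (subst (0 <_) (sym flag) (s≤s z≤n))))
          where
          g₅ = writeI (loc 7 0 0 0 0) 1 (writeR (loc 8 0 0 0 0) (R g₃ (loc 7 0 0 0 0)) g₃)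
          g₆ = writeR (loc 9 0 0 0 j) (R g₅ (loc 8 0 0 0 0)) g₅
          just-injective : ∀ {a b : Carrier} → just a ≡ just b → a ≡ b
          just-injective refl = refl
          break : R g₆ (loc 9 0 0 0 j) ≡ h
          break = trans (update-same (R g₅) (loc 9 0 0 0 j)) value
          ints : ∀ a k u v l → a < 4 → I g₆ (loc a k u v l) ≡ I g₃ (loc a k u v l)
          ints 0 k u v l _ = refl
          ints 1 k u v l _ = refl
          ints 2 k u v l _ = refl
          ints 3 k u v l _ = refl
          ints (suc (suc (suc (suc _)))) k u v l (s≤s (s≤s (s≤s (s≤s ()))))

      cell-ok : ∀ j g → j < B → Outer j g → Ensures cell (ρ₀ [ 5 ≔ j ]) (Outer (suc j)) g
      cell-ok j g j<B out =
        ensures {c = setI hiFlag zero} {Q = λ g′ → Lift ℓ (g′ ≡ g₁)} (lift refl) then λ { _ (lift refl) _ →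
        inner-ok j bottom g₁ (static₀-frame (λ a → a ≡ᵇ 6) (λ _ → false) {g} {g₁} refl refl refl refl fr₁ static) (lo-frame (λ a → a ≡ᵇ 6) (λ _ → false) {g} {g₁} bottom refl refl fr₁ loRep) (lift refl) then λ g₂ inn fr₂ →
        let open Inner inn using (top)
            stable = settled inn
        in
        binding (solvePath-ok j bottom top (Inner.nonEmpty inn) stable (I g₂ (loc 6 0 0 0 0)) g₂ (Inner.static inn) (Inner.loRep inn) (Inner.hiRep inn)) then λ g₃ solved fr₃ →
        finish j g g₂ g₃ out inn stable solved (λ i l → proj₁ fr₂ (loc 3 0 0 i l) refl)
          (λ l → trans (proj₂ fr₃ (loc 9 0 0 0 l) refl) (proj₂ fr₂ (loc 9 0 0 0 l) refl))
          (lo-frame (writesI (getI hiFlag solvePath)) (writesR (getI hiFlag solvePath)) {g₂} {g₃} bottom refl refl fr₃ (Inner.loRep inn)) top refl (hi-frame (writesI (getI hiFlag solvePath)) (writesR (getI hiFlag solvePath)) {g₂} {g₃} top refl refl fr₃ (Inner.hiRep inn)) }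
        where
        open Outer out
        g₁ = writeI (loc 6 0 0 0 0) 0 g
        fr₁ : Frame (λ a → a ≡ᵇ 6) (λ _ → false) g g₁
        fr₁ = (λ x e → update-name (I g) (loc 6 0 0 0 0) x e) , (λ _ _ → refl)
        settled : ∀ {g₂} (inn : Inner bottom B g₂) → Stable K bottom (Inner.top inn)
        settled inn with Inner.progress inn
        ... | inj₁ stable = stable
        -- Otherwise `B` refinements would have removed `B` breakpoints, more than there are.
        ... | inj₂ le = ⊥-elim (ℕ.<⇒≱ few (ℕ.≤-trans (ℕ.m≤n+m B _) le))

      main-ok : ∀ g → Ensures main ρ₀ (λ g′ → ∀ i → i < B → CellOk i g′) g
      main-ok g = load-ok g then λ g₁ st _ →
        ensures {c = setI loFlag zero} {Q = λ g′ → Lift ℓ (g′ ≡ writeI (loc 7 0 0 0 0) 0 g₁)} (lift refl) then λ { _ (lift refl) _ →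
        ensures {c = zeroR Preprocessing.lo} {Q = λ g′ → Lift ℓ (g′ ≡ writeR (loc 8 0 0 0 0) 0# (writeI (loc 7 0 0 0 0) 0 g₁))} (lift refl) then λ { _ (lift refl) _ →
        conclude (repeat boundPar Outer (start g₁ st) cell-ok) (λ _ out _ → Outer.cells out) } }
        where
        start : ∀ g₁ → Static₀ g₁ → Outer 0 (writeR (loc 8 0 0 0 0) 0# (writeI (loc 7 0 0 0 0) 0 g₁))
        start g₁ st = record
          { static = static₀-frame (λ a → a ≡ᵇ 7) (λ a → a ≡ᵇ 8) {g₁} {g₂} refl refl refl refl fr st ; bottom = nothing ; loRep = lift refl ; link = λ _ ()
          ; progress = inj₂ (ℕ.≤-trans (ℕ.≤-reflexive (ℕ.+-identityʳ _)) (count≤length (above? nothing) ℛ)) ; cells = λ _ () }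
          where
          g₂ = writeR (loc 8 0 0 0 0) 0# (writeI (loc 7 0 0 0 0) 0 g₁)
          fr : Frame (λ a → a ≡ᵇ 7) (λ a → a ≡ᵇ 8) g₁ g₂
          fr = (λ x e → update-name (I g₁) (loc 7 0 0 0 0) x e) , (λ x e → update-name (R g₁) (loc 8 0 0 0 0) x e)

open Programming

-- The query program and the set-up of the registers.

module Machines where
  open import Level using (_⊔_)
  open import Data.Bool.Base using (true; T)
  open import Data.List.Base using (List; []; _∷_; foldl)
  open import Data.Nat.Base hiding (_⊔_)
  open import Data.Nat.Properties as ℕ using (_≟_)
  open import Data.Product.Base using (∃-syntax; _×_; _,_; proj₁; proj₂)
  open import Data.Sum.Base using (_⊎_; inj₁; inj₂)
  open import Data.Empty using (⊥-elim)
  open import Relation.Binary.PropositionalEquality using (_≡_; _≢_; refl; sym; trans; cong; cong₂; subst; subst₂; ≢-sym)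
  open import Relation.Nullary using (¬_; Dec; yes; no; does)
  open import Relation.Nullary.Decidable using (dec-true; dec-false)
  open import Data.Unit.Base using (⊤)

  -- Bisection over the breaks, which start at register 2; the result is the address of row lo of the output.
  bisect : Program
  bisect = while (int< (at 13) (at 14))
    (instr (intOp plus (at 1) (at 13) (at 14)) ︔ instr (halve (at 1) (at 1)) ︔ instr (intOp plus (at 3) (at 2) (at 1)) ︔
     ifThen (real< (ind 3) (at 0)) (instr (intOp plus (at 13) (at 1) (at 11))) (instr (intCopy (at 14) (at 1))))

  scale9 : ℕ → Program
  scale9 r = instr (intOp times (at r) (at r) (at 9))

  -- The constants 10 and 4 are the leading digits of the arrays `breaks` and `output`, one more
  -- than their numbers 9 and 3. The search starts with the indices 0 and `B - 1`.
  query : Program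
  query = instr (intConst (at 2) 10) ︔ scale9 2 ︔ scale9 2 ︔ scale9 2 ︔ scale9 2 ︔
    instr (intConst (at 13) 0) ︔ instr (intOp monus (at 14) (at 9) (at 11)) ︔ bisect ︔
    instr (intConst (at 0) 4) ︔ scale9 0 ︔ scale9 0 ︔ scale9 0 ︔ instr (intOp plus (at 0) (at 0) (at 13)) ︔ scale9 0

  ⌊a+a+d/2⌋ : ∀ a d → ⌊ a + (a + d) /2⌋ ≡ a + ⌊ d /2⌋
  ⌊a+a+d/2⌋ zero    d = refl
  ⌊a+a+d/2⌋ (suc a) d = trans (cong ⌊_/2⌋ (cong suc (ℕ.+-suc a (a + d)))) (cong suc (⌊a+a+d/2⌋ a d))

  ⌊d/2⌋< : ∀ {d m} → d < 2 * m → ⌊ d /2⌋ < m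
  ⌊d/2⌋< {d} {m} d<2m = ℕ.*-cancelˡ-< 2 ⌊ d /2⌋ m (ℕ.≤-<-trans (ℕ.≤-trans (ℕ.≤-reflexive (cong (⌊ d /2⌋ +_) (ℕ.+-identityʳ _)))
    (ℕ.≤-trans (ℕ.+-monoʳ-≤ ⌊ d /2⌋ (ℕ.⌊n/2⌋≤⌈n/2⌉ d)) (ℕ.≤-reflexive (ℕ.⌊n/2⌋+⌈n/2⌉≡n d)))) d<2m)

  module Machine {c ℓ₁ ℓ₂} (ℝ : CompleteOrderedField c ℓ₁ ℓ₂) (F : RootFinder ℝ) (S : ℕ) where
    open CompleteOrderedField ℝ using (Carrier; _<?_) renaming (_<_ to _<ᵣ_)
    open RealRAM ℝ F

    fits-set : ∀ {σ} r v → Fits S σ → r < S → v < S → Fits S (store (int σ [ r ≔ v ]) (real σ))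
    fits-set {σ} r v fit r<S v<S = record
      { int-word = word ; int-blank = λ k S≤k → trans ([≔]-other (int σ) (λ e → ℕ.<⇒≱ r<S (subst (S ≤_) e S≤k))) (Fits.int-blank fit k S≤k)
      ; real-blank = Fits.real-blank fit }
      where
      word : ∀ k → (int σ [ r ≔ v ]) k < S
      word k with k ≟ r
      ... | yes refl = subst (_< S) (sym ([≔]-same (int σ) k)) v<S
      ... | no k≢r = subst (_< S) (sym ([≔]-other (int σ) k≢r)) (Fits.int-word fit k)

    put : ∀ {σ} i r {v w} → exec i σ ≡ store (int σ [ r ≔ w ]) (real σ) → cost i σ ≡ 1 → w ≡ v → r < S → v < S → Fits S σ →
          Run S (instr i) σ 1 (store (int σ [ r ≔ v ]) (real σ)) × Fits S (store (int σ [ r ≔ v ]) (real σ))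
    put {σ} i r {v} e e′ refl r<S v<S fit = subst₂ (λ t σ′ → Run S (instr i) σ t σ′) e′ e (instr (subst (Fits S) (sym e) fit′)) , fit′
      where fit′ = fits-set r v fit r<S v<S

    high : ∀ (m : ℕ → ℕ) {k v j} → k < 64 → 64 ≤ j → (m [ k ≔ v ]) j ≡ m j
    high m k<64 64≤j = [≔]-other m (λ e → ℕ.<⇒≱ k<64 (subst (64 ≤_) e 64≤j))

    high* : ∀ k vs (m : ℕ → ℕ) {j} → k < 64 → 64 ≤ j → foldl (λ m v → m [ k ≔ v ]) m vs j ≡ m j
    high* k []       m k<64 64≤j = refl
    high* k (v ∷ vs) m k<64 64≤j = trans (high* k vs (m [ k ≔ v ]) k<64 64≤j) (high m k<64 64≤j)

    module Querying (B : ℕ) (64≤B : 64 ≤ B) (S-large : 33 * B * B * B * B ≤ S) where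
      breaksBase : ℕ
      breaksBase = 10 * B * B * B * B

      label : ℕ → ℕ
      label i = (4 * B * B * B + i) * B

      private
        B>0 : 1 ≤ B
        B>0 = ℕ.≤-trans (s≤s z≤n) 64≤B

        m≤m*B : ∀ m → m ≤ m * B
        m≤m*B m = ℕ.m≤m*n m B {{>-nonZero B>0}}

        grow : ∀ {x} y → x < y → x * B < y * B
        grow y x<y = ℕ.*-monoˡ-< B {{>-nonZero B>0}} x<y

        <S₁ : ∀ {x} → x < 33 * B * B * B * B → x < S
        <S₁ lt = ℕ.<-≤-trans lt S-large

        S₁ : ∀ {x} → x < 33 → x < S
        S₁ {x} lt = <S₁ (ℕ.<-≤-trans lt (ℕ.≤-trans (m≤m*B 33) (ℕ.≤-trans (m≤m*B _) (ℕ.≤-trans (m≤m*B _) (m≤m*B _)))))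

        <B⇒<S : ∀ {x} → x ≤ B → x < S
        <B⇒<S {x} x≤B = <S₁ (ℕ.≤-<-trans x≤B (ℕ.<-≤-trans (ℕ.<-≤-trans (ℕ.≤-reflexive (cong suc (sym (ℕ.*-identityˡ B)))) (grow {1} 33 (s≤s (s≤s z≤n))))
          (ℕ.≤-trans (m≤m*B _) (ℕ.≤-trans (m≤m*B _) (m≤m*B _)))))

      -- The last row has no condition from the right: the search reads only breaks below its right
      -- index and so never the break `B - 1`.
      record Found (σ : Store) (i : ℕ) (σ′ : Store) : Set (c ⊔ ℓ₁ ⊔ ℓ₂) where
        field
          i<B   : i < B
          after : ∀ i′ → i ≡ suc i′ → real σ (breaksBase + i′) <ᵣ real σ 0
          until : suc i < B → ¬ real σ (breaksBase + i) <ᵣ real σ 0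
          reg9  : int σ′ 9 ≡ int σ 9
          reg11 : int σ′ 11 ≡ int σ 11
          highs : ∀ j → 64 ≤ j → int σ′ j ≡ int σ j
          reals : real σ′ ≡ real σ
          fit   : Fits S σ′

      -- The gap `d` at least halves in each round, so `d < 2^L` allows at most `L` rounds of six
      -- steps and one final test. The invariant speaks only of the breaks next to the two ends,
      -- which is all that `Found` asks for.
      bisect-run : ∀ L lo d σ → lo + d < B → d < 2 ^ L → Fits S σ → int σ 9 ≡ B → int σ 11 ≡ 1 → int σ 2 ≡ breaksBase → int σ 13 ≡ lo → int σ 14 ≡ lo + d →
        (∀ i′ → lo ≡ suc i′ → real σ (breaksBase + i′) <ᵣ real σ 0) → (suc (lo + d) < B → ¬ real σ (breaksBase + (lo + d)) <ᵣ real σ 0) →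
        ∃[ τ ] ∃[ i ] ∃[ σ′ ] τ ≤ suc (6 * L) × Run S bisect σ τ σ′ × int σ′ 13 ≡ i × Found σ i σ′
      bisect-run L lo zero σ lo<B d< fit e9 e11 e2 e13 e14 af un = 1 , lo , σ , s≤s z≤n ,
        while-false (dec-false (int σ 13 ℕ.<? int σ 14) (λ lt → ℕ.<-irrefl (trans e13 (trans (sym (ℕ.+-identityʳ lo)) (sym e14))) lt)) , e13 ,
        record { i<B = subst (_< B) (ℕ.+-identityʳ lo) lo<B ; after = af
               ; until = λ lt → subst (λ k → ¬ real σ (breaksBase + k) <ᵣ real σ 0) (ℕ.+-identityʳ lo) (un (subst (λ k → suc k < B) (sym (ℕ.+-identityʳ lo)) lt))
               ; reg9 = refl ; reg11 = refl ; highs = λ _ _ → refl ; reals = refl ; fit = fit }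
      bisect-run zero lo (suc d) σ _ (s≤s ()) _ _ _ _ _ _ _ _
      bisect-run (suc L) lo (suc d) σ hi<B d< fit e9 e11 e2 e13 e14 af un = go (real σ (breaksBase + mid) <? real σ 0)
        where
        mid = lo + ⌊ suc d /2⌋
        mid<hi : suc mid ≤ lo + suc d
        mid<hi = ℕ.≤-trans (ℕ.≤-reflexive (sym (ℕ.+-suc lo _))) (ℕ.+-monoʳ-≤ lo (ℕ.⌊n/2⌋<n d))
        mid<B : mid < B
        mid<B = ℕ.<-trans mid<hi hi<B
        s₁ = put {σ} (intOp plus (at 1) (at 13) (at 14)) 1 {lo + (lo + suc d)} refl refl (cong₂ _+_ e13 e14) (S₁ (s≤s (s≤s z≤n)))
          (<S₁ (ℕ.<-≤-trans (ℕ.+-mono-< (ℕ.≤-<-trans (ℕ.m≤m+n lo (suc d)) hi<B) hi<B) (ℕ.≤-trans (ℕ.≤-reflexive (cong (B +_) (sym (ℕ.+-identityʳ B))))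
            (ℕ.≤-trans (ℕ.*-monoˡ-≤ B {2} {33} (s≤s (s≤s z≤n))) (ℕ.≤-trans (m≤m*B (33 * B)) (ℕ.≤-trans (m≤m*B _) (m≤m*B _))))))) fit
        s₂ = put (halve (at 1) (at 1)) 1 {mid} refl refl (⌊a+a+d/2⌋ lo (suc d)) (S₁ (s≤s (s≤s z≤n))) (<B⇒<S (ℕ.<⇒≤ mid<B)) (proj₂ s₁)
        s₃ = put (intOp plus (at 3) (at 2) (at 1)) 3 {breaksBase + mid} refl refl (cong (_+ mid) e2) (S₁ (s≤s (s≤s (s≤s (s≤s z≤n)))))
          (<S₁ (ℕ.<-≤-trans (x*b+l<y*b B {10 * B * B * B} {11 * B * B * B} (grow (11 * B * B) (grow (11 * B) (grow 11 ℕ.≤-refl))) mid<B)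
            (ℕ.*-monoˡ-≤ B (ℕ.*-monoˡ-≤ B (ℕ.*-monoˡ-≤ B (ℕ.*-monoˡ-≤ B (ℕ.m≤m+n 11 22))))))) (proj₂ s₂)
        σ₃ = store (int σ [ 1 ≔ lo + (lo + suc d) ] [ 1 ≔ mid ] [ 3 ≔ breaksBase + mid ]) (real σ)
        test : does (int σ 13 ℕ.<? int σ 14) ≡ true
        test = dec-true (int σ 13 ℕ.<? int σ 14) (subst₂ _<_ (sym e13) (sym e14) (ℕ.m<m+n lo z<s))
        chain : ∀ {σ₄ i σ′} → int σ₄ 9 ≡ int σ 9 → int σ₄ 11 ≡ int σ 11 → (∀ j → 64 ≤ j → int σ₄ j ≡ int σ j) → real σ₄ ≡ real σ →
          Found σ₄ i σ′ → Found σ i σ′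
        chain e e′ h refl f = record { Found f ; reg9 = trans (Found.reg9 f) e ; reg11 = trans (Found.reg11 f) e′
          ; highs = λ j 64≤j → trans (Found.highs f j 64≤j) (h j 64≤j) }
        time : ∀ {τ} → τ ≤ suc (6 * L) → suc (1 + (1 + (1 + suc 1)) + τ) ≤ suc (6 * suc L)
        time {τ} le = s≤s (ℕ.≤-trans (ℕ.+-monoʳ-≤ 5 le) (ℕ.≤-reflexive (trans (ℕ.+-suc 5 (6 * L)) (sym (ℕ.*-suc 6 L)))))
        small : ∀ {k} → 64 ≤ k → ∀ {a b c} → (int σ [ 1 ≔ a ] [ 1 ≔ b ] [ 3 ≔ c ]) k ≡ int σ k
        small {k} 64≤k {a} {b} {c} = trans (high (int σ [ 1 ≔ a ] [ 1 ≔ b ]) (ℕ.m≤m+n 4 60) 64≤k) (trans (high (int σ [ 1 ≔ a ]) (ℕ.m≤m+n 2 62) 64≤k) (high (int σ) (ℕ.m≤m+n 2 62) 64≤k))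
        go : Dec (real σ (breaksBase + mid) <ᵣ real σ 0) → _
        go (yes lt) = _ , proj₁ (proj₂ rest) , proj₁ (proj₂ (proj₂ rest)) , time (proj₁ (proj₂ (proj₂ (proj₂ rest)))) ,
            while-true test (proj₁ s₁ ︔ proj₁ s₂ ︔ proj₁ s₃ ︔ if-true (dec-true (real σ (breaksBase + mid) <? real σ 0) lt) (proj₁ s₄)) (proj₁ (proj₂ (proj₂ (proj₂ (proj₂ rest))))) ,
            proj₁ (proj₂ (proj₂ (proj₂ (proj₂ (proj₂ rest))))) ,
            chain {σ₄} refl refl (λ j 64≤j → trans (high (int σ₃) (ℕ.m≤m+n 14 50) 64≤j) (small 64≤j)) refl (proj₂ (proj₂ (proj₂ (proj₂ (proj₂ (proj₂ rest))))))
          where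
          s₄ = put {σ₃} (intOp plus (at 13) (at 1) (at 11)) 13 {suc mid} refl refl (trans (cong (mid +_) e11) (ℕ.+-comm mid 1)) (S₁ (ℕ.m≤m+n 14 19)) (<B⇒<S mid<B) (proj₂ s₃)
          σ₄ = store (int σ₃ [ 13 ≔ suc mid ]) (real σ)
          -- Beyond the midpoint a gap of `⌊ d /2⌋` remains, since `⌊ suc d /2⌋` is `⌈ d /2⌉` by
          -- definition.
          hi≡ : suc mid + ⌊ d /2⌋ ≡ lo + suc d
          hi≡ = trans (cong suc (trans (ℕ.+-assoc lo ⌊ suc d /2⌋ ⌊ d /2⌋) (cong (lo +_) (trans (ℕ.+-comm ⌈ d /2⌉ ⌊ d /2⌋) (ℕ.⌊n/2⌋+⌈n/2⌉≡n d))))) (sym (ℕ.+-suc lo d))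
          rest = bisect-run L (suc mid) ⌊ d /2⌋ σ₄ (subst (_< B) (sym hi≡) hi<B) (ℕ.≤-<-trans (ℕ.⌊n/2⌋-mono (ℕ.n≤1+n d)) (⌊d/2⌋< {suc d} {2 ^ L} d<)) (proj₂ s₄) e9 e11 e2 refl (trans e14 (sym hi≡))
            (λ { _ refl → lt }) (subst (λ k → suc k < B → ¬ real σ (breaksBase + k) <ᵣ real σ 0) (sym hi≡) un)
        go (no ≮) = _ , proj₁ (proj₂ rest) , proj₁ (proj₂ (proj₂ rest)) , time (proj₁ (proj₂ (proj₂ (proj₂ rest)))) ,
            while-true test (proj₁ s₁ ︔ proj₁ s₂ ︔ proj₁ s₃ ︔ if-false (dec-false (real σ (breaksBase + mid) <? real σ 0) ≮) (proj₁ s₄)) (proj₁ (proj₂ (proj₂ (proj₂ (proj₂ rest))))) ,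
            proj₁ (proj₂ (proj₂ (proj₂ (proj₂ (proj₂ rest))))) ,
            chain {σ₄} refl refl (λ j 64≤j → trans (high (int σ₃) (ℕ.m≤m+n 15 49) 64≤j) (small 64≤j)) refl (proj₂ (proj₂ (proj₂ (proj₂ (proj₂ (proj₂ rest))))))
          where
          s₄ = put {σ₃} (intCopy (at 14) (at 1)) 14 {mid} refl refl refl (S₁ (ℕ.m≤m+n 15 18)) (<B⇒<S (ℕ.<⇒≤ mid<B)) (proj₂ s₃)
          σ₄ = store (int σ₃ [ 14 ≔ mid ]) (real σ)
          rest = bisect-run L lo ⌊ suc d /2⌋ σ₄ mid<B (⌊d/2⌋< {suc d} {2 ^ L} d<) (proj₂ s₄) e9 e11 e2 e13 refl af (λ _ → ≮)

      query-run : ∀ L σ → B ≤ 2 ^ L → Fits S σ → int σ 9 ≡ B → int σ 11 ≡ 1 →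
        ∃[ τ ] ∃[ i ] ∃[ σ′ ] τ ≤ 14 + 6 * L × Run S query σ τ σ′ × int σ′ 0 ≡ label i × Found σ i σ′
      query-run L σ B≤2^L fit₀ e9 e11 =
        _ , i , σ₉ , time τ≤ ,
        (proj₁ a₁ ︔ proj₁ a₂ ︔ proj₁ a₃ ︔ proj₁ a₄ ︔ proj₁ a₅ ︔ proj₁ a₆ ︔ proj₁ a₇ ︔ run ︔ proj₁ b₁ ︔ proj₁ b₂ ︔ proj₁ b₃ ︔ proj₁ b₄ ︔ proj₁ b₅ ︔ proj₁ b₆) ,
        refl , record
          { i<B = i<B ; after = after ; until = until ; reg9 = reg9 ; reg11 = reg11 ; reals = reals ; fit = proj₂ b₆
          ; highs = λ j 64≤j → trans (zero₆ 64≤j) (trans (highs j 64≤j) (trans (high (int σ₆) (ℕ.m≤m+n 15 49) 64≤j) (trans (high (int σ₅) (ℕ.m≤m+n 14 50) 64≤j) (two₅ 64≤j)))) }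
        where
        2<S = S₁ (ℕ.m≤m+n 3 30)
        0<S = S₁ (ℕ.m≤m+n 1 32)
        below₁ : ∀ {x} → x < 33 → x * B < S
        below₁ lt = <S₁ (ℕ.<-≤-trans (grow 33 lt) (ℕ.≤-trans (m≤m*B _) (ℕ.≤-trans (m≤m*B _) (m≤m*B _))))
        below₂ : ∀ {x} → x < 33 → x * B * B < S
        below₂ lt = <S₁ (ℕ.<-≤-trans (grow (33 * B) (grow 33 lt)) (ℕ.≤-trans (m≤m*B _) (m≤m*B _)))
        below₃ : ∀ {x} → x < 33 → x * B * B * B < S
        below₃ lt = <S₁ (ℕ.<-≤-trans (grow (33 * B * B) (grow (33 * B) (grow 33 lt))) (m≤m*B _))
        below₄ : ∀ {x} → x < 33 → x * B * B * B * B < S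
        below₄ lt = <S₁ (grow (33 * B * B * B) (grow (33 * B * B) (grow (33 * B) (grow 33 lt))))
        10<33 = ℕ.m≤m+n 11 22
        4<33 = ℕ.m≤m+n 5 28
        a₁ = put {σ} (intConst (at 2) 10) 2 {10} refl refl refl 2<S (S₁ 10<33) fit₀
        a₂ = put (intOp times (at 2) (at 2) (at 9)) 2 {10 * B} refl refl (cong (10 *_) e9) 2<S (below₁ 10<33) (proj₂ a₁)
        a₃ = put (intOp times (at 2) (at 2) (at 9)) 2 {10 * B * B} refl refl (cong (10 * B *_) e9) 2<S (below₂ 10<33) (proj₂ a₂)
        a₄ = put (intOp times (at 2) (at 2) (at 9)) 2 {10 * B * B * B} refl refl (cong (10 * B * B *_) e9) 2<S (below₃ 10<33) (proj₂ a₃)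
        a₅ = put (intOp times (at 2) (at 2) (at 9)) 2 {breaksBase} refl refl (cong (10 * B * B * B *_) e9) 2<S (below₄ 10<33) (proj₂ a₄)
        a₆ = put (intConst (at 13) 0) 13 {0} refl refl refl (S₁ (ℕ.m≤m+n 14 19)) 0<S (proj₂ a₅)
        a₇ = put (intOp monus (at 14) (at 9) (at 11)) 14 {B ∸ 1} refl refl (cong₂ _∸_ e9 e11) (S₁ (ℕ.m≤m+n 15 18)) (<B⇒<S (ℕ.m∸n≤m B 1)) (proj₂ a₆)
        σ₅ σ₆ σ₇ : Store
        σ₅ = store (int σ [ 2 ≔ 10 ] [ 2 ≔ 10 * B ] [ 2 ≔ 10 * B * B ] [ 2 ≔ 10 * B * B * B ] [ 2 ≔ breaksBase ]) (real σ)
        σ₆ = store (int σ₅ [ 13 ≔ 0 ]) (real σ)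
        σ₇ = store (int σ₆ [ 14 ≔ B ∸ 1 ]) (real σ)
        two₅ : ∀ {j} → 64 ≤ j → int σ₅ j ≡ int σ j
        two₅ = high* 2 (10 ∷ 10 * B ∷ 10 * B * B ∷ 10 * B * B * B ∷ breaksBase ∷ []) (int σ) (ℕ.m≤m+n 3 61)
        B∸1<B : suc (B ∸ 1) ≡ B
        B∸1<B = ℕ.m+[n∸m]≡n B>0
        found = bisect-run L 0 (B ∸ 1) σ₇ (ℕ.≤-reflexive B∸1<B) (ℕ.≤-trans (ℕ.≤-reflexive B∸1<B) B≤2^L) (proj₂ a₇) e9 e11 refl refl refl
          (λ _ ()) (λ lt → ⊥-elim (ℕ.<-irrefl B∸1<B lt))
        i = proj₁ (proj₂ found)
        σ₈ = proj₁ (proj₂ (proj₂ found))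
        τ≤ = proj₁ (proj₂ (proj₂ (proj₂ found)))
        run = proj₁ (proj₂ (proj₂ (proj₂ (proj₂ found))))
        e13 = proj₁ (proj₂ (proj₂ (proj₂ (proj₂ (proj₂ found)))))
        open Found (proj₂ (proj₂ (proj₂ (proj₂ (proj₂ (proj₂ found))))))
        e9₈ : int σ₈ 9 ≡ B
        e9₈ = trans reg9 e9
        row< : 4 * B * B * B + i < 5 * B * B * B
        row< = ℕ.<-≤-trans (ℕ.+-monoʳ-< (4 * B * B * B) i<B) (ℕ.≤-trans (ℕ.+-monoʳ-≤ (4 * B * B * B) (ℕ.≤-trans (m≤m*B B) (m≤m*B (B * B))))
          (ℕ.≤-reflexive (trans (sym (ℕ.*-distribʳ-+ B (4 * B * B) (B * B))) (cong (_* B) (trans (sym (ℕ.*-distribʳ-+ B (4 * B) B)) (cong (_* B) (ℕ.+-comm (4 * B) B)))))))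
        b₁ = put {σ₈} (intConst (at 0) 4) 0 {4} refl refl refl 0<S (S₁ 4<33) fit
        b₂ = put (intOp times (at 0) (at 0) (at 9)) 0 {4 * B} refl refl (cong (4 *_) e9₈) 0<S (below₁ 4<33) (proj₂ b₁)
        b₃ = put (intOp times (at 0) (at 0) (at 9)) 0 {4 * B * B} refl refl (cong (4 * B *_) e9₈) 0<S (below₂ 4<33) (proj₂ b₂)
        b₄ = put (intOp times (at 0) (at 0) (at 9)) 0 {4 * B * B * B} refl refl (cong (4 * B * B *_) e9₈) 0<S (below₃ 4<33) (proj₂ b₃)
        b₅ = put (intOp plus (at 0) (at 0) (at 13)) 0 {4 * B * B * B + i} refl refl (cong (4 * B * B * B +_) e13) 0<S
               (ℕ.<-trans row< (below₃ {5} (ℕ.m≤m+n 6 27))) (proj₂ b₄)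
        b₆ = put (intOp times (at 0) (at 0) (at 9)) 0 {label i} refl refl (cong ((4 * B * B * B + i) *_) e9₈) 0<S
               (ℕ.<-trans (grow (5 * B * B * B) row<) (below₄ {5} (ℕ.m≤m+n 6 27))) (proj₂ b₅)
        σ₉ = store (int σ₈ [ 0 ≔ 4 ] [ 0 ≔ 4 * B ] [ 0 ≔ 4 * B * B ] [ 0 ≔ 4 * B * B * B ] [ 0 ≔ 4 * B * B * B + i ] [ 0 ≔ label i ]) (real σ₈)
        zero₆ : ∀ {j} → 64 ≤ j → int σ₉ j ≡ int σ₈ j
        zero₆ = high* 0 (4 ∷ 4 * B ∷ 4 * B * B ∷ 4 * B * B * B ∷ 4 * B * B * B + i ∷ label i ∷ []) (int σ₈) (ℕ.m≤m+n 1 63)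
        time : ∀ {τ} → τ ≤ suc (6 * L) → 7 + (τ + 6) ≤ 14 + 6 * L
        time {τ} le = ℕ.≤-trans (ℕ.+-monoʳ-≤ 7 (ℕ.+-monoˡ-≤ 6 le)) (ℕ.≤-reflexive (cong (8 +_) (ℕ.+-comm (6 * L) 6)))

  -- The input fills the low cells, of which only cell 4 is known to be free (the graph has no loops).  So s, t and q are
  -- first saved at n⁸, n⁸ + 1 and n⁸ + 2; then the adjacency matrix is copied to n⁸ + 3, which frees the registers.
  save : Program
  save = instr (intOp times (at 4) (at 0) (at 0)) ︔ instr (intOp times (at 4) (at 4) (at 4)) ︔ instr (intOp times (at 4) (at 4) (at 4)) ︔
    instr (intCopy (ind 4) (at 2)) ︔ instr (intConst (at 2) 1) ︔ instr (intOp plus (at 4) (at 4) (at 2)) ︔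
    instr (intCopy (ind 4) (at 3)) ︔ instr (intOp plus (at 4) (at 4) (at 2)) ︔
    instr (intCopy (ind 4) (at 1)) ︔ instr (intOp plus (at 4) (at 4) (at 2)) ︔
    instr (intConst (at 1) 5) ︔ instr (intOp plus (at 3) (at 4) (at 2))

  relocate : Program
  relocate = while (int< (at 1) (at 4))
    (instr (intCopy (ind 3) (ind 1)) ︔ instr (intOp plus (at 1) (at 1) (at 2)) ︔ instr (intOp plus (at 3) (at 3) (at 2)))

  -- The saved values lie just before the relocated matrix and are fetched by counting down from its
  -- base. The products form the twelfth power of `nq` by squaring.
  setRegisters : Program
  setRegisters = instr (intOp monus (at 1) (at 4) (at 2)) ︔ instr (intCopy (at 10) (ind 1)) ︔
    instr (intOp monus (at 1) (at 1) (at 2)) ︔ instr (intCopy (at 19) (ind 1)) ︔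
    instr (intOp monus (at 1) (at 1) (at 2)) ︔ instr (intCopy (at 18) (ind 1)) ︔
    instr (intCopy (at 5) (at 0)) ︔ instr (intConst (at 11) 1) ︔ instr (intCopy (at 12) (at 4)) ︔
    instr (intOp plus (at 6) (at 10) (at 11)) ︔ instr (intOp plus (at 8) (at 5) (at 11)) ︔
    instr (intConst (at 16) 0) ︔ instr (intConst (at 17) 1) ︔
    instr (intOp times (at 1) (at 5) (at 10)) ︔ instr (intOp times (at 1) (at 1) (at 1)) ︔ instr (intOp times (at 1) (at 1) (at 1)) ︔
    instr (intCopy (at 2) (at 1)) ︔ instr (intOp times (at 2) (at 2) (at 1)) ︔ instr (intOp times (at 2) (at 2) (at 1)) ︔
    instr (intCopy (at 9) (at 2)) ︔ instr (intConst (at 20) 0) ︔ instr (intConst (at 3) 1)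

  -- Register 9 gains a factor `Z` for each doubling step, because each step multiplies the number
  -- of possible tables by at most `Z`.
  countLevels : Program
  countLevels = while (int< (at 3) (at 5))
    (instr (intOp plus (at 3) (at 3) (at 3)) ︔ instr (intOp plus (at 20) (at 20) (at 11)) ︔ instr (intOp times (at 9) (at 9) (at 2)))

  prelude : Program
  prelude = save ︔ relocate ︔ setRegisters ︔ countLevels ︔ instr (intOp plus (at 7) (at 20) (at 11))

  -- Correctness of the set-up.

  module Prelude {c ℓ₁ ℓ₂} (ℝ : CompleteOrderedField c ℓ₁ ℓ₂) (F : RootFinder ℝ) (S : ℕ) (n q s t d Λ : ℕ) where
    open CompleteOrderedField ℝ using (Carrier)
    open RealRAM ℝ F
    open Machine ℝ F S

    n⁸ Z : ℕ
    n⁸ = (n * n * (n * n)) * (n * n * (n * n))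
    Z = (e * e) * (e * e) * ((e * e) * (e * e)) * ((e * e) * (e * e))
      where e = n * q

    -- Writing `n⁸` as `64 + d` lets comparisons of a saved address with a small register number
    -- reduce by evaluation.
    record Room : Set where
      field
        n⁸≡    : n⁸ ≡ 64 + d
        room   : 200 + (d + d) ≤ S
        Z<S    : Z ^ suc Λ < S
        n≤2^Λ  : n ≤ 2 ^ Λ
        n≥1    : 1 ≤ n
        q≥1    : 1 ≤ q
        1+Λ<S  : suc Λ < S

    record Start (σ : Store) : Set ℓ₁ where
      field
        r0  : int σ 0 ≡ n
        r1  : int σ 1 ≡ q
        r2  : int σ 2 ≡ s
        r3  : int σ 3 ≡ t
        fit : Fits S σ

    module _ (H : Room) (σ₀ : Store) (start : Start σ₀) where
      open Room H
      open Start start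

      private
        lit : ∀ {k} → k < 64 → k < S
        lit k<64 = ℕ.<-≤-trans k<64 (ℕ.≤-trans (ℕ.m≤m+n 64 136) (ℕ.≤-trans (ℕ.m≤m+n 200 (d + d)) room))

        near : ∀ {k} → k < 200 → k + d < S
        near {k} k<200 = ℕ.<-≤-trans (ℕ.+-monoˡ-< d k<200) (ℕ.≤-trans (ℕ.+-monoʳ-≤ 200 (ℕ.m≤m+n d d)) room)

        value<S : ∀ {σ} → Fits S σ → ∀ j → int σ j < S
        value<S fit = Fits.int-word fit

        sq≤ : ∀ x → x ≤ x * x
        sq≤ zero    = z≤n
        sq≤ (suc x) = ℕ.m≤m*n (suc x) (suc x)

        n⁸<S : n⁸ < S
        n⁸<S = subst (_< S) (sym n⁸≡) (near (ℕ.m≤m+n 65 135))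

        +1 : ∀ x → x + 1 ≡ suc x
        +1 x = ℕ.+-comm x 1

        a₁ = put {σ₀} (intOp times (at 4) (at 0) (at 0)) 4 {n * n} refl refl (cong₂ _*_ r0 r0) (lit (ℕ.m≤m+n 5 59)) (ℕ.≤-<-trans (ℕ.≤-trans (sq≤ (n * n)) (sq≤ _)) n⁸<S) fit
        a₂ = put (intOp times (at 4) (at 4) (at 4)) 4 {n * n * (n * n)} refl refl refl (lit (ℕ.m≤m+n 5 59)) (ℕ.≤-<-trans (sq≤ _) n⁸<S) (proj₂ a₁)
        a₃ = put (intOp times (at 4) (at 4) (at 4)) 4 {64 + d} refl refl n⁸≡ (lit (ℕ.m≤m+n 5 59)) (near (ℕ.m≤m+n 65 135)) (proj₂ a₂)
        a₄ = put (intCopy (ind 4) (at 2)) (64 + d) {s} refl refl r2 (near (ℕ.m≤m+n 65 135)) (subst (_< S) r2 (value<S fit 2)) (proj₂ a₃)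
        a₅ = put (intConst (at 2) 1) 2 {1} refl refl refl (lit (ℕ.m≤m+n 3 61)) (lit (ℕ.m≤m+n 2 62)) (proj₂ a₄)
        a₆ = put (intOp plus (at 4) (at 4) (at 2)) 4 {65 + d} refl refl (+1 (64 + d)) (lit (ℕ.m≤m+n 5 59)) (near (ℕ.m≤m+n 66 134)) (proj₂ a₅)
        a₇ = put (intCopy (ind 4) (at 3)) (65 + d) {t} refl refl r3 (near (ℕ.m≤m+n 66 134)) (subst (_< S) r3 (value<S fit 3)) (proj₂ a₆)
        a₈ = put (intOp plus (at 4) (at 4) (at 2)) 4 {66 + d} refl refl (+1 (65 + d)) (lit (ℕ.m≤m+n 5 59)) (near (ℕ.m≤m+n 67 133)) (proj₂ a₇)
        a₉ = put (intCopy (ind 4) (at 1)) (66 + d) {q} refl refl r1 (near (ℕ.m≤m+n 67 133)) (subst (_< S) r1 (value<S fit 1)) (proj₂ a₈)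
        a₁₀ = put (intOp plus (at 4) (at 4) (at 2)) 4 {67 + d} refl refl (+1 (66 + d)) (lit (ℕ.m≤m+n 5 59)) (near (ℕ.m≤m+n 68 132)) (proj₂ a₉)
        a₁₁ = put (intConst (at 1) 5) 1 {5} refl refl refl (lit (ℕ.m≤m+n 2 62)) (lit (ℕ.m≤m+n 6 58)) (proj₂ a₁₀)
        a₁₂ = put (intOp plus (at 3) (at 4) (at 2)) 3 {68 + d} refl refl (+1 (67 + d)) (lit (ℕ.m≤m+n 4 60)) (near (ℕ.m≤m+n 69 131)) (proj₂ a₁₁)

      m₃ m₆ m₈ mA : ℕ → ℕ
      m₃ = int σ₀ [ 4 ≔ n * n ] [ 4 ≔ n * n * (n * n) ] [ 4 ≔ 64 + d ]
      m₆ = m₃ [ 64 + d ≔ s ] [ 2 ≔ 1 ] [ 4 ≔ 65 + d ]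
      m₈ = m₆ [ 65 + d ≔ t ] [ 4 ≔ 66 + d ]
      mA = m₈ [ 66 + d ≔ q ] [ 4 ≔ 67 + d ] [ 1 ≔ 5 ] [ 3 ≔ 68 + d ]

      save-run : Run S save σ₀ 12 (store mA (real σ₀)) × Fits S (store mA (real σ₀))
      save-run = (proj₁ a₁ ︔ proj₁ a₂ ︔ proj₁ a₃ ︔ proj₁ a₄ ︔ proj₁ a₅ ︔ proj₁ a₆ ︔ proj₁ a₇ ︔ proj₁ a₈ ︔ proj₁ a₉ ︔ proj₁ a₁₀ ︔ proj₁ a₁₁ ︔ proj₁ a₁₂) , proj₂ a₁₂

      -- Copying starts at cell 5: the matrix entry in cell 4 is that of the pair (0,0), hence zero,
      -- as is its untouched target. The stop is the base of the copy, already held by register 4,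
      -- so sources stay below targets; the cells copied beyond the matrix still end below the
      -- arrays.
      record Copied (k : ℕ) (σ : Store) : Set (c ⊔ ℓ₁) where
        field
          src   : int σ 1 ≡ 5 + k
          unit  : int σ 2 ≡ 1
          dst   : int σ 3 ≡ 68 + (d + k)
          stop  : int σ 4 ≡ 67 + d
          below : ∀ j → j ≢ 1 → j ≢ 3 → j < 68 + d → int σ j ≡ mA j
          moved : ∀ i → i < k → int σ (68 + (d + i)) ≡ mA (5 + i)
          above : ∀ j → 68 + (d + k) ≤ j → int σ j ≡ mA j
          reals : real σ ≡ real σ₀
          fit′  : Fits S σ

      relocate-run : ∀ r k σ → k + r ≡ 62 + d → Copied k σ → ∃[ σ′ ] Run S relocate σ (suc (r * 4)) σ′ × Copied (62 + d) σ′
      relocate-run zero k σ e cp = σ , while-false (dec-false (int σ 1 ℕ.<? int σ 4) (λ lt → ℕ.<-irrefl refl (subst₂ _<_ (trans src (cong (5 +_) k≡)) stop lt))) , subst (λ k → Copied k σ) k≡ cp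
        where
        open Copied cp
        k≡ : k ≡ 62 + d
        k≡ = trans (sym (ℕ.+-identityʳ k)) e
      relocate-run (suc r) k σ e cp = σ′ , while-true (dec-true (int σ 1 ℕ.<? int σ 4) (subst₂ _<_ (sym src) (sym stop) 5+k<)) (proj₁ b₁ ︔ proj₁ b₂ ︔ proj₁ b₃) run , cp′
        where
        open Copied cp
        k< : k < 62 + d
        k< = subst (k <_) e (ℕ.m<m+n k z<s)
        5+k< : 5 + k < 67 + d
        5+k< = ℕ.+-monoʳ-< 5 k<
        dst<S : 68 + (d + k) < S
        dst<S = ℕ.<-≤-trans (ℕ.+-monoʳ-< 68 (ℕ.+-monoʳ-< d k<)) (ℕ.≤-trans (ℕ.≤-reflexive (cong (68 +_) (trans (ℕ.+-comm d (62 + d)) refl))) (ℕ.≤-trans (ℕ.+-monoˡ-≤ (d + d) (ℕ.m≤m+n 130 70)) room))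
        v = mA (5 + k)
        read : int σ (int σ 1) ≡ v
        read = trans (cong (int σ) src) (below (5 + k) (λ ()) (λ ()) (ℕ.m<n⇒m<1+n 5+k<))
        b₁ : Run S (instr (intCopy (ind 3) (ind 1))) σ 1 (store (int σ [ 68 + (d + k) ≔ v ]) (real σ)) × Fits S (store (int σ [ 68 + (d + k) ≔ v ]) (real σ))
        b₁ = put (intCopy (ind 3) (ind 1)) (68 + (d + k)) {v} {int σ (int σ 1)} (cong (λ a → store (int σ [ a ≔ int σ (int σ 1) ]) (real σ)) dst) refl read dst<S
               (subst (_< S) read (value<S fit′ _)) fit′
        b₂ = put {store (int σ [ 68 + (d + k) ≔ v ]) (real σ)} (intOp plus (at 1) (at 1) (at 2)) 1 {6 + k} refl refl (trans (cong₂ _+_ src unit) (+1 (5 + k))) (lit (ℕ.m≤m+n 2 62))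
               (ℕ.<-≤-trans (s≤s 5+k<) (ℕ.<⇒≤ (near (ℕ.m≤m+n 69 131)))) (proj₂ b₁)
        b₃ = put (intOp plus (at 3) (at 3) (at 2)) 3 {69 + (d + k)} refl refl (trans (cong₂ _+_ dst unit) (+1 (68 + (d + k)))) (lit (ℕ.m≤m+n 4 60))
               (ℕ.<-≤-trans (s≤s (ℕ.+-monoʳ-< 68 (ℕ.+-monoʳ-< d k<))) (ℕ.≤-trans (ℕ.≤-reflexive (cong (69 +_) (trans (ℕ.+-comm d (62 + d)) refl))) (ℕ.≤-trans (ℕ.+-monoˡ-≤ (d + d) (ℕ.m≤m+n 131 69)) room))) (proj₂ b₂)
        σ₃ = store (int σ [ 68 + (d + k) ≔ v ] [ 1 ≔ 6 + k ] [ 3 ≔ 69 + (d + k) ]) (real σ)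
        outside : ∀ j → j ≢ 1 → j ≢ 3 → j ≢ 68 + (d + k) → int σ₃ j ≡ int σ j
        outside j j≢1 j≢3 j≢ = trans ([≔]-other (int σ [ 68 + (d + k) ≔ v ] [ 1 ≔ 6 + k ]) j≢3) (trans ([≔]-other (int σ [ 68 + (d + k) ≔ v ]) j≢1) ([≔]-other (int σ) j≢))
        cp₃ : Copied (suc k) σ₃
        cp₃ = record
          { above = λ j le → trans (outside j (≢64′ (ℕ.m≤m+n 2 62) le) (≢64′ (ℕ.m≤m+n 4 60) le) (≢-sym (ℕ.<⇒≢ (ℕ.<-≤-trans (ℕ.+-monoʳ-< 68 (ℕ.+-monoʳ-< d (ℕ.n<1+n k))) le)))) (above j (ℕ.≤-trans (ℕ.+-monoʳ-≤ 68 (ℕ.+-monoʳ-≤ d (ℕ.n≤1+n k))) le))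
          ; src = refl ; unit = unit ; dst = cong (68 +_) (sym (ℕ.+-suc d k)) ; stop = stop
          ; below = λ j j≢1 j≢3 j< → trans (outside j j≢1 j≢3 (ℕ.<⇒≢ (ℕ.<-≤-trans j< (ℕ.+-monoʳ-≤ 68 (ℕ.m≤m+n d k))))) (below j j≢1 j≢3 j<)
          ; moved = λ i i≤k → new i (ℕ.m≤n⇒m<n∨m≡n (ℕ.≤-pred i≤k))
          ; reals = reals ; fit′ = proj₂ b₃ }
          where
          ≢64′ : ∀ {r j} → r < 64 → 68 + (d + suc k) ≤ j → j ≢ r
          ≢64′ r<64 le refl = ℕ.<⇒≱ r<64 (ℕ.≤-trans (ℕ.m≤m+n 64 (4 + (d + suc k))) le)
          new : ∀ i → i < k ⊎ i ≡ k → int σ₃ (68 + (d + i)) ≡ mA (5 + i)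
          new i (inj₁ i<k) = trans (outside _ (λ ()) (λ ()) (λ eq → ℕ.<⇒≢ i<k (ℕ.+-cancelˡ-≡ d i k (ℕ.+-cancelˡ-≡ 68 _ _ eq)))) (moved i i<k)
          new i (inj₂ refl) = [≔]-same (int σ) (68 + (d + k))
        rest = relocate-run r (suc k) σ₃ (trans (sym (ℕ.+-suc k r)) e) cp₃
        σ′ = proj₁ rest
        run = proj₁ (proj₂ rest)
        cp′ = proj₂ (proj₂ rest)

      copied₀ : Copied 0 (store mA (real σ₀))
      copied₀ = record
        { above = λ _ _ → refl ; src = refl ; unit = refl ; dst = cong (68 +_) (sym (ℕ.+-identityʳ d)) ; stop = refl
        ; below = λ _ _ _ _ → refl ; moved = λ _ () ; reals = refl ; fit′ = proj₂ save-run }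

      module _ (σ₁ : Store) (cp : Copied (62 + d) σ₁) where
        open Copied cp

        private
          e : ℕ
          e = n * q

          saved-q : int σ₁ (66 + d) ≡ q
          saved-q = trans (below (66 + d) (λ ()) (λ ()) (ℕ.+-monoˡ-< d (ℕ.m≤m+n 67 1))) ([≔]-same m₈ (66 + d))

          saved-t : int σ₁ (65 + d) ≡ t
          saved-t = trans (below (65 + d) (λ ()) (λ ()) (ℕ.+-monoˡ-< d (ℕ.m≤m+n 66 2)))
            (trans ([≔]-other m₈ {66 + d} {65 + d} (ℕ.<⇒≢ ℕ.≤-refl)) ([≔]-same m₆ (65 + d)))

          saved-s : int σ₁ (64 + d) ≡ s
          saved-s = trans (below (64 + d) (λ ()) (λ ()) (ℕ.+-monoˡ-< d (ℕ.m≤m+n 65 3)))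
            (trans ([≔]-other m₈ {66 + d} {64 + d} (ℕ.<⇒≢ (ℕ.n≤1+n (65 + d)))) (trans ([≔]-other m₆ {65 + d} {64 + d} (ℕ.<⇒≢ ℕ.≤-refl)) ([≔]-same m₃ (64 + d))))

          n≡ : int σ₁ 0 ≡ n
          n≡ = trans (below 0 (λ ()) (λ ()) z<s) r0

          n<S = subst (_< S) r0 (value<S fit 0)
          q<S = subst (_< S) r1 (value<S fit 1)
          s<S = subst (_< S) r2 (value<S fit 2)
          t<S = subst (_< S) r3 (value<S fit 3)

          e≥1 : 1 ≤ e
          e≥1 = ℕ.*-mono-≤ n≥1 q≥1

          pos : ∀ {a b} → 1 ≤ a → 1 ≤ b → 1 ≤ a * b
          pos = ℕ.*-mono-≤

          e²≥1 = pos e≥1 e≥1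
          m≥1 = pos e²≥1 e²≥1
          mm≥1 = pos m≥1 m≥1

          Z≥1 : 1 ≤ Z
          Z≥1 = pos mm≥1 m≥1

          a≤a*b : ∀ {a b} → 1 ≤ b → a ≤ a * b
          a≤a*b {a} {b} 1≤b = ℕ.m≤m*n a b {{>-nonZero 1≤b}}

          Z<S′ : Z < S
          Z<S′ = ℕ.≤-<-trans (a≤a*b {Z} {Z ^ Λ} (ℕ.m^n>0 Z {{>-nonZero Z≥1}} Λ)) Z<S

          mm<S : (e * e) * (e * e) * ((e * e) * (e * e)) < S
          mm<S = ℕ.≤-<-trans (a≤a*b m≥1) Z<S′
          m<S : (e * e) * (e * e) < S
          m<S = ℕ.≤-<-trans (a≤a*b m≥1) mm<S
          e²<S : e * e < S
          e²<S = ℕ.≤-<-trans (a≤a*b e²≥1) m<S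
          e<S : e < S
          e<S = ℕ.≤-<-trans (a≤a*b e≥1) e²<S

          1+n<S : suc n < S
          1+n<S = ℕ.≤-<-trans (s≤s (ℕ.≤-trans (sq≤ n) (ℕ.≤-trans (sq≤ (n * n)) (ℕ.≤-trans (sq≤ (n * n * (n * n))) (ℕ.≤-reflexive n⁸≡))))) (near (ℕ.m≤m+n 66 134))

          1+q<S : suc q < S
          1+q<S = ℕ.≤-<-trans (ℕ.≤-trans (s≤s (ℕ.m≤n*m q n {{>-nonZero n≥1}})) (s≤s ℕ.≤-refl)) 1+e<S
            where
            1+e<S : suc e < S
            1+e<S with ℕ.m≤n⇒m<n∨m≡n e≥1
            ... | inj₁ 2≤e = ℕ.≤-<-trans (ℕ.≤-trans (ℕ.+-monoˡ-≤ e e≥1) (ℕ.≤-trans (ℕ.≤-reflexive (cong (e +_) (sym (ℕ.+-identityʳ e)))) (ℕ.*-monoˡ-≤ e 2≤e))) e²<S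
            ... | inj₂ 1≡e = subst (λ x → suc x < S) 1≡e (lit (ℕ.m≤m+n 3 61))

          b₁ = put {σ₁} (intOp monus (at 1) (at 4) (at 2)) 1 {66 + d} refl refl (cong₂ _∸_ stop unit) (lit (ℕ.m≤m+n 2 62)) (near (ℕ.m≤m+n 67 133)) fit′
          b₂ = put (intCopy (at 10) (ind 1)) 10 {q} refl refl saved-q (lit (ℕ.m≤m+n 11 53)) q<S (proj₂ b₁)
          b₃ = put (intOp monus (at 1) (at 1) (at 2)) 1 {65 + d} refl refl (cong (66 + d ∸_) unit) (lit (ℕ.m≤m+n 2 62)) (near (ℕ.m≤m+n 66 134)) (proj₂ b₂)
          b₄ = put (intCopy (at 19) (ind 1)) 19 {t} refl refl saved-t (lit (ℕ.m≤m+n 20 44)) t<S (proj₂ b₃)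
          b₅ = put (intOp monus (at 1) (at 1) (at 2)) 1 {64 + d} refl refl (cong (65 + d ∸_) unit) (lit (ℕ.m≤m+n 2 62)) (near (ℕ.m≤m+n 65 135)) (proj₂ b₄)
          b₆ = put (intCopy (at 18) (ind 1)) 18 {s} refl refl saved-s (lit (ℕ.m≤m+n 19 45)) s<S (proj₂ b₅)
          b₇ = put (intCopy (at 5) (at 0)) 5 {n} refl refl n≡ (lit (ℕ.m≤m+n 6 58)) n<S (proj₂ b₆)
          b₈ = put (intConst (at 11) 1) 11 {1} refl refl refl (lit (ℕ.m≤m+n 12 52)) (lit (ℕ.m≤m+n 2 62)) (proj₂ b₇)
          b₉ = put (intCopy (at 12) (at 4)) 12 {67 + d} refl refl stop (lit (ℕ.m≤m+n 13 51)) (near (ℕ.m≤m+n 68 132)) (proj₂ b₈)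
          b₁₀ = put (intOp plus (at 6) (at 10) (at 11)) 6 {suc q} refl refl (+1 q) (lit (ℕ.m≤m+n 7 57)) 1+q<S (proj₂ b₉)
          b₁₁ = put (intOp plus (at 8) (at 5) (at 11)) 8 {suc n} refl refl (+1 n) (lit (ℕ.m≤m+n 9 55)) 1+n<S (proj₂ b₁₀)
          b₁₂ = put (intConst (at 16) 0) 16 {0} refl refl refl (lit (ℕ.m≤m+n 17 47)) (lit (ℕ.m≤m+n 1 63)) (proj₂ b₁₁)
          b₁₃ = put (intConst (at 17) 1) 17 {1} refl refl refl (lit (ℕ.m≤m+n 18 46)) (lit (ℕ.m≤m+n 2 62)) (proj₂ b₁₂)
          b₁₄ = put (intOp times (at 1) (at 5) (at 10)) 1 {e} refl refl refl (lit (ℕ.m≤m+n 2 62)) e<S (proj₂ b₁₃)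
          b₁₅ = put (intOp times (at 1) (at 1) (at 1)) 1 {e * e} refl refl refl (lit (ℕ.m≤m+n 2 62)) e²<S (proj₂ b₁₄)
          b₁₆ = put (intOp times (at 1) (at 1) (at 1)) 1 {(e * e) * (e * e)} refl refl refl (lit (ℕ.m≤m+n 2 62)) m<S (proj₂ b₁₅)
          b₁₇ = put (intCopy (at 2) (at 1)) 2 {(e * e) * (e * e)} refl refl refl (lit (ℕ.m≤m+n 3 61)) m<S (proj₂ b₁₆)
          b₁₈ = put (intOp times (at 2) (at 2) (at 1)) 2 {(e * e) * (e * e) * ((e * e) * (e * e))} refl refl refl (lit (ℕ.m≤m+n 3 61)) mm<S (proj₂ b₁₇)
          b₁₉ = put (intOp times (at 2) (at 2) (at 1)) 2 {Z} refl refl refl (lit (ℕ.m≤m+n 3 61)) Z<S′ (proj₂ b₁₈)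
          b₂₀ = put (intCopy (at 9) (at 2)) 9 {Z} refl refl refl (lit (ℕ.m≤m+n 10 54)) Z<S′ (proj₂ b₁₉)
          b₂₁ = put (intConst (at 20) 0) 20 {0} refl refl refl (lit (ℕ.m≤m+n 21 43)) (lit (ℕ.m≤m+n 1 63)) (proj₂ b₂₀)
          b₂₂ = put (intConst (at 3) 1) 3 {1} refl refl refl (lit (ℕ.m≤m+n 4 60)) (lit (ℕ.m≤m+n 2 62)) (proj₂ b₂₁)

        registers : List (ℕ × ℕ)
        registers = (1 , 66 + d) ∷ (10 , q) ∷ (1 , 65 + d) ∷ (19 , t) ∷ (1 , 64 + d) ∷ (18 , s) ∷ (5 , n) ∷ (11 , 1) ∷ (12 , 67 + d) ∷
          (6 , suc q) ∷ (8 , suc n) ∷ (16 , 0) ∷ (17 , 1) ∷ (1 , e) ∷ (1 , e * e) ∷ (1 , (e * e) * (e * e)) ∷ (2 , (e * e) * (e * e)) ∷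
          (2 , (e * e) * (e * e) * ((e * e) * (e * e))) ∷ (2 , Z) ∷ (9 , Z) ∷ (20 , 0) ∷ (3 , 1) ∷ []

        σB : Store
        σB = store (foldl (λ m (r , v) → m [ r ≔ v ]) (int σ₁) registers) (real σ₁)

        setRegisters-run : Run S setRegisters σ₁ 22 σB × Fits S σB
        setRegisters-run = (proj₁ b₁ ︔ proj₁ b₂ ︔ proj₁ b₃ ︔ proj₁ b₄ ︔ proj₁ b₅ ︔ proj₁ b₆ ︔ proj₁ b₇ ︔ proj₁ b₈ ︔ proj₁ b₉ ︔ proj₁ b₁₀ ︔ proj₁ b₁₁ ︔
          proj₁ b₁₂ ︔ proj₁ b₁₃ ︔ proj₁ b₁₄ ︔ proj₁ b₁₅ ︔ proj₁ b₁₆ ︔ proj₁ b₁₇ ︔ proj₁ b₁₈ ︔ proj₁ b₁₉ ︔ proj₁ b₂₀ ︔ proj₁ b₂₁ ︔ proj₁ b₂₂) , proj₂ b₂₂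

        σB-high : ∀ j → 64 ≤ j → int σB j ≡ int σ₁ j
        σB-high j 64≤j = go registers (int σ₁) _
          where
          Low : List (ℕ × ℕ) → Set
          Low [] = ⊤
          Low ((r , _) ∷ rs) = T (r <ᵇ 64) × Low rs
          go : ∀ rs (m : ℕ → ℕ) → Low rs → foldl (λ m (r , v) → m [ r ≔ v ]) m rs j ≡ m j
          go [] m _ = refl
          go ((r , v) ∷ rs) m (r<64 , low) = trans (go rs (m [ r ≔ v ]) low) (high m (ℕ.<ᵇ⇒< r 64 r<64) 64≤j)

        record Doubled (i : ℕ) (σ : Store) : Set (c ⊔ ℓ₁) where
          field
            power : int σ 3 ≡ 2 ^ i
            levels : int σ 20 ≡ i
            bound : int σ 9 ≡ Z ^ suc i
            rest  : ∀ j → j ≢ 3 → j ≢ 20 → j ≢ 9 → int σ j ≡ int σB j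
            reals′ : real σ ≡ real σ₁
            fit″  : Fits S σ

        countLevels-run : ∀ r i σ → i + r ≡ Λ → Doubled i σ →
          ∃[ K ] ∃[ τ ] ∃[ σ′ ] τ ≤ suc (r * 4) × Run S countLevels σ τ σ′ × Doubled K σ′ × K ≤ Λ × n ≤ 2 ^ K
        countLevels-run r i σ eΛ ct = decide r eΛ (2 ^ i ℕ.<? n)
          where
          open Doubled ct
          decide : ∀ r → i + r ≡ Λ → Dec (2 ^ i < n) → ∃[ K ] ∃[ τ ] ∃[ σ′ ] τ ≤ suc (r * 4) × Run S countLevels σ τ σ′ × Doubled K σ′ × K ≤ Λ × n ≤ 2 ^ K
          decide r eΛ (no ≮) = i , 1 , σ , s≤s z≤n , while-false (dec-false (int σ 3 ℕ.<? int σ 5) (λ lt → ≮ (subst₂ _<_ power (rest 5 (λ ()) (λ ()) (λ ())) lt))) , ct ,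
            ℕ.≤-trans (ℕ.m≤m+n i r) (ℕ.≤-reflexive eΛ) , ℕ.≮⇒≥ ≮
          -- The fuel `Λ` suffices, because `2^Λ` already reaches `n`.
          decide zero eΛ (yes lt) = ⊥-elim (ℕ.<⇒≱ lt (subst (λ k → n ≤ 2 ^ k) (trans (sym eΛ) (ℕ.+-identityʳ i)) n≤2^Λ))
          decide (suc r) eΛ (yes lt) = proj₁ ih , _ , proj₁ (proj₂ (proj₂ ih)) , s≤s (ℕ.+-monoʳ-≤ 3 (proj₁ (proj₂ (proj₂ (proj₂ ih))))) ,
            while-true (dec-true (int σ 3 ℕ.<? int σ 5) (subst₂ _<_ (sym power) (sym (rest 5 (λ ()) (λ ()) (λ ()))) lt)) (proj₁ c₁ ︔ proj₁ c₂ ︔ proj₁ c₃)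
              (proj₁ (proj₂ (proj₂ (proj₂ (proj₂ ih))))) , proj₂ (proj₂ (proj₂ (proj₂ (proj₂ ih))))
            where
            i<Λ : suc i ≤ Λ
            i<Λ = subst (suc i ≤_) eΛ (subst (suc i ≤_) (sym (ℕ.+-suc i r)) (s≤s (ℕ.m≤m+n i r)))
            n≤64+d : n ≤ 64 + d
            n≤64+d = ℕ.≤-trans (sq≤ n) (ℕ.≤-trans (sq≤ (n * n)) (ℕ.≤-trans (sq≤ (n * n * (n * n))) (ℕ.≤-reflexive n⁸≡)))
            c₁ = put {σ} (intOp plus (at 3) (at 3) (at 3)) 3 {2 ^ suc i} refl refl (trans (cong₂ _+_ power power) (cong (2 ^ i +_) (sym (ℕ.+-identityʳ _)))) (lit (ℕ.m≤m+n 4 60))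
                   (ℕ.≤-<-trans (ℕ.≤-reflexive (cong (2 ^ i +_) (ℕ.+-identityʳ _))) (ℕ.<-≤-trans (ℕ.+-mono-< (ℕ.<-≤-trans lt n≤64+d) (ℕ.<-≤-trans lt n≤64+d))
                     (ℕ.≤-trans (ℕ.≤-reflexive (cong (64 +_) (trans (ℕ.+-comm d (64 + d)) refl))) (ℕ.≤-trans (ℕ.+-monoˡ-≤ (d + d) (ℕ.m≤m+n 128 72)) room)))) fit″
            c₂ = put (intOp plus (at 20) (at 20) (at 11)) 20 {suc i} refl refl (trans (cong₂ _+_ levels (rest 11 (λ ()) (λ ()) (λ ()))) (+1 i)) (lit (ℕ.m≤m+n 21 43))
                   (ℕ.≤-<-trans (ℕ.m≤n⇒m≤1+n i<Λ) 1+Λ<S) (proj₂ c₁)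
            c₃ = put (intOp times (at 9) (at 9) (at 2)) 9 {Z ^ suc (suc i)} refl refl (trans (cong₂ _*_ bound (rest 2 (λ ()) (λ ()) (λ ()))) (ℕ.*-comm (Z ^ suc i) Z)) (lit (ℕ.m≤m+n 10 54))
                   (ℕ.≤-<-trans (ℕ.^-monoʳ-≤ Z {{>-nonZero Z≥1}} (s≤s i<Λ)) Z<S) (proj₂ c₂)
            σ₃ = store (int σ [ 3 ≔ 2 ^ suc i ] [ 20 ≔ suc i ] [ 9 ≔ Z ^ suc (suc i) ]) (real σ)
            ih = countLevels-run r (suc i) σ₃ (trans (sym (ℕ.+-suc i r)) eΛ) (record
              { power = refl ; levels = refl ; bound = refl ; reals′ = reals′ ; fit″ = proj₂ c₃
              ; rest = λ j j≢3 j≢20 j≢9 → trans ([≔]-other (int σ [ 3 ≔ 2 ^ suc i ] [ 20 ≔ suc i ]) j≢9) (trans ([≔]-other (int σ [ 3 ≔ 2 ^ suc i ]) j≢20) (trans ([≔]-other (int σ) j≢3) (rest j j≢3 j≢20 j≢9))) })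

      record Prepared (K : ℕ) (σ : Store) : Set (c ⊔ ℓ₁) where
        field
          K≤Λ   : K ≤ Λ
          n≤2^K : n ≤ 2 ^ K
          p5    : int σ 5 ≡ n
          p6    : int σ 6 ≡ suc q
          p7    : int σ 7 ≡ suc K
          p8    : int σ 8 ≡ suc n
          p9    : int σ 9 ≡ Z ^ suc K
          p10   : int σ 10 ≡ q
          p11   : int σ 11 ≡ 1
          p12   : int σ 12 ≡ 67 + d
          p16   : int σ 16 ≡ 0
          p17   : int σ 17 ≡ 1
          p18   : int σ 18 ≡ s
          p19   : int σ 19 ≡ t
          p20   : int σ 20 ≡ K
          raw₀  : int σ (67 + d) ≡ int σ₀ (67 + d)
          raw   : ∀ i → i < 59 + d → int σ (68 + (d + i)) ≡ int σ₀ (5 + i)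
          above₀ : ∀ j → 68 + (d + (62 + d)) ≤ j → int σ j ≡ int σ₀ j
          reals : real σ ≡ real σ₀
          fits  : Fits S σ

      prelude-run : ∃[ K ] ∃[ τ ] ∃[ σ ] τ ≤ 12 + (suc ((62 + d) * 4) + (22 + (suc (Λ * 4) + 1))) × Run S prelude σ₀ τ σ × Prepared K σ
      prelude-run = continue (relocate-run (62 + d) 0 (store mA (real σ₀)) refl copied₀)
       where
       continue : (∃[ σ′ ] Run S relocate (store mA (real σ₀)) (suc ((62 + d) * 4)) σ′ × Copied (62 + d) σ′) →
         ∃[ K ] ∃[ τ ] ∃[ σ ] τ ≤ 12 + (suc ((62 + d) * 4) + (22 + (suc (Λ * 4) + 1))) × Run S prelude σ₀ τ σ × Prepared K σ
       continue (σ₁ , moved′ , cp) = K , _ , σ₄ , time , (proj₁ save-run ︔ moved′ ︔ proj₁ set ︔ proj₁ (proj₂ (proj₂ (proj₂ (proj₂ counted)))) ︔ proj₁ c₁) , record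
        { K≤Λ = K≤Λ ; n≤2^K = n≤2^K
        ; p5 = rest 5 (λ ()) (λ ()) (λ ()) ; p6 = rest 6 (λ ()) (λ ()) (λ ()) ; p7 = refl ; p8 = rest 8 (λ ()) (λ ()) (λ ())
        ; p9 = bound ; p10 = rest 10 (λ ()) (λ ()) (λ ()) ; p11 = rest 11 (λ ()) (λ ()) (λ ()) ; p12 = rest 12 (λ ()) (λ ()) (λ ())
        ; p16 = rest 16 (λ ()) (λ ()) (λ ()) ; p17 = rest 17 (λ ()) (λ ()) (λ ()) ; p18 = rest 18 (λ ()) (λ ()) (λ ())
        ; p19 = rest 19 (λ ()) (λ ()) (λ ()) ; p20 = levels
        ; raw₀ = trans (high₄ (67 + d) (ℕ.m≤m+n 64 _)) (trans (Copied.below cp (67 + d) (λ ()) (λ ()) ℕ.≤-refl)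
            (trans ([≔]-other m₈ {66 + d} {67 + d} (≢-sym (ℕ.<⇒≢ ℕ.≤-refl))) (trans ([≔]-other m₆ {65 + d} {67 + d} (≢-sym (ℕ.<⇒≢ (ℕ.n≤1+n (66 + d))))) ([≔]-other m₃ {64 + d} {67 + d} (≢-sym (ℕ.<⇒≢ (ℕ.m≤n+m (65 + d) 2)))))))
        ; raw = λ i i< → trans (high₄ (68 + (d + i)) (ℕ.m≤m+n 64 _)) (trans (Copied.moved cp i (ℕ.<-≤-trans i< (ℕ.+-monoˡ-≤ d (ℕ.m≤m+n 59 3)))) (kept i i<))
        ; above₀ = λ j le → trans (high₄ j (ℕ.≤-trans (ℕ.m≤m+n 64 _) le)) (trans (Copied.above cp j le) (kept-above j (ℕ.≤-trans (ℕ.+-monoʳ-≤ 68 (ℕ.m≤m+n d (62 + d))) le)))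
        ; reals = trans reals′ (Copied.reals cp) ; fits = proj₂ c₁ }
        where
        set = setRegisters-run σ₁ cp
        counted = countLevels-run σ₁ cp Λ 0 (σB σ₁ cp) refl (record
          { power = refl ; levels = refl ; bound = sym (ℕ.*-identityʳ Z) ; rest = λ _ _ _ _ → refl ; reals′ = refl ; fit″ = proj₂ set })
        K = proj₁ counted
        σ₃ = proj₁ (proj₂ (proj₂ counted))
        open Doubled (proj₁ (proj₂ (proj₂ (proj₂ (proj₂ (proj₂ counted))))))
        K≤Λ = proj₁ (proj₂ (proj₂ (proj₂ (proj₂ (proj₂ (proj₂ counted))))))
        n≤2^K = proj₂ (proj₂ (proj₂ (proj₂ (proj₂ (proj₂ (proj₂ counted))))))
        K+1<S : suc K < S
        K+1<S = ℕ.≤-<-trans (s≤s K≤Λ) 1+Λ<S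
        c₁ = put {σ₃} (intOp plus (at 7) (at 20) (at 11)) 7 {suc K} refl refl (trans (cong₂ _+_ levels (rest 11 (λ ()) (λ ()) (λ ()))) (+1 K)) (lit (ℕ.m≤m+n 8 56)) K+1<S fit″
        σ₄ = store (int σ₃ [ 7 ≔ suc K ]) (real σ₃)
        high₄ : ∀ j → 64 ≤ j → int σ₄ j ≡ int σ₁ j
        high₄ j 64≤j = trans (high (int σ₃) (ℕ.m≤m+n 8 56) 64≤j) (trans (rest j (≢64 (ℕ.m≤m+n 4 60)) (≢64 (ℕ.m≤m+n 21 43)) (≢64 (ℕ.m≤m+n 10 54))) (σB-high σ₁ cp j 64≤j))
          where
          ≢64 : ∀ {k} → k < 64 → j ≢ k
          ≢64 k<64 refl = ℕ.<⇒≱ k<64 64≤j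
        kept-above : ∀ j → 68 + d ≤ j → mA j ≡ int σ₀ j
        kept-above j@(suc (suc (suc (suc (suc _))))) le@(s≤s (s≤s (s≤s (s≤s (s≤s _))))) = trans ([≔]-other m₈ {66 + d} (≢-sym (ℕ.<⇒≢ (ℕ.<-≤-trans (ℕ.+-monoˡ-< d (ℕ.m≤m+n 67 1)) le))))
          (trans ([≔]-other m₆ {65 + d} (≢-sym (ℕ.<⇒≢ (ℕ.<-≤-trans (ℕ.+-monoˡ-< d (ℕ.m≤m+n 66 2)) le)))) ([≔]-other m₃ {64 + d} (≢-sym (ℕ.<⇒≢ (ℕ.<-≤-trans (ℕ.+-monoˡ-< d (ℕ.m≤m+n 65 3)) le)))))
        kept : ∀ i → i < 59 + d → mA (5 + i) ≡ int σ₀ (5 + i)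
        kept i i< = trans ([≔]-other m₈ {66 + d} {5 + i} (ℕ.<⇒≢ (ℕ.<-≤-trans (ℕ.+-monoʳ-< 5 i<) (ℕ.+-monoˡ-≤ d (ℕ.m≤m+n 64 2)))))
          (trans ([≔]-other m₆ {65 + d} {5 + i} (ℕ.<⇒≢ (ℕ.<-≤-trans (ℕ.+-monoʳ-< 5 i<) (ℕ.+-monoˡ-≤ d (ℕ.m≤m+n 64 1))))) ([≔]-other m₃ {64 + d} {5 + i} (ℕ.<⇒≢ (ℕ.+-monoʳ-< 5 i<))))
        time : 12 + (suc ((62 + d) * 4) + (22 + (proj₁ (proj₂ counted) + 1))) ≤ 12 + (suc ((62 + d) * 4) + (22 + (suc (Λ * 4) + 1)))
        time = ℕ.+-monoʳ-≤ 12 (ℕ.+-monoʳ-≤ (suc ((62 + d) * 4)) (ℕ.+-monoʳ-≤ 22 (ℕ.+-monoˡ-≤ 1 (proj₁ (proj₂ (proj₂ (proj₂ counted)))))))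

open Machines

-- Layout of the input, size estimates and assembly.

module Conclusion where
  open import Data.Fin.Base using (Fin; zero; suc; toℕ; fromℕ<)
  import Data.Fin.Properties as Fin
  open import Data.List.Base using (List; []; _∷_; length; map; concatMap; allFin; _++_; cartesianProduct; tabulate)
  import Data.List.Properties as List
  open import Data.List.Relation.Unary.All as All using (All; []; _∷_)
  import Data.List.Relation.Unary.All.Properties as All
  open import Data.Maybe.Base using (Maybe; just; nothing; maybe′)
  open import Data.Vec.Functional using (toList; replicate)
  open import Data.Nat.Base hiding (_⊔_)
  open import Data.Nat.Properties as ℕ using (_≟_)
  open import Data.Nat.Logarithm
  open import Data.Product.Base using (∃-syntax; _×_; _,_; proj₁; proj₂)
  open import Data.Sum.Base using (inj₁; inj₂)
  open import Data.Empty using (⊥-elim)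
  open import Function.Base using (_∘_)
  open import Relation.Binary.PropositionalEquality using (_≡_; _≢_; refl; sym; trans; cong; cong₂; subst; subst₂)
  open import Relation.Nullary using (yes; no)
  open import Data.Nat.Solver using (module +-*-Solver)
  open import Level using (_⊔_)
  open import Data.Unit.Base using (tt)

  -- Lookup as a relation with a natural index, so that positions in concatenations and products are
  -- plain arithmetic, as in the row-major layout of the input.
  data At {a} {A : Set a} : List A → ℕ → A → Set a where
    here  : ∀ {x xs} → At (x ∷ xs) 0 x
    there : ∀ {x xs i y} → At xs i y → At (x ∷ xs) (suc i) y

  module _ {a} {A : Set a} where
    At-++ˡ : ∀ {xs ys : List A} {i x} → At xs i x → At (xs ++ ys) i x
    At-++ˡ here      = here
    At-++ˡ (there p) = there (At-++ˡ p)

    At-++ʳ : ∀ (xs : List A) {ys i x} → At ys i x → At (xs ++ ys) (length xs + i) x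
    At-++ʳ []       p = p
    At-++ʳ (_ ∷ xs) p = there (At-++ʳ xs p)

    At-tabulate : ∀ {n} (f : Fin n → A) i → At (tabulate f) (toℕ i) (f i)
    At-tabulate f zero    = here
    At-tabulate f (suc i) = there (At-tabulate (f ∘ suc) i)

    [≔*]-at : ∀ (m : ℕ → A) k {vs i v} → At vs i v → (m [ k ≔* vs ]) (k + i) ≡ v
    [≔*]-at m k {v ∷ vs} here rewrite ℕ.+-identityʳ k = [≔]-same (m [ suc k ≔* vs ]) k
    [≔*]-at m k {v ∷ vs} {suc i} (there p) = trans ([≔]-other (m [ suc k ≔* vs ]) (λ e → ℕ.m≢1+m+n k (trans (sym e) (ℕ.+-suc k i))))
      (trans (cong (m [ suc k ≔* vs ]) (ℕ.+-suc k i)) ([≔*]-at m (suc k) p))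

    [≔*]-all : ∀ {p} {P : A → Set p} (m : ℕ → A) k {vs} → (∀ j → P (m j)) → All P vs → ∀ j → P ((m [ k ≔* vs ]) j)
    [≔*]-all m k {[]} h [] j = h j
    [≔*]-all {P = P} m k {v ∷ vs} h (pv ∷ pvs) j with j ≟ k
    ... | yes refl = subst P (sym ([≔]-same (m [ suc k ≔* vs ]) k)) pv
    ... | no j≢k = subst P (sym ([≔]-other (m [ suc k ≔* vs ]) j≢k)) ([≔*]-all m (suc k) h pvs j)

  At-map : ∀ {a b} {A : Set a} {B : Set b} (f : A → B) {xs i x} → At xs i x → At (map f xs) i (f x)
  At-map f here      = here
  At-map f (there p) = there (At-map f p)

  At-product : ∀ {a b} {A : Set a} {B : Set b} {xs : List A} {ys : List B} {i x j y} → At xs i x → At ys j y → At (cartesianProduct xs ys) (i * length ys + j) (x , y)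
  At-product {xs = x ∷ xs} {ys} here q = At-++ˡ (At-map (x ,_) q)
  At-product {xs = x ∷ xs} {ys} {x = z} {j} {y} (there {i = i} p) q =
    subst (λ k → At (cartesianProduct (x ∷ xs) ys) k (z , y)) (trans (cong (_+ (i * length ys + j)) (List.length-map (x ,_) ys)) (sym (ℕ.+-assoc (length ys) (i * length ys) j)))
      (At-++ʳ (map (x ,_) ys) (At-product p q))

  At-concatMap : ∀ {a b} {A : Set a} {B : Set b} (f : A → List B) {w} → (∀ x → length (f x) ≡ w) → ∀ {xs i x l y} → At xs i x → At (f x) l y → At (concatMap f xs) (i * w + l) y
  At-concatMap f len here q = At-++ˡ q
  At-concatMap f {w} len {x ∷ xs} {l = l} {y} (there {i = i} p) q =
    subst (λ k → At (concatMap f (x ∷ xs)) k y) (trans (cong (_+ (i * w + l)) (len x)) (sym (ℕ.+-assoc w (i * w) l))) (At-++ʳ (f x) (At-concatMap f len p q))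

  length-concatMap≡ : ∀ {a b} {A : Set a} {B : Set b} (f : A → List B) {w} → (∀ x → length (f x) ≡ w) → ∀ xs → length (concatMap f xs) ≡ length xs * w
  length-concatMap≡ f len []       = refl
  length-concatMap≡ f len (x ∷ xs) = trans (List.length-++ (f x)) (cong₂ _+_ (len x) (length-concatMap≡ f len xs))

  module Input {c ℓ₁ ℓ₂} (ℝ : CompleteOrderedField c ℓ₁ ℓ₂) (F : RootFinder ℝ) {n q : ℕ} (G : Graphs.Graph ℝ n q) (s t : Fin n) where
    open CompleteOrderedField ℝ using (Carrier; 0#) renaming (reflexive to ≈-reflexive)
    open ShortestPathQueries ℝ F
    open Graph G

    private
      length-allFin : ∀ n → length (allFin n) ≡ n
      length-allFin n = List.length-tabulate (λ i → i)

      pair : ∀ u v → At (cartesianProduct (allFin n) (allFin n)) (toℕ u * n + toℕ v) (u , v)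
      pair u v = subst (λ k → At (cartesianProduct (allFin n) (allFin n)) (toℕ u * k + toℕ v) (u , v)) (length-allFin n) (At-product (At-tabulate (λ i → i) u) (At-tabulate (λ i → i) v))

      length-pairs : length (cartesianProduct (allFin n) (allFin n)) ≡ n * n
      length-pairs = trans (length-cartesianProductWith _,_ (allFin n) (allFin n)) (cong₂ _*_ (length-allFin n) (length-allFin n))

      pairs : List (Fin n × Fin n)
      pairs = cartesianProduct (allFin n) (allFin n)

      adjacent : Fin n × Fin n → ℕ
      adjacent (u , v) = maybe′ (λ _ → 1) 0 (wt u v)

      coefficients : Fin n × Fin n → List Carrier
      coefficients (u , v) = toList (maybe′ (λ p → p) (replicate (suc q) 0#) (wt u v))

      length-coefficients : ∀ p → length (coefficients p) ≡ suc q
      length-coefficients (u , v) = List.length-tabulate (maybe′ (λ p → p) (replicate (suc q) 0#) (wt u v))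

      ints : List ℕ
      ints = n ∷ q ∷ toℕ s ∷ toℕ t ∷ map adjacent pairs

      length-ints : length ints ≡ 4 + n * n
      length-ints = cong (4 +_) (trans (List.length-map adjacent pairs) length-pairs)

    input-adjacent : ∀ u v → int (input G s t) (4 + (toℕ u * n + toℕ v)) ≡ maybe′ (λ _ → 1) 0 (wt u v)
    input-adjacent u v = [≔*]-at (λ _ → 0) 0 {ints} (there (there (there (there (At-map adjacent (pair u v))))))

    input-coefficient : ∀ u v l → real (input G s t) ((toℕ u * n + toℕ v) * suc q + toℕ l) ≡ maybe′ (λ p → p) (λ _ → 0#) (wt u v) l
    input-coefficient u v l = [≔*]-at (λ _ → 0#) 0 {concatMap coefficients pairs} (At-concatMap coefficients length-coefficients (pair u v) (At-tabulate (maybe′ (λ p → p) (replicate (suc q) 0#) (wt u v)) l))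

    input-fits : ∀ {S} → n < S → q < S → 2 ≤ S → 4 + n * n ≤ S → n * n * suc q ≤ S → Fits S (input G s t)
    input-fits {S} n<S q<S 2≤S cells reals = record
      { int-word = [≔*]-all {P = _< S} (λ _ → 0) 0 {ints} (λ _ → ℕ.≤-trans (s≤s z≤n) 2≤S)
          (n<S ∷ q<S ∷ ℕ.<-trans (Fin.toℕ<n s) n<S ∷ ℕ.<-trans (Fin.toℕ<n t) n<S ∷ All.map⁺ (All.universal (λ (u , v) → bit (wt u v)) pairs))
      ; int-blank = λ k S≤k → [≔*]-outside (λ _ → 0) 0 ints (inj₂ (ℕ.≤-trans (ℕ.≤-reflexive length-ints) (ℕ.≤-trans cells S≤k)))
      ; real-blank = λ k S≤k → ≈-reflexive ([≔*]-outside (λ _ → 0#) 0 (concatMap coefficients pairs) (inj₂ (ℕ.≤-trans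
          (ℕ.≤-reflexive (trans (length-concatMap≡ coefficients length-coefficients pairs) (cong (_* suc q) length-pairs))) (ℕ.≤-trans reals S≤k)))) }
      where
      bit : ∀ (m : Maybe (CompleteOrderedField.Polynomial ℝ q)) → maybe′ (λ _ → 1) 0 m < S
      bit nothing  = ℕ.≤-trans (s≤s z≤n) 2≤S
      bit (just _) = 2≤S

    input-blank : ∀ j → 4 + n * n ≤ j → int (input G s t) j ≡ 0
    input-blank j le = [≔*]-outside (λ _ → 0) 0 ints (inj₂ (ℕ.≤-trans (ℕ.≤-reflexive length-ints) le))

  n≤2^⌈log₂n⌉ : ∀ n → n ≤ 2 ^ ⌈log₂ n ⌉
  n≤2^⌈log₂n⌉ n = go n n ℕ.≤-refl
    where
    -- Fuel, because the recursion goes to `⌈ n /2⌉`, which is not structurally smaller.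
    go : ∀ fuel n → n ≤ fuel → n ≤ 2 ^ ⌈log₂ n ⌉
    go _ zero _ = z≤n
    go _ (suc zero) _ = ℕ.m^n>0 2 ⌈log₂ 1 ⌉
    go (suc fuel) n@(suc (suc m)) (s≤s le) = begin
      n                                ≡⟨ sym (ℕ.⌊n/2⌋+⌈n/2⌉≡n n) ⟩
      ⌊ n /2⌋ + ⌈ n /2⌉                ≤⟨ ℕ.+-monoˡ-≤ ⌈ n /2⌉ (ℕ.⌊n/2⌋≤⌈n/2⌉ n) ⟩
      ⌈ n /2⌉ + ⌈ n /2⌉                ≤⟨ ℕ.+-mono-≤ ih ih ⟩
      2 ^ l + 2 ^ l                    ≡⟨ cong (2 ^ l +_) (sym (ℕ.+-identityʳ (2 ^ l))) ⟩
      2 ^ suc l                        ≡⟨ cong (2 ^_) (trans (cong suc (⌈log₂⌈n/2⌉⌉≡⌈log₂n⌉∸1 n)) (ℕ.m+[n∸m]≡n (⌈log₂⌉-mono-≤ {2} {n} (s≤s (s≤s z≤n))))) ⟩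
      2 ^ ⌈log₂ n ⌉                    ∎
      where
      open ℕ.≤-Reasoning
      l = ⌈log₂ ⌈ n /2⌉ ⌉
      ih = go fuel ⌈ n /2⌉ (ℕ.≤-trans (ℕ.≤-pred (ℕ.⌈n/2⌉<n m)) le)

  module Powers (e L : ℕ) (2≤e : 2 ≤ e) (1≤L : 1 ≤ L) where
    infix 4 _⊑_
    -- Bounds of the form `(nq)^(a log(nq))`. They are closed under products by adding coefficients,
    -- and a sum costs one unit more, so every space and time estimate becomes a small numeral.
    _⊑_ : ℕ → ℕ → Set
    x ⊑ a = x ≤ e ^ (a * L)

    instance
      e≢0 : NonZero e
      e≢0 = >-nonZero (ℕ.≤-trans (s≤s z≤n) 2≤e)

    ⊑-weaken : ∀ {x a b} → a ≤ b → x ⊑ a → x ⊑ b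
    ⊑-weaken a≤b x⊑ = ℕ.≤-trans x⊑ (ℕ.^-monoʳ-≤ e (ℕ.*-monoˡ-≤ L a≤b))

    ⊑-* : ∀ {x y a b} → x ⊑ a → y ⊑ b → x * y ⊑ a + b
    ⊑-* {a = a} {b} p r = ℕ.≤-trans (ℕ.*-mono-≤ p r) (ℕ.≤-reflexive (trans (sym (ℕ.^-distribˡ-+-* e (a * L) (b * L))) (cong (e ^_) (sym (ℕ.*-distribʳ-+ L a b)))))

    ⊑-const : ∀ {x} j → x ≤ 2 ^ j → x ⊑ j
    ⊑-const j x≤ = ℕ.≤-trans x≤ (ℕ.≤-trans (ℕ.^-monoˡ-≤ j 2≤e) (ℕ.^-monoʳ-≤ e (ℕ.m≤m*n j L {{>-nonZero 1≤L}})))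

    ⊑-+ : ∀ {x y a b} → x ⊑ a → y ⊑ b → x + y ⊑ suc (a + b)
    ⊑-+ {x} {y} {a} {b} p r = ℕ.≤-trans (ℕ.+-mono-≤ (⊑-weaken (ℕ.m≤m+n a b) p) (⊑-weaken (ℕ.m≤n+m b a) r))
      (ℕ.≤-trans (ℕ.≤-reflexive (cong (z +_) (sym (ℕ.+-identityʳ z)))) (⊑-* {2} {z} {1} {a + b} (⊑-const 1 ℕ.≤-refl) ℕ.≤-refl))
      where z = e ^ ((a + b) * L)

    ⊑-^ : ∀ {x a} h → x ⊑ a → x ^ h ⊑ a * h
    ⊑-^ {x} {a} h p = ℕ.≤-trans (ℕ.^-monoˡ-≤ h p) (ℕ.≤-reflexive (trans (ℕ.^-*-assoc e (a * L) h) (cong (e ^_)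
      (trans (ℕ.*-assoc a L h) (trans (cong (a *_) (ℕ.*-comm L h)) (sym (ℕ.*-assoc a h L)))))))

    ⊑-suc : ∀ {x a} → x ⊑ a → suc x ⊑ suc a
    ⊑-suc {a = a} p = ⊑-+ {1} {_} {0} {a} (⊑-const 0 ℕ.≤-refl) p

    ⊑-base : ∀ {x} → x ≤ e → x ⊑ 1
    ⊑-base x≤e = ℕ.≤-trans x≤e (ℕ.≤-trans (ℕ.≤-reflexive (sym (ℕ.*-identityʳ e))) (ℕ.^-monoʳ-≤ e (ℕ.≤-trans 1≤L (ℕ.≤-reflexive (sym (ℕ.+-identityʳ L))))))

  n<2^n : ∀ n → n < 2 ^ n
  n<2^n zero    = s≤s z≤n
  n<2^n (suc n) = ℕ.≤-trans (s≤s (n<2^n n)) (ℕ.≤-trans (ℕ.+-monoˡ-≤ (2 ^ n) (ℕ.m^n>0 2 n)) (ℕ.≤-reflexive (cong (2 ^ n +_) (sym (ℕ.+-identityʳ (2 ^ n))))))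

  5+p≤p⁴ : ∀ {p} → 4 ≤ p → 5 + p ≤ p * p * (p * p)
  5+p≤p⁴ {p} 4≤p = ℕ.≤-trans (ℕ.≤-trans (ℕ.+-monoˡ-≤ p (ℕ.≤-trans (ℕ.m≤m+n 5 7) (ℕ.*-monoˡ-≤ 3 4≤p)))
    (ℕ.≤-trans (ℕ.≤-reflexive (trans (ℕ.+-comm (p * 3) p) (sym (ℕ.*-suc p 3)))) (ℕ.*-monoʳ-≤ p 4≤p))) (ℕ.m≤m*n (p * p) (p * p) {{>-nonZero pp}})
    where
    pp : 1 ≤ p * p
    pp = ℕ.≤-trans (s≤s z≤n) (ℕ.*-mono-≤ 4≤p 4≤p)

  module Magnitudes (n q : ℕ) (2≤n : 2 ≤ n) (1≤q : 1 ≤ q) where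
    -- The exponent of `Z = e^12` comes from the count: one table has at most `m = e^4` breakpoints,
    -- hence at most `m + (m + 1)^2` successors, and this is at most `5m^2`, which lies below `m^3`.
    e L Λ Z n⁸ d : ℕ
    e = n * q
    L = ⌈log₂ e ⌉
    Λ = ⌈log₂ n ⌉
    Z = (e * e) * (e * e) * ((e * e) * (e * e)) * ((e * e) * (e * e))
    n⁸ = (n * n * (n * n)) * (n * n * (n * n))
    d = n⁸ ∸ 64

    n≤e : n ≤ e
    n≤e = ℕ.m≤m*n n q {{>-nonZero 1≤q}}

    q≤e : q ≤ e
    q≤e = ℕ.m≤n*m q n {{>-nonZero (ℕ.≤-trans (s≤s z≤n) 2≤n)}}

    2≤e : 2 ≤ e
    2≤e = ℕ.≤-trans 2≤n n≤e

    1≤Λ : 1 ≤ Λ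
    1≤Λ = ⌈log₂⌉-mono-≤ {2} {n} 2≤n

    Λ≤L : Λ ≤ L
    Λ≤L = ⌈log₂⌉-mono-≤ {n} {e} n≤e

    1≤L : 1 ≤ L
    1≤L = ℕ.≤-trans 1≤Λ Λ≤L

    open Powers e L 2≤e 1≤L public

    n⁸≡ : n⁸ ≡ 64 + d
    n⁸≡ = sym (ℕ.m+[n∸m]≡n (ℕ.≤-trans (ℕ.m≤m+n 64 192) (ℕ.*-mono-≤ n⁴ n⁴)))
      where
      n⁴ : 16 ≤ n * n * (n * n)
      n⁴ = ℕ.*-mono-≤ (ℕ.*-mono-≤ 2≤n 2≤n) (ℕ.*-mono-≤ 2≤n 2≤n)

    5+n²≤64+d : 5 + n * n ≤ 64 + d
    5+n²≤64+d = ℕ.≤-trans (5+p≤p⁴ (ℕ.*-mono-≤ 2≤n 2≤n)) (ℕ.≤-reflexive n⁸≡)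

    4≤e² : 4 ≤ e * e
    4≤e² = ℕ.*-mono-≤ 2≤e 2≤e

    m mm : ℕ
    m = (e * e) * (e * e)
    mm = m * m

    16≤m : 16 ≤ m
    16≤m = ℕ.*-mono-≤ 4≤e² 4≤e²

    1≤m : 1 ≤ m
    1≤m = ℕ.≤-trans (ℕ.m≤m+n 1 15) 16≤m

    e≤e² : e ≤ e * e
    e≤e² = ℕ.m≤m*n e e

    1+e≤e² : suc e ≤ e * e
    1+e≤e² = ℕ.≤-trans (ℕ.+-monoˡ-≤ e (ℕ.≤-trans (s≤s z≤n) 2≤e)) (ℕ.≤-trans (ℕ.≤-reflexive (cong (e +_) (sym (ℕ.+-identityʳ e)))) (ℕ.*-monoˡ-≤ e 2≤e))

    e²≤m : e * e ≤ m
    e²≤m = ℕ.m≤m*n (e * e) (e * e) {{>-nonZero (ℕ.≤-trans (s≤s z≤n) 4≤e²)}}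

    m≤mm : m ≤ mm
    m≤mm = ℕ.m≤m*n m m {{>-nonZero 1≤m}}

    16mm≤Z : mm * 16 ≤ Z
    16mm≤Z = ℕ.*-monoʳ-≤ mm 16≤m

    mm≤Z : mm ≤ Z
    mm≤Z = ℕ.m≤m*n mm m {{>-nonZero 1≤m}}

    m≤Z : m ≤ Z
    m≤Z = ℕ.≤-trans m≤mm mm≤Z

    e²≤Z : e * e ≤ Z
    e²≤Z = ℕ.≤-trans e²≤m m≤Z

    64≤Z : 64 ≤ Z
    64≤Z = ℕ.≤-trans (ℕ.m≤m+n 64 192) (ℕ.≤-trans (ℕ.*-mono-≤ 16≤m 16≤m) mm≤Z)

    n²≤e² : n * n ≤ e * e
    n²≤e² = ℕ.*-mono-≤ n≤e n≤e

    n⁸≤mm : n⁸ ≤ mm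
    n⁸≤mm = ℕ.*-mono-≤ (ℕ.*-mono-≤ n²≤e² n²≤e²) (ℕ.*-mono-≤ n²≤e² n²≤e²)

    d≤n⁸ : d ≤ n⁸
    d≤n⁸ = ℕ.m∸n≤m n⁸ 64

    n⁸≤ : ∀ {x} → x ≤ (64 + d) * 16 → x ≤ Z
    n⁸≤ le = ℕ.≤-trans le (ℕ.≤-trans (ℕ.*-monoˡ-≤ 16 (ℕ.≤-trans (ℕ.≤-reflexive (sym n⁸≡)) n⁸≤mm)) 16mm≤Z)

    -- All cells that the set-up uses lie below this bound, hence below the array addresses, so the
    -- arrays start out blank.
    above≤Z : 68 + (d + (62 + d)) ≤ Z
    above≤Z = n⁸≤ (ℕ.≤-trans (ℕ.≤-reflexive (regroup 4 64 62 d)) (ℕ.≤-trans (ℕ.+-monoʳ-≤ N (ℕ.+-monoˡ-≤ N (ℕ.m≤m+n 2 (62 + d))))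
      (ℕ.≤-trans (ℕ.≤-reflexive (triple N)) (ℕ.*-monoʳ-≤ N (ℕ.m≤m+n 3 13)))))
      where
      open +-*-Solver
      N = 64 + d
      regroup : ∀ x y z d → (x + y) + (d + (z + d)) ≡ (y + d) + (x + (z + d))
      regroup = solve 4 (λ x y z d → (x :+ y) :+ (d :+ (z :+ d)) := (y :+ d) :+ (x :+ (z :+ d))) refl
      triple : ∀ N → N + (N + N) ≡ N * 3
      triple = solve 1 (λ N → N :+ (N :+ N) := N :* con 3) refl

    base≤Z : 67 + d + n * n ≤ Z
    base≤Z = n⁸≤ (ℕ.≤-trans (ℕ.+-mono-≤ (ℕ.+-monoˡ-≤ N (ℕ.m≤m+n 3 (61 + d))) (ℕ.≤-trans (ℕ.m≤n+m (n * n) 5) 5+n²≤64+d))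
      (ℕ.≤-trans (ℕ.≤-reflexive (triple N)) (ℕ.*-monoʳ-≤ N (ℕ.m≤m+n 3 13))))
      where
      open +-*-Solver
      N = 64 + d
      triple : ∀ N → (N + N) + N ≡ N * 3
      triple = solve 1 (λ N → (N :+ N) :+ N := N :* con 3) refl

    breakpoints≤m : n * (n * (n * (n * q))) ≤ m
    breakpoints≤m = ℕ.≤-trans (ℕ.*-mono-≤ n≤e (ℕ.*-mono-≤ n≤e (ℕ.*-monoˡ-≤ e n≤e))) (ℕ.≤-reflexive (sym (ℕ.*-assoc e e (e * e))))

    m+[1+m]²≤Z : m + suc m * suc m ≤ Z
    m+[1+m]²≤Z = ℕ.≤-trans (ℕ.+-mono-≤ m≤mm (ℕ.*-mono-≤ 1+m≤2m 1+m≤2m))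
      (ℕ.≤-trans (ℕ.≤-reflexive (collect m)) (ℕ.≤-trans (ℕ.*-monoʳ-≤ mm (ℕ.m≤m+n 5 11)) 16mm≤Z))
      where
      open +-*-Solver
      1+m≤2m : suc m ≤ m + m
      1+m≤2m = ℕ.+-monoˡ-≤ m 1≤m
      collect : ∀ m → m * m + (m + m) * (m + m) ≡ m * m * 5
      collect = solve 1 (λ m → m :* m :+ (m :+ m) :* (m :+ m) := m :* m :* con 5) refl

    coefficients≤Z : n * n * suc q ≤ Z
    coefficients≤Z = ℕ.≤-trans (ℕ.*-mono-≤ n²≤e² (ℕ.≤-trans (s≤s q≤e) 1+e≤e²)) m≤Z

    Z≡ : Z ≡ e ^ 12
    Z≡ = solve 1 (λ e → (e :* e) :* (e :* e) :* ((e :* e) :* (e :* e)) :* ((e :* e) :* (e :* e)) := e :^ 12) refl e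
      where open +-*-Solver

    1+Λ≤2L : suc Λ ≤ 2 * L
    1+Λ≤2L = ℕ.≤-trans (ℕ.+-mono-≤ 1≤L Λ≤L) (ℕ.≤-reflexive (cong (L +_) (sym (ℕ.+-identityʳ L))))

    -- Here `Z^(k+1)` is `e^(12(k+1))`, and `1 + Λ ≤ 2L` turns the exponent into `24 L`. The bound
    -- `B` is thus quasi-polynomial.
    Z^-⊑ : ∀ {k} → k ≤ Λ → Z ^ suc k ⊑ 24
    Z^-⊑ {k} k≤Λ = ℕ.≤-trans (ℕ.≤-reflexive (trans (cong (_^ suc k) Z≡) (ℕ.^-*-assoc e 12 (suc k))))
      (ℕ.^-monoʳ-≤ e (ℕ.≤-trans (ℕ.*-monoʳ-≤ 12 (ℕ.≤-trans (s≤s k≤Λ) 1+Λ≤2L)) (ℕ.≤-reflexive (sym (ℕ.*-assoc 12 2 L)))))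

    n⊑ : n ⊑ 1
    n⊑ = ⊑-base n≤e
    q⊑ : q ⊑ 1
    q⊑ = ⊑-base q≤e
    n²⊑ : n * n ⊑ 2
    n²⊑ = ⊑-* {n} {n} {1} {1} n⊑ n⊑
    d⊑ : d ⊑ 8
    d⊑ = ℕ.≤-trans d≤n⁸ (⊑-* {n⁴} {n⁴} {4} {4} n⁴⊑ n⁴⊑)
      where
      n⁴ = n * n * (n * n)
      n⁴⊑ = ⊑-* {n * n} {n * n} {2} {2} n²⊑ n²⊑
    Λ⊑ : Λ ⊑ 1
    Λ⊑ = ℕ.≤-trans (ℕ.≤-trans Λ≤L (ℕ.<⇒≤ (n<2^n L))) (ℕ.≤-trans (ℕ.^-monoˡ-≤ L 2≤e) (ℕ.^-monoʳ-≤ e (ℕ.≤-reflexive (sym (ℕ.+-identityʳ L)))))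

    prelude-time⊑ : 12 + (suc ((62 + d) * 4) + (22 + (suc (Λ * 4) + 1))) ⊑ 35
    prelude-time⊑ = ⊑-+ {12} {suc ((62 + d) * 4) + (22 + (suc (Λ * 4) + 1))} {4} {30} (⊑-const 4 (ℕ.m≤m+n 12 4))
      (⊑-+ {suc ((62 + d) * 4)} {22 + (suc (Λ * 4) + 1)} {18} {11}
        (⊑-suc {(62 + d) * 4} {17} (⊑-* {62 + d} {4} {15} {2} (⊑-+ {62} {d} {6} {8} (⊑-const 6 (ℕ.m≤m+n 62 2)) d⊑) (⊑-const 2 ℕ.≤-refl)))
        (⊑-+ {22} {suc (Λ * 4) + 1} {5} {5} (⊑-const 5 (ℕ.m≤m+n 22 10))
          (⊑-+ {suc (Λ * 4)} {1} {4} {0} (⊑-suc {Λ * 4} {3} (⊑-* {Λ} {4} {1} {2} Λ⊑ (⊑-const 2 ℕ.≤-refl))) (⊑-const 0 ℕ.≤-refl))))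

    cube-⊑ : ∀ {B} → B ⊑ 24 → 33 * B * B * B * B ⊑ 102
    cube-⊑ {B} b = ⊑-* {33 * B * B * B} {B} {78} {24} (⊑-* {33 * B * B} {B} {54} {24} (⊑-* {33 * B} {B} {30} {24} (⊑-* {33} {B} {6} {24} (⊑-const 6 (ℕ.m≤m+n 33 31)) b) b) b) b

    n≤2^Λ : n ≤ 2 ^ Λ
    n≤2^Λ = n≤2^⌈log₂n⌉ n

    -- A bound on log₂ B, of order log n · log (nq).
    Steps : ℕ
    Steps = (Λ + ⌈log₂ q ⌉) * 12 * suc Λ

    Z^≤2^ : ∀ {k} → k ≤ Λ → Z ^ suc k ≤ 2 ^ Steps
    Z^≤2^ {k} k≤Λ = begin
      Z ^ suc k                  ≡⟨ cong (_^ suc k) Z≡ ⟩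
      (e ^ 12) ^ suc k           ≤⟨ ℕ.^-monoʳ-≤ (e ^ 12) {{ℕ.m^n≢0 e 12}} (s≤s k≤Λ) ⟩
      (e ^ 12) ^ suc Λ           ≤⟨ ℕ.^-monoˡ-≤ (suc Λ) (ℕ.^-monoˡ-≤ 12 e≤) ⟩
      ((2 ^ l) ^ 12) ^ suc Λ     ≡⟨ cong (_^ suc Λ) (ℕ.^-*-assoc 2 l 12) ⟩
      (2 ^ (l * 12)) ^ suc Λ     ≡⟨ ℕ.^-*-assoc 2 (l * 12) (suc Λ) ⟩
      2 ^ Steps                  ∎
      where
      open ℕ.≤-Reasoning
      l = Λ + ⌈log₂ q ⌉
      e≤ : e ≤ 2 ^ l
      e≤ = ℕ.≤-trans (ℕ.*-mono-≤ n≤2^Λ (n≤2^⌈log₂n⌉ q)) (ℕ.≤-reflexive (sym (ℕ.^-distribˡ-+-* 2 Λ ⌈log₂ q ⌉)))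

    -- The query constant is 14 for the straight-line part plus `6 * 12 * 2` for the search: six
    -- steps a round, the exponent 12 of `Z`, and `1 + Λ ≤ 2Λ`.
    steps≤ : 14 + 6 * Steps ≤ 158 * (Λ ^ 2 + Λ * ⌈log₂ q ⌉)
    steps≤ = ℕ.≤-trans (ℕ.+-mono-≤ fourteen steps) (ℕ.≤-reflexive (sym (ℕ.*-distribʳ-+ X 14 144)))
      where
      open +-*-Solver
      X = Λ ^ 2 + Λ * ⌈log₂ q ⌉
      X≥1 : 1 ≤ X
      X≥1 = ℕ.≤-trans (ℕ.*-mono-≤ 1≤Λ (ℕ.*-mono-≤ 1≤Λ (ℕ.≤-refl {1}))) (ℕ.m≤m+n (Λ ^ 2) (Λ * ⌈log₂ q ⌉))
      fourteen : 14 ≤ 14 * X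
      fourteen = ℕ.m≤m*n 14 X {{>-nonZero X≥1}}
      collect : ∀ a b c x y → a * ((x + y) * b * (c * x)) ≡ (a * b * c) * (x * (x * 1) + x * y)
      collect = solve 5 (λ a b c x y → a :* ((x :+ y) :* b :* (c :* x)) := (a :* b :* c) :* (x :* (x :* con 1) :+ x :* y)) refl
      steps : 6 * Steps ≤ 144 * X
      steps = ℕ.≤-trans (ℕ.*-monoʳ-≤ 6 (ℕ.*-monoʳ-≤ ((Λ + ⌈log₂ q ⌉) * 12) (ℕ.≤-trans (ℕ.+-monoˡ-≤ Λ 1≤Λ) (ℕ.≤-reflexive (cong (Λ +_) (sym (ℕ.+-identityʳ Λ)))))))
        (ℕ.≤-reflexive (collect 6 12 2 Λ ⌈log₂ q ⌉))

    module Levels {K : ℕ} (K≤Λ : K ≤ Λ) where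
      B : ℕ
      B = Z ^ suc K

      private instance
        Z≢0 : NonZero Z
        Z≢0 = >-nonZero (ℕ.≤-trans (s≤s z≤n) 64≤Z)

      Z≤B : Z ≤ B
      Z≤B = ℕ.m≤m*n Z (Z ^ K) {{ℕ.m^n≢0 Z K}}

      ≤B : ∀ {x} → x ≤ Z → x ≤ B
      ≤B le = ℕ.≤-trans le Z≤B

      Z^K≤B : Z ^ K ≤ B
      Z^K≤B = ℕ.m≤n*m (Z ^ K) Z

      64≤B : 64 ≤ B
      64≤B = ≤B 64≤Z

      n≤B : n ≤ B
      n≤B = ≤B (ℕ.≤-trans n≤e (ℕ.≤-trans e≤e² e²≤Z))

      1+q≤B : suc q ≤ B
      1+q≤B = ≤B (ℕ.≤-trans (s≤s q≤e) (ℕ.≤-trans 1+e≤e² e²≤Z))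

      1+n≤B : suc n ≤ B
      1+n≤B = ≤B (ℕ.≤-trans (s≤s n≤e) (ℕ.≤-trans 1+e≤e² e²≤Z))

      1+K≤B : suc K ≤ B
      1+K≤B = ℕ.≤-trans (ℕ.<⇒≤ (n<2^n (suc K))) (ℕ.^-monoˡ-≤ (suc K) (ℕ.≤-trans (ℕ.m≤m+n 2 62) 64≤Z))

      B≤B⁴ : B ≤ B * B * B * B
      B≤B⁴ = ℕ.≤-trans (m≤m*B B) (ℕ.≤-trans (m≤m*B (B * B)) (m≤m*B (B * B * B)))
        where
        m≤m*B : ∀ m → m ≤ m * B
        m≤m*B m = ℕ.m≤m*n m B {{>-nonZero (ℕ.≤-trans (s≤s z≤n) 64≤B)}}

  module Answering {c ℓ₁ ℓ₂} (ℝ : CompleteOrderedField c ℓ₁ ℓ₂) (F : RootFinder ℝ) {n q : ℕ} (G : Graphs.Graph ℝ n q) (s t : Fin n) (S : ℕ) where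
    open CompleteOrderedField ℝ using (Carrier) renaming (_<_ to _<ᵣ_; _≤_ to _≤ᵣ_)
    open ShortestPathQueries ℝ F
    open Machine ℝ F S

    ListAt-same : ∀ {σ σ′} → (∀ j → 64 ≤ j → int σ′ j ≡ int σ j) → ∀ {k} xs → 64 ≤ k → ListAt σ k xs → ListAt σ′ k xs
    ListAt-same same []       64≤k _        = tt
    ListAt-same same (x ∷ xs) 64≤k (e , es) = trans (same _ 64≤k) e , ListAt-same same xs (ℕ.m≤n⇒m≤1+n 64≤k) es

    record StoredCell (B base label i : ℕ) (σ : Store) : Set (c ⊔ ℓ₁ ⊔ ℓ₂) where
      field
        path   : Walk G s t
        stored : StoredAt G σ label path
        valid  : ∀ x → NoNegativeCycle G x → (∀ i′ → i ≡ suc i′ → real σ (base + i′) <ᵣ x) →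
                 (suc i < B → x ≤ᵣ real σ (base + i)) → IsShortestPath G x path

    -- Mentions only what a query leaves alone: the registers 9 and 11, integer cells from 64 on and
    -- the breaks. This makes it an invariant of any sequence of queries.
    record Ready (steps : ℕ) (σ : Store) : Set (c ⊔ ℓ₁ ⊔ ℓ₂) where
      field
        B       : ℕ
        64≤B    : 64 ≤ B
        S-large : 33 * B * B * B * B ≤ S
        B≤2^    : B ≤ 2 ^ steps
        fits    : Fits S σ
        bound   : int σ 9 ≡ B
        one     : int σ 11 ≡ 1
      open Querying B 64≤B S-large public
      field
        cells   : ∀ i → i < B → StoredCell B breaksBase (label i) i σ

    module _ {steps : ℕ} {σ : Store} (ready : Ready steps σ) (x : Carrier) where
      open Ready ready

      private
        σₓ : Store
        σₓ = setReal (at 0) x σ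

        64≤*B : ∀ {a} → 1 ≤ a → 64 ≤ a * B
        64≤*B {a} 1≤a = ℕ.≤-trans 64≤B (ℕ.m≤n*m B a {{>-nonZero 1≤a}})

        1≤B : 1 ≤ B
        1≤B = ℕ.≤-trans (s≤s z≤n) 64≤B

        64≤label : ∀ i → 64 ≤ label i
        64≤label i = 64≤*B (ℕ.≤-trans (ℕ.*-mono-≤ {1} {4 * B * B} (ℕ.*-mono-≤ {1} {4 * B} (ℕ.*-mono-≤ {1} {4} (s≤s z≤n) 1≤B) 1≤B) 1≤B) (ℕ.m≤m+n _ i))

        -- The query is delivered in real cell 0, which must not hold a break.
        break≢0 : ∀ i → breaksBase + i ≢ 0
        break≢0 i e = ℕ.<⇒≢ (ℕ.≤-trans (ℕ.*-mono-≤ {1} {10 * B * B * B} (ℕ.*-mono-≤ {1} {10 * B * B} (ℕ.*-mono-≤ {1} {10 * B} (ℕ.*-mono-≤ {1} {10} (s≤s z≤n) 1≤B) 1≤B) 1≤B) 1≤B) (ℕ.m≤m+n breaksBase i)) (sym e)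

        break-same : ∀ i → real σₓ (breaksBase + i) ≡ real σ (breaksBase + i)
        break-same i = [≔]-other (real σ) (break≢0 i)

        fitsₓ : Fits S σₓ
        fitsₓ = record
          { int-word = Fits.int-word fits ; int-blank = Fits.int-blank fits
          ; real-blank = λ k S≤k → subst (λ r → CompleteOrderedField._≈_ ℝ r (CompleteOrderedField.0# ℝ))
              (sym ([≔]-other (real σ) (λ e → ℕ.<⇒≱ (Fits.int-word fits 0) (ℕ.≤-trans S≤k (ℕ.≤-trans (ℕ.≤-reflexive e) z≤n))))) (Fits.real-blank fits k S≤k) }

      answer-run : NoNegativeCycle G x → ∀ {T} → 14 + 6 * steps ≤ T → ∃[ σ′ ] Answers S T query G s t x σ σ′ × Ready steps σ′
      answer-run noNegative {T} time≤ = conclude (query-run steps σₓ B≤2^ fitsₓ bound one)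
       where
       conclude : (∃[ τ ] ∃[ i ] ∃[ σ′ ] τ ≤ 14 + 6 * steps × Run S query σₓ τ σ′ × int σ′ 0 ≡ label i × Found σₓ i σ′) →
         ∃[ σ′ ] Answers S T query G s t x σ σ′ × Ready steps σ′
       conclude (τ , i , σ′ , τ≤ , run , label≡ , found) = σ′ ,
        ((τ , ℕ.≤-trans τ≤ time≤ , run) , path ,
          valid x noNegative (λ i′ e → subst (_<ᵣ x) (break-same i′) (after i′ e)) (λ lt → subst (x ≤ᵣ_) (break-same i) (until lt)) ,
          subst (λ k → StoredAt G σ k path) (sym label≡) stored ,
          subst (λ k → StoredAt G σ′ k path) (sym label≡) (keep i path stored)) ,
        record
          { B = B ; 64≤B = 64≤B ; S-large = S-large ; B≤2^ = B≤2^ ; fits = fit ; bound = trans reg9 bound ; one = trans reg11 one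
          ; cells = λ j j<B → let module C = StoredCell (cells j j<B) in record
              { path = C.path ; stored = keep j C.path C.stored
              ; valid = λ y nn af un → C.valid y nn (λ i′ e → subst (_<ᵣ y) (real-same i′) (af i′ e)) (λ lt → subst (y ≤ᵣ_) (real-same j) (un lt)) } }
        where
        open Found found
        open StoredCell (cells i i<B)
        keep : ∀ j w → StoredAt G σ (label j) w → StoredAt G σ′ (label j) w
        keep j w = ListAt-same {σ} {σ′} highs _ (64≤label j)
        real-same : ∀ j → real σ′ (breaksBase + j) ≡ real σ (breaksBase + j)
        real-same j = trans (cong (λ m → m (breaksBase + j)) reals) (break-same j)

  module Assembly {c ℓ₁ ℓ₂} (ℝ : CompleteOrderedField c ℓ₁ ℓ₂) (F : RootFinder ℝ) where
    open CompleteOrderedField ℝ using (Carrier; 0#)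
    open RootFinder F
    open ShortestPathQueries ℝ F

    k₀ : ℕ
    k₀ = proj₁ rootTime-poly

    preprocessing : Program
    preprocessing = prelude ︔ compile Preprocessing.main

    -- The base `t₀` of the time bounds must exceed the root time with 64 added, of coefficient
    -- `3k₀ + 7`, and `B`, of coefficient 24. The 200 covers the space, of coefficient 102, and the
    -- cost of the set-up.
    timePower exponent : ℕ
    timePower = suc (3 * k₀ + 6) + 24
    exponent = 200 + timePower * timeExponent Preprocessing.main

    module _ (n q : ℕ) (2≤n : 2 ≤ n) (1≤q : 1 ≤ q) (G : Graph n q) (s t : Fin n) (someP : Path G s t) (Kc : ℕ) (large : 200 + timePower * timeExponent Preprocessing.main ≤ Kc) where
      open Magnitudes n q 2≤n 1≤q
      open Graph G
      open Input ℝ F G s t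

      S : ℕ
      S = quasiPoly Kc n q

      1≤Kc : 1 ≤ Kc
      1≤Kc = ℕ.≤-trans (s≤s z≤n) large

      -- The passage to the stated bound: `a L` is at most `Kc L^Kc`, as `L` and `Kc` are at least
      -- 1.
      ⊑S : ∀ {x a} → a ≤ Kc → x ⊑ a → x ≤ S
      ⊑S {x} {a} a≤Kc x⊑ = ℕ.≤-trans (⊑-weaken {x} {a} a≤Kc x⊑) (ℕ.^-monoʳ-≤ e (ℕ.*-monoʳ-≤ Kc
        (ℕ.≤-trans (ℕ.≤-reflexive (sym (ℕ.*-identityʳ L))) (ℕ.^-monoʳ-≤ L {{>-nonZero 1≤L}} 1≤Kc))))

      ≤Kc : ∀ {a} → a ≤ 200 → a ≤ Kc
      ≤Kc a≤ = ℕ.≤-trans a≤ (ℕ.≤-trans (ℕ.m≤m+n 200 _) large)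

      t₀ : ℕ
      t₀ = e ^ (timePower * L)

      rootTime≤t₀ : rootTime q + 64 ≤ t₀
      rootTime≤t₀ = ⊑-weaken {rootTime q + 64} {suc (3 * k₀ + 6)} (ℕ.m≤m+n _ 24) (⊑-+ {rootTime q} {64} {3 * k₀} {6}
        (ℕ.≤-trans (proj₂ rootTime-poly q) (⊑-^ {2 + q} {3} k₀ (⊑-+ {2} {q} {1} {1} (⊑-const 1 ℕ.≤-refl) q⊑))) (⊑-const 6 ℕ.≤-refl))

      room : Prelude.Room ℝ F S n q (toℕ s) (toℕ t) d Λ
      room = record
        { n⁸≡ = n⁸≡
        ; room = ⊑S (≤Kc (ℕ.m≤m+n 26 174)) (⊑-+ {200} {d + d} {8} {17} (⊑-const 8 (ℕ.m≤m+n 200 56)) (⊑-+ {d} {d} {8} {8} d⊑ d⊑))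
        ; Z<S = ⊑S (≤Kc (ℕ.m≤m+n 25 175)) (⊑-suc {Z ^ suc Λ} {24} (Z^-⊑ ℕ.≤-refl))
        ; n≤2^Λ = n≤2^Λ ; n≥1 = ℕ.≤-trans (s≤s z≤n) 2≤n ; q≥1 = 1≤q
        ; 1+Λ<S = ⊑S (≤Kc (ℕ.m≤m+n 3 197)) (⊑-suc {suc Λ} {2} (⊑-suc {Λ} {1} Λ⊑)) }

      σ₀ : Store
      σ₀ = input G s t

      start : Prelude.Start ℝ F S n q (toℕ s) (toℕ t) d Λ σ₀
      start = record
        { r0 = refl ; r1 = refl ; r2 = refl ; r3 = refl
        ; fit = input-fits (⊑S (≤Kc (ℕ.m≤m+n 2 198)) (⊑-suc {n} {1} n⊑)) (⊑S (≤Kc (ℕ.m≤m+n 2 198)) (⊑-suc {q} {1} q⊑)) (⊑S (≤Kc (ℕ.m≤m+n 1 199)) (⊑-const {2} 1 ℕ.≤-refl))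
            (⊑S (≤Kc (ℕ.m≤m+n 5 195)) (⊑-+ {4} {n * n} {2} {2} (⊑-const 2 ℕ.≤-refl) n²⊑))
            (⊑S (≤Kc (ℕ.m≤m+n 4 196)) (⊑-* {n * n} {suc q} {2} {2} n²⊑ (⊑-suc {q} {1} q⊑))) }

      open Prelude ℝ F S n q (toℕ s) (toℕ t) d Λ using (prelude-run; Prepared)

      module Prep (K : ℕ) (σ : Store) (prepared : Prepared room σ₀ start K σ) where
        open Prepared prepared
        open Levels K≤Λ
        open Correct ℝ F G s t K B using (CellOk; main-ok)
        open Tables ℝ F G s t K B
        open Main ℝ F G s t K B using (Row)
        open Soundness ℝ F n q K B adjacentAt coefficientAt (67 + d) S t₀ public

        S-large : 33 * B * B * B * B ≤ S
        S-large = ⊑S (≤Kc (ℕ.m≤m+n 102 98)) (cube-⊑ {B} (Z^-⊑ K≤Λ))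

        adjacent<64 : ∀ u v → adjacentAt u v < 64
        adjacent<64 u v with entry u v
        ... | nothing = s≤s z≤n
        ... | just _  = s≤s (s≤s z≤n)

        sizes : Sizes
        sizes = record
          { 64≤B = 64≤B ; par≤B = pars≤ ; 64≤base = ℕ.m≤m+n 64 (3 + d)
          ; base-fits = ℕ.≤-trans (≤B base≤Z) B≤B⁴ ; real-fits = ℕ.≤-trans (≤B coefficients≤Z) B≤B⁴
          ; adjacent<B = λ u v → ℕ.<-≤-trans (adjacent<64 u v) 64≤B ; S-large = S-large
          ; t₀-large = rootTime≤t₀ ; B≤t₀ = ⊑-weaken {B} {24} {timePower} (ℕ.m≤n+m 24 (suc (3 * k₀ + 6))) (Z^-⊑ K≤Λ) }
          where
          pars≤ : ∀ p → par p ≤ B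
          pars≤ vertexPar = n≤B
          pars≤ widthPar  = 1+q≤B
          pars≤ levelPar  = 1+K≤B
          pars≤ lengthPar = 1+n≤B
          pars≤ boundPar  = ℕ.≤-refl

        entries : ∀ u v → int σ (67 + d + (toℕ u * n + toℕ v)) ≡ adjacentAt (toℕ u) (toℕ v)
        entries u v = trans (copied (toℕ u * n + toℕ v) refl) (sym (cong (maybe′ (λ _ → 1) 0) (entry-toℕ u v)))
          where
          below : toℕ u * n + toℕ v < n * n
          below = ℕ.<-≤-trans (ℕ.+-monoʳ-< (toℕ u * n) (Fin.toℕ<n v)) (ℕ.≤-trans (ℕ.≤-reflexive (ℕ.+-comm (toℕ u * n) n)) (ℕ.*-monoˡ-≤ n (Fin.toℕ<n u)))
          copied : ∀ k → toℕ u * n + toℕ v ≡ k → int σ (67 + d + k) ≡ maybe′ (λ _ → 1) 0 (wt u v)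
          -- The first entry was never copied. Its target is blank, and it belongs to a diagonal
          -- pair, which is not an edge.
          copied zero e = trans (trans (cong (λ k → int σ k) (ℕ.+-identityʳ (67 + d))) (trans raw₀ (input-blank (67 + d) blank)))
            (sym (cong (maybe′ (λ _ → 1) 0) (trans (cong (wt u) (sym u≡v)) (loopless u))))
            where
            blank : 4 + n * n ≤ 67 + d
            blank = ℕ.≤-trans (ℕ.n≤1+n (4 + n * n)) (ℕ.≤-trans 5+n²≤64+d (ℕ.m≤n+m (64 + d) 3))
            u≡0 : toℕ u ≡ 0
            u≡0 with ℕ.m*n≡0⇒m≡0∨n≡0 (toℕ u) (ℕ.m+n≡0⇒m≡0 (toℕ u * n) e)
            ... | inj₁ eq = eq
            ... | inj₂ n≡0 = ⊥-elim (ℕ.<⇒≢ (ℕ.≤-trans (s≤s z≤n) 2≤n) (sym n≡0))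
            u≡v : u ≡ v
            u≡v = Fin.toℕ-injective (trans u≡0 (sym (ℕ.m+n≡0⇒n≡0 (toℕ u * n) e)))
          copied (suc i) e = trans (cong (λ k → int σ (67 + k)) (ℕ.+-suc d i)) (trans (raw i i<) (trans (cong (λ k → int σ₀ (4 + k)) (sym e)) (input-adjacent u v)))
            where
            i< : i < 59 + d
            i< = ℕ.≤-trans (ℕ.≤-trans (ℕ.≤-reflexive (sym e)) (ℕ.<⇒≤ below)) (ℕ.+-cancelˡ-≤ 5 (n * n) (59 + d) 5+n²≤64+d)

        coefficients≡ : ∀ u v l → real σ ((toℕ u * n + toℕ v) * suc q + toℕ l) ≡ coefficientAt (toℕ u) (toℕ v) (toℕ l)
        coefficients≡ u v l = trans (cong (λ m → m ((toℕ u * n + toℕ v) * suc q + toℕ l)) reals) (trans (input-coefficient u v l)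
          (trans (of (wt u v)) (cong (λ w → coefficientOf w (toℕ l)) (sym (entry-toℕ u v)))))
          where
          of : ∀ w → maybe′ (λ p → p) (λ _ → 0#) w l ≡ coefficientOf w (toℕ l)
          of nothing  = refl
          of (just p) = sym (coefficientOf-toℕ p l)

        -- The abstract memory is read off the machine at the array addresses, so the fields about
        -- array contents hold by `refl`.
        g : Mem
        g = mem (λ x → int σ (address′ x)) (λ x → real σ (address′ x))

        rep : Rep 5 ρ₀ g σ
        rep = record
          { depth = ℕ.m≤m+n 5 20 ; env = environment ; env<B = environment<B ; pars = parameters ; deg = p10 ; one = p11 ; raw = p12
          ; rawI = λ u v u<n v<n → subst₂ (λ u v → int σ (67 + d + (u * n + v)) ≡ adjacentAt u v) (Fin.toℕ-fromℕ< u<n) (Fin.toℕ-fromℕ< v<n) (entries (fromℕ< u<n) (fromℕ< v<n))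
          ; rawR = λ u v l u<n v<n l<w → subst₂ (λ u v → real σ ((u * n + v) * suc q + l) ≡ coefficientAt u v l) (Fin.toℕ-fromℕ< u<n) (Fin.toℕ-fromℕ< v<n)
              (subst (λ l → real σ ((toℕ (fromℕ< u<n) * n + toℕ (fromℕ< v<n)) * suc q + l) ≡ coefficientAt (toℕ (fromℕ< u<n)) (toℕ (fromℕ< v<n)) l) (Fin.toℕ-fromℕ< l<w)
                (coefficients≡ (fromℕ< u<n) (fromℕ< v<n) (fromℕ< l<w)))
          ; arrI = λ _ _ → refl ; arrI<B = λ x _ → blank x ; arrR = λ _ _ → refl ; fits = fits }
          where
          environment : ∀ i → i < 5 → int σ (16 + i) ≡ ρ₀ i
          environment 0 _ = p16
          environment 1 _ = p17
          environment 2 _ = p18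
          environment 3 _ = p19
          environment 4 _ = p20
          environment (suc (suc (suc (suc (suc _))))) (s≤s (s≤s (s≤s (s≤s (s≤s ())))))
          environment<B : ∀ i → i < 5 → ρ₀ i < B
          environment<B 0 _ = ℕ.≤-trans (s≤s z≤n) 64≤B
          environment<B 1 _ = ℕ.≤-trans (s≤s (s≤s z≤n)) 64≤B
          environment<B 2 _ = ℕ.<-≤-trans (Fin.toℕ<n s) n≤B
          environment<B 3 _ = ℕ.<-≤-trans (Fin.toℕ<n t) n≤B
          environment<B 4 _ = 1+K≤B
          environment<B (suc (suc (suc (suc (suc _))))) (s≤s (s≤s (s≤s (s≤s (s≤s ())))))
          parameters : ∀ p → int σ (parReg p) ≡ par p
          parameters vertexPar = p5
          parameters widthPar  = p6
          parameters levelPar  = p7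
          parameters lengthPar = p8
          parameters boundPar  = p9
          blank : ∀ x → int σ (address′ x) < B
          blank x = subst (_< B) (sym (trans (above₀ (address′ x) (far above≤Z)) (input-blank (address′ x) (far input≤Z)))) (ℕ.≤-trans (s≤s z≤n) 64≤B)
            where
            far : ∀ {y} → y ≤ Z → y ≤ address′ x
            far y≤Z = ℕ.≤-trans (≤B y≤Z) (ℕ.≤-trans B≤B⁴ (address-≥ x))
            input≤Z : 4 + n * n ≤ Z
            input≤Z = ℕ.≤-trans (ℕ.+-monoˡ-≤ (n * n) (ℕ.m≤m+n 4 (63 + d))) base≤Z

        run-ensured : ∀ {c : Cmd 5} {Q} → Ensures c ρ₀ Q g → Sound.Outcome sizes 5 ρ₀ (compile c) (t₀ ^ timeExponent c) Q σ
        run-ensured {c} (ensures holds) = Sound.sound sizes c rep holds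

        outcome : Sound.Outcome sizes 5 ρ₀ (compile Preprocessing.main) (t₀ ^ timeExponent Preprocessing.main) (λ g′ → ∀ i → i < B → CellOk i g′) σ
        outcome = run-ensured (main-ok someP n≤2^K
          (ℕ.<-≤-trans (Counting.length-allBreakpoints ℝ F G breakpoints≤m m+[1+m]²≤Z K) Z^K≤B) g)

        module _ {final : Mem} {end : Store} (rep : Rep 5 ρ₀ final end) (post : ∀ i → i < B → CellOk i final) where
          open Answering ℝ F G s t S
          open Machine.Querying ℝ F S B 64≤B S-large using (label; breaksBase)

          0<B : 0 < B
          0<B = ℕ.≤-trans (s≤s z≤n) 64≤B

          label≡ : ∀ i l → label i + l ≡ address′ (loc 3 0 0 i l)
          label≡ i l = cong (λ k → (k + i) * B + l) (trans (cong (λ k → k * B * B) (sym (ℕ.+-identityʳ (4 * B)))) (cong (_* B) (sym (ℕ.+-identityʳ ((4 * B + 0) * B)))))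

          break≡ : ∀ i → breaksBase + i ≡ address′ (loc 9 0 0 0 i)
          break≡ i = cong (_+ i) (trans (cong (λ k → k * B * B * B) (sym (ℕ.+-identityʳ (10 * B))))
            (trans (cong (λ k → k * B * B) (sym (ℕ.+-identityʳ ((10 * B + 0) * B)))) (cong (_* B) (sym (ℕ.+-identityʳ (((10 * B + 0) * B + 0) * B))))))

          row-stored : ∀ i l xs → i < B → l + length xs ≤ B → Row final i l xs → ListAt end (label i + l) xs
          row-stored i l []       _   _   _        = tt
          row-stored i l (x ∷ xs) i<B le (e , es) =
            trans (trans (cong (int end) (label≡ i l)) (Rep.arrI rep (loc 3 0 0 i l) (s≤s (s≤s (s≤s (s≤s z≤n))) , 0<B , 0<B , i<B , ℕ.<-≤-trans (ℕ.m<m+n l (s≤s z≤n)) le))) e ,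
            subst (λ k → ListAt end k xs) (ℕ.+-suc (label i) l) (row-stored i (suc l) xs i<B (ℕ.≤-trans (ℕ.≤-reflexive (sym (ℕ.+-suc l (length xs)))) le) es)

          break-stored : ∀ i → i < B → real end (breaksBase + i) ≡ R final (loc 9 0 0 0 i)
          break-stored i i<B = trans (cong (real end) (break≡ i)) (Rep.arrR rep (loc 9 0 0 0 i) (ℕ.m≤m+n 10 22 , 0<B , 0<B , 0<B , i<B))

          ready : Ready Steps end
          ready = record
            { B = B ; 64≤B = 64≤B ; S-large = S-large ; B≤2^ = Z^≤2^ K≤Λ ; fits = Rep.fits rep ; bound = Rep.pars rep boundPar ; one = Rep.one rep
            ; cells = λ i i<B → let open CellOk (post i i<B) in record
                { path = path
                ; stored = subst (λ k → StoredAt G end k path) (ℕ.+-identityʳ (label i)) (row-stored i 0 (length (vertices G path) ∷ map toℕ (vertices G path)) i<B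
                    (ℕ.≤-trans (s≤s (ℕ.≤-trans (ℕ.≤-reflexive (List.length-map toℕ (vertices G path))) (Walks.path-length ℝ G path isPath))) 1+n≤B) row)
                ; valid = λ x nn af un → valid x nn
                    (λ { i′ refl → subst (λ y → CompleteOrderedField._<_ ℝ y x) (break-stored i′ (ℕ.<-trans (ℕ.n<1+n i′) i<B)) (af i′ refl) })
                    (λ lt → subst (λ y → CompleteOrderedField._≤_ ℝ x y) (break-stored i i<B) (un lt)) } }

      solves : Solves preprocessing query S S (queryTime 158 n q) G s t
      solves = conclude (prelude-run room σ₀ start)
        where
        conclude : (∃[ K ] ∃[ τ ] ∃[ σ ] τ ≤ 12 + (suc ((62 + d) * 4) + (22 + (suc (Λ * 4) + 1))) × Run S prelude σ₀ τ σ × Prepared room σ₀ start K σ) →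
          Solves preprocessing query S S (queryTime 158 n q) G s t
        conclude (K , τ , σ , τ≤ , runPrelude , prepared) = record
          { Ready = Answering.Ready ℝ F G s t S Steps
          ; preprocess = τ + time , end , total , runPrelude ︔ run , Rep.fits rep′ , ready rep′ post
          ; answer = λ ready x nn → Answering.answer-run ℝ F G s t S ready x nn steps≤ }
          where
          open Prep K σ prepared using (outcome; ready; module Sound; module Rep)
          open Sound.Outcome outcome using (time; end; time≤; run; post) renaming (rep to rep′)
          bound : ∀ h → τ + t₀ ^ h ⊑ suc (35 + timePower * h)
          bound h = ⊑-+ {τ} {t₀ ^ h} {35} {timePower * h} (ℕ.≤-trans τ≤ prelude-time⊑) (⊑-^ {t₀} {timePower} h ℕ.≤-refl)
          total : τ + time ≤ S
          total = ℕ.≤-trans (ℕ.+-monoʳ-≤ τ time≤) (⊑S {a = suc (35 + timePower * timeExponent Preprocessing.main)} (ℕ.≤-trans (ℕ.+-monoˡ-≤ (timePower * timeExponent Preprocessing.main) (ℕ.m≤m+n 36 164)) large) (bound (timeExponent Preprocessing.main)))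

open Conclusion

open import Data.Fin.Base using (Fin)
open import Data.Nat.Base using (ℕ; _≤_)
open import Data.Product.Base using (∃-syntax; _,_)
import Data.Nat.Properties as ℕ

theorem7 : ∀ {c ℓ₁ ℓ₂} (ℝ : CompleteOrderedField c ℓ₁ ℓ₂) (F : RootFinder ℝ) →
    let open ShortestPathQueries ℝ F in
    ∃[ pre ] ∃[ query ] ∃[ K ] ∃[ C ]
    (∀ (n q : ℕ) → 2 ≤ n → 1 ≤ q →
    ∀ (G : Graph n q) (s t : Fin n) → Path G s t →
    Solves pre query (quasiPoly K n q) (quasiPoly K n q) (queryTime C n q) G s t)
theorem7 ℝ F = Assembly.preprocessing ℝ F , query , Assembly.exponent ℝ F , 158 ,
  λ n q 2≤n 1≤q G s t path → Assembly.solves ℝ F n q 2≤n 1≤q G s t path (Assembly.exponent ℝ F) ℕ.≤-refl
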